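{- Let $S$ be a nonempty finite set of positive integers with $\max(S)=i$. Then the sequence of $S_n$-representations $\{\beta_S(\Pi_n)\}_n$ stabilizes beyond $n=4i$. Furthermore, when $S=\{i\}$, it stabilizes sharply at $n=4i$.
   Context: $\Pi_n$ is the lattice of set partitions of $\{1,\ldots,n\}$ ordered by refinement ($\pi\le\sigma$ if every block of $\sigma$ is a union of blocks of $\pi$), graded by $\mathrm{rank}(\pi)=n-(\text{number of blocks of }\pi)$, with $S_n$ acting naturally. For a finite set $T$ of positive integers, $\alpha_T(\Pi_n)$ is the permutation representation of $S_n$ on the set of chains in $\Pi_n$ consisting of exactly one element of each rank in $T$ (the zero representation if there are none; $\alpha_\emptyset$ is trivial). The rank-selected homology representation is the virtual representation $\beta_S(\Pi_n):=\sum_{T\subseteq S}(-1)^{|S\setminus T|}\alpha_T(\Pi_n)$. For a partition $\lambda$ and $m\ge0$, $\lambda+(m):=(\lambda_1+m,\lambda_2,\ldots)$; for $\chi=\sum c_\lambda\chi^\lambda$ (irreducible $S_n$-characters $\chi^\lambda$) set $\chi^{(+m)}:=\sum c_\lambda\chi^{\lambda+(m)}$. A sequence $\{\chi_n\}$ stabilizes beyond $n_0$ if $\chi_n=\chi_{n_0}^{(+(n-n_0))}$ for all $n\ge n_0$, and stabilizes sharply at $n_0$ if $n_0$ is the least such integer. -}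

module Defs where

open import Data.Bool using (Bool; true; false; _∧_; _∨_; not; if_then_else_)
open import Data.Nat as ℕ using (ℕ; zero; suc; _∸_; _≤_; _<_; _≡ᵇ_; _<ᵇ_)
open import Data.Integer as ℤ using (ℤ; +_; -_)
open import Data.Fin using (Fin; toℕ)
open import Data.Fin.Properties using () renaming (_≟_ to _≟F_)
open import Data.Fin.Permutation using (Permutation′; _⟨$⟩ʳ_)
open import Data.List as L using (List; []; _∷_; map; concatMap; filter; length; allFin; foldr; upTo)
open import Data.List.Relation.Unary.All using (All)
open import Data.List.Relation.Unary.Linked using (Linked)
open import Data.Vec as V using (Vec; lookup)
open import Data.Product using (_×_; _,_; proj₁; proj₂; Σ; ∃)
open import Relation.Binary.PropositionalEquality using (_≡_; subst)
open import Data.Nat.Properties using (+-identityʳ)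
open import Relation.Nullary using (¬_)
open import Relation.Nullary.Decidable using (⌊_⌋)
open import Data.Bool using (T?)
open import Data.Maybe using (Maybe; just; nothing)

allVec : {A : Set} → List A → (n : ℕ) → List (Vec A n)
allVec xs zero    = V.[] ∷ []
allVec xs (suc n) = concatMap (λ x → map (x V.∷_) (allVec xs n)) xs

allB : {n : ℕ} → (Fin n → Bool) → Bool
allB {n} p = go (allFin n)
  where
  go : List (Fin n) → Bool
  go []       = true
  go (x ∷ xs) = p x ∧ go xs

count : {A : Set} → (A → Bool) → List A → ℕ
count p []       = 0
count p (x ∷ xs) = (if p x then 1 else 0) ℕ.+ count p xs

sumℕ : List ℕ → ℕ
sumℕ = foldr ℕ._+_ 0

sumℤ : List ℤ → ℤ
sumℤ = foldr ℤ._+_ (+ 0)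

_⇒ᵇ_ : Bool → Bool → Bool
a ⇒ᵇ b = not a ∨ b

_≡Bᵇ_ : Bool → Bool → Bool
true  ≡Bᵇ b = b
false ≡Bᵇ b = not b

-- Set partitions of {1..n}, encoded as equivalence relations on Fin n
-- (Boolean relation matrices satisfying reflexivity, symmetry, transitivity).
-- Distinct matrices = distinct set partitions.

Rel : ℕ → Set
Rel n = Vec (Vec Bool n) n

rel : {n : ℕ} → Rel n → Fin n → Fin n → Bool
rel π x y = lookup (lookup π x) y

isEquivᵇ : {n : ℕ} → Rel n → Bool
isEquivᵇ π =
  allB (λ x → rel π x x) ∧
  allB (λ x → allB (λ y → rel π x y ⇒ᵇ rel π y x)) ∧
  allB (λ x → allB (λ y → allB (λ z → (rel π x y ∧ rel π y z) ⇒ᵇ rel π x z)))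

SetPartitions : (n : ℕ) → List (Rel n)
SetPartitions n = filter (λ π → T? (isEquivᵇ π)) (allVec (allVec (true ∷ false ∷ []) n) n)

numBlocks : {n : ℕ} → Rel n → ℕ
numBlocks {n} π = count (λ x → allB (λ y → (toℕ y <ᵇ toℕ x) ⇒ᵇ not (rel π x y))) (allFin n)

rank : {n : ℕ} → Rel n → ℕ
rank {n} π = n ∸ numBlocks π

_≤Πᵇ_ : {n : ℕ} → Rel n → Rel n → Bool
π ≤Πᵇ σ = allB (λ x → allB (λ y → rel π x y ⇒ᵇ rel σ x y))

fixedᵇ : {n : ℕ} → Permutation′ n → Rel n → Bool
fixedᵇ g π = allB (λ x → allB (λ y → rel π x y ≡Bᵇ rel π (g ⟨$⟩ʳ x) (g ⟨$⟩ʳ y)))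

bottom : (n : ℕ) → Rel n
bottom n = V.tabulate (λ x → V.tabulate (λ y → ⌊ x ≟F y ⌋))

ClassFn : ℕ → Set
ClassFn n = Permutation′ n → ℤ

_≐_ : {n : ℕ} → ClassFn n → ClassFn n → Set
χ ≐ ψ = ∀ g → χ g ≡ ψ g

-- number of g-fixed chains π_1 < ... < π_k in Π_n with rank π_j = t_j,
-- each π_j above `prev`.  (T is given as an increasing list of ranks.)
fixedChains : {n : ℕ} → Permutation′ n → Rel n → List ℕ → ℕ
fixedChains g prev [] = 1
fixedChains {n} g prev (t ∷ ts) =
  sumℕ (map (λ π → if (rank π ≡ᵇ t) ∧ (prev ≤Πᵇ π) ∧ fixedᵇ g π
                      then fixedChains g π ts else 0)
             (SetPartitions n))

-- α_T(Π_n): character of the permutation representation on chains with rank set T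
-- (value at g = number of such chains fixed by g)
alphaΠ : (n : ℕ) → List ℕ → ClassFn n
alphaΠ n T g = + fixedChains g (bottom n) T

-- sublists (= subsets, for a strictly increasing list S)
sublists : List ℕ → List (List ℕ)
sublists []       = [] ∷ []
sublists (x ∷ xs) = map (x ∷_) (sublists xs) L.++ sublists xs

signℤ : ℕ → ℤ
signℤ zero          = + 1
signℤ (suc zero)    = - (+ 1)
signℤ (suc (suc k)) = signℤ k

betaΠ : (n : ℕ) → List ℕ → ClassFn n
betaΠ n S g = sumℤ (map (λ T → signℤ (length S ∸ length T) ℤ.* alphaΠ n T g) (sublists S))

IsPartition : ℕ → List ℕ → Set
IsPartition n λ' = Linked (λ a b → b ≤ a) λ' × All (λ a → 0 < a) λ' × sumℕ λ' ≡ n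

addFirst : ℕ → List ℕ → List ℕ
addFirst zero    []       = []
addFirst (suc m) []       = suc m ∷ []
addFirst m       (a ∷ as) = (m ℕ.+ a) ∷ as

insertions : ℕ → List ℕ → List (List ℕ)
insertions x []       = (x ∷ []) ∷ []
insertions x (y ∷ ys) = (x ∷ y ∷ ys) ∷ map (y ∷_) (insertions x ys)

perms : List ℕ → List (List ℕ)
perms []       = [] ∷ []
perms (x ∷ xs) = concatMap (insertions x) (perms xs)

inversions : List ℕ → ℕ
inversions []       = 0
inversions (x ∷ xs) = count (λ y → y <ᵇ x) xs ℕ.+ inversions xs

-- character of Ind_{S_α}^{S_n} 1 for a composition α (zero parts allowed):
-- value at g = number of g-invariant maps f : {1..n} → {1..ℓ} with |f⁻¹(j)| = α_j
-- (= number of g-fixed ordered set partitions of {1..n} of shape α)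
youngChar : (n : ℕ) → List ℕ → ClassFn n
youngChar n α g =
  + count (λ f → allB (λ x → ⌊ lookup f (g ⟨$⟩ʳ x) ≟F lookup f x ⌋) ∧ fibresOK f)
          (allVec (allFin (length α)) n)
  where
  fibresOK : Vec (Fin (length α)) n → Bool
  fibresOK f = allB (λ j → count (λ x → ⌊ lookup f x ≟F j ⌋) (allFin n) ≡ᵇ lookup (V.fromList α) j)

jtComp : ℕ → List ℕ → List ℕ → Maybe (List ℕ)
jtComp i (l ∷ ls) (s ∷ ss) with i ℕ.≤ᵇ (l ℕ.+ s) | jtComp (suc i) ls ss
... | true  | just rest = just ((l ℕ.+ s ∸ i) ∷ rest)
... | _     | _         = nothing
jtComp i _ _ = just []

-- irreducible character χ^λ of S_n, via the Jacobi–Trudi (Frobenius) determinantal formula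
--   χ^λ = det( η_{λ_i - i + j} ) = Σ_{σ ∈ S_ℓ} sgn(σ) · η_{(λ_i - i + σ(i))_i}
-- where η_α is the Young permutation character youngChar n α (η with a negative part = 0).
irrChar : (n : ℕ) → List ℕ → ClassFn n
irrChar n λ' g = sumℤ (map term (perms (upTo (length λ'))))
  where
  term : List ℕ → ℤ
  term σ with jtComp 0 λ' σ
  ... | just α  = signℤ (inversions σ) ℤ.* youngChar n α g
  ... | nothing = + 0

record Term (n0 : ℕ) : Set where
  constructor term
  field
    shape : List ℕ
    isPart : IsPartition n0 shape
    coeff : ℤ
open Term public

combo : {n0 : ℕ} → (n m : ℕ) → List (Term n0) → ClassFn n
combo n m cs g = sumℤ (map (λ c → coeff c ℤ.* irrChar n (addFirst m (shape c)) g) cs)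

-- χ_n = χ_{n0}^{(+(n - n0))}: writing χ_{n0} = Σ c_λ χ^λ (a decomposition into
-- irreducibles, unique since irreducibles are linearly independent),
-- χ_n = Σ c_λ χ^{λ + (n - n0)}.
IsShiftOf : (χ : (n : ℕ) → ClassFn n) (n0 m : ℕ) → Set
IsShiftOf χ n0 m = Σ (List (Term n0)) λ cs →
  (χ n0 ≐ combo n0 0 cs)
  × (χ (n0 ℕ.+ m) ≐ combo (n0 ℕ.+ m) m cs)

StabilizesBeyond : ((n : ℕ) → ClassFn n) → ℕ → Set
StabilizesBeyond χ n0 = ∀ m → IsShiftOf χ n0 m

StabilizesSharplyAt : ((n : ℕ) → ClassFn n) → ℕ → Set
StabilizesSharplyAt χ n0 = StabilizesBeyond χ n0 × (∀ k → k < n0 → ¬ StabilizesBeyond χ k)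

{-# OPTIONS --safe #-}
-- The points that are singletons in all members of a chain of top rank at most i can be removed, and at most 2i
-- points remain. Hence α_T(Πₙ) is the sum over k ≤ 2i of Ind (V_k ⊗ 1) for permutation characters V_k of S_k that
-- do not depend on n. Each V_k is an integral combination Σ b_β η_β of Young characters: by Burnside's lemma its
-- inner products with Young characters are integers, the matrix of the ⟨χ^λ, η_γ⟩ is unitriangular by column
-- operations in the Jacobi-Trudi determinant, and a class function orthogonal to all Young characters vanishes.
-- So α_T(Πₙ) = Σ b_β η_(n-|β|, β) with |β| ≤ 2i. When n ≥ 4i the first part is at least the sum of the others;
-- solving the Jacobi-Trudi formula recursively for η_(a, β) never decreases the first part, so the resulting
-- expansion into irreducible characters is the same for all such n up to a shift of the first part.
--
-- Sharpness: a character χ^λ of S_{4i} with λ₁ > λ₂, in particular χ^{μ+(m)} with m > 0, has the same inner product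
-- with η_(2i, 2i) as with η_(2i+1, 2i-1), while for α_{i}(Π_{4i}) the two differ by the multiplicity of the trivial
-- character in V_{2i}, which is positive because V_{2i} counts perfect matchings.
module Submission where

open import Defs
open import Data.Bool using (Bool; true; false; _∧_; _∨_; not; if_then_else_; T; T?)
import Data.Bool.Properties as Boolₚ
open import Data.Nat as ℕ using (ℕ; zero; suc; _∸_; _≤_; _<_; z≤n; s≤s; _≡ᵇ_; _<ᵇ_)
open import Data.Nat.DivMod using (m≡m%n+[m/n]*n; m%n<n)
open import Data.Nat.ListAction.Properties using (sum-↭)
import Data.Nat.Properties as ℕₚ
open import Data.Integer as ℤ using (ℤ; +_; -[1+_]; _+_; _*_; -_; _-_; 0ℤ; 1ℤ)
import Data.Integer.Properties as ℤₚ
open import Data.Integer.Tactic.RingSolver using (solve-∀)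
import Data.Nat.Tactic.RingSolver as ℕ-Solver
open import Data.Fin as F using (Fin; zero; suc; toℕ)
import Data.Fin.Properties as Fₚ
open import Data.Fin.Permutation as P using (Permutation′; _⟨$⟩ʳ_; _⟨$⟩ˡ_; _∘ₚ_; _≈_)
open import Data.List as L using (List; []; _∷_; _++_; map; concatMap; filter; length; allFin; upTo)
open import Data.List.Relation.Unary.All as All using (All; []; _∷_)
open import Data.List.Relation.Unary.Any as Any using (Any; here; there)
open import Data.List.Relation.Unary.Linked using (Linked; []; [-]; _∷_)
import Data.List.Relation.Unary.Any.Properties as Anyₚ
open import Data.List.Membership.Propositional using (_∈_)
open import Data.List.Membership.Propositional.Properties using (∈-allFin)
open import Data.List.Relation.Unary.AllPairs using (AllPairs; []; _∷_)
import Data.List.Relation.Unary.All.Properties as Allₚ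
import Data.List.Properties as Lₚ
open import Data.List.Relation.Binary.Permutation.Propositional as Perm using (_↭_)
import Data.List.Relation.Binary.Permutation.Propositional.Properties as Permₚ
open import Data.Vec as V using (Vec; lookup; tabulate; []; _∷_)
import Data.Vec.Properties as Vₚ
open import Data.Product using (_×_; _,_; proj₁; proj₂; Σ-syntax; ∃-syntax)
import Data.Product.Properties as Productₚ
open import Data.Sum as Sum using (_⊎_; inj₁; inj₂)
open import Data.Empty using (⊥; ⊥-elim)
open import Data.Unit using (⊤; tt)
open import Data.Maybe as Maybe using (Maybe; just; nothing)
open import Function using (_∘_; id; case_of_)
open import Relation.Nullary using (¬_; Dec; yes; no; contradiction)
open import Relation.Nullary.Decidable using (⌊_⌋; _×-dec_; ¬?; map′)
open import Relation.Binary using (DecidableEquality; Tri; tri<; tri≈; tri>)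
open import Relation.Binary.PropositionalEquality
import Data.List.Relation.Binary.Permutation.Setoid.Properties (setoid ℕ) as ↭ₛ
open import Data.List.Relation.Binary.Permutation.Setoid (setoid ℕ) using (onIndices)
open ≡-Reasoning

-- The constant 4i is 2i + 2i: |β| is at most 2i because a block of size s costs rank s - 1, which
-- is at least s/2 when s ≥ 2, and the recursion needs the first part n - |β| to dominate the
-- remaining |β|. Then sorting never moves the first part, so enlarging it by m changes nothing
-- else. The test in the sharpness argument is the multiplicity of one irreducible character: η_(2i,
-- 2i) - η_(2i+1, 2i-1) is χ^(2i, 2i) by Jacobi-Trudi, and a partition with two equal leading parts
-- is no shift μ + (m) with m > 0.
--
-- Two requirements shape the rest. Coefficients are integers, so averages over the group are
-- avoided: inner products are plain sums that carry the group order `ord n` as a factor, and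
-- integrality comes from Burnside's lemma together with the unit diagonal of the Kostka matrix.
-- Moreover one list of terms has to expand the characters for 4i and for 4i + m at once; hence the
-- relation `Good` between two class functions, which is closed under linear combinations and is
-- established for Young characters directly.

*-swap : ∀ a b c → a * (b * c) ≡ b * (a * c)
*-swap = solve-∀

i<j⇒i-j<0 : ∀ {i} j → i ℤ.< j → i - j ℤ.< 0ℤ
i<j⇒i-j<0 {i} j lt = subst (i - j ℤ.<_) (ℤₚ.+-inverseʳ j) (ℤₚ.+-monoˡ-< (- j) lt)

-- Truth values as integers

⟦_⟧ : Bool → ℤ
⟦ true ⟧ = 1ℤ
⟦ false ⟧ = 0ℤ

bool-ext : ∀ {a b} → (a ≡ true → b ≡ true) → (b ≡ true → a ≡ true) → a ≡ b
bool-ext {true}  {b}     f g = sym (f refl)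
bool-ext {false} {false} f g = refl
bool-ext {false} {true}  f g = g refl

∧-true : ∀ {a b} → a ∧ b ≡ true → a ≡ true × b ≡ true
∧-true {true} eq = refl , eq

true-∧ : ∀ {a b} → a ≡ true → b ≡ true → a ∧ b ≡ true
true-∧ refl refl = refl

⟦∧⟧ : ∀ a b → ⟦ a ∧ b ⟧ ≡ ⟦ a ⟧ * ⟦ b ⟧
⟦∧⟧ true  b = sym (ℤₚ.*-identityˡ _)
⟦∧⟧ false b = refl

≡ᵇ-true : ∀ {a b} → a ≡ b → (a ≡ᵇ b) ≡ true
≡ᵇ-true {a} {b} e with a ≡ᵇ b | ℕₚ.≡⇒≡ᵇ a b e
... | true | _ = refl

≡ᵇ-sound : ∀ {a b} → (a ≡ᵇ b) ≡ true → a ≡ b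
≡ᵇ-sound {a} {b} e = ℕₚ.≡ᵇ⇒≡ a b (subst T (sym e) tt)

⌊⌋-true : {P : Set} (d : Dec P) → P → ⌊ d ⌋ ≡ true
⌊⌋-true (yes _) p = refl
⌊⌋-true (no ¬p) p = contradiction p ¬p

true-⌊⌋ : {P : Set} (d : Dec P) → ⌊ d ⌋ ≡ true → P
true-⌊⌋ (yes p) _ = p

⌊⌋-cong : {P Q : Set} (d : Dec P) (e : Dec Q) → (P → Q) → (Q → P) → ⌊ d ⌋ ≡ ⌊ e ⌋
⌊⌋-cong d e f g = bool-ext (⌊⌋-true e ∘ f ∘ true-⌊⌋ d) (⌊⌋-true d ∘ g ∘ true-⌊⌋ e)

⟦⟧-* : ∀ b {x y} → (b ≡ true → x ≡ y) → ⟦ b ⟧ * x ≡ ⟦ b ⟧ * y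
⟦⟧-* true  eq = cong (1ℤ *_) (eq refl)
⟦⟧-* false eq = refl

⟦⟧-nonneg : ∀ b → 0ℤ ℤ.≤ ⟦ b ⟧
⟦⟧-nonneg true  = ℤ.+≤+ z≤n
⟦⟧-nonneg false = ℤ.+≤+ z≤n

-- The local function of allB is not nameable; it is recovered as the solution of the metavariable in allB-go.
mutual
  allB-go : ∀ n → (Fin n → Bool) → List (Fin n) → Bool
  allB-go = _

  allB-go-spec : ∀ n (p : Fin n → Bool) → allB-go n p (allFin n) ≡ allB p
  allB-go-spec n p with allFin n
  ... | xs = refl

module _ {n : ℕ} (p : Fin n → Bool) where

  private
    go : List (Fin n) → Bool
    go = allB-go n p

    sound : ∀ xs → go xs ≡ true → All (λ x → p x ≡ true) xs
    sound []       eq = []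
    sound (x ∷ xs) eq = proj₁ (∧-true eq) ∷ sound xs (proj₂ (∧-true eq))

    complete : ∀ xs → (∀ x → p x ≡ true) → go xs ≡ true
    complete []       h = refl
    complete (x ∷ xs) h = true-∧ (h x) (complete xs h)

  allB-sound : allB p ≡ true → ∀ x → p x ≡ true
  allB-sound eq x = All.lookup (sound (allFin n) eq) (∈-allFin x)

  allB-complete : (∀ x → p x ≡ true) → allB p ≡ true
  allB-complete = complete (allFin n)

-- Finite sums

∑ : {A : Set} → List A → (A → ℤ) → ℤ
∑ []       f = 0ℤ
∑ (x ∷ xs) f = f x + ∑ xs f


module _ {A : Set} where

  ∑-cong : ∀ (xs : List A) {f g : A → ℤ} → (∀ x → f x ≡ g x) → ∑ xs f ≡ ∑ xs g
  ∑-cong []       h = refl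
  ∑-cong (x ∷ xs) h = cong₂ _+_ (h x) (∑-cong xs h)

  ∑-zero : ∀ (xs : List A) {f : A → ℤ} → (∀ x → f x ≡ 0ℤ) → ∑ xs f ≡ 0ℤ
  ∑-zero []       h = refl
  ∑-zero (x ∷ xs) h = cong₂ _+_ (h x) (∑-zero xs h)

  ∑-+ : ∀ (xs : List A) (f g : A → ℤ) → ∑ xs (λ x → f x + g x) ≡ ∑ xs f + ∑ xs g
  ∑-+ []       f g = refl
  ∑-+ (x ∷ xs) f g = trans (cong (_+_ (f x + g x)) (∑-+ xs f g)) (shuffle (f x) (g x) (∑ xs f) (∑ xs g))
    where shuffle : ∀ a b c d → a + b + (c + d) ≡ a + c + (b + d)
          shuffle = solve-∀

  ∑-*ˡ : ∀ (xs : List A) c (f : A → ℤ) → ∑ xs (λ x → c * f x) ≡ c * ∑ xs f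
  ∑-*ˡ []       c f = sym (ℤₚ.*-zeroʳ c)
  ∑-*ˡ (x ∷ xs) c f = trans (cong (_+_ (c * f x)) (∑-*ˡ xs c f)) (sym (ℤₚ.*-distribˡ-+ c _ _))

  ∑-*ʳ : ∀ (xs : List A) c (f : A → ℤ) → ∑ xs (λ x → f x * c) ≡ ∑ xs f * c
  ∑-*ʳ xs c f = trans (∑-cong xs (λ x → ℤₚ.*-comm (f x) c)) (trans (∑-*ˡ xs c f) (ℤₚ.*-comm c _))

  ∑-neg : ∀ (xs : List A) (f : A → ℤ) → ∑ xs (λ x → - f x) ≡ - ∑ xs f
  ∑-neg []       f = refl
  ∑-neg (x ∷ xs) f = trans (cong (_+_ (- f x)) (∑-neg xs f)) (sym (ℤₚ.neg-distrib-+ (f x) _))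

  ∑-++ : ∀ (xs ys : List A) f → ∑ (xs ++ ys) f ≡ ∑ xs f + ∑ ys f
  ∑-++ []       ys f = sym (ℤₚ.+-identityˡ _)
  ∑-++ (x ∷ xs) ys f = trans (cong (_+_ (f x)) (∑-++ xs ys f)) (sym (ℤₚ.+-assoc (f x) _ _))

  ∑-mono : ∀ (xs : List A) {f g : A → ℤ} → (∀ x → f x ℤ.≤ g x) → ∑ xs f ℤ.≤ ∑ xs g
  ∑-mono []       h = ℤₚ.≤-refl
  ∑-mono (x ∷ xs) h = ℤₚ.+-mono-≤ (h x) (∑-mono xs h)

  ∑-nonneg : ∀ (xs : List A) {f : A → ℤ} → (∀ x → 0ℤ ℤ.≤ f x) → 0ℤ ℤ.≤ ∑ xs f
  ∑-nonneg []       h = ℤₚ.≤-refl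
  ∑-nonneg (x ∷ xs) h = ℤₚ.+-mono-≤ (h x) (∑-nonneg xs h)

  ∑-count : ∀ (p : A → Bool) xs → + count p xs ≡ ∑ xs (λ x → ⟦ p x ⟧)
  ∑-count p [] = refl
  ∑-count p (x ∷ xs) = trans (ℤₚ.pos-+ (if p x then 1 else 0) _) (cong₂ _+_ (lem (p x)) (∑-count p xs))
    where lem : ∀ b → + (if b then 1 else 0) ≡ ⟦ b ⟧
          lem true = refl
          lem false = refl

  ∑-filter : ∀ (p : A → Bool) xs f → ∑ (filter (λ x → T? (p x)) xs) f ≡ ∑ xs (λ x → ⟦ p x ⟧ * f x)
  ∑-filter p [] f = refl
  ∑-filter p (x ∷ xs) f with p x
  ... | true  = cong₂ _+_ (sym (ℤₚ.*-identityˡ (f x))) (∑-filter p xs f)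
  ... | false = trans (∑-filter p xs f) (sym (ℤₚ.+-identityˡ _))

module _ {A B : Set} where

  ∑-map : ∀ (h : A → B) xs (f : B → ℤ) → ∑ (map h xs) f ≡ ∑ xs (λ x → f (h x))
  ∑-map h []       f = refl
  ∑-map h (x ∷ xs) f = cong (_+_ (f (h x))) (∑-map h xs f)

  ∑-concatMap : ∀ (h : A → List B) xs (f : B → ℤ) → ∑ (concatMap h xs) f ≡ ∑ xs (λ x → ∑ (h x) f)
  ∑-concatMap h []       f = refl
  ∑-concatMap h (x ∷ xs) f = trans (∑-++ (h x) (concatMap h xs) f) (cong (_+_ (∑ (h x) f)) (∑-concatMap h xs f))

  ∑-swap : ∀ (xs : List A) (ys : List B) (f : A → B → ℤ) →
    ∑ xs (λ x → ∑ ys (λ y → f x y)) ≡ ∑ ys (λ y → ∑ xs (λ x → f x y))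
  ∑-swap []       ys f = sym (∑-zero ys (λ _ → refl))
  ∑-swap (x ∷ xs) ys f = trans (cong (_+_ (∑ ys (f x))) (∑-swap xs ys f)) (sym (∑-+ ys (f x) _))

∑-sumℤ : ∀ {A : Set} (f : A → ℤ) xs → sumℤ (map f xs) ≡ ∑ xs f
∑-sumℤ f []       = refl
∑-sumℤ f (x ∷ xs) = cong (_+_ (f x)) (∑-sumℤ f xs)

∑-sumℕ : ∀ {A : Set} (f : A → ℕ) xs → + sumℕ (map f xs) ≡ ∑ xs (λ x → + f x)
∑-sumℕ f []       = refl
∑-sumℕ f (x ∷ xs) = trans (ℤₚ.pos-+ (f x) _) (cong (_+_ (+ f x)) (∑-sumℕ f xs))

∑-allVec : ∀ {A : Set} (xs : List A) n (f : Vec A (suc n) → ℤ) →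
  ∑ (allVec xs (suc n)) f ≡ ∑ xs (λ x → ∑ (allVec xs n) (λ v → f (x ∷ v)))
∑-allVec xs n f = trans (∑-concatMap _ xs f) (∑-cong xs (λ x → ∑-map (x ∷_) (allVec xs n) f))

nonneg-+-zero : ∀ {a b} → 0ℤ ℤ.≤ a → 0ℤ ℤ.≤ b → a + b ≡ 0ℤ → a ≡ 0ℤ × b ≡ 0ℤ
nonneg-+-zero {+ zero} {+ zero} _ _ _ = refl , refl

∑-zero⁻¹ : ∀ {A : Set} (xs : List A) {f : A → ℤ} → (∀ x → 0ℤ ℤ.≤ f x) → ∑ xs f ≡ 0ℤ → All (λ x → f x ≡ 0ℤ) xs
∑-zero⁻¹ []       h eq = []
∑-zero⁻¹ (x ∷ xs) h eq with nonneg-+-zero (h x) (∑-nonneg xs h) eq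
... | a , b = a ∷ ∑-zero⁻¹ xs h b

-- Finite types

-- Multiplicity one in the enumeration is stated as a sum of indicators, the form in which it enters
-- every exchange of summations below.
record Finite (A : Set) : Set where
  field
    elems : List A
    _≟_   : DecidableEquality A
    once  : ∀ a → ∑ elems (λ x → ⟦ ⌊ x ≟ a ⌋ ⟧) ≡ 1ℤ

  _==_ : A → A → Bool
  x == y = ⌊ x ≟ y ⌋

  ==-refl : ∀ x → (x == x) ≡ true
  ==-refl x = ⌊⌋-true (x ≟ x) refl

  ==-sound : ∀ {x y} → (x == y) ≡ true → x ≡ y
  ==-sound = true-⌊⌋ (_ ≟ _)

  ∑-pick : ∀ a (f : A → ℤ) → ∑ elems (λ x → ⟦ x == a ⟧ * f x) ≡ f a
  ∑-pick a f = begin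
    ∑ elems (λ x → ⟦ x == a ⟧ * f x)
      ≡⟨ ∑-cong elems (λ x → ⟦⟧-* (x == a) (λ e → cong f (==-sound e))) ⟩
    ∑ elems (λ x → ⟦ x == a ⟧ * f a)
      ≡⟨ ∑-*ʳ elems (f a) _ ⟩
    ∑ elems (λ x → ⟦ x == a ⟧) * f a
      ≡⟨ cong (_* f a) (once a) ⟩
    1ℤ * f a
      ≡⟨ ℤₚ.*-identityˡ (f a) ⟩
    f a ∎

  mem : ∀ a → a ∈ elems
  mem a with Any.any? (λ x → a ≟ x) elems
  ... | yes p = p
  ... | no ¬p = contradiction (trans (sym (once a)) (none elems ¬p)) (λ ())
    where
    none : ∀ xs → ¬ Any (a ≡_) xs → ∑ xs (λ x → ⟦ x == a ⟧) ≡ 0ℤ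
    none [] _ = refl
    none (x ∷ xs) ¬p with x ≟ a
    ... | yes e = contradiction (here (sym e)) ¬p
    ... | no _  = trans (ℤₚ.+-identityˡ _) (none xs (¬p ∘ there))

  opaque
    any? : (p : A → Bool) → Dec (∃[ x ] p x ≡ true)
    any? p = map′ (λ a → Any.lookup a , Anyₚ.lookup-result a)
                  (λ (x , e) → Any.map (λ { refl → e }) (mem x))
                  (Any.any? (λ x → p x Boolₚ.≟ true) elems)

  ∑-zero⇒ : ∀ {f : A → ℤ} → (∀ x → 0ℤ ℤ.≤ f x) → ∑ elems f ≡ 0ℤ → ∀ x → f x ≡ 0ℤ
  ∑-zero⇒ h eq x = All.lookup (∑-zero⁻¹ elems h eq) (mem x)

open Finite using (elems) public

Bool-finite : Finite Bool
Bool-finite = record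
  { elems = true ∷ false ∷ [] ; _≟_ = Boolₚ._≟_ ; once = λ { true → refl ; false → refl } }

Vec-finite : ∀ {A : Set} → Finite A → ∀ n → Finite (Vec A n)
Vec-finite {A} FA n = record { elems = allVec (elems FA) n ; _≟_ = _≟ⱽ_ ; once = once-Vec n }
  where
  open Finite FA using (_≟_; _==_; ∑-pick)
  _≟ⱽ_ : ∀ {n} → DecidableEquality (Vec A n)
  _≟ⱽ_ = Vₚ.≡-dec _≟_
  once-Vec : ∀ n (v : Vec A n) → ∑ (allVec (elems FA) n) (λ w → ⟦ ⌊ w ≟ⱽ v ⌋ ⟧) ≡ 1ℤ
  once-Vec zero [] = refl
  once-Vec (suc n) (a ∷ v) = begin
    ∑ (allVec (elems FA) (suc n)) (λ w → ⟦ ⌊ w ≟ⱽ (a ∷ v) ⌋ ⟧)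
      ≡⟨ ∑-allVec (elems FA) n _ ⟩
    ∑ (elems FA) (λ x → ∑ (allVec (elems FA) n) (λ w → ⟦ ⌊ (x ∷ w) ≟ⱽ (a ∷ v) ⌋ ⟧))
      ≡⟨ ∑-cong (elems FA) (λ x → trans (∑-cong (allVec (elems FA) n) (λ w → split x w)) (∑-*ˡ (allVec (elems FA) n) ⟦ x == a ⟧ _)) ⟩
    ∑ (elems FA) (λ x → ⟦ x == a ⟧ * ∑ (allVec (elems FA) n) (λ w → ⟦ ⌊ w ≟ⱽ v ⌋ ⟧))
      ≡⟨ ∑-pick a _ ⟩
    ∑ (allVec (elems FA) n) (λ w → ⟦ ⌊ w ≟ⱽ v ⌋ ⟧)
      ≡⟨ once-Vec n v ⟩
    1ℤ ∎
    where
    split : ∀ x w → ⟦ ⌊ (x ∷ w) ≟ⱽ (a ∷ v) ⌋ ⟧ ≡ ⟦ x == a ⟧ * ⟦ ⌊ w ≟ⱽ v ⌋ ⟧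
    split x w = trans (cong ⟦_⟧ (⌊⌋-cong ((x ∷ w) ≟ⱽ (a ∷ v)) ((x ≟ a) ×-dec (w ≟ⱽ v))
                                  Vₚ.∷-injective (λ { (refl , refl) → refl })))
                      (lem (x ≟ a) (w ≟ⱽ v))
      where
      lem : {P Q : Set} (d : Dec P) (e : Dec Q) → ⟦ ⌊ d ×-dec e ⌋ ⟧ ≡ ⟦ ⌊ d ⌋ ⟧ * ⟦ ⌊ e ⌋ ⟧
      lem (yes _) (yes _) = refl
      lem (yes _) (no _) = refl
      lem (no _) _ = refl

×-finite : ∀ {A B : Set} → Finite A → Finite B → Finite (A × B)
×-finite {A} {B} FA FB = record { elems = concatMap pairs (elems FA) ; _≟_ = _≟ˣ_ ; once = once-× }
  where
  module FA = Finite FA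
  module FB = Finite FB
  pairs : A → List (A × B)
  pairs a = map (a ,_) (elems FB)
  _≟ˣ_ : DecidableEquality (A × B)
  _≟ˣ_ = Productₚ.≡-dec FA._≟_ FB._≟_
  once-× : ∀ c → ∑ (concatMap pairs (elems FA)) (λ x → ⟦ ⌊ x ≟ˣ c ⌋ ⟧) ≡ 1ℤ
  once-× (a , b) = begin
    ∑ (concatMap pairs (elems FA)) (λ x → ⟦ ⌊ x ≟ˣ (a , b) ⌋ ⟧)
      ≡⟨ ∑-concatMap pairs (elems FA) _ ⟩
    ∑ (elems FA) (λ x → ∑ (pairs x) (λ x → ⟦ ⌊ x ≟ˣ (a , b) ⌋ ⟧))
      ≡⟨ ∑-cong (elems FA) (λ x → trans (∑-map (x ,_) (elems FB) _)
           (trans (∑-cong (elems FB) (λ y → split x y)) (∑-*ˡ (elems FB) ⟦ x FA.== a ⟧ _))) ⟩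
    ∑ (elems FA) (λ x → ⟦ x FA.== a ⟧ * ∑ (elems FB) (λ y → ⟦ y FB.== b ⟧))
      ≡⟨ FA.∑-pick a _ ⟩
    ∑ (elems FB) (λ y → ⟦ y FB.== b ⟧)
      ≡⟨ FB.once b ⟩
    1ℤ ∎
    where
    split : ∀ x y → ⟦ ⌊ (x , y) ≟ˣ (a , b) ⌋ ⟧ ≡ ⟦ x FA.== a ⟧ * ⟦ y FB.== b ⟧
    split x y = trans (cong ⟦_⟧ (bool-ext
        (λ e → let e′ = true-⌊⌋ ((x , y) ≟ˣ (a , b)) e in
               true-∧ (⌊⌋-true (x FA.≟ a) (cong proj₁ e′)) (⌊⌋-true (y FB.≟ b) (cong proj₂ e′)))
        (λ e → ⌊⌋-true ((x , y) ≟ˣ (a , b))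
                 (cong₂ _,_ (FA.==-sound (proj₁ (∧-true e))) (FB.==-sound (proj₂ (∧-true e)))))))
      (⟦∧⟧ (x FA.== a) (y FB.== b))

∑-× : ∀ {A B : Set} (FA : Finite A) (FB : Finite B) (f : A × B → ℤ) →
  ∑ (elems (×-finite FA FB)) f ≡ ∑ (elems FA) (λ a → ∑ (elems FB) (λ b → f (a , b)))
∑-× FA FB f = trans (∑-concatMap _ (elems FA) f) (∑-cong (elems FA) (λ x → ∑-map (x ,_) (elems FB) f))

∑-tabulate : ∀ {A : Set} {n} (h : Fin n → A) (f : A → ℤ) → ∑ (L.tabulate h) f ≡ ∑ (allFin n) (λ i → f (h i))
∑-tabulate {n = zero} h f = refl
∑-tabulate {n = suc n} h f = cong (_+_ (f (h zero)))
  (trans (∑-tabulate (h ∘ suc) f) (sym (∑-tabulate suc (f ∘ h))))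

∑-allFin : ∀ n (f : Fin (suc n) → ℤ) → ∑ (allFin (suc n)) f ≡ f zero + ∑ (allFin n) (λ i → f (suc i))
∑-allFin n f = cong (_+_ (f zero)) (∑-tabulate suc f)

Fin-finite : ∀ n → Finite (Fin n)
Fin-finite n = record { elems = allFin n ; _≟_ = Fₚ._≟_ ; once = once-Fin }
  where
  once-Fin : ∀ {n} (a : Fin n) → ∑ (allFin n) (λ x → ⟦ ⌊ x Fₚ.≟ a ⌋ ⟧) ≡ 1ℤ
  once-Fin {suc n} zero = trans (∑-allFin n (λ x → ⟦ ⌊ x Fₚ.≟ zero ⌋ ⟧)) (cong (_+_ 1ℤ) (∑-zero (allFin n) {λ x → ⟦ ⌊ suc x Fₚ.≟ zero ⌋ ⟧} (λ _ → refl)))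
  once-Fin {suc n} (suc a) = trans (∑-allFin n (λ x → ⟦ ⌊ x Fₚ.≟ suc a ⌋ ⟧)) (trans (ℤₚ.+-identityˡ _)
    (trans (∑-cong (allFin n) (λ x → cong ⟦_⟧ (⌊⌋-cong (suc x Fₚ.≟ suc a) (x Fₚ.≟ a) Fₚ.suc-injective (cong suc))))
           (once-Fin a)))

-- Insert the indicator of b = `to a`, exchange the sums, and read the indicator as a = `from b`.
-- The two maps are inverse only on the supports P and Q, and there the two indicators agree.
∑-bij : ∀ {A B : Set} (FA : Finite A) (FB : Finite B) (P : A → Bool) (Q : B → Bool) (f : A → ℤ) (g : B → ℤ)
  (to : A → B) (from : B → A) →
  (∀ a → P a ≡ true → Q (to a) ≡ true × from (to a) ≡ a × f a ≡ g (to a)) →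
  (∀ b → Q b ≡ true → P (from b) ≡ true × to (from b) ≡ b) →
  ∑ (elems FA) (λ a → ⟦ P a ⟧ * f a) ≡ ∑ (elems FB) (λ b → ⟦ Q b ⟧ * g b)
∑-bij FA FB P Q f g to from h k = begin
  ∑ (elems FA) (λ a → ⟦ P a ⟧ * f a)
    ≡⟨ ∑-cong (elems FA) (λ a → sym (FB.∑-pick (to a) _)) ⟩
  ∑ (elems FA) (λ a → ∑ (elems FB) (λ b → ⟦ b FB.== to a ⟧ * (⟦ P a ⟧ * f a)))
    ≡⟨ ∑-swap (elems FA) (elems FB) _ ⟩
  ∑ (elems FB) (λ b → ∑ (elems FA) (λ a → ⟦ b FB.== to a ⟧ * (⟦ P a ⟧ * f a)))
    ≡⟨ ∑-cong (elems FB) (λ b → ∑-cong (elems FA) (λ a → same a b)) ⟩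
  ∑ (elems FB) (λ b → ∑ (elems FA) (λ a → ⟦ a FA.== from b ⟧ * (⟦ Q b ⟧ * g b)))
    ≡⟨ ∑-cong (elems FB) (λ b → FA.∑-pick (from b) _) ⟩
  ∑ (elems FB) (λ b → ⟦ Q b ⟧ * g b) ∎
  where
  module FA = Finite FA
  module FB = Finite FB
  same : ∀ a b → ⟦ b FB.== to a ⟧ * (⟦ P a ⟧ * f a) ≡ ⟦ a FA.== from b ⟧ * (⟦ Q b ⟧ * g b)
  same a b with b FB.≟ to a | P a in p | a FA.≟ from b | Q b in q
  ... | yes e | true | yes _ | true = cong (λ x → 1ℤ * (1ℤ * x)) (trans (proj₂ (proj₂ (h a p))) (cong g (sym e)))
  ... | yes e | true | no ¬e | _ = contradiction (trans (sym (proj₁ (proj₂ (h a p)))) (cong from (sym e))) ¬e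
  ... | yes e | true | yes _ | false = contradiction (trans (sym q) (trans (cong Q e) (proj₁ (h a p)))) (λ ())
  ... | yes _ | false | no _ | _ = refl
  ... | yes _ | false | yes _ | false = refl
  ... | yes _ | false | yes e | true = contradiction (trans (sym p) (trans (cong P e) (proj₁ (k b q)))) (λ ())
  ... | no ¬e | _ | yes e | true = contradiction (trans (sym (proj₂ (k b q))) (cong to (sym e))) ¬e
  ... | no _ | _ | yes _ | false = refl
  ... | no _ | _ | no _ | _ = refl

-- Counts the pairs related by E in two ways. It serves where elements correspond through a relation
-- and no canonical map is at hand, as for representatives of blocks.
∑-double : ∀ {A B : Set} (xs : List A) (ys : List B) (P : A → Bool) (Q : B → Bool) (E : A → B → Bool) →
  (∀ x → P x ≡ true → ∑ ys (λ y → ⟦ Q y ⟧ * ⟦ E x y ⟧) ≡ 1ℤ) →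
  (∀ y → Q y ≡ true → ∑ xs (λ x → ⟦ P x ⟧ * ⟦ E x y ⟧) ≡ 1ℤ) →
  ∑ xs (λ x → ⟦ P x ⟧) ≡ ∑ ys (λ y → ⟦ Q y ⟧)
∑-double xs ys P Q E h k = begin
  ∑ xs (λ x → ⟦ P x ⟧)
    ≡⟨ ∑-cong xs (λ x → sym (trans (⟦⟧-* (P x) (h x)) (ℤₚ.*-identityʳ _))) ⟩
  ∑ xs (λ x → ⟦ P x ⟧ * ∑ ys (λ y → ⟦ Q y ⟧ * ⟦ E x y ⟧))
    ≡⟨ ∑-cong xs (λ x → sym (∑-*ˡ ys ⟦ P x ⟧ _)) ⟩
  ∑ xs (λ x → ∑ ys (λ y → ⟦ P x ⟧ * (⟦ Q y ⟧ * ⟦ E x y ⟧)))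
    ≡⟨ ∑-swap xs ys _ ⟩
  ∑ ys (λ y → ∑ xs (λ x → ⟦ P x ⟧ * (⟦ Q y ⟧ * ⟦ E x y ⟧)))
    ≡⟨ ∑-cong ys (λ y → trans (∑-cong xs (λ x → *-swap ⟦ P x ⟧ ⟦ Q y ⟧ ⟦ E x y ⟧)) (∑-*ˡ xs ⟦ Q y ⟧ _)) ⟩
  ∑ ys (λ y → ⟦ Q y ⟧ * ∑ xs (λ x → ⟦ P x ⟧ * ⟦ E x y ⟧))
    ≡⟨ ∑-cong ys (λ y → trans (⟦⟧-* (Q y) (k y)) (ℤₚ.*-identityʳ _)) ⟩
  ∑ ys (λ y → ⟦ Q y ⟧) ∎

-- Sums over the symmetric group

-- Permutations are records of functions and are compared pointwise by `≈`; a function on them can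
-- be reindexed in a sum only if it respects this comparison.
Ext : ∀ {k} → (Permutation′ k → ℤ) → Set
Ext F = ∀ g h → g ≈ h → F g ≡ F h

module _ {k : ℕ} where

  private
    -- A permutation is tabulated together with its inverse, so that being a permutation is a
    -- pointwise test on the two tables and decoding involves no search.
    Code : Set
    Code = Vec (Fin k) k × Vec (Fin k) k

    Code-finite : Finite Code
    Code-finite = ×-finite (Vec-finite (Fin-finite k) k) (Vec-finite (Fin-finite k) k)

    inverses : Code → Bool
    inverses (v , w) = allB (λ x → ⌊ lookup w (lookup v x) Fₚ.≟ x ⌋) ∧ allB (λ x → ⌊ lookup v (lookup w x) Fₚ.≟ x ⌋)

    -- The outcome of the test is a separate argument, so that facts about `decode` can be proved by
    -- cases on it. Codes of no permutation decode to the identity and have weight 0 in `∑ᴳ`.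
    decode-as : ∀ c b → inverses c ≡ b → Permutation′ k
    decode-as (v , w) true eq = P.permutation (lookup v) (lookup w)
      (λ x → true-⌊⌋ (lookup v (lookup w x) Fₚ.≟ x) (allB-sound (λ x → ⌊ lookup v (lookup w x) Fₚ.≟ x ⌋) (proj₂ (∧-true eq)) x))
      (λ x → true-⌊⌋ (lookup w (lookup v x) Fₚ.≟ x) (allB-sound (λ x → ⌊ lookup w (lookup v x) Fₚ.≟ x ⌋) (proj₁ (∧-true eq)) x))
    decode-as c false eq = P.id

    decode : Code → Permutation′ k
    decode c = decode-as c (inverses c) refl

    encode : Permutation′ k → Code
    encode g = tabulate (g ⟨$⟩ʳ_) , tabulate (g ⟨$⟩ˡ_)

    inverses-encode : ∀ g → inverses (encode g) ≡ true
    inverses-encode g = true-∧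
      (allB-complete _ (λ x → ⌊⌋-true (lookup (tabulate (g ⟨$⟩ˡ_)) (lookup (tabulate (g ⟨$⟩ʳ_)) x) Fₚ.≟ x)
        (trans (Vₚ.lookup∘tabulate (g ⟨$⟩ˡ_) (lookup (tabulate (g ⟨$⟩ʳ_)) x)) (trans (cong (g ⟨$⟩ˡ_) (Vₚ.lookup∘tabulate (g ⟨$⟩ʳ_) x)) (P.inverseˡ g)))))
      (allB-complete _ (λ x → ⌊⌋-true (lookup (tabulate (g ⟨$⟩ʳ_)) (lookup (tabulate (g ⟨$⟩ˡ_)) x) Fₚ.≟ x)
        (trans (Vₚ.lookup∘tabulate (g ⟨$⟩ʳ_) (lookup (tabulate (g ⟨$⟩ˡ_)) x)) (trans (cong (g ⟨$⟩ʳ_) (Vₚ.lookup∘tabulate (g ⟨$⟩ˡ_) x)) (P.inverseʳ g)))))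

    decode-true : ∀ c → inverses c ≡ true →
      (∀ x → decode c ⟨$⟩ʳ x ≡ lookup (proj₁ c) x) × (∀ x → decode c ⟨$⟩ˡ x ≡ lookup (proj₂ c) x)
    decode-true c = lem (inverses c) refl
      where
      lem : ∀ b eq → b ≡ true → (∀ x → decode-as c b eq ⟨$⟩ʳ x ≡ lookup (proj₁ c) x)
                                 × (∀ x → decode-as c b eq ⟨$⟩ˡ x ≡ lookup (proj₂ c) x)
      lem true eq _ = (λ _ → refl) , (λ _ → refl)

    encode-decode : ∀ c → inverses c ≡ true → encode (decode c) ≡ c
    encode-decode c@(v , w) e = cong₂ _,_
      (trans (Vₚ.tabulate-cong (proj₁ (decode-true c e))) (Vₚ.tabulate∘lookup v))
      (trans (Vₚ.tabulate-cong (proj₂ (decode-true c e))) (Vₚ.tabulate∘lookup w))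

    decode-encode : ∀ g → decode (encode g) ≈ g
    decode-encode g x = trans (proj₁ (decode-true (encode g) (inverses-encode g)) x) (Vₚ.lookup∘tabulate (g ⟨$⟩ʳ_) x)

  ≈-from : ∀ {g h : Permutation′ k} → g ≈ h → ∀ x → g ⟨$⟩ˡ x ≡ h ⟨$⟩ˡ x
  ≈-from {g} {h} e x = begin
    g ⟨$⟩ˡ x                       ≡⟨ cong (g ⟨$⟩ˡ_) (sym (P.inverseʳ h)) ⟩
    g ⟨$⟩ˡ (h ⟨$⟩ʳ (h ⟨$⟩ˡ x))   ≡⟨ cong (g ⟨$⟩ˡ_) (sym (e (h ⟨$⟩ˡ x))) ⟩
    g ⟨$⟩ˡ (g ⟨$⟩ʳ (h ⟨$⟩ˡ x))   ≡⟨ P.inverseˡ g ⟩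
    h ⟨$⟩ˡ x                       ∎

  private
    encode-cong : ∀ {g h} → g ≈ h → encode g ≡ encode h
    encode-cong {g} {h} e = cong₂ _,_ (Vₚ.tabulate-cong e) (Vₚ.tabulate-cong (≈-from {g} {h} e))

  opaque
    ∑ᴳ : (Permutation′ k → ℤ) → ℤ
    ∑ᴳ F = ∑ (elems Code-finite) (λ c → ⟦ inverses c ⟧ * F (decode c))

    ∑ᴳ-cong : ∀ {F G} → (∀ g → F g ≡ G g) → ∑ᴳ F ≡ ∑ᴳ G
    ∑ᴳ-cong h = ∑-cong (elems Code-finite) (λ c → cong (⟦ inverses c ⟧ *_) (h (decode c)))

    ∑ᴳ-+ : ∀ F G → ∑ᴳ (λ g → F g + G g) ≡ ∑ᴳ F + ∑ᴳ G
    ∑ᴳ-+ F G = trans (∑-cong (elems Code-finite) (λ c → ℤₚ.*-distribˡ-+ ⟦ inverses c ⟧ (F (decode c)) (G (decode c))))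
      (∑-+ (elems Code-finite) _ _)

    ∑ᴳ-*ˡ : ∀ a F → ∑ᴳ (λ g → a * F g) ≡ a * ∑ᴳ F
    ∑ᴳ-*ˡ a F = trans (∑-cong (elems Code-finite) (λ c → *-swap ⟦ inverses c ⟧ a (F (decode c))))
      (∑-*ˡ (elems Code-finite) a _)

    ∑ᴳ-∑ : ∀ {A : Set} (xs : List A) (F : Permutation′ k → A → ℤ) →
      ∑ᴳ (λ g → ∑ xs (F g)) ≡ ∑ xs (λ x → ∑ᴳ (λ g → F g x))
    ∑ᴳ-∑ xs F = trans (∑-cong (elems Code-finite) (λ c → sym (∑-*ˡ xs ⟦ inverses c ⟧ (F (decode c)))))
      (∑-swap (elems Code-finite) xs _)

    ∑ᴳ-zero⇒ : ∀ {F} → Ext F → (∀ g → 0ℤ ℤ.≤ F g) → ∑ᴳ F ≡ 0ℤ → ∀ g → F g ≡ 0ℤ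
    ∑ᴳ-zero⇒ {F} ext h eq g = begin
      F g                                               ≡⟨ ext _ _ (λ x → sym (decode-encode g x)) ⟩
      F (decode (encode g))                             ≡⟨ sym (ℤₚ.*-identityˡ _) ⟩
      ⟦ true ⟧ * F (decode (encode g))                  ≡⟨ cong (λ b → ⟦ b ⟧ * F (decode (encode g))) (sym (inverses-encode g)) ⟩
      ⟦ inverses (encode g) ⟧ * F (decode (encode g))   ≡⟨ Finite.∑-zero⇒ Code-finite (λ c → lem (inverses c) (h (decode c))) eq (encode g) ⟩
      0ℤ ∎
      where lem : ∀ b {x} → 0ℤ ℤ.≤ x → 0ℤ ℤ.≤ ⟦ b ⟧ * x
            lem true  {x} p = subst (0ℤ ℤ.≤_) (sym (ℤₚ.*-identityˡ x)) p
            lem false p = ℤₚ.≤-refl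

    -- φ and ψ are inverse only up to `≈`; transported to codes, whose equality is strict, they
    -- become a bijection.
    ∑ᴳ-bij : (φ ψ : Permutation′ k → Permutation′ k) →
      (∀ {g h} → g ≈ h → φ g ≈ φ h) → (∀ {g h} → g ≈ h → ψ g ≈ ψ h) →
      (∀ g → ψ (φ g) ≈ g) → (∀ g → φ (ψ g) ≈ g) →
      ∀ {F} → Ext F → ∑ᴳ (λ g → F (φ g)) ≡ ∑ᴳ F
    ∑ᴳ-bij φ ψ φ≈ ψ≈ ψφ φψ {F} ext = ∑-bij Code-finite Code-finite inverses inverses _ _
      (λ c → encode (φ (decode c))) (λ c → encode (ψ (decode c)))
      (λ c e → inverses-encode (φ (decode c)) ,
        trans (encode-cong {ψ (decode (encode (φ (decode c))))} {decode c} (λ x → trans (ψ≈ (decode-encode (φ (decode c))) x) (ψφ (decode c) x))) (encode-decode c e) ,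
        ext _ _ (λ x → sym (decode-encode (φ (decode c)) x)))
      (λ c e → inverses-encode (ψ (decode c)) ,
        trans (encode-cong {φ (decode (encode (ψ (decode c))))} {decode c} (λ x → trans (φ≈ (decode-encode (ψ (decode c))) x) (φψ (decode c) x))) (encode-decode c e))

  ∑ᴳ-translate : ∀ h {F} → Ext F → ∑ᴳ (λ g → F (g ∘ₚ h)) ≡ ∑ᴳ F
  ∑ᴳ-translate h = ∑ᴳ-bij (_∘ₚ h) (_∘ₚ P.flip h)
    (λ e x → cong (h ⟨$⟩ʳ_) (e x)) (λ e x → cong (h ⟨$⟩ˡ_) (e x))
    (λ g x → P.inverseˡ h) (λ g x → P.inverseʳ h)

  conj : Permutation′ k → Permutation′ k → Permutation′ k
  conj h g = P.flip h ∘ₚ g ∘ₚ h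

  ∑ᴳ-conj : ∀ h {F} → Ext F → ∑ᴳ (λ g → F (conj h g)) ≡ ∑ᴳ F
  ∑ᴳ-conj h = ∑ᴳ-bij (conj h) (conj (P.flip h))
    (λ e x → cong (h ⟨$⟩ʳ_) (e (h ⟨$⟩ˡ x))) (λ e x → cong (h ⟨$⟩ˡ_) (e (h ⟨$⟩ʳ x)))
    (λ g x → trans (P.inverseˡ h) (cong (g ⟨$⟩ʳ_) (P.inverseˡ h)))
    (λ g x → trans (P.inverseʳ h) (cong (g ⟨$⟩ʳ_) (P.inverseʳ h)))

  anyᴳ : (p : Permutation′ k → Bool) → (∀ {g h} → g ≈ h → p g ≡ true → p h ≡ true) → Dec (∃[ g ] p g ≡ true)
  anyᴳ p ext = map′ (λ (c , e) → decode c , e) (λ (g , e) → encode g , ext (λ x → sym (decode-encode g x)) e)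
    (Finite.any? Code-finite (λ c → p (decode c)))

-- This is k!, kept unevaluated: it accompanies all inner products as a factor and is cancelled as a
-- nonzero integer.
ord : ℕ → ℤ
ord k = ∑ᴳ {k} (λ _ → 1ℤ)

ord≢0 : ∀ k → ord k ≢ 0ℤ
ord≢0 k e with ∑ᴳ-zero⇒ {k} (λ _ _ _ → refl) (λ _ → ℤ.+≤+ z≤n) e P.id
... | ()

-- Finite right actions of the symmetric group

record GSet (k : ℕ) : Set₁ where
  field
    X      : Set
    finite : Finite X
    act    : Permutation′ k → X → X
    act-≈  : ∀ {g h} → g ≈ h → ∀ x → act g x ≡ act h x
    act-id : ∀ x → act P.id x ≡ x
    act-∘  : ∀ g h x → act g (act h x) ≡ act (g ∘ₚ h) x

  open Finite finite public using (_==_; ==-refl; ==-sound) renaming (_≟_ to _≟ˣ_)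

  act-flip : ∀ g {x y} → act g x ≡ y → act (P.flip g) y ≡ x
  act-flip g {x} refl = trans (act-∘ (P.flip g) g x) (trans (act-≈ (λ _ → P.inverseʳ g) x) (act-id x))

  act-flip′ : ∀ g {x y} → act (P.flip g) x ≡ y → act g y ≡ x
  act-flip′ g {x} refl = trans (act-∘ g (P.flip g) x) (trans (act-≈ (λ _ → P.inverseˡ g) x) (act-id x))

  fix : Permutation′ k → X → Bool
  fix g x = act g x == x

  perm-char : (X → Bool) → ClassFn k
  perm-char p g = ∑ (elems finite) (λ x → ⟦ p x ⟧ * ⟦ fix g x ⟧)

  perm-char-ext : ∀ p → Ext (perm-char p)
  perm-char-ext p g h e = ∑-cong (elems finite) (λ x → cong (λ y → ⟦ p x ⟧ * ⟦ y == x ⟧) (act-≈ e x))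

  Invariant : (X → Bool) → Set
  Invariant p = ∀ g x → p (act g x) ≡ p x

  fix-conj : ∀ h g x → fix (conj h g) x ≡ fix g (act h x)
  fix-conj h g x = bool-ext
    (λ e → ⌊⌋-true (_ ≟ˣ _) (trans (sym step) (cong (act h) (==-sound e))))
    (λ e → ⌊⌋-true (_ ≟ˣ _) (begin
      act (conj h g) x                       ≡⟨ sym (act-flip h refl) ⟩
      act (P.flip h) (act h (act (conj h g) x)) ≡⟨ cong (act (P.flip h)) (trans step (==-sound e)) ⟩
      act (P.flip h) (act h x)               ≡⟨ act-flip h refl ⟩
      x ∎))
    where
    step : act h (act (conj h g) x) ≡ act g (act h x)
    step = trans (act-∘ h (conj h g) x) (trans (act-≈ (λ y → cong (λ z → h ⟨$⟩ʳ (g ⟨$⟩ʳ z)) (P.inverseˡ h)) x) (sym (act-∘ g h x)))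

  perm-char-conj : ∀ p → Invariant p → ∀ h g → perm-char p (conj h g) ≡ perm-char p g
  perm-char-conj p inv h g = ∑-bij finite finite p p _ _ (act h) (act (P.flip h))
    (λ x e → trans (inv h x) e , act-flip h refl , cong ⟦_⟧ (fix-conj h g x))
    (λ x e → trans (inv (P.flip h) x) e , act-flip′ h refl)

  hits : X → X → ℤ
  hits y x = ∑ᴳ (λ g → ⟦ act g y == x ⟧)

  stab : X → ℤ
  stab x = hits x x

  orbit? : ∀ y x → Dec (∃[ g ] (act g y == x) ≡ true)
  orbit? y x = anyᴳ (λ g → act g y == x) (λ e eq → trans (cong (_== x) (sym (act-≈ e y))) eq)

  orbit : X → X → Bool
  orbit y x = ⌊ orbit? y x ⌋

  orbit-true : ∀ y x g → act g y ≡ x → orbit y x ≡ true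
  orbit-true y x g e = ⌊⌋-true (orbit? y x) (g , ⌊⌋-true (_ ≟ˣ _) e)

  orbit-sound : ∀ y x → orbit y x ≡ true → ∃[ g ] act g y ≡ x
  orbit-sound y x e with true-⌊⌋ (orbit? y x) e
  ... | g , eq = g , ==-sound eq

  -- Translation by a permutation taking y to x identifies the stabiliser of x with the permutations
  -- that send y to x; off the orbit of y there are none of the latter.
  orbit-stab : ∀ y x → ⟦ orbit y x ⟧ * stab x ≡ hits y x
  orbit-stab y x with orbit? y x
  ... | yes (s , e) = trans (ℤₚ.*-identityˡ _) (begin
      ∑ᴳ (λ g → ⟦ act g x == x ⟧)
        ≡⟨ ∑ᴳ-cong (λ g → cong (λ z → ⟦ z == x ⟧) (trans (cong (act g) (sym (==-sound e))) (act-∘ g s y))) ⟩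
      ∑ᴳ (λ g → ⟦ act (g ∘ₚ s) y == x ⟧)
        ≡⟨ ∑ᴳ-translate s (λ g h e → cong (λ z → ⟦ z == x ⟧) (act-≈ e y)) ⟩
      hits y x ∎)
  ... | no ¬o = sym (trans (∑ᴳ-cong (λ g → miss g)) (∑ᴳ-*ˡ 0ℤ (λ _ → 0ℤ)))
    where
    miss : ∀ g → ⟦ act g y == x ⟧ ≡ 0ℤ
    miss g with act g y == x in eq
    ... | true = contradiction (g , eq) ¬o
    ... | false = refl

  -- The orbit-stabiliser theorem without division: every permutation sends y to exactly one point.
  ∑-orbit : ∀ y → ∑ (elems finite) (λ x → ⟦ orbit y x ⟧ * stab x) ≡ ord k
  ∑-orbit y = begin
    ∑ (elems finite) (λ x → ⟦ orbit y x ⟧ * stab x)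
      ≡⟨ ∑-cong (elems finite) (orbit-stab y) ⟩
    ∑ (elems finite) (λ x → ∑ᴳ (λ g → ⟦ act g y == x ⟧))
      ≡⟨ sym (∑ᴳ-∑ (elems finite) _) ⟩
    ∑ᴳ (λ g → ∑ (elems finite) (λ x → ⟦ act g y == x ⟧))
      ≡⟨ ∑ᴳ-cong (λ g → trans (∑-cong (elems finite) (λ x → cong ⟦_⟧ (⌊⌋-cong (_ ≟ˣ _) (x ≟ˣ act g y) sym sym))) (Finite.once finite (act g y))) ⟩
    ord k ∎

  ∑ᴳ-perm-char : ∀ p → ∑ᴳ (perm-char p) ≡ ∑ (elems finite) (λ x → ⟦ p x ⟧ * stab x)
  ∑ᴳ-perm-char p = trans (∑ᴳ-∑ (elems finite) _) (∑-cong (elems finite) (λ x → ∑ᴳ-*ˡ ⟦ p x ⟧ _))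

  transitive-sum : ∀ p y → p y ≡ true → Invariant p → (∀ x → p x ≡ true → ∃[ g ] act g y ≡ x) → ∑ᴳ (perm-char p) ≡ ord k
  transitive-sum p y py inv tr = trans (∑ᴳ-perm-char p) (trans (∑-cong (elems finite) (λ x → cong (λ b → ⟦ b ⟧ * stab x)
      (bool-ext (λ e → orbit-true y x (proj₁ (tr x e)) (proj₂ (tr x e)))
                (λ e → let g , eq = orbit-sound y x e in trans (cong p (sym eq)) (trans (inv g y) py)))))
    (∑-orbit y))

  -- Burnside's lemma, by removing one orbit at a time.
  burnside : ∀ p → Invariant p → ∃[ N ] ∑ᴳ (perm-char p) ≡ ord k * N
  burnside p inv with go (elems finite) p inv (λ x _ → Any.map (λ { refl → orbit-true x x P.id (act-id x) }) (Finite.mem finite x))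
    where
    go : ∀ ys p → Invariant p → (∀ x → p x ≡ true → Any (λ y → orbit y x ≡ true) ys) →
      ∃[ N ] ∑ (elems finite) (λ x → ⟦ p x ⟧ * stab x) ≡ ord k * N
    go [] p inv cov = 0ℤ , trans (∑-zero (elems finite) (λ x → lem x)) (sym (ℤₚ.*-zeroʳ (ord k)))
      where
      lem : ∀ x → ⟦ p x ⟧ * stab x ≡ 0ℤ
      lem x with p x in eq
      ... | false = refl
      ... | true with cov x eq
      ...   | ()
    go (y ∷ ys) p inv cov with p y in py
    ... | false = go ys p inv (λ x px → shrink x px (cov x px))
      where
      shrink : ∀ x → p x ≡ true → Any (λ y → orbit y x ≡ true) (y ∷ ys) → Any (λ y → orbit y x ≡ true) ys
      shrink x px (here o) = let g , e = orbit-sound y x o in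
        contradiction (trans (sym py) (trans (sym (inv g y)) (trans (cong p e) px))) (λ ())
      shrink x px (there a) = a
    ... | true with go ys p′ inv′ cov′
      where
      orbit-inv : ∀ g x → orbit y (act g x) ≡ orbit y x
      orbit-inv g x = bool-ext
        (λ o → let h , e = orbit-sound y (act g x) o in
               orbit-true y x (P.flip g ∘ₚ h) (trans (sym (act-∘ (P.flip g) h y)) (trans (cong (act (P.flip g)) e) (act-flip g refl))))
        (λ o → let h , e = orbit-sound y x o in
               orbit-true y (act g x) (g ∘ₚ h) (trans (sym (act-∘ g h y)) (cong (act g) e)))
      p′ : X → Bool
      p′ x = p x ∧ not (orbit y x)
      inv′ : Invariant p′
      inv′ g x = cong₂ _∧_ (inv g x) (cong not (orbit-inv g x))
      cov′ : ∀ x → p′ x ≡ true → Any (λ y → orbit y x ≡ true) ys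
      cov′ x e with cov x (proj₁ (∧-true e))
      ... | here o = contradiction (trans (sym (proj₂ (∧-true {p x} e))) (cong not o)) (λ ())
      ... | there a = a
    ...   | N , eq = 1ℤ + N , (begin
      ∑ (elems finite) (λ x → ⟦ p x ⟧ * stab x)
        ≡⟨ ∑-cong (elems finite) split ⟩
      ∑ (elems finite) (λ x → ⟦ orbit y x ⟧ * stab x + ⟦ p x ∧ not (orbit y x) ⟧ * stab x)
        ≡⟨ ∑-+ (elems finite) _ _ ⟩
      ∑ (elems finite) (λ x → ⟦ orbit y x ⟧ * stab x) + ∑ (elems finite) (λ x → ⟦ p x ∧ not (orbit y x) ⟧ * stab x)
        ≡⟨ cong₂ _+_ (∑-orbit y) eq ⟩
      ord k + ord k * N
        ≡⟨ ring (ord k) N ⟩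
      ord k * (1ℤ + N) ∎)
      where
      ring : ∀ a b → a + a * b ≡ a * (1ℤ + b)
      ring = solve-∀
      split : ∀ x → ⟦ p x ⟧ * stab x ≡ ⟦ orbit y x ⟧ * stab x + ⟦ p x ∧ not (orbit y x) ⟧ * stab x
      split x with p x in px | orbit y x in o
      ... | true  | true  = sym (ℤₚ.+-identityʳ (1ℤ * stab x))
      ... | true  | false = sym (ℤₚ.+-identityˡ (1ℤ * stab x))
      ... | false | false = refl
      ... | false | true  = let g , e = orbit-sound y x o in
        contradiction (trans (sym px) (trans (cong p (sym e)) (trans (inv g y) py))) (λ ())
  ... | N , eq = N , trans (∑ᴳ-perm-char p) eq

×-GSet : ∀ {k} → GSet k → GSet k → GSet k
×-GSet A B = record
  { X = A.X × B.X
  ; finite = ×-finite A.finite B.finite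
  ; act = λ g (a , b) → A.act g a , B.act g b
  ; act-≈ = λ e (a , b) → cong₂ _,_ (A.act-≈ e a) (B.act-≈ e b)
  ; act-id = λ (a , b) → cong₂ _,_ (A.act-id a) (B.act-id b)
  ; act-∘ = λ g h (a , b) → cong₂ _,_ (A.act-∘ g h a) (B.act-∘ g h b)
  }
  where module A = GSet A
        module B = GSet B

-- A product of permutation characters is again a permutation character, so Burnside's lemma makes
-- the inner product of two of them an integral multiple of `ord k`.
perm-char-× : ∀ {k} (A B : GSet k) p q g →
  GSet.perm-char (×-GSet A B) (λ (a , b) → p a ∧ q b) g ≡ GSet.perm-char A p g * GSet.perm-char B q g
perm-char-× A B p q g = begin
  GSet.perm-char (×-GSet A B) (λ (a , b) → p a ∧ q b) g
    ≡⟨ ∑-× A.finite B.finite _ ⟩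
  ∑ (elems A.finite) (λ a → ∑ (elems B.finite) (λ b → ⟦ p a ∧ q b ⟧ * ⟦ (A.act g a , B.act g b) AB.== (a , b) ⟧))
    ≡⟨ ∑-cong (elems A.finite) (λ a → ∑-cong (elems B.finite) (λ b → split a b)) ⟩
  ∑ (elems A.finite) (λ a → ∑ (elems B.finite) (λ b → (⟦ p a ⟧ * ⟦ A.fix g a ⟧) * (⟦ q b ⟧ * ⟦ B.fix g b ⟧)))
    ≡⟨ ∑-cong (elems A.finite) (λ a → ∑-*ˡ (elems B.finite) (⟦ p a ⟧ * ⟦ A.fix g a ⟧) _) ⟩
  ∑ (elems A.finite) (λ a → (⟦ p a ⟧ * ⟦ A.fix g a ⟧) * B.perm-char q g)
    ≡⟨ ∑-*ʳ (elems A.finite) (B.perm-char q g) _ ⟩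
  A.perm-char p g * B.perm-char q g ∎
  where
  module A = GSet A
  module B = GSet B
  module AB = GSet (×-GSet A B)
  shuffle : ∀ a b c d → (a * b) * (c * d) ≡ (a * c) * (b * d)
  shuffle = solve-∀
  split : ∀ a b → ⟦ p a ∧ q b ⟧ * ⟦ (A.act g a , B.act g b) AB.== (a , b) ⟧ ≡ (⟦ p a ⟧ * ⟦ A.fix g a ⟧) * (⟦ q b ⟧ * ⟦ B.fix g b ⟧)
  split a b = trans (cong₂ _*_ (⟦∧⟧ (p a) (q b)) (trans (cong ⟦_⟧ (bool-ext
      (λ e → let e′ = AB.==-sound {A.act g a , B.act g b} {a , b} e in
             true-∧ (⌊⌋-true (_ A.≟ˣ _) (cong proj₁ e′)) (⌊⌋-true (_ B.≟ˣ _) (cong proj₂ e′)))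
      (λ e → ⌊⌋-true (_ AB.≟ˣ _) (cong₂ _,_ (A.==-sound (proj₁ (∧-true e))) (B.==-sound (proj₂ (∧-true {A.fix g a} e)))))))
      (⟦∧⟧ (A.fix g a) (B.fix g b))))
    (shuffle ⟦ p a ⟧ ⟦ q b ⟧ ⟦ A.fix g a ⟧ ⟦ B.fix g b ⟧)

-- Words and their contents

∑-true : ∀ {A : Set} (xs : List A) f → ∑ xs (λ x → ⟦ true ⟧ * f x) ≡ ∑ xs f
∑-true xs f = ∑-cong xs (λ x → ℤₚ.*-identityˡ (f x))

∑-reindex : ∀ {A B : Set} (FA : Finite A) (FB : Finite B) (to : A → B) (from : B → A) →
  (∀ a → from (to a) ≡ a) → (∀ b → to (from b) ≡ b) → ∀ f →
  ∑ (elems FA) (λ a → f (to a)) ≡ ∑ (elems FB) f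
∑-reindex FA FB to from ft tf f = begin
  ∑ (elems FA) (λ a → f (to a))             ≡⟨ sym (∑-true (elems FA) (f ∘ to)) ⟩
  ∑ (elems FA) (λ a → ⟦ true ⟧ * f (to a))  ≡⟨ ∑-bij FA FB (λ _ → true) (λ _ → true) (f ∘ to) f to from
                                                   (λ a _ → refl , ft a , refl) (λ b _ → refl , tf b) ⟩
  ∑ (elems FB) (λ b → ⟦ true ⟧ * f b)       ≡⟨ ∑-true (elems FB) f ⟩
  ∑ (elems FB) f ∎

∑-perm : ∀ {n} (g : Permutation′ n) f → ∑ (allFin n) (λ x → f (g ⟨$⟩ʳ x)) ≡ ∑ (allFin n) f
∑-perm {n} g = ∑-reindex (Fin-finite n) (Fin-finite n) (g ⟨$⟩ʳ_) (g ⟨$⟩ˡ_) (λ _ → P.inverseˡ g) (λ _ → P.inverseʳ g)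

∑-punchIn : ∀ {n} (i : Fin (suc n)) (f : Fin (suc n) → ℤ) →
  ∑ (allFin (suc n)) f ≡ f i + ∑ (allFin n) (λ x → f (F.punchIn i x))
∑-punchIn {n} zero f = ∑-allFin n f
∑-punchIn {suc n} (suc i) f = begin
  ∑ (allFin (suc (suc n))) f
    ≡⟨ ∑-allFin (suc n) f ⟩
  f zero + ∑ (allFin (suc n)) (λ x → f (suc x))
    ≡⟨ cong (_+_ (f zero)) (∑-punchIn i (f ∘ suc)) ⟩
  f zero + (f (suc i) + ∑ (allFin n) (λ x → f (suc (F.punchIn i x))))
    ≡⟨ shuffle (f zero) (f (suc i)) _ ⟩
  f (suc i) + (f zero + ∑ (allFin n) (λ x → f (suc (F.punchIn i x))))
    ≡⟨ cong (_+_ (f (suc i))) (sym (∑-allFin n (f ∘ F.punchIn (suc i)))) ⟩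
  f (suc i) + ∑ (allFin (suc n)) (λ x → f (F.punchIn (suc i) x)) ∎
  where
  shuffle : ∀ a b c → a + (b + c) ≡ b + (a + c)
  shuffle = solve-∀

∑-one : ∀ n → ∑ (allFin n) (λ _ → 1ℤ) ≡ + n
∑-one zero = refl
∑-one (suc n) = trans (∑-allFin n (λ _ → 1ℤ)) (cong (_+_ 1ℤ) (∑-one n))

+-cancelˡ : ∀ a {b c} → a + b ≡ a + c → b ≡ c
+-cancelˡ a {b} {c} e = trans (lem a b) (trans (cong (_+_ (- a)) e) (sym (lem a c)))
  where lem : ∀ a b → b ≡ - a + (a + b)
        lem = solve-∀

module Words {A : Set} (FA : Finite A) where

  open Finite FA using (_==_; _≟_; ==-refl; ==-sound)

  cnt : ∀ {n} → (Fin n → A) → A → ℤ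
  cnt {n} f a = ∑ (allFin n) (λ x → ⟦ f x == a ⟧)

  cnt-cong : ∀ {n} {f f′ : Fin n → A} → (∀ x → f x ≡ f′ x) → ∀ a → cnt f a ≡ cnt f′ a
  cnt-cong {n} h a = ∑-cong (allFin n) (λ x → cong (λ z → ⟦ z == a ⟧) (h x))

  cnt-perm : ∀ {n} (g : Permutation′ n) f a → cnt (λ x → f (g ⟨$⟩ʳ x)) a ≡ cnt f a
  cnt-perm g f a = ∑-perm g (λ x → ⟦ f x == a ⟧)

  -- Some position i of f carries the first letter of f′, since that letter has a positive count.
  -- Deleting both occurrences leaves equal contents, and the permutation of the rest is extended by
  -- 0 ↦ i. Thus the words of a given content form a single orbit.
  same-content : ∀ n (f f′ : Fin n → A) → (∀ a → cnt f a ≡ cnt f′ a) → ∃[ g ] (∀ x → f (g ⟨$⟩ʳ x) ≡ f′ x)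
  same-content zero f f′ h = P.id , λ ()
  same-content (suc n) f f′ h with Finite.any? (Fin-finite (suc n)) (λ x → f x == f′ zero)
  ... | no ¬i = contradiction pos (λ { (ℤ.+≤+ ()) })
    where
    none : cnt f′ (f′ zero) ≡ 0ℤ
    none = trans (sym (h (f′ zero))) (∑-zero (allFin (suc n)) miss)
      where miss : ∀ x → ⟦ f x == f′ zero ⟧ ≡ 0ℤ
            miss x with f x == f′ zero in e
            ... | true = contradiction (x , e) ¬i
            ... | false = refl
    pos : 1ℤ ℤ.≤ 0ℤ
    pos = subst (1ℤ ℤ.≤_) (trans (cong (λ b → ⟦ b ⟧ + ∑ (allFin n) (λ x → ⟦ f′ (suc x) == f′ zero ⟧)) (sym (==-refl (f′ zero))))
                              (trans (sym (∑-allFin n (λ x → ⟦ f′ x == f′ zero ⟧))) none))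
            (ℤₚ.+-monoʳ-≤ 1ℤ (∑-nonneg (allFin n) (λ x → ⟦⟧-nonneg (f′ (suc x) == f′ zero))))
  ... | yes (i , e) with same-content n (f ∘ F.punchIn i) (f′ ∘ suc) (λ a → +-cancelˡ ⟦ f i == a ⟧ (begin
        ⟦ f i == a ⟧ + cnt (f ∘ F.punchIn i) a  ≡⟨ sym (∑-punchIn i (λ x → ⟦ f x == a ⟧)) ⟩
        cnt f a                                  ≡⟨ h a ⟩
        cnt f′ a                                 ≡⟨ ∑-allFin n (λ x → ⟦ f′ x == a ⟧) ⟩
        ⟦ f′ zero == a ⟧ + cnt (f′ ∘ suc) a      ≡⟨ cong (λ z → ⟦ z == a ⟧ + cnt (f′ ∘ suc) a) (sym (==-sound e)) ⟩
        ⟦ f i == a ⟧ + cnt (f′ ∘ suc) a ∎))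
  ...   | g , eq = P.insert zero i g , λ
          { zero → ==-sound e
          ; (suc x) → trans (cong f (P.insert-punchIn zero i g x)) (eq x) }

  words : ∀ n → GSet n
  words n = record
    { X = Vec A n
    ; finite = Vec-finite FA n
    ; act = λ g w → tabulate (λ x → lookup w (g ⟨$⟩ʳ x))
    ; act-≈ = λ e w → Vₚ.tabulate-cong (λ x → cong (lookup w) (e x))
    ; act-id = Vₚ.tabulate∘lookup
    ; act-∘ = λ g h w → Vₚ.tabulate-cong (λ x → Vₚ.lookup∘tabulate (λ y → lookup w (h ⟨$⟩ʳ y)) (g ⟨$⟩ʳ x))
    }

  opaque
    content? : ∀ {n} (c : A → ℤ) (w : Vec A n) → Dec (∀ a → cnt (lookup w) a ≡ c a)
    content? c w with Finite.any? FA (λ a → ⌊ ¬? (cnt (lookup w) a ℤ.≟ c a) ⌋)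
    ... | yes (a , e) = no (λ h → true-⌊⌋ (¬? (cnt (lookup w) a ℤ.≟ c a)) e (h a))
    ... | no ¬a = yes (λ a → case cnt (lookup w) a ℤ.≟ c a of λ
            { (yes e) → e ; (no ¬e) → contradiction (a , ⌊⌋-true (¬? (cnt (lookup w) a ℤ.≟ c a)) ¬e) ¬a })

  has : ∀ {n} → (A → ℤ) → Vec A n → Bool
  has c w = ⌊ content? c w ⌋

  has-invariant : ∀ n c → GSet.Invariant (words n) (has c)
  has-invariant n c g w = ⌊⌋-cong (content? c (tabulate (λ x → lookup w (g ⟨$⟩ʳ x)))) (content? c w)
    (λ h a → trans (sym (lem a)) (h a)) (λ h a → trans (lem a) (h a))
    where
    lem : ∀ a → cnt (lookup (tabulate (λ x → lookup w (g ⟨$⟩ʳ x)))) a ≡ cnt (lookup w) a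
    lem a = trans (cnt-cong (Vₚ.lookup∘tabulate (λ x → lookup w (g ⟨$⟩ʳ x))) a) (cnt-perm g (lookup w) a)

  same-content-act : ∀ {n} (v w : Vec A n) → (∀ a → cnt (lookup v) a ≡ cnt (lookup w) a) →
    ∃[ g ] GSet.act (words n) g v ≡ w
  same-content-act v w h with same-content _ (lookup v) (lookup w) h
  ... | g , e = g , trans (Vₚ.tabulate-cong e) (Vₚ.tabulate∘lookup w)

  word-exists : ∀ n (c : A → ℕ) → ∑ (elems FA) (λ a → + c a) ≡ + n →
    ∃[ f ] (∀ a → cnt {n} f a ≡ + c a)
  word-exists n c eq = subst (λ m → ∃[ f ] (∀ a → cnt {m} f a ≡ + c a)) len
    (L.lookup blocks , λ a → trans (cnt-lookup blocks a) (trans (blocks-∑ (λ x → ⟦ x == a ⟧)) (trans (∑-cong (elems FA) (λ b → ℤₚ.*-comm (+ c b) ⟦ b == a ⟧)) (Finite.∑-pick FA a (λ b → + c b)))))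
    where
    blocks : List A
    blocks = concatMap (λ a → L.replicate (c a) a) (elems FA)
    ∑-replicate : ∀ m a (f : A → ℤ) → ∑ (L.replicate m a) f ≡ + m * f a
    ∑-replicate zero a f = refl
    ∑-replicate (suc m) a f = trans (cong (_+_ (f a)) (∑-replicate m a f)) (sym (ℤₚ.suc-* (+ m) (f a)))
    blocks-∑ : ∀ f → ∑ blocks f ≡ ∑ (elems FA) (λ a → + c a * f a)
    blocks-∑ f = trans (∑-concatMap _ (elems FA) f) (∑-cong (elems FA) (λ a → ∑-replicate (c a) a f))
    ∑-length : ∀ (xs : List A) → ∑ xs (λ _ → 1ℤ) ≡ + length xs
    ∑-length [] = refl
    ∑-length (x ∷ xs) = cong (_+_ 1ℤ) (∑-length xs)
    len : length blocks ≡ n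
    len = ℤₚ.+-injective (trans (sym (∑-length blocks)) (trans (blocks-∑ (λ _ → 1ℤ)) (trans (∑-cong (elems FA) (λ a → ℤₚ.*-identityʳ (+ c a))) eq)))
    cnt-lookup : ∀ (xs : List A) a → cnt (L.lookup xs) a ≡ ∑ xs (λ x → ⟦ x == a ⟧)
    cnt-lookup [] a = refl
    cnt-lookup (x ∷ xs) a = trans (∑-allFin (length xs) (λ i → ⟦ L.lookup (x ∷ xs) i == a ⟧)) (cong (_+_ ⟦ x == a ⟧) (cnt-lookup xs a))

-- Young characters as permutation characters

colours : (α : List ℕ) → Fin (length α) → ℤ
colours α j = + lookup (V.fromList α) j

-- The same device as for `allB-go`: the test local to `youngChar` is recovered by unification.
mutual
  youngChar-fibresOK : ∀ n (α : List ℕ) → Permutation′ n → Vec (Fin (length α)) n → Bool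
  youngChar-fibresOK = _

  youngChar-spec : ∀ n α g → youngChar n α g ≡
    + count (λ f → allB (λ x → ⌊ lookup f (g ⟨$⟩ʳ x) Fₚ.≟ lookup f x ⌋) ∧ youngChar-fibresOK n α g f)
            (allVec (allFin (length α)) n)
  youngChar-spec n α g = refl

module Coloured (p : ℕ) = Words (Fin-finite p)

-- `youngChar` rephrased as the permutation character of an action on words. It is defined for every
-- α and vanishes when the parts of α do not add up to n, as there are no words of such a content.
young : ∀ n (α : List ℕ) → ClassFn n
young n α = GSet.perm-char (Coloured.words (length α) n) (Coloured.has (length α) (colours α))

youngChar≡young : ∀ n α g → youngChar n α g ≡ young n α g
youngChar≡young n α g = trans (youngChar-spec n α g) (trans (∑-count _ (allVec (allFin (length α)) n))
  (∑-cong (allVec (allFin (length α)) n) (λ f → begin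
    ⟦ allB (λ x → ⌊ lookup f (g ⟨$⟩ʳ x) Fₚ.≟ lookup f x ⌋) ∧ youngChar-fibresOK n α g f ⟧
      ≡⟨ cong ⟦_⟧ (cong₂ _∧_ (fixed f) (fibres f)) ⟩
    ⟦ GSet.fix (W.words n) g f ∧ W.has (colours α) f ⟧
      ≡⟨ ⟦∧⟧ (GSet.fix (W.words n) g f) (W.has (colours α) f) ⟩
    ⟦ GSet.fix (W.words n) g f ⟧ * ⟦ W.has (colours α) f ⟧
      ≡⟨ ℤₚ.*-comm ⟦ GSet.fix (W.words n) g f ⟧ ⟦ W.has (colours α) f ⟧ ⟩
    ⟦ W.has (colours α) f ⟧ * ⟦ GSet.fix (W.words n) g f ⟧ ∎)))
  where
  module W = Coloured (length α)
  fixed : ∀ f → allB (λ x → ⌊ lookup f (g ⟨$⟩ʳ x) Fₚ.≟ lookup f x ⌋) ≡ GSet.fix (W.words n) g f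
  fixed f = bool-ext
    (λ e → ⌊⌋-true (GSet._≟ˣ_ (W.words n) _ f) (trans (Vₚ.tabulate-cong (λ x → true-⌊⌋ (lookup f (g ⟨$⟩ʳ x) Fₚ.≟ lookup f x) (allB-sound _ e x))) (Vₚ.tabulate∘lookup f)))
    (λ e → allB-complete _ (λ x → ⌊⌋-true (lookup f (g ⟨$⟩ʳ x) Fₚ.≟ lookup f x)
      (trans (sym (Vₚ.lookup∘tabulate (λ y → lookup f (g ⟨$⟩ʳ y)) x)) (cong (λ v → lookup v x) (GSet.==-sound (W.words n) {_} {f} e)))))
  fibres : ∀ f → youngChar-fibresOK n α g f ≡ W.has (colours α) f
  fibres f = bool-ext
    (λ e → ⌊⌋-true (W.content? (colours α) f) (λ j → trans (sym (∑-count (λ x → ⌊ lookup f x Fₚ.≟ j ⌋) (allFin n)))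
      (cong +_ (≡ᵇ-sound (allB-sound (λ j → count (λ x → ⌊ lookup f x Fₚ.≟ j ⌋) (allFin n) ≡ᵇ lookup (V.fromList α) j) e j)))))
    (λ e → allB-complete (λ j → count (λ x → ⌊ lookup f x Fₚ.≟ j ⌋) (allFin n) ≡ᵇ lookup (V.fromList α) j)
      (λ j → ≡ᵇ-true (ℤₚ.+-injective (trans (∑-count (λ x → ⌊ lookup f x Fₚ.≟ j ⌋) (allFin n)) (true-⌊⌋ (W.content? (colours α) f) e j)))))

-- Inner products of Young characters count matrices with prescribed row and column sums

∑-upTo : ∀ m (f : ℕ → ℤ) → ∑ (upTo (suc m)) f ≡ f 0 + ∑ (upTo m) (λ s → f (suc s))
∑-upTo m f = cong (_+_ (f 0)) (applyUpTo-suc m id f)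
  where
  applyUpTo-suc : ∀ m (h : ℕ → ℕ) (f : ℕ → ℤ) → ∑ (L.applyUpTo (h ∘ suc) m) f ≡ ∑ (upTo m) (λ s → f (h (suc s)))
  applyUpTo-suc zero h f = refl
  applyUpTo-suc (suc m) h f = cong (_+_ (f (h 1))) (trans (applyUpTo-suc m (h ∘ suc) f) (sym (applyUpTo-suc m id (f ∘ h ∘ suc))))

allZero : List ℤ → Bool
allZero [] = true
allZero (u ∷ l) = ⌊ u ℤ.≟ 0ℤ ⌋ ∧ allZero l

-- T⁻ a F l sums F over all ways to subtract a vector of naturals of total a from l.
T⁻ : ℕ → (List ℤ → ℤ) → List ℤ → ℤ
T⁻ a F [] = ⟦ a ≡ᵇ 0 ⟧ * F []
T⁻ a F (u ∷ l) = ∑ (upTo (suc a)) (λ s → T⁻ (a ∸ s) (λ l′ → F ((u - + s) ∷ l′)) l)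

-- The number of ℕ-matrices with row sums l and column sums γ (zero if an entry of l is negative).
M : List ℤ → List ℕ → ℤ
M l [] = ⟦ allZero l ⟧
M l (a ∷ γ) = T⁻ a (λ l′ → M l′ γ) l

T⁻-cong : ∀ a {F G : List ℤ → ℤ} l → (∀ l′ → length l′ ≡ length l → F l′ ≡ G l′) → T⁻ a F l ≡ T⁻ a G l
T⁻-cong a [] h = cong (⟦ a ≡ᵇ 0 ⟧ *_) (h [] refl)
T⁻-cong a (u ∷ l) h = ∑-cong (upTo (suc a)) (λ s → T⁻-cong (a ∸ s) l (λ l′ e → h _ (cong suc e)))

∑-allFin-upTo : ∀ m (f : ℕ → ℤ) → ∑ (allFin m) (λ i → f (toℕ i)) ≡ ∑ (upTo m) f
∑-allFin-upTo zero f = refl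
∑-allFin-upTo (suc m) f = trans (∑-allFin m (f ∘ toℕ)) (trans (cong (_+_ (f 0)) (∑-allFin-upTo m (f ∘ suc))) (sym (∑-upTo m f)))

∑-upTo-extend : ∀ {a m} → a ≤ m → (f : ℕ → ℤ) → (∀ s → a ≤ s → f s ≡ 0ℤ) → ∑ (upTo m) f ≡ ∑ (upTo a) f
∑-upTo-extend {zero} {m} z≤n f h = ∑-zero (upTo m) (λ s → h s z≤n)
∑-upTo-extend {suc a} {suc m} (s≤s le) f h = trans (∑-upTo m f)
  (trans (cong (_+_ (f 0)) (∑-upTo-extend le (f ∘ suc) (λ s e → h (suc s) (s≤s e)))) (sym (∑-upTo a f)))

∑-upTo-cong : ∀ m {f g : ℕ → ℤ} → (∀ s → s < m → f s ≡ g s) → ∑ (upTo m) f ≡ ∑ (upTo m) g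
∑-upTo-cong zero h = refl
∑-upTo-cong (suc m) {f} {g} h = trans (∑-upTo m f) (trans (cong₂ _+_ (h 0 (s≤s z≤n)) (∑-upTo-cong m (λ s e → h (suc s) (s≤s e)))) (sym (∑-upTo m g)))

private
  weight : ∀ {n p} → Vec (Fin n) p → ℕ
  weight [] = 0
  weight (s ∷ r) = toℕ s ℕ.+ weight r

  sub : ∀ {n p} → List ℤ → Vec (Fin n) p → List ℤ
  sub (u ∷ l) (s ∷ r) = (u - + toℕ s) ∷ sub l r
  sub l _ = l

  length-sub : ∀ {n p} l (r : Vec (Fin n) p) → length (sub l r) ≡ length l
  length-sub [] r = refl
  length-sub (u ∷ l) [] = refl
  length-sub (u ∷ l) (s ∷ r) = cong suc (length-sub l r)

  -- `T⁻` lets each entry range up to what remains of a, whereas here all entries range over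
  -- `Fin (suc n)`; an entry beyond the remainder already violates the weight condition.
  columns-T⁻ : ∀ n a → a ≤ n → ∀ l F →
    ∑ (allVec (allFin (suc n)) (length l)) (λ r → ⟦ weight r ≡ᵇ a ⟧ * F (sub l r)) ≡ T⁻ a F l
  columns-T⁻ n a le [] F = trans (ℤₚ.+-identityʳ _) (cong (λ b → ⟦ b ⟧ * F []) (zero-sym a))
    where zero-sym : ∀ a → (0 ≡ᵇ a) ≡ (a ≡ᵇ 0)
          zero-sym zero = refl
          zero-sym (suc a) = refl
  columns-T⁻ n a le (u ∷ l) F = begin
    ∑ (allVec (allFin (suc n)) (suc (length l))) (λ r → ⟦ weight r ≡ᵇ a ⟧ * F (sub (u ∷ l) r))
      ≡⟨ ∑-allVec (allFin (suc n)) (length l) _ ⟩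
    ∑ (allFin (suc n)) (λ s → H (toℕ s))
      ≡⟨ ∑-allFin-upTo (suc n) H ⟩
    ∑ (upTo (suc n)) H
      ≡⟨ ∑-upTo-extend (s≤s le) H (λ s lt → ∑-zero (allVec (allFin (suc n)) (length l)) (λ r →
           cong (λ b → ⟦ b ⟧ * F ((u - + s) ∷ sub l r)) (too-big s (weight r) lt))) ⟩
    ∑ (upTo (suc a)) H
      ≡⟨ ∑-upTo-cong (suc a) (λ s lt → trans (∑-cong (allVec (allFin (suc n)) (length l)) (λ r →
           cong (λ b → ⟦ b ⟧ * F ((u - + s) ∷ sub l r)) (shift s a (weight r) (ℕₚ.≤-pred lt))))
           (columns-T⁻ n (a ∸ s) (ℕₚ.≤-trans (ℕₚ.m∸n≤m a s) le) l (λ l′ → F ((u - + s) ∷ l′)))) ⟩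
    T⁻ a F (u ∷ l) ∎
    where
    H : ℕ → ℤ
    H s = ∑ (allVec (allFin (suc n)) (length l)) (λ r → ⟦ (s ℕ.+ weight r) ≡ᵇ a ⟧ * F ((u - + s) ∷ sub l r))
    too-big : ∀ s w → a < s → ((s ℕ.+ w) ≡ᵇ a) ≡ false
    too-big s w lt with (s ℕ.+ w) ≡ᵇ a in e
    ... | false = refl
    ... | true = contradiction (ℕₚ.m≤m+n s w) (ℕₚ.<⇒≱ (subst (_< s) (sym (ℕₚ.≡ᵇ⇒≡ (s ℕ.+ w) a (subst T (sym e) tt))) lt))
    shift : ∀ s a w → s ≤ a → ((s ℕ.+ w) ≡ᵇ a) ≡ (w ≡ᵇ (a ∸ s))
    shift zero a w le = refl
    shift (suc s) (suc a) w (s≤s le) = shift s a w le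

  fits : ∀ {n p} → List ℤ → (γ : List ℕ) → Vec (Vec (Fin n) p) (length γ) → Bool
  fits l [] [] = allZero l
  fits l (a ∷ γ) (r ∷ C) = (weight r ≡ᵇ a) ∧ fits (sub l r) γ C

  matrices-M : ∀ n γ → All (_≤ n) γ → ∀ p l → length l ≡ p →
    ∑ (allVec (allVec (allFin (suc n)) p) (length γ)) (λ C → ⟦ fits l γ C ⟧) ≡ M l γ
  matrices-M n [] [] p l e = ℤₚ.+-identityʳ _
  matrices-M n (a ∷ γ) (le ∷ les) p l refl = begin
    ∑ (allVec R (suc (length γ))) (λ C → ⟦ fits l (a ∷ γ) C ⟧)
      ≡⟨ ∑-allVec R (length γ) _ ⟩
    ∑ R (λ r → ∑ (allVec R (length γ)) (λ C → ⟦ (weight r ≡ᵇ a) ∧ fits (sub l r) γ C ⟧))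
      ≡⟨ ∑-cong R (λ r → trans (∑-cong (allVec R (length γ)) (λ C → ⟦∧⟧ (weight r ≡ᵇ a) (fits (sub l r) γ C)))
           (trans (∑-*ˡ (allVec R (length γ)) ⟦ weight r ≡ᵇ a ⟧ _)
             (cong (⟦ weight r ≡ᵇ a ⟧ *_) (matrices-M n γ les (length l) (sub l r) (length-sub l r))))) ⟩
    ∑ R (λ r → ⟦ weight r ≡ᵇ a ⟧ * M (sub l r) γ)
      ≡⟨ columns-T⁻ n a le l (λ l′ → M l′ γ) ⟩
    T⁻ a (λ l′ → M l′ γ) l ∎
    where R = allVec (allFin (suc n)) (length l)

  at : List ℤ → ℕ → ℤ
  at [] _ = 0ℤ
  at (u ∷ l) zero = u
  at (u ∷ l) (suc i) = at l i

  at-sub : ∀ {n p} l (r : Vec (Fin n) p) → length l ≡ p → ∀ (i : Fin p) →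
    at (sub l r) (toℕ i) ≡ at l (toℕ i) - + toℕ (lookup r i)
  at-sub (u ∷ l) (s ∷ r) e zero = refl
  at-sub (u ∷ l) (s ∷ r) e (suc i) = at-sub l r (ℕₚ.suc-injective e) i

  allZero-sound : ∀ {p} l → length l ≡ p → allZero l ≡ true → ∀ (i : Fin p) → at l (toℕ i) ≡ 0ℤ
  allZero-sound (u ∷ l) e h zero = true-⌊⌋ (u ℤ.≟ 0ℤ) (proj₁ (∧-true h))
  allZero-sound (u ∷ l) e h (suc i) = allZero-sound l (ℕₚ.suc-injective e) (proj₂ (∧-true {⌊ u ℤ.≟ 0ℤ ⌋} h)) i

  allZero-complete : ∀ p l → length l ≡ p → (∀ (i : Fin p) → at l (toℕ i) ≡ 0ℤ) → allZero l ≡ true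
  allZero-complete zero [] e h = refl
  allZero-complete (suc p) (u ∷ l) e h = true-∧ (⌊⌋-true (u ℤ.≟ 0ℤ) (h zero)) (allZero-complete p l (ℕₚ.suc-injective e) (h ∘ suc))

  isolate : ∀ a b c → a - b ≡ c → a ≡ b + c
  isolate a b c e = trans (lem a b) (cong (_+_ b) e)
    where lem : ∀ a b → a ≡ b + (a - b)
          lem = solve-∀

  isolate⁻¹ : ∀ a b c → a ≡ b + c → a - b ≡ c
  isolate⁻¹ a b c e = trans (cong (_- b) e) (lem b c)
    where lem : ∀ b c → b + c - b ≡ c
          lem = solve-∀

  module _ {n p : ℕ} where

    RowSums : List ℤ → ∀ {q} → Vec (Vec (Fin n) p) q → Set
    RowSums l {q} C = ∀ i → at l (toℕ i) ≡ ∑ (allFin q) (λ j → + toℕ (lookup (lookup C j) i))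

    ColSums : (γ : List ℕ) → Vec (Vec (Fin n) p) (length γ) → Set
    ColSums γ C = ∀ j → weight (lookup C j) ≡ lookup (V.fromList γ) j

    fits-sound : ∀ l γ C → length l ≡ p → fits l γ C ≡ true → RowSums l C × ColSums γ C
    fits-sound l [] [] e h = allZero-sound l e h , λ ()
    fits-sound l (a ∷ γ) (r ∷ C) e h with fits-sound (sub l r) γ C (trans (length-sub l r) e) (proj₂ (∧-true {weight r ≡ᵇ a} h))
    ... | rows , cols = (λ i → trans (isolate _ _ _ (trans (sym (at-sub l r e i)) (rows i)))
                               (sym (∑-allFin (length γ) (λ j → + toℕ (lookup (lookup (r ∷ C) j) i))))) ,
                        λ { zero → ℕₚ.≡ᵇ⇒≡ _ _ (subst T (sym (proj₁ (∧-true h))) tt) ; (suc j) → cols j }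

    fits-complete : ∀ l γ C → length l ≡ p → RowSums l C → ColSums γ C → fits l γ C ≡ true
    fits-complete l [] [] e rows cols = allZero-complete p l e rows
    fits-complete l (a ∷ γ) (r ∷ C) e rows cols = true-∧ (≡ᵇ-true (cols zero))
      (fits-complete (sub l r) γ C (trans (length-sub l r) e)
        (λ i → trans (at-sub l r e i) (isolate⁻¹ _ _ _ (trans (rows i) (∑-allFin (length γ) (λ j → + toℕ (lookup (lookup (r ∷ C) j) i))))))
        (cols ∘ suc))

  at-map : ∀ β (i : Fin (length β)) → at (map +_ β) (toℕ i) ≡ colours β i
  at-map (b ∷ β) zero = refl
  at-map (b ∷ β) (suc i) = at-map β i

  weight-∑ : ∀ {n p} (r : Vec (Fin n) p) → + weight r ≡ ∑ (allFin p) (λ i → + toℕ (lookup r i))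
  weight-∑ [] = refl
  weight-∑ {p = suc p} (s ∷ r) = trans (ℤₚ.pos-+ (toℕ s) (weight r)) (trans (cong (_+_ (+ toℕ s)) (weight-∑ r)) (sym (∑-allFin p (λ i → + toℕ (lookup (s ∷ r) i)))))

∑-colours : ∀ β → ∑ (allFin (length β)) (colours β) ≡ + sumℕ β
∑-colours [] = refl
∑-colours (b ∷ β) = trans (∑-allFin (length β) (colours (b ∷ β))) (trans (cong (_+_ (+ b)) (∑-colours β)) (sym (ℤₚ.pos-+ b (sumℕ β))))

module _ (n : ℕ) (β γ : List ℕ) (β-sum : sumℕ β ≡ n) (γ-small : All (_≤ n) γ) where

  private
    p = length β
    q = length γ
    A = Fin p × Fin q
    FA : Finite A
    FA = ×-finite (Fin-finite p) (Fin-finite q)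
    module W = Words FA
    module U₁ = Coloured p
    module U₂ = Coloured q
    C-finite : Finite (Vec (Vec (Fin (suc n)) p) q)
    C-finite = Vec-finite (Vec-finite (Fin-finite (suc n)) p) q

    entry : Vec (Vec (Fin (suc n)) p) q → A → ℤ
    entry C (i , j) = + toℕ (lookup (lookup C j) i)

    fst : Vec A n → Vec (Fin p) n
    fst z = V.map proj₁ z
    snd : Vec A n → Vec (Fin q) n
    snd z = V.map proj₂ z

    both : Vec A n → Bool
    both z = U₁.has (colours β) (fst z) ∧ U₂.has (colours γ) (snd z)

    unzip-act : ∀ {B : Set} (FB : Finite B) (f : A → B) g (z : Vec A n) →
      V.map f (GSet.act (W.words n) g z) ≡ GSet.act (Words.words FB n) g (V.map f z)
    unzip-act FB f g z = trans (sym (Vₚ.tabulate-∘ f (λ x → lookup z (g ⟨$⟩ʳ x))))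
      (Vₚ.tabulate-cong (λ x → sym (Vₚ.lookup-map (g ⟨$⟩ʳ x) f z)))

    zip-proj : ∀ {m} (z : Vec A m) → V.zip (V.map proj₁ z) (V.map proj₂ z) ≡ z
    zip-proj [] = refl
    zip-proj (x ∷ z) = cong (x ∷_) (zip-proj z)

    proj-zip₁ : ∀ {m} (v : Vec (Fin p) m) (w : Vec (Fin q) m) → V.map proj₁ (V.zip v w) ≡ v
    proj-zip₁ [] [] = refl
    proj-zip₁ (x ∷ v) (y ∷ w) = cong (x ∷_) (proj-zip₁ v w)

    proj-zip₂ : ∀ {m} (v : Vec (Fin p) m) (w : Vec (Fin q) m) → V.map proj₂ (V.zip v w) ≡ w
    proj-zip₂ [] [] = refl
    proj-zip₂ (x ∷ v) (y ∷ w) = cong (y ∷_) (proj-zip₂ v w)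

    young-* : ∀ g → young n β g * young n γ g ≡ GSet.perm-char (W.words n) both g
    young-* g = trans (sym (perm-char-× (U₁.words n) (U₂.words n) (U₁.has (colours β)) (U₂.has (colours γ)) g))
      (∑-bij (×-finite (Vec-finite (Fin-finite p) n) (Vec-finite (Fin-finite q) n)) (Vec-finite FA n)
        (λ (v , w) → U₁.has (colours β) v ∧ U₂.has (colours γ) w) both (λ x → ⟦ GSet.fix (×-GSet (U₁.words n) (U₂.words n)) g x ⟧) (λ z → ⟦ GSet.fix (W.words n) g z ⟧)
        (λ (v , w) → V.zip v w) (λ z → fst z , snd z)
        (λ (v , w) e → trans (cong₂ (λ v w → U₁.has (colours β) v ∧ U₂.has (colours γ) w) (proj-zip₁ v w) (proj-zip₂ v w)) e ,
                       cong₂ _,_ (proj-zip₁ v w) (proj-zip₂ v w) , cong ⟦_⟧ (fix-zip v w))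
        (λ z e → e , zip-proj z))
      where
      fix-zip : ∀ v w → GSet.fix (×-GSet (U₁.words n) (U₂.words n)) g (v , w) ≡ GSet.fix (W.words n) g (V.zip v w)
      fix-zip v w = ⌊⌋-cong (GSet._≟ˣ_ (×-GSet (U₁.words n) (U₂.words n)) _ (v , w)) (GSet._≟ˣ_ (W.words n) _ (V.zip v w))
        (λ e → trans (sym (zip-proj _)) (cong₂ V.zip
          (trans (unzip-act (Fin-finite p) proj₁ g (V.zip v w)) (trans (cong (GSet.act (U₁.words n) g) (proj-zip₁ v w)) (cong proj₁ e)))
          (trans (unzip-act (Fin-finite q) proj₂ g (V.zip v w)) (trans (cong (GSet.act (U₂.words n) g) (proj-zip₂ v w)) (cong proj₂ e)))))
        (λ e → cong₂ _,_
          (trans (cong (GSet.act (U₁.words n) g) (sym (proj-zip₁ v w))) (trans (sym (unzip-act (Fin-finite p) proj₁ g (V.zip v w))) (trans (cong (V.map proj₁) e) (proj-zip₁ v w))))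
          (trans (cong (GSet.act (U₂.words n) g) (sym (proj-zip₂ v w))) (trans (sym (unzip-act (Fin-finite q) proj₂ g (V.zip v w))) (trans (cong (V.map proj₂) e) (proj-zip₂ v w)))))

    ∑-A : ∀ (f : A → ℤ) → ∑ (elems FA) f ≡ ∑ (allFin p) (λ i → ∑ (allFin q) (λ j → f (i , j)))
    ∑-A = ∑-× (Fin-finite p) (Fin-finite q)

    pair-== : ∀ (x : A) i j → ⟦ Finite._==_ FA x (i , j) ⟧ ≡ ⟦ ⌊ proj₁ x Fₚ.≟ i ⌋ ⟧ * ⟦ ⌊ proj₂ x Fₚ.≟ j ⌋ ⟧
    pair-== x i j = trans (cong ⟦_⟧ (bool-ext
      (λ e → let e′ = Finite.==-sound FA {x} {i , j} e in true-∧ (⌊⌋-true (_ Fₚ.≟ _) (cong proj₁ e′)) (⌊⌋-true (_ Fₚ.≟ _) (cong proj₂ e′)))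
      (λ e → ⌊⌋-true (Finite._≟_ FA x (i , j)) (cong₂ _,_ (true-⌊⌋ (_ Fₚ.≟ _) (proj₁ (∧-true e))) (true-⌊⌋ (_ Fₚ.≟ _) (proj₂ (∧-true {⌊ proj₁ x Fₚ.≟ i ⌋} e)))))))
      (⟦∧⟧ ⌊ proj₁ x Fₚ.≟ i ⌋ ⌊ proj₂ x Fₚ.≟ j ⌋)

    row-count : ∀ z i → U₁.cnt (lookup (fst z)) i ≡ ∑ (allFin q) (λ j → W.cnt (lookup z) (i , j))
    row-count z i = begin
      U₁.cnt (lookup (fst z)) i
        ≡⟨ U₁.cnt-cong (λ x → Vₚ.lookup-map x proj₁ z) i ⟩
      ∑ (allFin n) (λ x → ⟦ ⌊ proj₁ (lookup z x) Fₚ.≟ i ⌋ ⟧)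
        ≡⟨ ∑-cong (allFin n) (λ x → sym (trans (∑-cong (allFin q) (λ j → pair-== (lookup z x) i j)) (trans (∑-*ˡ (allFin q) ⟦ ⌊ proj₁ (lookup z x) Fₚ.≟ i ⌋ ⟧ _) (trans
            (cong (⟦ ⌊ proj₁ (lookup z x) Fₚ.≟ i ⌋ ⟧ *_) (trans (∑-cong (allFin q) (λ j → cong ⟦_⟧ (⌊⌋-cong (proj₂ (lookup z x) Fₚ.≟ j) (j Fₚ.≟ proj₂ (lookup z x)) sym sym))) (Finite.once (Fin-finite q) (proj₂ (lookup z x)))))
            (ℤₚ.*-identityʳ _))))) ⟩
      ∑ (allFin n) (λ x → ∑ (allFin q) (λ j → ⟦ Finite._==_ FA (lookup z x) (i , j) ⟧))
        ≡⟨ ∑-swap (allFin n) (allFin q) _ ⟩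
      ∑ (allFin q) (λ j → W.cnt (lookup z) (i , j)) ∎

    col-count : ∀ z j → U₂.cnt (lookup (snd z)) j ≡ ∑ (allFin p) (λ i → W.cnt (lookup z) (i , j))
    col-count z j = begin
      U₂.cnt (lookup (snd z)) j
        ≡⟨ U₂.cnt-cong (λ x → Vₚ.lookup-map x proj₂ z) j ⟩
      ∑ (allFin n) (λ x → ⟦ ⌊ proj₂ (lookup z x) Fₚ.≟ j ⌋ ⟧)
        ≡⟨ ∑-cong (allFin n) (λ x → sym (trans (∑-cong (allFin p) (λ i → pair-== (lookup z x) i j)) (trans (∑-*ʳ (allFin p) ⟦ ⌊ proj₂ (lookup z x) Fₚ.≟ j ⌋ ⟧ _) (trans
            (cong (_* ⟦ ⌊ proj₂ (lookup z x) Fₚ.≟ j ⌋ ⟧) (trans (∑-cong (allFin p) (λ i → cong ⟦_⟧ (⌊⌋-cong (proj₁ (lookup z x) Fₚ.≟ i) (i Fₚ.≟ proj₁ (lookup z x)) sym sym))) (Finite.once (Fin-finite p) (proj₁ (lookup z x)))))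
            (ℤₚ.*-identityˡ _))))) ⟩
      ∑ (allFin n) (λ x → ∑ (allFin p) (λ i → ⟦ Finite._==_ FA (lookup z x) (i , j) ⟧))
        ≡⟨ ∑-swap (allFin n) (allFin p) _ ⟩
      ∑ (allFin p) (λ i → W.cnt (lookup z) (i , j)) ∎

    fits-both : ∀ C z → W.has (entry C) z ≡ true → fits (map +_ β) γ C ≡ both z
    fits-both C z h = bool-ext to from
      where
      c≡ : ∀ a → W.cnt (lookup z) a ≡ entry C a
      c≡ = true-⌊⌋ (W.content? (entry C) z) h
      rows : ∀ i → U₁.cnt (lookup (fst z)) i ≡ ∑ (allFin q) (λ j → + toℕ (lookup (lookup C j) i))
      rows i = trans (row-count z i) (∑-cong (allFin q) (λ j → c≡ (i , j)))
      cols : ∀ j → U₂.cnt (lookup (snd z)) j ≡ + weight (lookup C j)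
      cols j = trans (col-count z j) (trans (∑-cong (allFin p) (λ i → c≡ (i , j))) (sym (weight-∑ (lookup C j))))
      to : fits (map +_ β) γ C ≡ true → both z ≡ true
      to e with fits-sound (map +_ β) γ C (Lₚ.length-map +_ β) e
      ... | rs , cs = true-∧
        (⌊⌋-true (U₁.content? (colours β) (fst z)) (λ i → trans (rows i) (trans (sym (rs i)) (at-map β i))))
        (⌊⌋-true (U₂.content? (colours γ) (snd z)) (λ j → trans (cols j) (cong +_ (cs j))))
      from : both z ≡ true → fits (map +_ β) γ C ≡ true
      from e = fits-complete (map +_ β) γ C (Lₚ.length-map +_ β)
        (λ i → trans (at-map β i) (trans (sym (true-⌊⌋ (U₁.content? (colours β) (fst z)) (proj₁ (∧-true e)) i)) (rows i)))
        (λ j → ℤₚ.+-injective (trans (sym (cols j)) (true-⌊⌋ (U₂.content? (colours γ) (snd z)) (proj₂ (∧-true {U₁.has (colours β) (fst z)} e)) j)))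
    count-length : ∀ {X : Set} (f : X → Bool) xs → count f xs ≤ length xs
    count-length f [] = z≤n
    count-length f (x ∷ xs) with f x
    ... | true = s≤s (count-length f xs)
    ... | false = ℕₚ.≤-trans (count-length f xs) (ℕₚ.n≤1+n _)

    -- Every word over pairs of colours has exactly one content matrix, and its entries are counts
    -- of positions, at most n; this is the reason for the range `Fin (suc n)`.
    joint : ∀ z → ∑ (elems C-finite) (λ C → ⟦ W.has (entry C) z ⟧) ≡ 1ℤ
    joint z = trans (∑-cong (elems C-finite) (λ C → cong ⟦_⟧ (⌊⌋-cong (W.content? (entry C) z) (Finite._≟_ C-finite C C₀) (to C) (λ { refl → from }))))
      (Finite.once C-finite C₀)
      where
      k : Fin p → Fin q → ℕ
      k i j = count (λ x → Finite._==_ FA (lookup z x) (i , j)) (allFin n)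
      k< : ∀ i j → k i j < suc n
      k< i j = s≤s (subst (k i j ≤_) (Lₚ.length-tabulate {n = n} id) (count-length _ (allFin n)))
      C₀ : Vec (Vec (Fin (suc n)) p) q
      C₀ = tabulate (λ j → tabulate (λ i → F.fromℕ< (k< i j)))
      C₀≡ : ∀ i j → lookup (lookup C₀ j) i ≡ F.fromℕ< (k< i j)
      C₀≡ i j = trans (cong (λ v → lookup v i) (Vₚ.lookup∘tabulate (λ j → tabulate (λ i → F.fromℕ< (k< i j))) j)) (Vₚ.lookup∘tabulate (λ i → F.fromℕ< (k< i j)) i)
      from : ∀ a → W.cnt (lookup z) a ≡ entry C₀ a
      from (i , j) = trans (sym (∑-count (λ x → Finite._==_ FA (lookup z x) (i , j)) (allFin n)))
        (cong +_ (sym (trans (cong toℕ (C₀≡ i j)) (Fₚ.toℕ-fromℕ< (k< i j)))))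
      to : ∀ C → (∀ a → W.cnt (lookup z) a ≡ entry C a) → C ≡ C₀
      to C h = trans (sym (Vₚ.tabulate∘lookup C)) (Vₚ.tabulate-cong (λ j → trans (sym (Vₚ.tabulate∘lookup (lookup C j))) (Vₚ.tabulate-cong (λ i →
        Fₚ.toℕ-injective (ℤₚ.+-injective (trans (sym (h (i , j))) (trans (from (i , j)) (cong (λ x → + toℕ x) (C₀≡ i j)))))))))

    total : ∀ C → fits (map +_ β) γ C ≡ true → ∑ (elems FA) (entry C) ≡ + n
    total C e = begin
      ∑ (elems FA) (entry C)
        ≡⟨ ∑-A (entry C) ⟩
      ∑ (allFin p) (λ i → ∑ (allFin q) (λ j → entry C (i , j)))
        ≡⟨ ∑-cong (allFin p) (λ i → trans (sym (proj₁ (fits-sound (map +_ β) γ C (Lₚ.length-map +_ β) e) i)) (at-map β i)) ⟩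
      ∑ (allFin p) (colours β)
        ≡⟨ ∑-colours β ⟩
      + sumℕ β
        ≡⟨ cong +_ β-sum ⟩
      + n ∎
    one-orbit : ∀ C → fits (map +_ β) γ C ≡ true → ∑ᴳ (GSet.perm-char (W.words n) (W.has (entry C))) ≡ ord n
    one-orbit C e with W.word-exists n (λ a → toℕ (lookup (lookup C (proj₂ a)) (proj₁ a))) (total C e)
    ... | f , h = GSet.transitive-sum (W.words n) (W.has (entry C)) (tabulate f) y∈ (W.has-invariant n (entry C))
        (λ x x∈ → W.same-content-act (tabulate f) x (λ a → trans (y-cnt a) (sym (true-⌊⌋ (W.content? (entry C) x) x∈ a))))
      where
      y-cnt : ∀ a → W.cnt (lookup (tabulate f)) a ≡ entry C a
      y-cnt a = trans (W.cnt-cong (Vₚ.lookup∘tabulate f) a) (h a)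
      y∈ : W.has (entry C) (tabulate f) ≡ true
      y∈ = ⌊⌋-true (W.content? (entry C) (tabulate f)) y-cnt

  -- Two words of length n are one word over pairs of colours. Its content is a matrix whose row
  -- sums are β and whose column sums are γ, and the pairs of words with a given matrix form one
  -- orbit, which contributes `ord n`.
  young-inner : ∑ᴳ (λ g → young n β g * young n γ g) ≡ ord n * M (map +_ β) γ
  young-inner = begin
    ∑ᴳ (λ g → young n β g * young n γ g)
      ≡⟨ ∑ᴳ-cong young-* ⟩
    ∑ᴳ (GSet.perm-char (W.words n) both)
      ≡⟨ ∑ᴳ-cong (λ g → trans (∑-cong (elems (Vec-finite FA n)) (λ z → refine g z)) (trans
           (∑-swap (elems (Vec-finite FA n)) (elems C-finite) _)
           (∑-cong (elems C-finite) (λ C → ∑-*ˡ (elems (Vec-finite FA n)) ⟦ fits (map +_ β) γ C ⟧ _)))) ⟩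
    ∑ᴳ (λ g → ∑ (elems C-finite) (λ C → ⟦ fits (map +_ β) γ C ⟧ * GSet.perm-char (W.words n) (W.has (entry C)) g))
      ≡⟨ ∑ᴳ-∑ (elems C-finite) _ ⟩
    ∑ (elems C-finite) (λ C → ∑ᴳ (λ g → ⟦ fits (map +_ β) γ C ⟧ * GSet.perm-char (W.words n) (W.has (entry C)) g))
      ≡⟨ ∑-cong (elems C-finite) (λ C → trans (∑ᴳ-*ˡ ⟦ fits (map +_ β) γ C ⟧ _) (⟦⟧-* (fits (map +_ β) γ C) (one-orbit C))) ⟩
    ∑ (elems C-finite) (λ C → ⟦ fits (map +_ β) γ C ⟧ * ord n)
      ≡⟨ ∑-*ʳ (elems C-finite) (ord n) _ ⟩
    ∑ (elems C-finite) (λ C → ⟦ fits (map +_ β) γ C ⟧) * ord n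
      ≡⟨ cong (_* ord n) (matrices-M n γ γ-small p (map +_ β) (Lₚ.length-map +_ β)) ⟩
    M (map +_ β) γ * ord n
      ≡⟨ ℤₚ.*-comm (M (map +_ β) γ) (ord n) ⟩
    ord n * M (map +_ β) γ ∎
    where
    shuffle : ∀ a b c → a * b * c ≡ a * (b * c)
    shuffle = solve-∀
    refine : ∀ g z → ⟦ both z ⟧ * ⟦ GSet.fix (W.words n) g z ⟧ ≡
      ∑ (elems C-finite) (λ C → ⟦ fits (map +_ β) γ C ⟧ * (⟦ W.has (entry C) z ⟧ * ⟦ GSet.fix (W.words n) g z ⟧))
    refine g z = sym (begin
      ∑ (elems C-finite) (λ C → ⟦ fits (map +_ β) γ C ⟧ * (⟦ W.has (entry C) z ⟧ * ⟦ GSet.fix (W.words n) g z ⟧))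
        ≡⟨ ∑-cong (elems C-finite) (λ C → trans (lem C) (sym (shuffle ⟦ W.has (entry C) z ⟧ ⟦ both z ⟧ ⟦ GSet.fix (W.words n) g z ⟧))) ⟩
      ∑ (elems C-finite) (λ C → ⟦ W.has (entry C) z ⟧ * ⟦ both z ⟧ * ⟦ GSet.fix (W.words n) g z ⟧)
        ≡⟨ trans (∑-*ʳ (elems C-finite) ⟦ GSet.fix (W.words n) g z ⟧ _) (cong (_* ⟦ GSet.fix (W.words n) g z ⟧) (∑-*ʳ (elems C-finite) ⟦ both z ⟧ _)) ⟩
      ∑ (elems C-finite) (λ C → ⟦ W.has (entry C) z ⟧) * ⟦ both z ⟧ * ⟦ GSet.fix (W.words n) g z ⟧
        ≡⟨ cong (λ x → x * ⟦ both z ⟧ * ⟦ GSet.fix (W.words n) g z ⟧) (joint z) ⟩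
      1ℤ * ⟦ both z ⟧ * ⟦ GSet.fix (W.words n) g z ⟧
        ≡⟨ cong (_* ⟦ GSet.fix (W.words n) g z ⟧) (ℤₚ.*-identityˡ ⟦ both z ⟧) ⟩
      ⟦ both z ⟧ * ⟦ GSet.fix (W.words n) g z ⟧ ∎)
      where
      lem : ∀ C → ⟦ fits (map +_ β) γ C ⟧ * (⟦ W.has (entry C) z ⟧ * ⟦ GSet.fix (W.words n) g z ⟧) ≡ ⟦ W.has (entry C) z ⟧ * (⟦ both z ⟧ * ⟦ GSet.fix (W.words n) g z ⟧)
      lem C = trans (*-swap ⟦ fits (map +_ β) γ C ⟧ ⟦ W.has (entry C) z ⟧ ⟦ GSet.fix (W.words n) g z ⟧)
        (⟦⟧-* (W.has (entry C) z) (λ h → cong (λ b → ⟦ b ⟧ * ⟦ GSet.fix (W.words n) g z ⟧) (fits-both C z h)))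

-- Alternating sums over placements of rows in columns


Symmetric : (List ℤ → ℤ) → Set
Symmetric F = ∀ {l l′} → l ↭ l′ → F l ≡ F l′

-- Both sides run over the triangle s + t ≤ a; padded by an indicator to a square, they differ by an
-- exchange of sums.
∑-triangle : ∀ a (f : ℕ → ℕ → ℤ) →
  ∑ (upTo (suc a)) (λ s → ∑ (upTo (suc (a ∸ s))) (f s)) ≡ ∑ (upTo (suc a)) (λ t → ∑ (upTo (suc (a ∸ t))) (λ s → f s t))
∑-triangle a f = trans (square f) (trans (∑-swap (upTo (suc a)) (upTo (suc a)) (λ s t → ⟦ (s ℕ.+ t) ℕ.≤ᵇ a ⟧ * f s t)) (trans
  (∑-cong (upTo (suc a)) (λ t → ∑-cong (upTo (suc a)) (λ s → cong (λ x → ⟦ x ℕ.≤ᵇ a ⟧ * f s t) (ℕₚ.+-comm s t))))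
  (sym (square (λ t s → f s t)))))
  where
  le : ∀ s t → s ≤ a → t ≤ a ∸ s → s ℕ.+ t ≤ a
  le s t p q = subst (s ℕ.+ t ≤_) (ℕₚ.m+[n∸m]≡n p) (ℕₚ.+-monoʳ-≤ s q)
  inside : ∀ s t → s ≤ a → t ≤ a ∸ s → ((s ℕ.+ t) ℕ.≤ᵇ a) ≡ true
  inside s t p q with (s ℕ.+ t) ℕ.≤ᵇ a | ℕₚ.≤⇒≤ᵇ (le s t p q)
  ... | true | _ = refl
  outside : ∀ s t → s ≤ a → suc (a ∸ s) ≤ t → ((s ℕ.+ t) ℕ.≤ᵇ a) ≡ false
  outside s t p q with (s ℕ.+ t) ℕ.≤ᵇ a in e
  ... | false = refl
  ... | true = contradiction (ℕₚ.m+n≤o⇒m≤o∸n t (subst (_≤ a) (ℕₚ.+-comm s t) (ℕₚ.≤ᵇ⇒≤ (s ℕ.+ t) a (subst T (sym e) tt)))) (ℕₚ.<⇒≱ q)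
  square : ∀ (f : ℕ → ℕ → ℤ) → ∑ (upTo (suc a)) (λ s → ∑ (upTo (suc (a ∸ s))) (f s)) ≡
    ∑ (upTo (suc a)) (λ s → ∑ (upTo (suc a)) (λ t → ⟦ (s ℕ.+ t) ℕ.≤ᵇ a ⟧ * f s t))
  square f = ∑-upTo-cong (suc a) (λ s lt → let p = ℕₚ.≤-pred lt in sym (trans
    (∑-upTo-extend (s≤s (ℕₚ.m∸n≤m a s)) (λ t → ⟦ (s ℕ.+ t) ℕ.≤ᵇ a ⟧ * f s t) (λ t q → cong (λ b → ⟦ b ⟧ * f s t) (outside s t p q)))
    (∑-upTo-cong (suc (a ∸ s)) (λ t q → trans (cong (λ b → ⟦ b ⟧ * f s t) (inside s t p (ℕₚ.≤-pred q))) (ℤₚ.*-identityˡ (f s t))))))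

T⁻-symmetric : ∀ a {F} → Symmetric F → Symmetric (T⁻ a F)
T⁻-symmetric a sym-F Perm.refl = refl
T⁻-symmetric a sym-F (Perm.prep x p) = ∑-cong (upTo (suc a)) (λ s → T⁻-symmetric (a ∸ s) (λ q → sym-F (Perm.prep _ q)) p)
T⁻-symmetric a {F} sym-F {x ∷ y ∷ l} {y ∷ x ∷ l′} (Perm.swap x y p) = trans
  (∑-triangle a (λ s t → T⁻ (a ∸ s ∸ t) (λ m → F ((x - + s) ∷ (y - + t) ∷ m)) l))
  (∑-cong (upTo (suc a)) (λ t → ∑-cong (upTo (suc (a ∸ t))) (λ s → begin
    T⁻ (a ∸ s ∸ t) (λ m → F ((x - + s) ∷ (y - + t) ∷ m)) l
      ≡⟨ cong (λ b → T⁻ b (λ m → F ((x - + s) ∷ (y - + t) ∷ m)) l)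
           (trans (ℕₚ.∸-+-assoc a s t) (trans (cong (a ∸_) (ℕₚ.+-comm s t)) (sym (ℕₚ.∸-+-assoc a t s)))) ⟩
    T⁻ (a ∸ t ∸ s) (λ m → F ((x - + s) ∷ (y - + t) ∷ m)) l
      ≡⟨ T⁻-cong (a ∸ t ∸ s) l (λ m _ → sym-F (Perm.swap _ _ Perm.refl)) ⟩
    T⁻ (a ∸ t ∸ s) (λ m → F ((y - + t) ∷ (x - + s) ∷ m)) l
      ≡⟨ T⁻-symmetric (a ∸ t ∸ s) (λ q → sym-F (Perm.prep _ (Perm.prep _ q))) p ⟩
    T⁻ (a ∸ t ∸ s) (λ m → F ((y - + t) ∷ (x - + s) ∷ m)) l′ ∎)))
T⁻-symmetric a sym-F (Perm.trans p q) = trans (T⁻-symmetric a sym-F p) (T⁻-symmetric a sym-F q)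

M-symmetric : ∀ γ → Symmetric (λ l → M l γ)
M-symmetric [] Perm.refl = refl
M-symmetric [] (Perm.prep x p) = trans (⟦∧⟧ ⌊ x ℤ.≟ 0ℤ ⌋ _) (trans (cong (⟦ ⌊ x ℤ.≟ 0ℤ ⌋ ⟧ *_) (M-symmetric [] p)) (sym (⟦∧⟧ ⌊ x ℤ.≟ 0ℤ ⌋ _)))
M-symmetric [] {x ∷ y ∷ l} {_ ∷ _ ∷ l′} (Perm.swap x y p) = trans (lem ⌊ x ℤ.≟ 0ℤ ⌋ ⌊ y ℤ.≟ 0ℤ ⌋ (allZero l))
  (trans (cong (λ z → ⟦ ⌊ y ℤ.≟ 0ℤ ⌋ ⟧ * (⟦ ⌊ x ℤ.≟ 0ℤ ⌋ ⟧ * z)) (M-symmetric [] p)) (sym (lem′ ⌊ y ℤ.≟ 0ℤ ⌋ ⌊ x ℤ.≟ 0ℤ ⌋ (allZero l′))))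
  where
  lem′ : ∀ a b c → ⟦ a ∧ b ∧ c ⟧ ≡ ⟦ a ⟧ * (⟦ b ⟧ * ⟦ c ⟧)
  lem′ a b c = trans (⟦∧⟧ a (b ∧ c)) (cong (⟦ a ⟧ *_) (⟦∧⟧ b c))
  lem : ∀ a b c → ⟦ a ∧ b ∧ c ⟧ ≡ ⟦ b ⟧ * (⟦ a ⟧ * ⟦ c ⟧)
  lem a b c = trans (lem′ a b c) (*-swap ⟦ a ⟧ ⟦ b ⟧ ⟦ c ⟧)
M-symmetric [] (Perm.trans p q) = trans (M-symmetric [] p) (M-symmetric [] q)
M-symmetric (a ∷ γ) = T⁻-symmetric a (M-symmetric γ)

-- Laplace expansion along a column: pick a row, with alternating signs.
Pick : List ℤ → (ℤ → List ℤ → ℤ) → ℤ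
Pick [] G = 0ℤ
Pick (κ ∷ κs) G = G κ κs - Pick κs (λ x r → G x (κ ∷ r))

-- Formally det (h_(κ + c)) over the rows κ and columns c, where F receives the list of indices of
-- each product in column order. F need not be multiplicative, so determinant manipulations apply
-- directly to inner products.
Alt : List ℕ → List ℤ → (List ℤ → ℤ) → ℤ
Alt [] κs F = F []
Alt (c ∷ cs) κs F = Pick κs (λ κ r → Alt cs r (λ l → F ((κ + + c) ∷ l)))

Pick-cong : ∀ κs {G H} → (∀ x r → suc (length r) ≡ length κs → G x r ≡ H x r) → Pick κs G ≡ Pick κs H
Pick-cong [] h = refl
Pick-cong (κ ∷ κs) h = cong₂ _-_ (h κ κs refl) (Pick-cong κs (λ x r e → h x (κ ∷ r) (cong suc e)))

Pick-All : ∀ {P : ℤ → Set} {κs G} → All P κs → (∀ x r → P x → G x r ≡ 0ℤ) → Pick κs G ≡ 0ℤ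
Pick-All [] h = refl
Pick-All (p ∷ ps) h = cong₂ _-_ (h _ _ p) (Pick-All ps (λ x r q → h x _ q))

Pick-+ : ∀ κs G H → Pick κs (λ x r → G x r + H x r) ≡ Pick κs G + Pick κs H
Pick-+ [] G H = refl
Pick-+ (κ ∷ κs) G H = trans (cong (_-_ (G κ κs + H κ κs)) (Pick-+ κs _ _)) (shuffle (G κ κs) (H κ κs) (Pick κs (λ x r → G x (κ ∷ r))) (Pick κs (λ x r → H x (κ ∷ r))))
  where shuffle : ∀ a b c d → a + b - (c + d) ≡ (a - c) + (b - d)
        shuffle = solve-∀

Pick-* : ∀ κs c G → Pick κs (λ x r → c * G x r) ≡ c * Pick κs G
Pick-* [] c G = sym (ℤₚ.*-zeroʳ c)
Pick-* (κ ∷ κs) c G = trans (cong (_-_ (c * G κ κs)) (Pick-* κs c _)) (shuffle c (G κ κs) (Pick κs (λ x r → G x (κ ∷ r))))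
  where shuffle : ∀ c a b → c * a - c * b ≡ c * (a - b)
        shuffle = solve-∀

Pick-∑ : ∀ {A : Set} κs (xs : List A) (G : A → ℤ → List ℤ → ℤ) →
  Pick κs (λ x r → ∑ xs (λ a → G a x r)) ≡ ∑ xs (λ a → Pick κs (G a))
Pick-∑ κs [] G = Pick-All {P = λ _ → ⊤} (All.universal (λ _ → tt) κs) (λ _ _ _ → refl)
Pick-∑ κs (x ∷ xs) G = trans (Pick-+ κs (G x) (λ y r → ∑ xs (λ a → G a y r))) (cong (_+_ (Pick κs (G x))) (Pick-∑ κs xs G))

-- Picking the same pair of rows in the two orders gives opposite signs.
Pick-symmetric : ∀ κs (H : ℤ → ℤ → List ℤ → ℤ) → (∀ x y r → H x y r ≡ H y x r) →
  Pick κs (λ x r → Pick r (H x)) ≡ 0ℤ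
Pick-symmetric [] H h = refl
Pick-symmetric (κ ∷ κs) H h = begin
  Pick κs (H κ) - Pick κs (λ x r → H x κ r - Pick r (λ y r′ → H x y (κ ∷ r′)))
    ≡⟨ cong (_-_ (Pick κs (H κ))) (trans (Pick-cong κs (λ x r _ → lem₁ (H x κ r) (Pick r (λ y r′ → H x y (κ ∷ r′)))))
         (Pick-+ κs (λ x r → H x κ r) (λ x r → -[1+ 0 ] * Pick r (λ y r′ → H x y (κ ∷ r′))))) ⟩
  Pick κs (H κ) - (Pick κs (λ x r → H x κ r) + Pick κs (λ x r → -[1+ 0 ] * Pick r (λ y r′ → H x y (κ ∷ r′))))
    ≡⟨ cong₂ (λ a b → Pick κs (H κ) - (a + b)) (Pick-cong κs (λ x r _ → h x κ r))
         (trans (Pick-* κs -[1+ 0 ] _) (cong (-[1+ 0 ] *_) (Pick-symmetric κs (λ x y r → H x y (κ ∷ r)) (λ x y r → h x y (κ ∷ r))))) ⟩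
  Pick κs (H κ) - (Pick κs (H κ) + 0ℤ)
    ≡⟨ lem₂ (Pick κs (H κ)) ⟩
  0ℤ ∎
  where
  lem₁ : ∀ a b → a - b ≡ a + -[1+ 0 ] * b
  lem₁ = solve-∀
  lem₂ : ∀ a → a - (a + 0ℤ) ≡ 0ℤ
  lem₂ = solve-∀

Alt-cong : ∀ cs κs {F G} → (∀ l → length l ≡ length cs → F l ≡ G l) → Alt cs κs F ≡ Alt cs κs G
Alt-cong [] κs h = h [] refl
Alt-cong (c ∷ cs) κs h = Pick-cong κs (λ κ r _ → Alt-cong cs r (λ l e → h _ (cong suc e)))

Alt-+ : ∀ cs κs F G → Alt cs κs (λ l → F l + G l) ≡ Alt cs κs F + Alt cs κs G
Alt-+ [] κs F G = refl
Alt-+ (c ∷ cs) κs F G = trans (Pick-cong κs (λ κ r _ → Alt-+ cs r _ _)) (Pick-+ κs _ _)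

Alt-zero : ∀ cs κs {F} → (∀ l → length l ≡ length cs → F l ≡ 0ℤ) → Alt cs κs F ≡ 0ℤ
Alt-zero [] κs h = h [] refl
Alt-zero (c ∷ cs) κs h = Pick-All {P = λ _ → ⊤} (All.universal (λ _ → tt) κs) (λ x r _ → Alt-zero cs r (λ l e → h _ (cong suc e)))

Alt-∑ : ∀ {A : Set} cs κs (xs : List A) (F : A → List ℤ → ℤ) → Alt cs κs (λ l → ∑ xs (λ a → F a l)) ≡ ∑ xs (λ a → Alt cs κs (F a))
Alt-∑ [] κs xs F = refl
Alt-∑ (c ∷ cs) κs xs F = trans (Pick-cong κs (λ κ r _ → Alt-∑ cs r xs _)) (Pick-∑ κs xs _)

-- If rows x and y are picked in columns c and c + 1, exchanging them turns the entries (u, v) into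
-- (v - 1, u + 1). The condition on G is thus invariance under this exchange, which reverses the
-- sign.
Alt-antisymmetric : ∀ c cs κs G → (∀ u v l → G (u ∷ v ∷ l) ≡ G ((v - 1ℤ) ∷ (u + 1ℤ) ∷ l)) → Alt (c ∷ suc c ∷ cs) κs G ≡ 0ℤ
Alt-antisymmetric c cs κs G h = Pick-symmetric κs (λ x y r → Alt cs r (λ l → G ((x + + c) ∷ (y + + suc c) ∷ l)))
  (λ x y r → Alt-cong cs r (λ l _ → trans (h _ _ l) (cong₂ (λ a b → G (a ∷ b ∷ l)) (lem₁ y) (lem₂ x))))
  where
  lem₁ : ∀ y → y + + suc c - 1ℤ ≡ y + + c
  lem₁ y = trans (ℤₚ.+-assoc y (+ suc c) (- 1ℤ)) (cong (_+_ y) (trans (cong (_- 1ℤ) (ℤₚ.pos-+ 1 c)) (ring (+ c))))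
    where ring : ∀ a → 1ℤ + a - 1ℤ ≡ a
          ring = solve-∀
  lem₂ : ∀ x → x + + c + 1ℤ ≡ x + + suc c
  lem₂ x = trans (ℤₚ.+-assoc x (+ c) 1ℤ) (cong (_+_ x) (trans (sym (ℤₚ.pos-+ c 1)) (cong +_ (ℕₚ.+-comm c 1))))

∑-upTo-last : ∀ m (f : ℕ → ℤ) → ∑ (upTo (suc m)) f ≡ ∑ (upTo m) f + f m
∑-upTo-last zero f = trans (ℤₚ.+-identityʳ (f 0)) (sym (ℤₚ.+-identityˡ (f 0)))
∑-upTo-last (suc m) f = begin
  ∑ (upTo (suc (suc m))) f                            ≡⟨ ∑-upTo (suc m) f ⟩
  f 0 + ∑ (upTo (suc m)) (f ∘ suc)                    ≡⟨ cong (_+_ (f 0)) (∑-upTo-last m (f ∘ suc)) ⟩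
  f 0 + (∑ (upTo m) (f ∘ suc) + f (suc m))            ≡⟨ sym (ℤₚ.+-assoc (f 0) (∑ (upTo m) (f ∘ suc)) (f (suc m))) ⟩
  f 0 + ∑ (upTo m) (f ∘ suc) + f (suc m)              ≡⟨ cong (_+ f (suc m)) (sym (∑-upTo m f)) ⟩
  ∑ (upTo (suc m)) f + f (suc m) ∎

∑-upTo-reverse : ∀ m (f : ℕ → ℤ) → ∑ (upTo m) (λ s → f (m ∸ suc s)) ≡ ∑ (upTo m) f
∑-upTo-reverse zero f = refl
∑-upTo-reverse (suc m) f = begin
  ∑ (upTo (suc m)) (λ s → f (m ∸ s))            ≡⟨ ∑-upTo m (λ s → f (m ∸ s)) ⟩
  f m + ∑ (upTo m) (λ s → f (m ∸ suc s))        ≡⟨ cong (_+_ (f m)) (∑-upTo-reverse m f) ⟩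
  f m + ∑ (upTo m) f                            ≡⟨ ℤₚ.+-comm (f m) (∑ (upTo m) f) ⟩
  ∑ (upTo m) f + f m                            ≡⟨ sym (∑-upTo-last m f) ⟩
  ∑ (upTo (suc m)) f ∎

cols : ℕ → ℕ → List ℕ
cols c zero = []
cols c (suc p) = c ∷ cols (suc c) p

headMinus : ℕ → (List ℤ → ℤ) → List ℤ → ℤ
headMinus a F [] = F []
headMinus a F (u ∷ l) = F ((u - + a) ∷ l)

pos-∸ : ∀ {a s} → s ≤ a → + (a ∸ s) ≡ + a - + s
pos-∸ {a} {s} p = trans (sym (ℤₚ.⊖-≥ p)) (sym (ℤₚ.m-n≡m⊖n a s))

-- In the determinant det (h_{λᵢ-i+j}) in variables x ∪ {x₀}, subtracting x₀ times column j-1 from column j,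
-- for j = p-1, …, 1, removes x₀ from all columns but the first.
column-operations : ∀ p c a κs F → Symmetric F →
  Alt (cols c (suc p)) κs (T⁻ a F) ≡ Alt (cols c (suc p)) κs (headMinus a F)
column-operations zero c a κs F sym-F = Alt-cong (c ∷ []) κs {T⁻ a F} {headMinus a F} (λ { (u ∷ []) _ → last u })
  where
  only : ∀ a (f : ℕ → ℤ) → ∑ (upTo (suc a)) (λ s → ⟦ (a ∸ s) ≡ᵇ 0 ⟧ * f s) ≡ f a
  only zero f = trans (ℤₚ.+-identityʳ (1ℤ * f 0)) (ℤₚ.*-identityˡ (f 0))
  only (suc a) f = trans (∑-upTo (suc a) (λ s → ⟦ (suc a ∸ s) ≡ᵇ 0 ⟧ * f s)) (trans (ℤₚ.+-identityˡ _) (only a (f ∘ suc)))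
  last : ∀ u → T⁻ a F (u ∷ []) ≡ F ((u - + a) ∷ [])
  last u = only a (λ s → F ((u - + s) ∷ []))
column-operations (suc p) c a κs F sym-F = begin
  Pick κs (λ κ r → Alt cs r (λ l → T⁻ a F ((κ + + c) ∷ l)))
    ≡⟨ Pick-cong κs (λ κ r _ → trans (Alt-∑ cs r (upTo (suc a)) (λ s → T⁻ (a ∸ s) (λ l → F (((κ + + c) - + s) ∷ l)))) (trans
         (∑-cong (upTo (suc a)) (λ s → column-operations p (suc c) (a ∸ s) r (λ l → F (((κ + + c) - + s) ∷ l)) (λ q → sym-F (Perm.prep _ q))))
         (sym (Alt-∑ cs r (upTo (suc a)) (λ s → headMinus (a ∸ s) (λ l → F (((κ + + c) - + s) ∷ l))))))) ⟩
  Alt (c ∷ cs) κs G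
    ≡⟨ Alt-cong (c ∷ cs) κs {G} {λ l → G′ l + headMinus a F l} (λ { (u ∷ v ∷ l) _ → split u v l ; (u ∷ []) () ; [] () }) ⟩
  Alt (c ∷ cs) κs (λ l → G′ l + headMinus a F l)
    ≡⟨ Alt-+ (c ∷ cs) κs G′ (headMinus a F) ⟩
  Alt (c ∷ cs) κs G′ + Alt (c ∷ cs) κs (headMinus a F)
    ≡⟨ cong (_+ Alt (c ∷ cs) κs (headMinus a F)) (Alt-antisymmetric c (cols (suc (suc c)) p) κs G′ anti) ⟩
  0ℤ + Alt (c ∷ cs) κs (headMinus a F)
    ≡⟨ ℤₚ.+-identityˡ _ ⟩
  Alt (c ∷ cs) κs (headMinus a F) ∎
  where
  cs = cols (suc c) (suc p)
  -- By induction on the later columns, whatever column c does not lose is lost by the next column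
  -- alone. The term s = a is the desired one; `G′` collects the terms s < a.
  G G′ : List ℤ → ℤ
  G (u ∷ l) = ∑ (upTo (suc a)) (λ s → headMinus (a ∸ s) (λ l′ → F ((u - + s) ∷ l′)) l)
  G [] = 0ℤ
  G′ (u ∷ v ∷ l) = ∑ (upTo a) (λ s → F ((u - + s) ∷ (v - + (a ∸ s)) ∷ l))
  G′ _ = 0ℤ
  minus-0 : ∀ v → v - + 0 ≡ v
  minus-0 = solve-∀
  split : ∀ u v l → G (u ∷ v ∷ l) ≡ G′ (u ∷ v ∷ l) + headMinus a F (u ∷ v ∷ l)
  split u v l = trans (∑-upTo-last a _) (cong (λ x → G′ (u ∷ v ∷ l) + F ((u - + a) ∷ x ∷ l))
    (trans (cong (λ z → v - + z) (ℕₚ.n∸n≡0 a)) (minus-0 v)))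
  -- The substitution s ↦ a - 1 - s together with the symmetry of `F` exchanges the two columns.
  anti : ∀ u v l → G′ (u ∷ v ∷ l) ≡ G′ ((v - 1ℤ) ∷ (u + 1ℤ) ∷ l)
  anti u v l = trans (∑-upTo-cong a (λ s lt → trans (sym-F (Perm.swap _ _ Perm.refl)) (cong₂ (λ x y → F (x ∷ y ∷ l)) (lem₁ s lt) (lem₂ s lt))))
    (∑-upTo-reverse a (λ s → F ((v - 1ℤ - + s) ∷ (u + 1ℤ - + (a ∸ s)) ∷ l)))
    where
    ring₁ : ∀ v a s → v - (a - s) ≡ v - 1ℤ - (a - (1ℤ + s))
    ring₁ = solve-∀
    ring₂ : ∀ u s a → u - s ≡ u + 1ℤ - (a - (a - (1ℤ + s)))
    ring₂ = solve-∀
    ∸-suc : ∀ s → s < a → + (a ∸ suc s) ≡ + a - (1ℤ + + s)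
    ∸-suc s lt = trans (pos-∸ lt) (cong (_-_ (+ a)) (ℤₚ.pos-+ 1 s))
    lem₁ : ∀ s → s < a → v - + (a ∸ s) ≡ v - 1ℤ - + (a ∸ suc s)
    lem₁ s lt = trans (cong (_-_ v) (pos-∸ (ℕₚ.<⇒≤ lt))) (trans (ring₁ v (+ a) (+ s)) (cong (_-_ (v - 1ℤ)) (sym (∸-suc s lt))))
    lem₂ : ∀ s → s < a → u - + s ≡ u + 1ℤ - + (a ∸ (a ∸ suc s))
    lem₂ s lt = trans (ring₂ u (+ s) (+ a)) (cong (_-_ (u + 1ℤ)) (sym (trans (pos-∸ (ℕₚ.m∸n≤m a (suc s))) (cong (_-_ (+ a)) (∸-suc s lt)))))

Alt-shift : ∀ cs κs F → Alt (map suc cs) (map (_- 1ℤ) κs) F ≡ Alt cs κs F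
Alt-shift [] κs F = refl
Alt-shift (c ∷ cs) κs F = trans (Pick-map κs _) (Pick-cong κs (λ κ r _ → trans (Alt-shift cs r _)
    (Alt-cong cs r (λ l _ → cong (λ x → F (x ∷ l)) (trans (cong (_+_ (κ - 1ℤ)) (ℤₚ.pos-+ 1 c)) (ring κ (+ c)))))))
  where
  ring : ∀ k c → k - 1ℤ + (1ℤ + c) ≡ k + c
  ring = solve-∀
  Pick-map : ∀ κs G → Pick (map (_- 1ℤ) κs) G ≡ Pick κs (λ x r → G (x - 1ℤ) (map (_- 1ℤ) r))
  Pick-map [] G = refl
  Pick-map (κ ∷ κs) G = cong (_-_ (G (κ - 1ℤ) (map (_- 1ℤ) κs))) (Pick-map κs _)

-- Kostka numbers: inner products of Jacobi-Trudi characters with Young characters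


rows : ℕ → List ℕ → List ℤ
rows i [] = []
rows i (a ∷ l) = (+ a - + i) ∷ rows (suc i) l

-- The Kostka number ⟨χ^λ, η_γ⟩: `M` is the inner product of two Young characters, and the
-- alternation is the Jacobi-Trudi determinant in the first of them.
K : List ℕ → List ℕ → ℤ
K λ′ γ = Alt (cols 0 (length λ′)) (rows 0 λ′) (λ l → M l γ)

-- The indices are the total and a bound on the largest part, the two quantities on which `K-solve`
-- recurses.
data Part : ℕ → ℕ → List ℕ → Set where
  nil  : ∀ {m} → Part 0 m []
  cons : ∀ {n m a γ} → 0 < a → a ≤ m → Part n a γ → Part (a ℕ.+ n) m (a ∷ γ)

Part-weaken : ∀ {n m m′ γ} → m ≤ m′ → Part n m γ → Part n m′ γ
Part-weaken le nil = nil
Part-weaken le (cons p q r) = cons p (ℕₚ.≤-trans q le) r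

Part-sum : ∀ {n m γ} → Part n m γ → sumℕ γ ≡ n
Part-sum nil = refl
Part-sum (cons {a = a} _ _ p) = cong (a ℕ.+_) (Part-sum p)

Part-small : ∀ {n m γ} → Part n m γ → All (_≤ n) γ
Part-small nil = []
Part-small (cons {n} {a = a} _ _ p) = ℕₚ.m≤m+n a n ∷ All.map (λ le → ℕₚ.≤-trans le (ℕₚ.m≤n+m n a)) (Part-small p)

Part⇒IsPartition : ∀ {n m γ} → Part n m γ → IsPartition n γ
Part⇒IsPartition p = desc p , positive p , Part-sum p
  where
  desc : ∀ {n m γ} → Part n m γ → Linked (λ a b → b ≤ a) γ
  desc nil = []
  desc (cons _ _ nil) = [-]
  desc (cons _ _ p@(cons _ q _)) = q ∷ desc p
  positive : ∀ {n m γ} → Part n m γ → All (λ a → 0 < a) γ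
  positive nil = []
  positive (cons p _ r) = p ∷ positive r

IsPartition⇒Part : ∀ {n γ} → IsPartition n γ → ∀ m → All (_≤ m) γ → Part n m γ
IsPartition⇒Part {γ = []} (_ , _ , refl) m _ = nil
IsPartition⇒Part {γ = a ∷ []} (_ , p ∷ _ , refl) m (le ∷ _) = cons p le nil
IsPartition⇒Part {γ = a ∷ b ∷ γ} (r ∷ rs , p ∷ ps , refl) m (le ∷ _) =
  cons p le (IsPartition⇒Part (rs , ps , refl) a (below rs r))
  where
  below : ∀ {b γ} → Linked (λ a b → b ≤ a) (b ∷ γ) → b ≤ a → All (_≤ a) (b ∷ γ)
  below [-] r = r ∷ []
  below (s ∷ rs) r = r ∷ below rs (ℕₚ.≤-trans s r)

T⁻-zero : ∀ a {F} l → (∀ l′ → F l′ ≡ 0ℤ) → T⁻ a F l ≡ 0ℤ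
T⁻-zero a [] h = trans (cong (⟦ a ≡ᵇ 0 ⟧ *_) (h [])) (ℤₚ.*-zeroʳ ⟦ a ≡ᵇ 0 ⟧)
T⁻-zero a (u ∷ l) h = ∑-zero (upTo (suc a)) (λ s → T⁻-zero (a ∸ s) l (λ l′ → h _))

minus-neg : ∀ {u} s → u ℤ.< 0ℤ → u - + s ℤ.< 0ℤ
minus-neg {u} s lt = ℤₚ.≤-<-trans (ℤₚ.i≤j⇒i-k≤j (+ s) ℤₚ.≤-refl) lt

M-neg : ∀ {u} l γ → u ℤ.< 0ℤ → M (u ∷ l) γ ≡ 0ℤ
M-neg {u} l [] lt with u ℤ.≟ 0ℤ
... | yes refl = contradiction lt (ℤₚ.<-irrefl refl)
... | no _ = refl
M-neg l (a ∷ γ) lt = ∑-zero (upTo (suc a)) (λ s → T⁻-zero (a ∸ s) l (λ l′ → M-neg l′ γ (minus-neg s lt)))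

-- A row of sum 0 can only lose 0: any other choice makes it negative, and it stays negative.
M-zero : ∀ l γ → M (0ℤ ∷ l) γ ≡ M l γ
M-zero l [] = refl
M-zero l (a ∷ γ) = trans (∑-upTo a (λ s → T⁻ (a ∸ s) (λ l′ → M ((0ℤ - + s) ∷ l′) γ) l)) (trans (cong₂ _+_
    (T⁻-cong a l (λ l′ _ → M-zero l′ γ))
    (∑-zero (upTo a) (λ s → T⁻-zero (a ∸ suc s) l (λ l′ → M-neg l′ γ (ℤ.-<+ {s})))))
  (ℤₚ.+-identityʳ _))

rows-bounded : ∀ i {n m λ′} → Part n m λ′ → All (ℤ._≤ + m - + i) (rows i λ′)
rows-bounded i nil = []
rows-bounded i (cons {m = m} {a} _ le p) = ℤₚ.+-monoˡ-≤ (- + i) (ℤ.+≤+ le) ∷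
  All.map (λ {x} q → ℤₚ.≤-trans q (ℤₚ.+-mono-≤ (ℤ.+≤+ le) (ℤₚ.neg-mono-≤ (ℤ.+≤+ (ℕₚ.n≤1+n i))))) (rows-bounded (suc i) p)

-- The column operations remove the variable belonging to the first part a from all columns but the
-- first, along which the determinant is then expanded.
K-expand : ∀ b λ′ a γ → K (b ∷ λ′) (a ∷ γ) ≡
  Pick (rows 0 (b ∷ λ′)) (λ κ r → Alt (cols 1 (length λ′)) r (λ l → M ((κ + 0ℤ - + a) ∷ l) γ))
K-expand b λ′ a γ = column-operations (length λ′) 0 a (rows 0 (b ∷ λ′)) (λ l → M l γ) (M-symmetric γ)

K-column-neg : ∀ cs r {κ} a γ → κ ℤ.< + a → Alt cs r (λ l → M ((κ + 0ℤ - + a) ∷ l) γ) ≡ 0ℤ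
K-column-neg cs r {κ} a γ lt = Alt-zero cs r (λ l _ → M-neg l γ
  (subst (ℤ._< 0ℤ) (cong (_- + a) (sym (ℤₚ.+-identityʳ κ))) (i<j⇒i-j<0 (+ a) lt)))

-- All row indices are at most m < a, so whichever row is picked in the first column is left with a
-- negative sum. This is the vanishing half of triangularity.
K-large : ∀ {n m λ′ a} γ → m < a → Part n m λ′ → K λ′ (a ∷ γ) ≡ 0ℤ
K-large {a = suc a} γ lt nil = refl
K-large {m = m} {a = a} γ lt p@(cons {a = b} {γ = λ′} _ _ _) = trans (K-expand b λ′ a γ)
  (Pick-All (rows-bounded 0 p) (λ κ r le → K-column-neg (cols 1 (length λ′)) r a γ (ℤₚ.≤-<-trans le
    (subst (ℤ._< + a) (sym (ℤₚ.+-identityʳ (+ m))) (ℤ.+<+ lt)))))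

rows-suc : ∀ i λ′ → rows (suc i) λ′ ≡ map (_- 1ℤ) (rows i λ′)
rows-suc i [] = refl
rows-suc i (a ∷ l) = cong₂ _∷_ (trans (cong (λ x → + a - x) (ℤₚ.pos-+ 1 i)) (ring (+ a) (+ i))) (rows-suc (suc i) l)
  where ring : ∀ a i → a - (1ℤ + i) ≡ a - i - 1ℤ
        ring = solve-∀

cols-suc : ∀ c p → cols (suc c) p ≡ map suc (cols c p)
cols-suc c zero = refl
cols-suc c (suc p) = cong (suc c ∷_) (cols-suc (suc c) p)

Alt-rows-suc : ∀ λ′ F → Alt (cols 1 (length λ′)) (rows 1 λ′) F ≡ Alt (cols 0 (length λ′)) (rows 0 λ′) F
Alt-rows-suc λ′ F = trans (cong₂ (λ cs κs → Alt cs κs F) (cols-suc 0 (length λ′)) (rows-suc 0 λ′)) (Alt-shift (cols 0 (length λ′)) (rows 0 λ′) F)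

-- Only the first row contributes to the column of γ₁ when γ₁ = λ₁.
K-first-row : ∀ {n b λ′} (G : ℤ → List ℤ → ℤ) → Part n b λ′ → (∀ κ r → κ ℤ.< + b → G κ r ≡ 0ℤ) →
  Pick (rows 0 (b ∷ λ′)) G ≡ G (+ b + 0ℤ) (rows 1 λ′)
K-first-row {b = b} {λ′} G p h = trans (cong (_-_ (G (+ b + 0ℤ) (rows 1 λ′))) (Pick-All (rows-bounded 1 p) (λ κ r le → h κ (_ ∷ r)
    (ℤₚ.≤-<-trans le (subst (+ b - 1ℤ ℤ.<_) (ℤₚ.+-identityʳ (+ b)) (ℤₚ.+-monoʳ-< (+ b) (ℤ.-<+ {0} {0})))))))
  (ℤₚ.+-identityʳ _)

-- In the first column only the first row survives, and it is used up entirely. Deleting both leaves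
-- the determinant of λ′, with rows and columns renumbered by one. Repeated, this gives the diagonal
-- entries 1.
K-equal : ∀ {n b λ′} γ → Part n b λ′ → K (b ∷ λ′) (b ∷ γ) ≡ K λ′ γ
K-equal {b = b} {λ′} γ p = begin
  K (b ∷ λ′) (b ∷ γ)
    ≡⟨ K-expand b λ′ b γ ⟩
  Pick (rows 0 (b ∷ λ′)) (λ κ r → Alt (cols 1 (length λ′)) r (λ l → M ((κ + 0ℤ - + b) ∷ l) γ))
    ≡⟨ K-first-row _ p (λ κ r lt → K-column-neg (cols 1 (length λ′)) r b γ lt) ⟩
  Alt (cols 1 (length λ′)) (rows 1 λ′) (λ l → M ((+ b + 0ℤ + 0ℤ - + b) ∷ l) γ)
    ≡⟨ Alt-cong (cols 1 (length λ′)) (rows 1 λ′) (λ l _ → trans (cong (λ x → M (x ∷ l) γ) (ring (+ b))) (M-zero l γ)) ⟩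
  Alt (cols 1 (length λ′)) (rows 1 λ′) (λ l → M l γ)
    ≡⟨ Alt-rows-suc λ′ (λ l → M l γ) ⟩
  K λ′ γ ∎
  where
  ring : ∀ b → b + 0ℤ + 0ℤ - b ≡ 0ℤ
  ring = solve-∀

Part-0 : ∀ {n γ} → Part n 0 γ → n ≡ 0 × γ ≡ []
Part-0 nil = refl , refl
Part-0 (cons p q _) = contradiction (ℕₚ.≤-trans p q) λ ()

-- The Kostka matrix is unitriangular for the lexicographic order, so integer systems with this matrix are solvable.
K-solve : ∀ fuel n m → n ℕ.+ m ≤ fuel → (N : List ℕ → ℤ) →
  Σ[ cs ∈ List (ℤ × List ℕ) ] All (λ c → Part n m (proj₂ c)) cs ×
    (∀ γ → Part n m γ → N γ ≡ ∑ cs (λ c → proj₁ c * K (proj₂ c) γ))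
K-solve fuel zero zero le N = (N [] , []) ∷ [] , nil ∷ [] ,
  λ γ p → subst (λ γ → N γ ≡ N [] * K [] γ + 0ℤ) (sym (proj₂ (Part-0 p))) (sym (trans (ℤₚ.+-identityʳ _) (ℤₚ.*-identityʳ (N []))))
K-solve fuel (suc n) zero le N = [] , [] , λ γ p → contradiction (proj₁ (Part-0 p)) λ ()
K-solve zero zero (suc m) () N
K-solve zero (suc n) (suc m) () N
K-solve (suc fuel) n (suc m) le N with ℕₚ.≤-<-connex (suc m) n
... | inj₂ lt with K-solve fuel n m (ℕₚ.≤-pred (subst (_≤ suc fuel) (ℕₚ.+-suc n m) le)) N
...   | cs , ps , eq = cs , All.map (Part-weaken (ℕₚ.n≤1+n m)) ps , λ γ p → eq γ (smaller lt p)
  where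
  smaller : ∀ {n γ} → n < suc m → Part n (suc m) γ → Part n m γ
  smaller lt nil = nil
  smaller lt (cons {n′} {a = a} p q r) = cons p (ℕₚ.≤-pred (ℕₚ.≤-<-trans (ℕₚ.m≤m+n a n′) lt)) r
K-solve (suc fuel) n (suc m) le N | inj₁ ge with ℕₚ.m≤n⇒∃[o]m+o≡n ge
-- The γ with first part `suc m` are solved first, by shapes with the same first part and `K-equal`.
-- The shapes with smaller parts, found next for the remaining defect, do not disturb these γ
-- because of `K-large`.
...   | n′ , refl with K-solve fuel n′ (suc m) (ℕₚ.≤-trans (ℕₚ.+-monoˡ-≤ (suc m) (ℕₚ.m≤n+m n′ m)) (ℕₚ.≤-pred le)) (λ γ → N (suc m ∷ γ))
...   | cs , ps , eq with K-solve fuel (suc m ℕ.+ n′) m (ℕₚ.≤-pred (subst (_≤ suc fuel) (ℕₚ.+-suc (suc m ℕ.+ n′) m) le))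
        (λ γ → N γ - ∑ (map (λ c → proj₁ c , suc m ∷ proj₂ c) cs) (λ c → proj₁ c * K (proj₂ c) γ))
...     | cs′ , ps′ , eq′ = cs₁ ++ cs′ ,
        Allₚ.++⁺ (Allₚ.map⁺ (All.map (cons (s≤s z≤n) ℕₚ.≤-refl) ps)) (All.map (Part-weaken (ℕₚ.n≤1+n m)) ps′) ,
        λ γ p → trans (solved γ p) (sym (∑-++ cs₁ cs′ _))
  where
  cs₁ = map (λ c → proj₁ c , suc m ∷ proj₂ c) cs
  S₁ S₂ : List ℕ → ℤ
  S₁ γ = ∑ cs₁ (λ c → proj₁ c * K (proj₂ c) γ)
  S₂ γ = ∑ cs′ (λ c → proj₁ c * K (proj₂ c) γ)
  ring : ∀ a b → a ≡ b + (a - b)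
  ring = solve-∀
  ∑-zeroᴬ : ∀ {cs} {f : ℤ × List ℕ → ℤ} → All (λ c → f c ≡ 0ℤ) cs → ∑ cs f ≡ 0ℤ
  ∑-zeroᴬ [] = refl
  ∑-zeroᴬ (e ∷ es) = cong₂ _+_ e (∑-zeroᴬ es)
  top : ∀ {n″ γ} → Part n″ (suc m) γ → n′ ≡ n″ → N (suc m ∷ γ) ≡ S₁ (suc m ∷ γ)
  top {γ = γ} p refl = trans (eq γ p) (trans (lem cs ps) (sym (∑-map _ cs _)))
    where
    lem : ∀ cs → All (λ c → Part n′ (suc m) (proj₂ c)) cs →
      ∑ cs (λ c → proj₁ c * K (proj₂ c) γ) ≡ ∑ cs (λ c → proj₁ c * K (suc m ∷ proj₂ c) (suc m ∷ γ))
    lem [] [] = refl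
    lem ((x , λ′) ∷ cs) (p ∷ ps) = cong₂ _+_ (cong (x *_) (sym (K-equal γ p))) (lem cs ps)
  solved-at : ∀ {n″ γ} → n″ ≡ suc m ℕ.+ n′ → Part n″ (suc m) γ → N γ ≡ S₁ γ + S₂ γ
  solved-at () nil
  solved-at e (cons {n″} {a = a} {γ} p q r) with ℕₚ.m≤n⇒m<n∨m≡n q
  ... | inj₁ lt = trans (ring (N (a ∷ γ)) (S₁ (a ∷ γ))) (cong (_+_ (S₁ (a ∷ γ))) (eq′ (a ∷ γ) (subst (λ k → Part k m (a ∷ γ)) e (cons p (ℕₚ.≤-pred lt) r))))
  ... | inj₂ refl = trans (top r (sym (ℕₚ.+-cancelˡ-≡ (suc m) n″ n′ e))) (sym (trans (cong (_+_ (S₁ (suc m ∷ γ)))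
      (∑-zeroᴬ (All.map (λ {c} p′ → trans (cong (proj₁ c *_) (K-large γ (ℕₚ.n<1+n m) p′)) (ℤₚ.*-zeroʳ (proj₁ c))) ps′))) (ℤₚ.+-identityʳ _)))
  solved : ∀ γ → Part (suc m ℕ.+ n′) (suc m) γ → N γ ≡ S₁ γ + S₂ γ
  solved γ p = solved-at refl p

-- The Jacobi-Trudi sum over permutations as an alternating sum

zipAdd : List ℤ → List ℕ → List ℤ
zipAdd (κ ∷ κs) (s ∷ ss) = (κ + + s) ∷ zipAdd κs ss
zipAdd _ _ = []

signℤ-+ : ∀ a b → signℤ (a ℕ.+ b) ≡ signℤ a * signℤ b
signℤ-+ zero b = sym (ℤₚ.*-identityˡ (signℤ b))
signℤ-+ (suc zero) b = trans (signℤ-suc b) (sym (ℤₚ.-1*i≡-i (signℤ b)))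
  where signℤ-suc : ∀ b → signℤ (suc b) ≡ - signℤ b
        signℤ-suc zero = refl
        signℤ-suc (suc zero) = refl
        signℤ-suc (suc (suc b)) = signℤ-suc b
signℤ-+ (suc (suc a)) b = signℤ-+ a b

∑-congᴬ : ∀ {A : Set} {xs : List A} {f g : A → ℤ} → All (λ x → f x ≡ g x) xs → ∑ xs f ≡ ∑ xs g
∑-congᴬ [] = refl
∑-congᴬ (e ∷ es) = cong₂ _+_ e (∑-congᴬ es)

insertions-↭ : ∀ x ys → All (_↭ (x ∷ ys)) (insertions x ys)
insertions-↭ x [] = Perm.refl ∷ []
insertions-↭ x (y ∷ ys) = Perm.refl ∷ Allₚ.map⁺ (All.map (λ p → Perm.trans (Perm.prep y p) (Perm.swap y x Perm.refl)) (insertions-↭ x ys))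

perms-↭ : ∀ xs → All (_↭ xs) (perms xs)
perms-↭ [] = Perm.refl ∷ []
perms-↭ (x ∷ xs) = Allₚ.concat⁺ (Allₚ.map⁺ (All.map (λ {σ} p → All.map (λ q → Perm.trans q (Perm.prep x p)) (insertions-↭ x σ)) (perms-↭ xs)))

count-insertions : ∀ (p : ℕ → Bool) x ys → All (λ τ → count p τ ≡ count p (x ∷ ys)) (insertions x ys)
count-insertions p x [] = refl ∷ []
count-insertions p x (y ∷ ys) = refl ∷ Allₚ.map⁺ (All.map
  (λ e → trans (cong ((if p y then 1 else 0) ℕ.+_) e) (shuffle (if p y then 1 else 0) (if p x then 1 else 0) (count p ys)))
  (count-insertions p x ys))
  where shuffle : ∀ a b c → a ℕ.+ (b ℕ.+ c) ≡ b ℕ.+ (a ℕ.+ c)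
        shuffle = ℕ-Solver.solve-∀

<ᵇ-true : ∀ {a b} → a < b → (a <ᵇ b) ≡ true
<ᵇ-true {a} {b} lt with a <ᵇ b | ℕₚ.<⇒<ᵇ lt
... | true | _ = refl

<ᵇ-false : ∀ {a b} → a < b → (b <ᵇ a) ≡ false
<ᵇ-false {a} {b} lt with b <ᵇ a in e
... | false = refl
... | true = contradiction (ℕₚ.<ᵇ⇒< b a (subst T (sym e) tt)) (ℕₚ.<-asym lt)

-- Inserting the least letter x at position k creates k inversions, which is the sign that `Pick`
-- attaches to row k; the symmetry of F brings the corresponding entry to the front.
insertions-Pick : ∀ x σ κs F → All (x <_) σ → length κs ≡ suc (length σ) → Symmetric F →
  ∑ (insertions x σ) (λ τ → signℤ (inversions τ) * F (zipAdd κs τ)) ≡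
  Pick κs (λ κ r → signℤ (inversions σ) * F ((κ + + x) ∷ zipAdd r σ))
insertions-Pick x [] (κ ∷ []) F _ _ _ = refl
insertions-Pick x (y ∷ ys) (κ ∷ κs) F (lt ∷ lts) len sym-F = cong₂ _+_
  (cong (λ c → signℤ c * F (zipAdd (κ ∷ κs) (x ∷ y ∷ ys))) (cong (ℕ._+ inversions (y ∷ ys)) (none-below (lt ∷ lts))))
  (begin
    ∑ (map (y ∷_) (insertions x ys)) (λ τ → signℤ (inversions τ) * F (zipAdd (κ ∷ κs) τ))
      ≡⟨ ∑-map (y ∷_) (insertions x ys) _ ⟩
    ∑ (insertions x ys) (λ τ → signℤ (count (_<ᵇ y) τ ℕ.+ inversions τ) * F ((κ + + y) ∷ zipAdd κs τ))
      ≡⟨ ∑-congᴬ (All.map (λ {τ} e → trans (cong (_* F ((κ + + y) ∷ zipAdd κs τ)) (trans (signℤ-+ (count (_<ᵇ y) τ) (inversions τ)) (cong (λ c → signℤ c * signℤ (inversions τ)) e)))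
           (ℤₚ.*-assoc (signℤ (count (_<ᵇ y) (x ∷ ys))) (signℤ (inversions τ)) (F ((κ + + y) ∷ zipAdd κs τ)))) (count-insertions (_<ᵇ y) x ys)) ⟩
    ∑ (insertions x ys) (λ τ → signℤ (count (_<ᵇ y) (x ∷ ys)) * (signℤ (inversions τ) * F ((κ + + y) ∷ zipAdd κs τ)))
      ≡⟨ ∑-*ˡ (insertions x ys) (signℤ (count (_<ᵇ y) (x ∷ ys))) _ ⟩
    signℤ (count (_<ᵇ y) (x ∷ ys)) * ∑ (insertions x ys) (λ τ → signℤ (inversions τ) * F ((κ + + y) ∷ zipAdd κs τ))
      ≡⟨ cong₂ _*_ (cong (λ b → signℤ ((if b then 1 else 0) ℕ.+ count (_<ᵇ y) ys)) (<ᵇ-true lt))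
           (insertions-Pick x ys κs (λ l → F ((κ + + y) ∷ l)) lts (ℕₚ.suc-injective len) (λ p → sym-F (Perm.prep _ p))) ⟩
    signℤ (suc c) * Pick κs (λ κ′ r → signℤ (inversions ys) * F ((κ + + y) ∷ (κ′ + + x) ∷ zipAdd r ys))
      ≡⟨ cong (_* Pick κs (λ κ′ r → signℤ (inversions ys) * F ((κ + + y) ∷ (κ′ + + x) ∷ zipAdd r ys))) (signℤ-+ 1 c) ⟩
    (- 1ℤ * signℤ c) * Pick κs (λ κ′ r → signℤ (inversions ys) * F ((κ + + y) ∷ (κ′ + + x) ∷ zipAdd r ys))
      ≡⟨ neg (signℤ c) (Pick κs (λ κ′ r → signℤ (inversions ys) * F ((κ + + y) ∷ (κ′ + + x) ∷ zipAdd r ys))) ⟩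
    - (signℤ c * Pick κs (λ κ′ r → signℤ (inversions ys) * F ((κ + + y) ∷ (κ′ + + x) ∷ zipAdd r ys)))
      ≡⟨ cong -_ (trans (sym (Pick-* κs (signℤ c) _)) (Pick-cong κs (λ κ′ r _ →
           trans (sym (ℤₚ.*-assoc (signℤ c) (signℤ (inversions ys)) (F ((κ + + y) ∷ (κ′ + + x) ∷ zipAdd r ys))))
                 (cong₂ _*_ (sym (signℤ-+ c (inversions ys))) (sym-F (Perm.swap _ _ Perm.refl)))))) ⟩
    - Pick κs (λ κ′ r → signℤ (inversions (y ∷ ys)) * F ((κ′ + + x) ∷ zipAdd (κ ∷ r) (y ∷ ys))) ∎)
  where
  c = count (_<ᵇ y) ys
  none-below : ∀ {zs} → All (x <_) zs → count (_<ᵇ x) zs ≡ 0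
  none-below [] = refl
  none-below (lt ∷ lts) = cong₂ ℕ._+_ (cong (λ b → if b then 1 else 0) (<ᵇ-false lt)) (none-below lts)
  neg : ∀ a b → (- 1ℤ * a) * b ≡ - (a * b)
  neg = solve-∀

-- The Leibniz formula against Laplace expansion: `perms` inserts the least letter into all
-- positions of the permutations of the others, which is an expansion along the first column.
perms-Alt : ∀ xs κs F → AllPairs _<_ xs → length κs ≡ length xs → Symmetric F →
  ∑ (perms xs) (λ σ → signℤ (inversions σ) * F (zipAdd κs σ)) ≡ Alt xs κs F
perms-Alt [] [] F _ _ _ = trans (ℤₚ.+-identityʳ (1ℤ * F [])) (ℤₚ.*-identityˡ (F []))
perms-Alt (x ∷ xs) κs F (lt ∷ lts) len sym-F = begin
  ∑ (concatMap (insertions x) (perms xs)) (λ σ → signℤ (inversions σ) * F (zipAdd κs σ))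
    ≡⟨ ∑-concatMap (insertions x) (perms xs) _ ⟩
  ∑ (perms xs) (λ σ → ∑ (insertions x σ) (λ τ → signℤ (inversions τ) * F (zipAdd κs τ)))
    ≡⟨ ∑-congᴬ (All.map (λ {σ} p → insertions-Pick x σ κs F (Permₚ.All-resp-↭ (Perm.↭-sym p) lt) (trans len (cong suc (sym (Permₚ.↭-length p)))) sym-F) (perms-↭ xs)) ⟩
  ∑ (perms xs) (λ σ → Pick κs (λ κ r → signℤ (inversions σ) * F ((κ + + x) ∷ zipAdd r σ)))
    ≡⟨ sym (Pick-∑ κs (perms xs) (λ σ κ r → signℤ (inversions σ) * F ((κ + + x) ∷ zipAdd r σ))) ⟩
  Pick κs (λ κ r → ∑ (perms xs) (λ σ → signℤ (inversions σ) * F ((κ + + x) ∷ zipAdd r σ)))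
    ≡⟨ Pick-cong κs (λ κ r e → perms-Alt xs r (λ l → F ((κ + + x) ∷ l)) lts (ℕₚ.suc-injective (trans e len)) (λ p → sym-F (Perm.prep _ p))) ⟩
  Alt (x ∷ xs) κs F ∎

-- The summand local to `irrChar`, again recovered by unification.
mutual
  irrTerm : ∀ n → List ℕ → Permutation′ n → List ℕ → ℤ
  irrTerm = _

  irrChar-spec : ∀ n λ′ g → irrChar n λ′ g ≡ sumℤ (map (irrTerm n λ′ g) (perms (upTo (length λ′))))
  irrChar-spec n λ′ g = refl

irrTerm-just : ∀ n λ′ g σ {α} → jtComp 0 λ′ σ ≡ just α → irrTerm n λ′ g σ ≡ signℤ (inversions σ) * youngChar n α g
irrTerm-just n λ′ g σ e rewrite e = refl

irrTerm-nothing : ∀ n λ′ g σ → jtComp 0 λ′ σ ≡ nothing → irrTerm n λ′ g σ ≡ 0ℤ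
irrTerm-nothing n λ′ g σ e rewrite e = refl

irrChar-∑ : ∀ n λ′ g → irrChar n λ′ g ≡ ∑ (perms (upTo (length λ′))) (irrTerm n λ′ g)
irrChar-∑ n λ′ g = trans (irrChar-spec n λ′ g) (∑-sumℤ (irrTerm n λ′ g) (perms (upTo (length λ′))))

≤ᵇ-true : ∀ a b → (a ℕ.≤ᵇ b) ≡ true → a ≤ b
≤ᵇ-true a b e = ℕₚ.≤ᵇ⇒≤ a b (subst T (sym e) tt)

jt-just : ∀ i λ′ σ {α} → length λ′ ≡ length σ → jtComp i λ′ σ ≡ just α → map +_ α ≡ zipAdd (rows i λ′) σ
jt-just i [] [] len refl = refl
jt-just i (l ∷ ls) (s ∷ ss) len e with i ℕ.≤ᵇ (l ℕ.+ s) in le | jtComp (suc i) ls ss in eq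
jt-just i (l ∷ ls) (s ∷ ss) len refl | true | just rest = cong₂ _∷_
  (trans (pos-∸ (≤ᵇ-true i (l ℕ.+ s) le)) (trans (cong (_- + i) (ℤₚ.pos-+ l s)) (ring (+ l) (+ s) (+ i))))
  (jt-just (suc i) ls ss (ℕₚ.suc-injective len) eq)
  where ring : ∀ l s i → l + s - i ≡ l - i + s
        ring = solve-∀
jt-just i (l ∷ ls) (s ∷ ss) len () | true | nothing
jt-just i (l ∷ ls) (s ∷ ss) len () | false | _

-- `jtComp` fails at a negative index λᵢ - i + σᵢ, where the convention η = 0 agrees with the
-- vanishing of `M` on negative row sums.
jt-nothing : ∀ i λ′ σ → jtComp i λ′ σ ≡ nothing → Any (ℤ._< 0ℤ) (zipAdd (rows i λ′) σ)
jt-nothing i (l ∷ ls) (s ∷ ss) e with i ℕ.≤ᵇ (l ℕ.+ s) in le | jtComp (suc i) ls ss in eq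
jt-nothing i (l ∷ ls) (s ∷ ss) () | true | just _
... | true | nothing = there (jt-nothing (suc i) ls ss eq)
... | false | _ = here (subst (ℤ._< 0ℤ) (trans (cong (_- + i) (ℤₚ.pos-+ l s)) (ring (+ l) (+ s) (+ i)))
    (i<j⇒i-j<0 (+ i) ((ℤ.+<+ (ℕₚ.≰⇒> (λ p → contradiction (ℕₚ.≤⇒≤ᵇ p) (λ t → subst T le t)))))))
  where ring : ∀ l s i → l + s - i ≡ l - i + s
        ring = solve-∀

jt-sum : ∀ i λ′ σ {α} → length λ′ ≡ length σ → jtComp i λ′ σ ≡ just α →
  sumℕ α ℕ.+ sumℕ (cols i (length λ′)) ≡ sumℕ λ′ ℕ.+ sumℕ σ
jt-sum i [] [] len refl = refl
jt-sum i (l ∷ ls) (s ∷ ss) len e with i ℕ.≤ᵇ (l ℕ.+ s) in le | jtComp (suc i) ls ss in eq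
jt-sum i (l ∷ ls) (s ∷ ss) len refl | true | just rest = begin
  (l ℕ.+ s ∸ i ℕ.+ sumℕ rest) ℕ.+ (i ℕ.+ sumℕ (cols (suc i) (length ls)))
    ≡⟨ shuffle (l ℕ.+ s ∸ i) (sumℕ rest) i (sumℕ (cols (suc i) (length ls))) ⟩
  (l ℕ.+ s ∸ i ℕ.+ i) ℕ.+ (sumℕ rest ℕ.+ sumℕ (cols (suc i) (length ls)))
    ≡⟨ cong₂ ℕ._+_ (ℕₚ.m∸n+n≡m (≤ᵇ-true i (l ℕ.+ s) le)) (jt-sum (suc i) ls ss (ℕₚ.suc-injective len) eq) ⟩
  (l ℕ.+ s) ℕ.+ (sumℕ ls ℕ.+ sumℕ ss)
    ≡⟨ shuffle l s (sumℕ ls) (sumℕ ss) ⟩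
  (l ℕ.+ sumℕ ls) ℕ.+ (s ℕ.+ sumℕ ss) ∎
  where shuffle : ∀ a b c d → (a ℕ.+ b) ℕ.+ (c ℕ.+ d) ≡ (a ℕ.+ c) ℕ.+ (b ℕ.+ d)
        shuffle = ℕ-Solver.solve-∀
jt-sum i (l ∷ ls) (s ∷ ss) len () | true | nothing
jt-sum i (l ∷ ls) (s ∷ ss) len () | false | _

upTo≡cols : ∀ p → upTo p ≡ cols 0 p
upTo≡cols p = lem 0 p id (λ _ → refl)
  where
  lem : ∀ c p f → (∀ s → f s ≡ c ℕ.+ s) → L.applyUpTo f p ≡ cols c p
  lem c zero f h = refl
  lem c (suc p) f h = cong₂ _∷_ (trans (h 0) (ℕₚ.+-identityʳ c)) (lem (suc c) p (f ∘ suc) (λ s → trans (h (suc s)) (ℕₚ.+-suc c s)))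

cols-increasing : ∀ c p → AllPairs _<_ (cols c p)
cols-increasing c zero = []
cols-increasing c (suc p) = above (suc c) p ℕₚ.≤-refl ∷ cols-increasing (suc c) p
  where
  above : ∀ {c} c′ p → c < c′ → All (c <_) (cols c′ p)
  above c′ zero lt = []
  above c′ (suc p) lt = lt ∷ above (suc c′) p (ℕₚ.m<n⇒m<1+n lt)

length-cols : ∀ c p → length (cols c p) ≡ p
length-cols c zero = refl
length-cols c (suc p) = cong suc (length-cols (suc c) p)

length-rows : ∀ i λ′ → length (rows i λ′) ≡ length λ′
length-rows i [] = refl
length-rows i (a ∷ l) = cong suc (length-rows (suc i) l)

M-any-neg : ∀ γ {l} → Any (ℤ._< 0ℤ) l → M l γ ≡ 0ℤ
M-any-neg γ (here lt) = M-neg _ γ lt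
M-any-neg γ {u ∷ l} (there {x = .u} p) = lem γ u p
  where
  T⁻-any : ∀ a {F} {l} → (∀ {l′} → Any (ℤ._< 0ℤ) l′ → F l′ ≡ 0ℤ) → Any (ℤ._< 0ℤ) l → T⁻ a F l ≡ 0ℤ
  T⁻-any a {F} {u ∷ l} h (here lt) = ∑-zero (upTo (suc a)) (λ s → T⁻-zero (a ∸ s) l (λ l′ → h (here (minus-neg s lt))))
  T⁻-any a h (there p) = ∑-zero (upTo (suc a)) (λ s → T⁻-any (a ∸ s) (λ q → h (there q)) p)
  allZero-any : ∀ {l} → Any (ℤ._< 0ℤ) l → ⟦ allZero l ⟧ ≡ 0ℤ
  allZero-any {u ∷ l} (here lt) = M-neg l [] lt
  allZero-any {u ∷ l} (there p) = trans (⟦∧⟧ ⌊ u ℤ.≟ 0ℤ ⌋ (allZero l)) (trans (cong (⟦ ⌊ u ℤ.≟ 0ℤ ⌋ ⟧ *_) (allZero-any p)) (ℤₚ.*-zeroʳ ⟦ ⌊ u ℤ.≟ 0ℤ ⌋ ⟧))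
  lem : ∀ γ u {l} → Any (ℤ._< 0ℤ) l → M (u ∷ l) γ ≡ 0ℤ
  all : ∀ γ {l} → Any (ℤ._< 0ℤ) l → M l γ ≡ 0ℤ
  all [] p = allZero-any p
  all (a ∷ γ) p = T⁻-any a (all γ) p
  lem γ u p = all γ (there p)

irrChar-inner : ∀ n λ′ γ → sumℕ λ′ ≡ n → All (_≤ n) γ →
  ∑ᴳ (λ g → irrChar n λ′ g * young n γ g) ≡ ord n * K λ′ γ
irrChar-inner n λ′ γ sum-λ small = begin
  ∑ᴳ (λ g → irrChar n λ′ g * young n γ g)
    ≡⟨ ∑ᴳ-cong (λ g → trans (cong (_* young n γ g) (irrChar-∑ n λ′ g)) (sym (∑-*ʳ ps (young n γ g) (irrTerm n λ′ g)))) ⟩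
  ∑ᴳ (λ g → ∑ ps (λ σ → irrTerm n λ′ g σ * young n γ g))
    ≡⟨ ∑ᴳ-∑ ps _ ⟩
  ∑ ps (λ σ → ∑ᴳ (λ g → irrTerm n λ′ g σ * young n γ g))
    ≡⟨ ∑-congᴬ (All.map (λ {σ} → term-inner σ) (perms-↭ (upTo p))) ⟩
  ∑ ps (λ σ → ord n * (signℤ (inversions σ) * M (zipAdd (rows 0 λ′) σ) γ))
    ≡⟨ ∑-*ˡ ps (ord n) _ ⟩
  ord n * ∑ ps (λ σ → signℤ (inversions σ) * M (zipAdd (rows 0 λ′) σ) γ)
    ≡⟨ cong (λ xs → ord n * ∑ (perms xs) (λ σ → signℤ (inversions σ) * M (zipAdd (rows 0 λ′) σ) γ)) (upTo≡cols p) ⟩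
  ord n * ∑ (perms (cols 0 p)) (λ σ → signℤ (inversions σ) * M (zipAdd (rows 0 λ′) σ) γ)
    ≡⟨ cong (ord n *_) (perms-Alt (cols 0 p) (rows 0 λ′) (λ l → M l γ) (cols-increasing 0 p)
         (trans (length-rows 0 λ′) (sym (length-cols 0 p))) (M-symmetric γ)) ⟩
  ord n * K λ′ γ ∎
  where
  p = length λ′
  ps = perms (upTo p)
  term-inner : ∀ σ → σ ↭ upTo p → ∑ᴳ (λ g → irrTerm n λ′ g σ * young n γ g) ≡ ord n * (signℤ (inversions σ) * M (zipAdd (rows 0 λ′) σ) γ)
  term-inner σ σ↭ = by-cases (jtComp 0 λ′ σ) refl
    where
    by-cases : ∀ r → jtComp 0 λ′ σ ≡ r → ∑ᴳ (λ g → irrTerm n λ′ g σ * young n γ g) ≡ ord n * (signℤ (inversions σ) * M (zipAdd (rows 0 λ′) σ) γ)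
    by-cases nothing e = trans (trans (∑ᴳ-cong (λ g → cong (_* young n γ g) (irrTerm-nothing n λ′ g σ e))) (∑ᴳ-*ˡ 0ℤ (young n γ)))
        (sym (trans (cong (λ x → ord n * (signℤ (inversions σ) * x)) (M-any-neg γ (jt-nothing 0 λ′ σ e)))
             (trans (cong (ord n *_) (ℤₚ.*-zeroʳ (signℤ (inversions σ)))) (ℤₚ.*-zeroʳ (ord n)))))
    by-cases (just α) e = begin
      ∑ᴳ (λ g → irrTerm n λ′ g σ * young n γ g)
        ≡⟨ ∑ᴳ-cong (λ g → trans (cong (_* young n γ g) (trans (irrTerm-just n λ′ g σ e) (cong (signℤ (inversions σ) *_) (youngChar≡young n α g))))
                                (ℤₚ.*-assoc (signℤ (inversions σ)) (young n α g) (young n γ g))) ⟩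
      ∑ᴳ (λ g → signℤ (inversions σ) * (young n α g * young n γ g))
        ≡⟨ ∑ᴳ-*ˡ (signℤ (inversions σ)) _ ⟩
      signℤ (inversions σ) * ∑ᴳ (λ g → young n α g * young n γ g)
        ≡⟨ cong (signℤ (inversions σ) *_) (young-inner n α γ sum-α small) ⟩
      signℤ (inversions σ) * (ord n * M (map +_ α) γ)
        ≡⟨ *-swap (signℤ (inversions σ)) (ord n) (M (map +_ α) γ) ⟩
      ord n * (signℤ (inversions σ) * M (map +_ α) γ)
        ≡⟨ cong (λ l → ord n * (signℤ (inversions σ) * M l γ)) (jt-just 0 λ′ σ len e) ⟩
      ord n * (signℤ (inversions σ) * M (zipAdd (rows 0 λ′) σ) γ) ∎
      where
      len : length λ′ ≡ length σ
      len = trans (sym (Lₚ.length-upTo p)) (sym (Permₚ.↭-length σ↭))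
      sum-α : sumℕ α ≡ n
      sum-α = ℕₚ.+-cancelʳ-≡ (sumℕ (cols 0 p)) (sumℕ α) n (trans (jt-sum 0 λ′ σ len e)
        (cong₂ ℕ._+_ sum-λ (trans (sum-↭ σ↭) (cong sumℕ (upTo≡cols p)))))
        where open import Data.Nat.ListAction.Properties using (sum-↭)

-- Permutations with the same orbits are conjugate

module _ {n : ℕ} where

  iter : Permutation′ n → ℕ → Fin n → Fin n
  iter g zero x = x
  iter g (suc j) x = g ⟨$⟩ʳ iter g j x

  iter-+ : ∀ g a b x → iter g (a ℕ.+ b) x ≡ iter g a (iter g b x)
  iter-+ g zero b x = refl
  iter-+ g (suc a) b x = cong (g ⟨$⟩ʳ_) (iter-+ g a b x)

  iter-injective : ∀ g a {x y} → iter g a x ≡ iter g a y → x ≡ y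
  iter-injective g zero e = e
  iter-injective g (suc a) e = iter-injective g a (trans (sym (P.inverseˡ g)) (trans (cong (g ⟨$⟩ˡ_) e) (P.inverseˡ g)))

  iter-difference : ∀ g {a b} x → a ≤ b → iter g a x ≡ iter g b x → iter g (b ∸ a) x ≡ x
  iter-difference g {a} {b} x le e = iter-injective g a (begin
    iter g a (iter g (b ∸ a) x)   ≡⟨ sym (iter-+ g a (b ∸ a) x) ⟩
    iter g (a ℕ.+ (b ∸ a)) x      ≡⟨ cong (λ k → iter g k x) (ℕₚ.m+[n∸m]≡n le) ⟩
    iter g b x                    ≡⟨ sym e ⟩
    iter g a x ∎)

  iter-multiple : ∀ g p q x → iter g p x ≡ x → iter g (q ℕ.* p) x ≡ x
  iter-multiple g p zero x e = refl
  iter-multiple g p (suc q) x e = trans (iter-+ g p (q ℕ.* p) x) (trans (cong (iter g p) (iter-multiple g p q x e)) e)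

  iter-mod : ∀ g p x → iter g (suc p) x ≡ x → ∀ j → iter g (j ℕ.% suc p) x ≡ iter g j x
  iter-mod g p x e j = sym (begin
    iter g j x
      ≡⟨ cong (λ k → iter g k x) (m≡m%n+[m/n]*n j (suc p)) ⟩
    iter g (j ℕ.% suc p ℕ.+ (j ℕ./ suc p) ℕ.* suc p) x
      ≡⟨ iter-+ g (j ℕ.% suc p) _ x ⟩
    iter g (j ℕ.% suc p) (iter g ((j ℕ./ suc p) ℕ.* suc p) x)
      ≡⟨ cong (iter g (j ℕ.% suc p)) (iter-multiple g (suc p) (j ℕ./ suc p) x e) ⟩
    iter g (j ℕ.% suc p) x ∎)

  collision : ∀ g x p → (f : Fin (suc p) → Fin p) → (∀ i j → f i ≡ f j → iter g (toℕ i) x ≡ iter g (toℕ j) x) →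
    ∃[ k ] k < p × iter g (suc k) x ≡ x
  collision g x p f h with Fₚ.pigeonhole (ℕₚ.n<1+n p) f
  ... | i , j , i<j , e with toℕ j ∸ toℕ i in d
  ...   | zero = contradiction (ℕₚ.m∸n≡0⇒m≤n d) (ℕₚ.<⇒≱ i<j)
  ...   | suc k = k , ℕₚ.≤-trans (subst (_≤ toℕ j) d (ℕₚ.m∸n≤m (toℕ j) (toℕ i))) (ℕₚ.≤-pred (Fₚ.toℕ<n j)) ,
                  subst (λ m → iter g m x ≡ x) d (iter-difference g x (ℕₚ.<⇒≤ i<j) (h i j e))

  private
    least : (P : ℕ → Set) → (∀ k → Dec (P k)) → ∀ k → P k → ∃[ q ] q ≤ k × P q × (∀ j → j < q → ¬ P j)
    least P P? zero pk = 0 , z≤n , pk , λ _ ()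
    least P P? (suc k) pk with P? 0
    ... | yes p0 = 0 , z≤n , p0 , λ _ ()
    ... | no ¬p0 with least (P ∘ suc) (P? ∘ suc) k pk
    ...   | q , le , pq , min = suc q , s≤s le , pq , λ { zero _ → ¬p0 ; (suc j) (s≤s lt) → min j lt }

  -- The period is stored through its predecessor, so that `suc pred` is visibly nonzero as a
  -- modulus.
  record Period (g : Permutation′ n) (x : Fin n) : Set where
    field
      pred    : ℕ
      pred<n  : pred < n
      returns : iter g (suc pred) x ≡ x
      minimal : ∀ k → k < pred → iter g (suc k) x ≢ x

  opaque
    period : ∀ g x → Period g x
    period g x with collision g x n (λ i → iter g (toℕ i) x) (λ _ _ e → e)
    ... | k , k<n , e with least (λ k → iter g (suc k) x ≡ x) (λ k → iter g (suc k) x Fₚ.≟ x) k e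
    ...   | q , q≤k , eq , min = record { pred = q ; pred<n = ℕₚ.≤-<-trans q≤k k<n ; returns = eq ; minimal = min }

    reach? : ∀ g x y → Dec (∃[ j ] iter g (toℕ {n} j) x ≡ y)
    reach? g x y = Fₚ.any? (λ j → iter g (toℕ j) x Fₚ.≟ y)

    reach : Permutation′ n → Fin n → Fin n → Bool
    reach g x y = ⌊ reach? g x y ⌋

    reach-sound : ∀ g x y → reach g x y ≡ true → ∃[ j ] iter g j x ≡ y
    reach-sound g x y e with true-⌊⌋ (reach? g x y) e
    ... | j , eq = toℕ j , eq

    -- The period of x is at most n, so reduction modulo it brings every exponent into the range
    -- searched by `reach?`.
    reach-complete : ∀ g x j → reach g x (iter g j x) ≡ true
    reach-complete g x j = ⌊⌋-true (reach? g x (iter g j x))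
      (F.fromℕ< lt , trans (cong (λ k → iter g k x) (Fₚ.toℕ-fromℕ< lt)) (iter-mod g pred x returns j))
      where
      open Period (period g x)
      lt : j ℕ.% suc pred < n
      lt = ℕₚ.<-≤-trans (m%n<n j (suc pred)) pred<n

    reach-≈ : ∀ {g h : Permutation′ n} → g ≈ h → (∀ x y → reach g x y ≡ reach h x y)
    reach-≈ {g} {h} e x y = ⌊⌋-cong (reach? g x y) (reach? h x y)
        (λ (j , p) → j , trans (sym (iter-≈ (toℕ j))) p) (λ (j , p) → j , trans (iter-≈ (toℕ j)) p)
      where
      iter-≈ : ∀ j → iter g j x ≡ iter h j x
      iter-≈ zero = refl
      iter-≈ (suc j) = trans (e (iter g j x)) (cong (h ⟨$⟩ʳ_) (iter-≈ j))

  reach-complete′ : ∀ g {x y} j → iter g j x ≡ y → reach g x y ≡ true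
  reach-complete′ g j refl = reach-complete g _ j

  reach-refl : ∀ g x → reach g x x ≡ true
  reach-refl g x = reach-complete g x 0

  reach-sym : ∀ g {x y} → reach g x y ≡ true → reach g y x ≡ true
  reach-sym g {x} {y} e with reach-sound g x y e
  ... | j , refl = reach-complete′ g (suc pred ∸ (j ℕ.% suc pred)) (begin
      iter g (suc pred ∸ (j ℕ.% suc pred)) (iter g j x)
        ≡⟨ cong (iter g (suc pred ∸ (j ℕ.% suc pred))) (sym (iter-mod g pred x returns j)) ⟩
      iter g (suc pred ∸ (j ℕ.% suc pred)) (iter g (j ℕ.% suc pred) x)
        ≡⟨ sym (iter-+ g (suc pred ∸ (j ℕ.% suc pred)) (j ℕ.% suc pred) x) ⟩
      iter g (suc pred ∸ (j ℕ.% suc pred) ℕ.+ (j ℕ.% suc pred)) x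
        ≡⟨ cong (λ k → iter g k x) (ℕₚ.m∸n+n≡m (ℕₚ.<⇒≤ (m%n<n j (suc pred)))) ⟩
      iter g (suc pred) x
        ≡⟨ returns ⟩
      x ∎)
    where
    open Period (period g x)

  reach-trans : ∀ g {x y z} → reach g x y ≡ true → reach g y z ≡ true → reach g x z ≡ true
  reach-trans g {x} {y} {z} e e′ with reach-sound g x y e | reach-sound g y z e′
  ... | j , refl | k , refl = reach-complete′ g (k ℕ.+ j) (iter-+ g k j x)

  SameOrbits : Permutation′ n → Permutation′ n → Set
  SameOrbits g h = ∀ x y → reach g x y ≡ reach h x y

  -- The h-iterates of x stay in its g-orbit, which has at most `suc p` points when `suc p` is the
  -- period under g. By pigeonhole some h-iterate with a positive exponent of at most `suc p`
  -- returns to x.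
  period-≤ : ∀ g h → SameOrbits g h → ∀ x → Period.pred (period h x) ≤ Period.pred (period g x)
  period-≤ g h same x with collision h x (suc p) f inj
    where
    open Period (period g x) renaming (pred to p)
    pt : ∀ (i : Fin (suc (suc p))) → ∃[ j ] iter g j x ≡ iter h (toℕ i) x
    pt i = reach-sound g x _ (trans (same x _) (reach-complete h x (toℕ i)))
    f : Fin (suc (suc p)) → Fin (suc p)
    f i = F.fromℕ< (m%n<n (proj₁ (pt i)) (suc p))
    f-pt : ∀ i → iter g (toℕ (f i)) x ≡ iter h (toℕ i) x
    f-pt i = trans (cong (λ k → iter g k x) (Fₚ.toℕ-fromℕ< (m%n<n (proj₁ (pt i)) (suc p))))
      (trans (iter-mod g p x (Period.returns (period g x)) (proj₁ (pt i))) (proj₂ (pt i)))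
    inj : ∀ i j → f i ≡ f j → iter h (toℕ i) x ≡ iter h (toℕ j) x
    inj i j e = trans (sym (f-pt i)) (trans (cong (λ k → iter g (toℕ k) x) e) (f-pt j))
  ... | k , lt , e with ℕₚ.≤-<-connex (Period.pred (period h x)) k
  ...   | inj₁ le = ℕₚ.≤-trans le (ℕₚ.≤-pred lt)
  ...   | inj₂ k< = contradiction e (Period.minimal (period h x) k k<)

  same-period : ∀ g h → SameOrbits g h → ∀ x d → iter g d x ≡ x → iter h d x ≡ x
  same-period g h same x d e = trans (sym (iter-mod h p′ x (Period.returns (period h x)) d)) (cong (λ k → iter h k x) d%p′)
    where
    p = Period.pred (period g x)
    p′ = Period.pred (period h x)
    p≡p′ : p ≡ p′
    p≡p′ = ℕₚ.≤-antisym (period-≤ h g (λ x y → sym (same x y)) x) (period-≤ g h same x)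
    d%p : d ℕ.% suc p ≡ 0
    d%p with d ℕ.% suc p in eq
    ... | zero = refl
    ... | suc k = contradiction (subst (λ m → iter g m x ≡ x) eq (trans (iter-mod g p x (Period.returns (period g x)) d) e))
                    (Period.minimal (period g x) k (ℕₚ.≤-pred (subst (_< suc p) eq (m%n<n d (suc p)))))
    d%p′ : d ℕ.% suc p′ ≡ 0
    d%p′ = subst (λ q → d ℕ.% suc q ≡ 0) p≡p′ d%p

  -- The periods of x under g and h agree, so the same pairs of exponents give equal points. Hence
  -- `transport` does not depend on the exponent found by the search.
  same-iter : ∀ g h → SameOrbits g h → ∀ x a b → iter g a x ≡ iter g b x → iter h a x ≡ iter h b x
  same-iter g h same x a b e with ℕₚ.≤-total a b
  ... | inj₁ le = sym (go le e)
    where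
    go : ∀ {a b} → a ≤ b → iter g a x ≡ iter g b x → iter h b x ≡ iter h a x
    go {a} {b} le e = trans (cong (λ k → iter h k x) (sym (ℕₚ.m+[n∸m]≡n le))) (trans (iter-+ h a (b ∸ a) x)
      (cong (iter h a) (same-period g h same x (b ∸ a) (iter-difference g x le e))))
  ... | inj₂ le = trans (cong (λ k → iter h k x) (sym (ℕₚ.m+[n∸m]≡n le))) (trans (iter-+ h b (a ∸ b) x)
      (cong (iter h b) (same-period g h same x (a ∸ b) (iter-difference g x le (sym e)))))

find : ∀ {n} → (Fin n → Bool) → Maybe (Fin n)
find {zero} p = nothing
find {suc n} p with p zero
... | true = just zero
... | false = Maybe.map suc (find (p ∘ suc))

find-cong : ∀ {n} {p q : Fin n → Bool} → (∀ x → p x ≡ q x) → find p ≡ find q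
find-cong {zero} h = refl
find-cong {suc n} {p} {q} h with p zero | q zero | h zero
... | true | true | _ = refl
... | false | false | _ = cong (Maybe.map suc) (find-cong (h ∘ suc))

find-spec : ∀ {n} (p : Fin n → Bool) x → p x ≡ true → ∃[ y ] find p ≡ just y × p y ≡ true
find-spec {suc n} p x e with p zero in eq
... | true = zero , refl , eq
find-spec {suc n} p zero e | false = contradiction (trans (sym e) eq) λ ()
find-spec {suc n} p (suc x) e | false with find-spec (p ∘ suc) x e
... | y , f , py rewrite f = suc y , refl , py

module _ {n : ℕ} where

  -- The least point of the orbit, so that points of one orbit receive the same representative.
  root : Permutation′ n → Fin n → Fin n
  root g x = Maybe.fromMaybe x (find (reach g x))

  reach-root : ∀ g x → reach g x (root g x) ≡ true
  reach-root g x with find-spec (reach g x) x (reach-refl g x)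
  ... | y , f , r rewrite f = r

  root-cong : ∀ g {x y} → reach g x y ≡ true → root g x ≡ root g y
  root-cong g {x} {y} e with find-spec (reach g x) x (reach-refl g x)
  ... | z , f , r rewrite f | trans (sym (find-cong {p = reach g x} {reach g y} (λ z → bool-ext (reach-trans g (reach-sym g e)) (reach-trans g e)))) f = refl

  module _ (g h : Permutation′ n) (same : SameOrbits g h) (r : Fin n → Fin n)
           (r-reach : ∀ x → reach g (r x) x ≡ true) where

    private
      index : ∀ x → ∃[ j ] iter g j (r x) ≡ x
      index x = reach-sound g (r x) x (r-reach x)

    -- Sends g^j r to h^j r on the orbit of each representative r.
    transport : Fin n → Fin n
    transport x = iter h (proj₁ (index x)) (r x)

    transport-iter : ∀ x j → iter g j (r x) ≡ x → transport x ≡ iter h j (r x)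
    transport-iter x j e = same-iter g h same (r x) (proj₁ (index x)) j (trans (proj₂ (index x)) (sym e))

    transport-reach : ∀ x → reach g x (transport x) ≡ true
    transport-reach x = reach-trans g (reach-sym g (r-reach x))
      (trans (same (r x) (transport x)) (reach-complete h (r x) (proj₁ (index x))))

  module _ (g h : Permutation′ n) (same : SameOrbits g h) where

    private
      same′ : SameOrbits h g
      same′ x y = sym (same x y)

      r = root g

      r-g : ∀ x → reach g (r x) x ≡ true
      r-g x = reach-sym g (reach-root g x)

      r-h : ∀ x → reach h (r x) x ≡ true
      r-h x = trans (sym (same (r x) x)) (r-g x)

      s t : Fin n → Fin n
      s = transport g h same r r-g
      t = transport h g same′ r r-h

      s-index : ∀ x → ∃[ j ] iter g j (r x) ≡ x × s x ≡ iter h j (r x)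
      s-index x = let j , e = reach-sound g (r x) x (r-g x) in j , e , transport-iter g h same r r-g x j e

      t-index : ∀ x → ∃[ j ] iter h j (r x) ≡ x × t x ≡ iter g j (r x)
      t-index x = let j , e = reach-sound h (r x) x (r-h x) in j , e , transport-iter h g same′ r r-h x j e

      r-s : ∀ x → r (s x) ≡ r x
      r-s x = sym (root-cong g (transport-reach g h same r r-g x))

      r-t : ∀ x → r (t x) ≡ r x
      r-t x = sym (root-cong g (trans (same x (t x)) (transport-reach h g same′ r r-h x)))

      t-s : ∀ x → t (s x) ≡ x
      t-s x with s-index x
      ... | j , e , e′ = trans (transport-iter h g same′ r r-h (s x) j (trans (cong (iter h j) (r-s x)) (sym e′)))
              (trans (cong (iter g j) (r-s x)) e)

      s-t : ∀ x → s (t x) ≡ x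
      s-t x with t-index x
      ... | j , e , e′ = trans (transport-iter g h same r r-g (t x) j (trans (cong (iter g j) (r-t x)) (sym e′)))
              (trans (cong (iter h j) (r-t x)) e)

      s-g : ∀ x → s (g ⟨$⟩ʳ x) ≡ h ⟨$⟩ʳ s x
      s-g x with s-index x
      ... | j , e , e′ = trans (transport-iter g h same r r-g (g ⟨$⟩ʳ x) (suc j) (trans (cong (iter g (suc j)) r-gx) (cong (g ⟨$⟩ʳ_) e)))
              (trans (cong (iter h (suc j)) r-gx) (cong (h ⟨$⟩ʳ_) (sym e′)))
        where
        r-gx : r (g ⟨$⟩ʳ x) ≡ r x
        r-gx = sym (root-cong g (reach-complete g x 1))

    -- The map g^j r ↦ h^j r intertwines g with h, since each of them raises the exponent by one.
    -- Its inverse is the same construction with g and h exchanged, based at the same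
    -- representatives r.
    same-orbits-conjugate : ∃[ c ] conj c g ≈ h
    same-orbits-conjugate = P.permutation s t s-t t-s , λ x → trans (s-g (t x)) (cong (h ⟨$⟩ʳ_) (s-t x))

-- Class functions are determined by their inner products with Young characters

∑-strict : ∀ {A : Set} (FA : Finite A) {f g : A → ℤ} → (∀ x → f x ℤ.≤ g x) → ∀ a → f a ≢ g a → ∑ (elems FA) f ℤ.< ∑ (elems FA) g
∑-strict FA {f} {g} le a ne = ℤₚ.≤∧≢⇒< (∑-mono (elems FA) le) (λ e → ne (sym (ℤₚ.i-j≡0⇒i≡j (g a) (f a)
  (Finite.∑-zero⇒ FA {λ x → g x - f x} (λ x → ℤₚ.i≤j⇒0≤j-i (le x))
    (trans (∑-+ (elems FA) g (λ x → - f x)) (trans (cong (_+_ (∑ (elems FA) g)) (∑-neg (elems FA) f)) (trans (cong (λ z → ∑ (elems FA) g + - z) e) (ℤₚ.+-inverseʳ (∑ (elems FA) g))))) a))))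

record IsClassFunction {n} (φ : ClassFn n) : Set where
  field
    ext       : Ext φ
    conj-inv  : ∀ h g → φ (conj h g) ≡ φ g

module _ {n : ℕ} (φ : ClassFn n) (φ-class : IsClassFunction φ) where

  open IsClassFunction φ-class
  private
    module W = Coloured n
    module G = GSet (W.words n)

    -- The sum of φ over the stabiliser of w. By conjugation invariance it is the same for all words
    -- of one content, so the inner product of φ with the Young character of that content is this
    -- sum times the number of such words.
    local : Vec (Fin n) n → ℤ
    local w = ∑ᴳ (λ g → φ g * ⟦ G.fix g w ⟧)

    fix-ext : ∀ w → Ext (λ g → φ g * ⟦ G.fix g w ⟧)
    fix-ext w g h e = cong₂ (λ a v → a * ⟦ v G.== w ⟧) (ext g h e) (G.act-≈ {g} {h} e w)

    local-act : ∀ h w → local (G.act h w) ≡ local w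
    local-act h w = trans (∑ᴳ-cong (λ g → cong₂ (λ a b → a * ⟦ b ⟧) (sym (conj-inv h g)) (sym (G.fix-conj h g w))))
      (∑ᴳ-conj h (fix-ext w))

    local-zero : ∀ c w → W.has c w ≡ true → ∑ᴳ (λ g → φ g * G.perm-char (W.has c) g) ≡ 0ℤ → local w ≡ 0ℤ
    local-zero c w w∈ e with ℤₚ.i*j≡0⇒i≡0∨j≡0 (∑ (elems G.finite) (λ v → ⟦ W.has c v ⟧)) (trans (sym total) e)
      where
      equal : ∀ v → ⟦ W.has c v ⟧ * local v ≡ ⟦ W.has c v ⟧ * local w
      equal v = ⟦⟧-* (W.has c v) (λ v∈ → move (W.same-content-act w v (same-cnt v∈)))
        where
        same-cnt : W.has c v ≡ true → ∀ a → W.cnt (lookup w) a ≡ W.cnt (lookup v) a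
        same-cnt v∈ a = trans (true-⌊⌋ (W.content? c w) w∈ a) (sym (true-⌊⌋ (W.content? c v) v∈ a))
        move : ∃[ h ] G.act h w ≡ v → local v ≡ local w
        move (h , eq) = trans (cong local (sym eq)) (local-act h w)
      total : ∑ᴳ (λ g → φ g * G.perm-char (W.has c) g) ≡ ∑ (elems G.finite) (λ v → ⟦ W.has c v ⟧) * local w
      total = begin
        ∑ᴳ (λ g → φ g * G.perm-char (W.has c) g)
          ≡⟨ ∑ᴳ-cong (λ g → sym (∑-*ˡ (elems G.finite) (φ g) _)) ⟩
        ∑ᴳ (λ g → ∑ (elems G.finite) (λ v → φ g * (⟦ W.has c v ⟧ * ⟦ G.fix g v ⟧)))
          ≡⟨ ∑ᴳ-∑ (elems G.finite) _ ⟩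
        ∑ (elems G.finite) (λ v → ∑ᴳ (λ g → φ g * (⟦ W.has c v ⟧ * ⟦ G.fix g v ⟧)))
          ≡⟨ ∑-cong (elems G.finite) (λ v → trans (∑ᴳ-cong (λ g → *-swap (φ g) ⟦ W.has c v ⟧ ⟦ G.fix g v ⟧)) (trans (∑ᴳ-*ˡ ⟦ W.has c v ⟧ _) (equal v))) ⟩
        ∑ (elems G.finite) (λ v → ⟦ W.has c v ⟧ * local w)
          ≡⟨ ∑-*ʳ (elems G.finite) (local w) _ ⟩
        ∑ (elems G.finite) (λ v → ⟦ W.has c v ⟧) * local w ∎
    ... | inj₂ z = z
    ... | inj₁ z = contradiction (trans (sym (cong ⟦_⟧ w∈)) (Finite.∑-zero⇒ G.finite (λ v → ⟦⟧-nonneg (W.has c v)) z w)) λ ()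

    pairs : Finite (Fin n × Fin n)
    pairs = ×-finite (Fin-finite n) (Fin-finite n)

    -- Induction measure: the number of pairs of points in a common orbit, which drops strictly when
    -- the orbits are refined.
    size : Permutation′ n → ℤ
    size g = ∑ (elems pairs) (λ (x , y) → ⟦ reach g x y ⟧)

    ⟦⟧-mono : ∀ {a b} → (a ≡ true → b ≡ true) → ⟦ a ⟧ ℤ.≤ ⟦ b ⟧
    ⟦⟧-mono {true} h rewrite h refl = ℤₚ.≤-refl
    ⟦⟧-mono {false} {b} h = ⟦⟧-nonneg b

    size-nonneg : ∀ g → 0ℤ ℤ.≤ size g
    size-nonneg g = ∑-nonneg (elems pairs) (λ (x , y) → ⟦⟧-nonneg (reach g x y))

    Finer : Permutation′ n → Permutation′ n → Set
    Finer h g = ∃[ e ] (reach g (proj₁ e) (proj₂ e) ∧ not (reach h (proj₁ e) (proj₂ e))) ≡ true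

    finer? : ∀ h g → Dec (Finer h g)
    finer? h g = Finite.any? pairs (λ (x , y) → reach g x y ∧ not (reach h x y))

    -- The stabiliser of the colouring of the points by their g-orbits consists of permutations with the
    -- same orbits as g, hence conjugate to g, and of permutations with finer orbits.
    module Orbits (g : Permutation′ n) where

      w : Vec (Fin n) n
      w = tabulate (root g)

      B : Permutation′ n → ℤ
      B h = ⟦ G.fix h w ∧ not ⌊ finer? h g ⌋ ⟧

      inside : ∀ h → G.fix h w ≡ true → ∀ x y → reach h x y ≡ true → reach g x y ≡ true
      inside h e x y r with reach-sound h x y r
      ... | j , refl = along j
        where
        step : ∀ x → root g (h ⟨$⟩ʳ x) ≡ root g x
        step x = trans (sym (Vₚ.lookup∘tabulate (root g) (h ⟨$⟩ʳ x))) (trans (sym (Vₚ.lookup∘tabulate (λ x → lookup w (h ⟨$⟩ʳ x)) x))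
          (trans (cong (λ v → lookup v x) (G.==-sound {_} {w} e)) (Vₚ.lookup∘tabulate (root g) x)))
        step-reach : ∀ x → reach g x (h ⟨$⟩ʳ x) ≡ true
        step-reach x = reach-trans g (subst (λ z → reach g x z ≡ true) (sym (step x)) (reach-root g x)) (reach-sym g (reach-root g (h ⟨$⟩ʳ x)))
        along : ∀ j → reach g x (iter h j x) ≡ true
        along zero = reach-refl g x
        along (suc j) = reach-trans g (along j) (step-reach (iter h j x))

      outside : ∀ h → ¬ Finer h g → ∀ x y → reach g x y ≡ true → reach h x y ≡ true
      outside h ¬d x y r with reach h x y in q
      ... | true = refl
      ... | false = contradiction ((x , y) , true-∧ r (cong not q)) ¬d

      smaller : ∀ h → G.fix h w ≡ true → Finer h g → size h ℤ.< size g
      smaller h e ((x , y) , d) = ∑-strict pairs {λ (x , y) → ⟦ reach h x y ⟧} {λ (x , y) → ⟦ reach g x y ⟧}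
          (λ (x , y) → ⟦⟧-mono (inside h e x y)) (x , y) (differ d)
        where
        differ : ∀ {a b} → (b ∧ not a) ≡ true → ⟦ a ⟧ ≢ ⟦ b ⟧
        differ {false} {true} _ ()

      reduce : (∀ h → size h ℤ.< size g → φ h ≡ 0ℤ) → ∀ h → φ h * ⟦ G.fix h w ⟧ ≡ φ g * B h
      reduce ih h = by-cases (G.fix h w) refl (finer? h g)
        where
        by-cases : ∀ b → G.fix h w ≡ b → (d : Dec (Finer h g)) → φ h * ⟦ b ⟧ ≡ φ g * ⟦ b ∧ not ⌊ d ⌋ ⟧
        by-cases false _ _ = trans (ℤₚ.*-zeroʳ (φ h)) (sym (ℤₚ.*-zeroʳ (φ g)))
        by-cases true e (yes d) = trans (cong (_* 1ℤ) (ih h (smaller h e d))) (sym (ℤₚ.*-zeroʳ (φ g)))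
        by-cases true e (no ¬d) = let c , eq = same-orbits-conjugate g h (λ x y → bool-ext (outside h ¬d x y) (inside h e x y)) in
          cong (_* 1ℤ) (trans (sym (ext _ _ eq)) (conj-inv c g))

      B-ext : Ext B
      B-ext h h′ e = cong₂ (λ v b → ⟦ (v G.== w) ∧ not b ⟧) (G.act-≈ {h} {h′} e w) (⌊⌋-cong (finer? h g) (finer? h′ g)
        (λ ((x , y) , d) → (x , y) , trans (cong (λ b → reach g x y ∧ not b) (sym (reach-≈ {g = h} {h′} e x y))) d)
        (λ ((x , y) , d) → (x , y) , trans (cong (λ b → reach g x y ∧ not b) (reach-≈ {g = h} {h′} e x y)) d))

      B-g : B g ≡ 1ℤ
      B-g = cong₂ (λ a b → ⟦ a ∧ b ⟧)
        (⌊⌋-true (G._≟ˣ_ _ w) (Vₚ.tabulate-cong (λ x → trans (Vₚ.lookup∘tabulate (root g) (g ⟨$⟩ʳ x)) (sym (root-cong g (reach-complete g x 1))))))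
        (self (finer? g g))
        where
        ∧-not : ∀ b → (b ∧ not b) ≢ true
        ∧-not true ()
        ∧-not false ()
        self : (d : Dec (Finer g g)) → not ⌊ d ⌋ ≡ true
        self (no _) = refl
        self (yes ((x , y) , d)) = contradiction d (∧-not (reach g x y))

      -- Once the permutations with finer orbits contribute 0, the stabiliser sum is φ(g) times a
      -- number of permutations, among which is g itself.
      vanishes : (∀ h → size h ℤ.< size g → φ h ≡ 0ℤ) → local w ≡ 0ℤ → φ g ≡ 0ℤ
      vanishes ih l = Sum.[ id , (λ z → contradiction (trans (sym B-g) (∑ᴳ-zero⇒ B-ext (λ h → ⟦⟧-nonneg (G.fix h w ∧ not ⌊ finer? h g ⌋)) z g)) λ ()) ]
        (ℤₚ.i*j≡0⇒i≡0∨j≡0 (φ g) (trans (sym (∑ᴳ-*ˡ (φ g) B)) (trans (sym (∑ᴳ-cong (reduce ih))) l)))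

  class-function-zero : (∀ (w : Vec (Fin n) n) → ∑ᴳ (λ g → φ g * G.perm-char (W.has (W.cnt (lookup w))) g) ≡ 0ℤ) → ∀ g → φ g ≡ 0ℤ
  class-function-zero hyp g = go ℤ.∣ 1ℤ + size g ∣ g (ℤₚ.<-≤-trans (ℤₚ.suc[i]≤j⇒i<j {size g} ℤₚ.≤-refl)
      (ℤₚ.≤-reflexive (sym (ℤₚ.0≤i⇒+∣i∣≡i (ℤₚ.+-mono-≤ (ℤ.+≤+ (z≤n {1})) (size-nonneg g))))))
    where
    go : ∀ N g → size g ℤ.< + N → φ g ≡ 0ℤ
    go zero g lt = contradiction (size-nonneg g) (ℤₚ.<⇒≱ lt)
    go (suc N) g lt = Orbits.vanishes g (λ h lt′ → go N h (ℤₚ.<-≤-trans lt′ (ℤₚ.i<j⇒i≤pred[j] lt)))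
      (local-zero (W.cnt (lookup w)) w (⌊⌋-true (W.content? (W.cnt (lookup w)) w) (λ _ → refl)) (hyp w))
      where w = Orbits.w g

-- Symmetries of Young characters

-- The variant of `∑-bij` for a map whose inverse is known only through the existence of preimages.
∑-bij-surjective : ∀ {A B : Set} (FA : Finite A) (FB : Finite B) (P : A → Bool) (Q : B → Bool) (f : A → ℤ) (g : B → ℤ)
  (to : A → B) →
  (∀ a → P a ≡ true → Q (to a) ≡ true × f a ≡ g (to a)) →
  (∀ a a′ → P a ≡ true → P a′ ≡ true → to a ≡ to a′ → a ≡ a′) →
  (∀ b → Q b ≡ true → ∃[ a ] P a ≡ true × to a ≡ b) →
  ∑ (elems FA) (λ a → ⟦ P a ⟧ * f a) ≡ ∑ (elems FB) (λ b → ⟦ Q b ⟧ * g b)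
∑-bij-surjective FA FB P Q f g to h inj surj = begin
  ∑ (elems FA) (λ a → ⟦ P a ⟧ * f a)
    ≡⟨ ∑-cong (elems FA) (λ a → sym (FB.∑-pick (to a) _)) ⟩
  ∑ (elems FA) (λ a → ∑ (elems FB) (λ b → ⟦ b FB.== to a ⟧ * (⟦ P a ⟧ * f a)))
    ≡⟨ ∑-swap (elems FA) (elems FB) _ ⟩
  ∑ (elems FB) (λ b → ∑ (elems FA) (λ a → ⟦ b FB.== to a ⟧ * (⟦ P a ⟧ * f a)))
    ≡⟨ ∑-cong (elems FB) fibre ⟩
  ∑ (elems FB) (λ b → ⟦ Q b ⟧ * g b) ∎
  where
  module FA = Finite FA
  module FB = Finite FB
  fibre : ∀ b → ∑ (elems FA) (λ a → ⟦ b FB.== to a ⟧ * (⟦ P a ⟧ * f a)) ≡ ⟦ Q b ⟧ * g b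
  fibre b with Q b in q
  ... | false = ∑-zero (elems FA) (λ a → none a)
    where
    none : ∀ a → ⟦ b FB.== to a ⟧ * (⟦ P a ⟧ * f a) ≡ 0ℤ
    none a with b FB.≟ to a | P a in p
    ... | yes refl | true = contradiction (trans (sym q) (proj₁ (h a p))) λ ()
    ... | yes _ | false = refl
    ... | no _ | _ = refl
  ... | true with surj b q
  ...   | a₀ , p₀ , refl = trans (∑-cong (elems FA) one) (trans (FA.∑-pick a₀ (λ a → f a)) (trans (proj₂ (h a₀ p₀)) (sym (ℤₚ.*-identityˡ (g (to a₀))))))
    where
    one : ∀ a → ⟦ to a₀ FB.== to a ⟧ * (⟦ P a ⟧ * f a) ≡ ⟦ a FA.== a₀ ⟧ * f a
    one a with to a₀ FB.≟ to a | P a in p | a FA.≟ a₀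
    ... | yes e | true | yes _ = cong (1ℤ *_) (ℤₚ.*-identityˡ (f a))
    ... | yes e | true | no ¬e = contradiction (inj a a₀ p p₀ (sym e)) ¬e
    ... | yes e | false | yes refl = contradiction (trans (sym p) p₀) λ ()
    ... | yes e | false | no _ = refl
    ... | no ¬e | _ | yes e = contradiction (cong to (sym e)) ¬e
    ... | no ¬e | _ | no _ = refl

-- Renaming colours commutes with permuting positions, and a colour outside the image has
-- multiplicity 0, so it occurs in no word of content d. This one statement covers reordering parts,
-- dropping zero parts and changing the index type of the colours.
recolour : ∀ {A B : Set} (FA : Finite A) (FB : Finite B) {n} (c : A → ℤ) (d : B → ℤ) (to : A → B) →
  (∀ {a a′} → to a ≡ to a′ → a ≡ a′) → (∀ a → d (to a) ≡ c a) → (∀ b → (∃[ a ] to a ≡ b) ⊎ ((∀ a → to a ≢ b) × d b ≡ 0ℤ)) →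
  ∀ g → GSet.perm-char (Words.words FA n) (Words.has FA c) g ≡ GSet.perm-char (Words.words FB n) (Words.has FB d) g
recolour {A} {B} FA FB {n} c d to inj d-to img g =
  ∑-bij-surjective (Vec-finite FA n) (Vec-finite FB n) (WA.has c) (WB.has d) _ _ (V.map to)
    (λ w h → ⌊⌋-true (WB.content? d (V.map to w)) (content w (true-⌊⌋ (WA.content? c w) h)) , cong ⟦_⟧ (fixed w))
    (λ v w _ _ e → map-injective v w e)
    lift
  where
  module FA = Finite FA
  module FB = Finite FB
  module WA = Words FA
  module WB = Words FB
  map-injective : ∀ {m} (v w : Vec A m) → V.map to v ≡ V.map to w → v ≡ w
  map-injective [] [] e = refl
  map-injective (x ∷ v) (y ∷ w) e = cong₂ _∷_ (inj (proj₁ (Vₚ.∷-injective e))) (map-injective v w (proj₂ (Vₚ.∷-injective e)))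
  same-letter : ∀ x a → ⟦ to x FB.== to a ⟧ ≡ ⟦ x FA.== a ⟧
  same-letter x a = cong ⟦_⟧ (⌊⌋-cong (to x FB.≟ to a) (x FA.≟ a) inj (cong to))
  cnt-map : ∀ w a → WB.cnt (lookup (V.map to w)) (to a) ≡ WA.cnt (lookup w) a
  cnt-map w a = trans (WB.cnt-cong (λ x → Vₚ.lookup-map x to w) (to a)) (∑-cong (allFin n) (λ x → same-letter (lookup w x) a))
  content : ∀ w → (∀ a → WA.cnt (lookup w) a ≡ c a) → ∀ b → WB.cnt (lookup (V.map to w)) b ≡ d b
  content w h b with img b
  ... | inj₁ (a , refl) = trans (cnt-map w a) (trans (h a) (sym (d-to a)))
  ... | inj₂ (miss , d0) = trans (WB.cnt-cong (λ x → Vₚ.lookup-map x to w) b) (trans (∑-zero (allFin n) (λ x → absent (lookup w x))) (sym d0))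
    where
    absent : ∀ a → ⟦ to a FB.== b ⟧ ≡ 0ℤ
    absent a with to a FB.≟ b
    ... | yes e = contradiction e (miss a)
    ... | no _ = refl
  act-map : ∀ w → GSet.act (WB.words n) g (V.map to w) ≡ V.map to (GSet.act (WA.words n) g w)
  act-map w = trans (Vₚ.tabulate-cong (λ x → Vₚ.lookup-map (g ⟨$⟩ʳ x) to w)) (Vₚ.tabulate-∘ to (λ x → lookup w (g ⟨$⟩ʳ x)))
  fixed : ∀ w → GSet.fix (WA.words n) g w ≡ GSet.fix (WB.words n) g (V.map to w)
  fixed w = ⌊⌋-cong (GSet._≟ˣ_ (WA.words n) _ w) (GSet._≟ˣ_ (WB.words n) _ (V.map to w))
    (λ e → trans (act-map w) (cong (V.map to) e)) (λ e → map-injective _ w (trans (sym (act-map w)) e))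
  lift : ∀ w → WB.has d w ≡ true → ∃[ v ] WA.has c v ≡ true × V.map to v ≡ w
  lift w h = v , ⌊⌋-true (WA.content? c v) (λ a → trans (sym (cnt-map v a)) (trans (cong (λ z → WB.cnt (lookup z) (to a)) map-v) (trans (h′ (to a)) (d-to a)))) , map-v
    where
    h′ = true-⌊⌋ (WB.content? d w) h
    letter : ∀ x → ∃[ a ] to a ≡ lookup w x
    letter x with img (lookup w x)
    ... | inj₁ e = e
    ... | inj₂ (_ , d0) = contradiction (trans (sym (cong ⟦_⟧ (FB.==-refl (lookup w x))))
            (Finite.∑-zero⇒ (Fin-finite n) {λ y → ⟦ lookup w y FB.== lookup w x ⟧} (λ y → ⟦⟧-nonneg (lookup w y FB.== lookup w x)) (trans (h′ (lookup w x)) d0) x)) λ ()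
    v = tabulate (λ x → proj₁ (letter x))
    map-v : V.map to v ≡ w
    map-v = trans (sym (Vₚ.tabulate-∘ to (λ x → proj₁ (letter x)))) (trans (Vₚ.tabulate-cong (λ x → proj₂ (letter x))) (Vₚ.tabulate∘lookup w))

colours-lookup : ∀ α j → colours α j ≡ + L.lookup α j
colours-lookup (a ∷ α) zero = refl
colours-lookup (a ∷ α) (suc j) = colours-lookup α j

young-↭ : ∀ n {α β} → α ↭ β → ∀ g → young n α g ≡ young n β g
young-↭ n {α} {β} p = recolour (Fin-finite (length α)) (Fin-finite (length β)) (colours α) (colours β) (π ⟨$⟩ʳ_)
    (λ e → trans (sym (P.inverseˡ π)) (trans (cong (π ⟨$⟩ˡ_) e) (P.inverseˡ π)))
    (λ j → trans (colours-lookup β (π ⟨$⟩ʳ j)) (trans (cong +_ (sym (↭ₛ.onIndices-lookup (Perm.↭⇒↭ₛ p) j))) (sym (colours-lookup α j))))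
    (λ j → inj₁ (π ⟨$⟩ˡ j , P.inverseʳ π))
  where
  π = onIndices (Perm.↭⇒↭ₛ p)

young-0 : ∀ n α g → young n (0 ∷ α) g ≡ young n α g
young-0 n α g = sym (recolour (Fin-finite (length α)) (Fin-finite (suc (length α))) (colours α) (colours (0 ∷ α)) suc
  Fₚ.suc-injective (λ _ → refl) (λ { zero → inj₂ ((λ _ ()) , refl) ; (suc j) → inj₁ (j , refl) }) g)

young-zeros : ∀ n k α g → young n (L.replicate k 0 ++ α) g ≡ young n α g
young-zeros n zero α g = refl
young-zeros n (suc k) α g = trans (young-0 n (L.replicate k 0 ++ α) g) (young-zeros n k α g)

insert↓ : ℕ → List ℕ → List ℕ
insert↓ a [] = a ∷ []
insert↓ a (b ∷ l) with b ℕ.≤? a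
... | yes _ = a ∷ b ∷ l
... | no _ = b ∷ insert↓ a l

insert↓-↭ : ∀ a l → insert↓ a l ↭ a ∷ l
insert↓-↭ a [] = Perm.refl
insert↓-↭ a (b ∷ l) with b ℕ.≤? a
... | yes _ = Perm.refl
... | no _ = Perm.trans (Perm.prep b (insert↓-↭ a l)) (Perm.swap b a Perm.refl)

insert↓-sorted : ∀ a l → Linked (λ x y → y ≤ x) l → Linked (λ x y → y ≤ x) (insert↓ a l)
insert↓-sorted a [] _ = [-]
insert↓-sorted a (b ∷ l) s with b ℕ.≤? a
... | yes le = le ∷ s
... | no ¬le = go l s
  where
  go : ∀ l → Linked (λ x y → y ≤ x) (b ∷ l) → Linked (λ x y → y ≤ x) (b ∷ insert↓ a l)
  go [] _ = ℕₚ.≰⇒≥ ¬le ∷ [-]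
  go (c ∷ l) (r ∷ s) with insert↓-sorted a (c ∷ l) s
  ... | s′ with c ℕ.≤? a
  ...   | yes _ = ℕₚ.≰⇒≥ ¬le ∷ s′
  ...   | no _ = r ∷ s′

normal : ∀ α → ∃[ k ] ∃[ l ] IsPartition (sumℕ α) l × α ↭ L.replicate k 0 ++ l
normal [] = 0 , [] , ([] , [] , refl) , Perm.refl
normal (zero ∷ α) with normal α
... | k , l , part , p = suc k , l , part , Perm.prep 0 p
normal (suc a ∷ α) with normal α
... | k , l , (sorted , pos , sum) , p = k , insert↓ (suc a) l ,
  (insert↓-sorted (suc a) l sorted , Permₚ.All-resp-↭ (Perm.↭-sym (insert↓-↭ (suc a) l)) (s≤s z≤n ∷ pos) ,
   trans (sum-↭ (insert↓-↭ (suc a) l)) (cong (suc a ℕ.+_) sum)) ,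
  Perm.trans (Perm.prep (suc a) p) (Perm.trans (Perm.↭-sym (Permₚ.shift (suc a) (L.replicate k 0) l))
    (Permₚ.++⁺ˡ (L.replicate k 0) (Perm.↭-sym (insert↓-↭ (suc a) l))))

young-normal : ∀ n k l {α} → α ↭ L.replicate k 0 ++ l → ∀ g → young n α g ≡ young n l g
young-normal n k l p g = trans (young-↭ n p g) (young-zeros n k l g)

parts≤sum : ∀ l → All (_≤ sumℕ l) l
parts≤sum [] = []
parts≤sum (a ∷ l) = ℕₚ.m≤m+n a (sumℕ l) ∷ All.map (λ le → ℕₚ.≤-trans le (ℕₚ.m≤n+m (sumℕ l) a)) (parts≤sum l)

IsPartition⇒Part′ : ∀ {n l} → IsPartition n l → Part n n l
IsPartition⇒Part′ {l = l} p@(_ , _ , refl) = IsPartition⇒Part p (sumℕ l) (parts≤sum l)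

-- The integral span of the Young characters

YoungSpan : ∀ n → ClassFn n → Set
YoungSpan n φ = Σ[ bs ∈ List (ℤ × List ℕ) ] All (λ b → sumℕ (proj₂ b) ≡ n) bs ×
  (∀ g → φ g ≡ ∑ bs (λ b → proj₁ b * young n (proj₂ b) g))

module _ {n : ℕ} where

  span-young : ∀ α → sumℕ α ≡ n → YoungSpan n (young n α)
  span-young α e = (1ℤ , α) ∷ [] , e ∷ [] , λ g → sym (trans (ℤₚ.+-identityʳ _) (ℤₚ.*-identityˡ (young n α g)))

  span-zero : YoungSpan n (λ _ → 0ℤ)
  span-zero = [] , [] , λ _ → refl

  span-+ : ∀ {φ ψ} → YoungSpan n φ → YoungSpan n ψ → YoungSpan n (λ g → φ g + ψ g)
  span-+ (bs , ps , e) (bs′ , ps′ , e′) = bs ++ bs′ , Allₚ.++⁺ ps ps′ , λ g → trans (cong₂ _+_ (e g) (e′ g)) (sym (∑-++ bs bs′ _))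

  span-* : ∀ c {φ} → YoungSpan n φ → YoungSpan n (λ g → c * φ g)
  span-* c (bs , ps , e) = map (λ b → c * proj₁ b , proj₂ b) bs , Allₚ.map⁺ ps ,
    λ g → trans (cong (c *_) (e g)) (trans (sym (∑-*ˡ bs c _)) (trans (∑-cong bs (λ b → sym (ℤₚ.*-assoc c (proj₁ b) (young n (proj₂ b) g)))) (sym (∑-map _ bs _))))

  span-≐ : ∀ {φ ψ : ClassFn n} → φ ≐ ψ → YoungSpan n ψ → YoungSpan n φ
  span-≐ h (bs , ps , e) = bs , ps , λ g → trans (h g) (e g)

  span-∑ : ∀ {A : Set} {xs : List A} {φ : A → ClassFn n} → All (λ x → YoungSpan n (φ x)) xs → YoungSpan n (λ g → ∑ xs (λ x → φ x g))
  span-∑ [] = span-zero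
  span-∑ (s ∷ ss) = span-+ s (span-∑ ss)

  jt-length : ∀ (λ′ : List ℕ) {σ : List ℕ} → σ ↭ upTo (length λ′) → length λ′ ≡ length σ
  jt-length λ′ p = trans (sym (Lₚ.length-upTo (length λ′))) (sym (Permₚ.↭-length p))

  jt-sum₀ : ∀ λ′ {σ α} → σ ↭ upTo (length λ′) → jtComp 0 λ′ σ ≡ just α → sumℕ α ≡ sumℕ λ′
  jt-sum₀ λ′ {σ} {α} p e = ℕₚ.+-cancelʳ-≡ (sumℕ (cols 0 (length λ′))) (sumℕ α) (sumℕ λ′)
    (trans (jt-sum 0 λ′ σ (jt-length λ′ p) e) (cong (sumℕ λ′ ℕ.+_) (trans (sum-↭ p) (cong sumℕ (upTo≡cols (length λ′))))))

  span-irrTerm : ∀ λ′ σ → sumℕ λ′ ≡ n → σ ↭ upTo (length λ′) → YoungSpan n (λ g → irrTerm n λ′ g σ)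
  span-irrTerm λ′ σ sum p = by-cases (jtComp 0 λ′ σ) refl
    where
    by-cases : ∀ r → jtComp 0 λ′ σ ≡ r → YoungSpan n (λ g → irrTerm n λ′ g σ)
    by-cases (just α) e = span-≐ (λ g → trans (irrTerm-just n λ′ g σ e) (cong (signℤ (inversions σ) *_) (youngChar≡young n α g)))
      (span-* (signℤ (inversions σ)) (span-young α (trans (jt-sum₀ λ′ p e) sum)))
    by-cases nothing e = span-≐ (λ g → irrTerm-nothing n λ′ g σ e) span-zero

  span-irrChar : ∀ λ′ → sumℕ λ′ ≡ n → YoungSpan n (irrChar n λ′)
  span-irrChar λ′ sum = span-≐ (irrChar-∑ n λ′) (span-∑ (All.map (λ {σ} → span-irrTerm λ′ σ sum) (perms-↭ (upTo (length λ′)))))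

  young-class : ∀ α → IsClassFunction (young n α)
  young-class α = record
    { ext = GSet.perm-char-ext (Coloured.words (length α) n) (Coloured.has (length α) (colours α))
    ; conj-inv = GSet.perm-char-conj (Coloured.words (length α) n) (Coloured.has (length α) (colours α)) (Coloured.has-invariant (length α) n (colours α)) }

  span-class : ∀ {φ} → YoungSpan n φ → IsClassFunction φ
  span-class (bs , _ , e) = record
    { ext = λ g h g≈h → trans (e g) (trans (∑-cong bs (λ b → cong (proj₁ b *_) (IsClassFunction.ext (young-class (proj₂ b)) g h g≈h))) (sym (e h)))
    ; conj-inv = λ h g → trans (e (conj h g)) (trans (∑-cong bs (λ b → cong (proj₁ b *_) (IsClassFunction.conj-inv (young-class (proj₂ b)) h g))) (sym (e g))) }

  private
    γ-of : Vec (Fin n) n → List ℕ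
    γ-of w = L.tabulate (λ j → count (λ x → ⌊ lookup w x Fₚ.≟ j ⌋) (allFin n))

    γ-young : ∀ w g → GSet.perm-char (Coloured.words n n) (Coloured.has n (Coloured.cnt n (lookup w))) g ≡ young n (γ-of w) g
    γ-young w = recolour (Fin-finite n) (Fin-finite (length (γ-of w))) (Coloured.cnt n (lookup w)) (colours (γ-of w)) (F.cast (sym len))
        (λ e → Fₚ.toℕ-injective (trans (sym (Fₚ.toℕ-cast (sym len) _)) (trans (cong toℕ e) (Fₚ.toℕ-cast (sym len) _))))
        (λ j → trans (colours-lookup (γ-of w) (F.cast (sym len) j)) (trans (cong +_ (Lₚ.lookup-tabulate c j)) (∑-count (λ x → ⌊ lookup w x Fₚ.≟ j ⌋) (allFin n))))
        (λ j → inj₁ (F.cast len j , Fₚ.cast-involutive (sym len) len j))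
      where
      c = λ j → count (λ x → ⌊ lookup w x Fₚ.≟ j ⌋) (allFin n)
      len = Lₚ.length-tabulate c

    γ-sum : ∀ w → sumℕ (γ-of w) ≡ n
    γ-sum w = ℤₚ.+-injective (begin
      + sumℕ (γ-of w)
        ≡⟨ ∑-list (γ-of w) ⟩
      ∑ (γ-of w) (λ a → + a)
        ≡⟨ ∑-tabulate (λ j → count (λ x → ⌊ lookup w x Fₚ.≟ j ⌋) (allFin n)) (λ a → + a) ⟩
      ∑ (allFin n) (λ j → + count (λ x → ⌊ lookup w x Fₚ.≟ j ⌋) (allFin n))
        ≡⟨ ∑-cong (allFin n) (λ j → ∑-count (λ x → ⌊ lookup w x Fₚ.≟ j ⌋) (allFin n)) ⟩
      ∑ (allFin n) (λ j → ∑ (allFin n) (λ x → ⟦ ⌊ lookup w x Fₚ.≟ j ⌋ ⟧))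
        ≡⟨ ∑-swap (allFin n) (allFin n) _ ⟩
      ∑ (allFin n) (λ x → ∑ (allFin n) (λ j → ⟦ ⌊ lookup w x Fₚ.≟ j ⌋ ⟧))
        ≡⟨ ∑-cong (allFin n) (λ x → trans (∑-cong (allFin n) (λ j → cong ⟦_⟧ (⌊⌋-cong (lookup w x Fₚ.≟ j) (j Fₚ.≟ lookup w x) sym sym))) (Finite.once (Fin-finite n) (lookup w x))) ⟩
      ∑ (allFin n) (λ _ → 1ℤ)
        ≡⟨ ∑-one n ⟩
      + n ∎)
      where
      ∑-list : ∀ l → + sumℕ l ≡ ∑ l (λ a → + a)
      ∑-list [] = refl
      ∑-list (a ∷ l) = trans (ℤₚ.pos-+ a (sumℕ l)) (cong (_+_ (+ a)) (∑-list l))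

  -- `K-solve` finds an integral combination ψ of the χ^λ with the same inner products as φ; the
  -- difference is orthogonal to all Young characters, hence zero, and Jacobi-Trudi rewrites ψ in
  -- Young characters.
  integral⇒span : ∀ {φ} → IsClassFunction φ → (∀ γ → ∃[ N ] ∑ᴳ (λ g → φ g * young n γ g) ≡ ord n * N) → YoungSpan n φ
  integral⇒span {φ} φ-class int with K-solve (n ℕ.+ n) n n ℕₚ.≤-refl (λ γ → proj₁ (int γ))
  ... | cs , ps , solved = span-≐ (λ g → ℤₚ.i-j≡0⇒i≡j (φ g) (ψ g) (trans (ring (φ g) (ψ g)) (class-function-zero δ δ-class δ-zero g))) ψ-span
    where
    ψ δ : ClassFn n
    ψ g = ∑ cs (λ c → proj₁ c * irrChar n (proj₂ c) g)
    δ g = φ g + -[1+ 0 ] * ψ g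
    ring : ∀ a b → a - b ≡ a + -[1+ 0 ] * b
    ring = solve-∀
    ring₂ : ∀ a b c → (a + -[1+ 0 ] * b) * c ≡ a * c + -[1+ 0 ] * (b * c)
    ring₂ = solve-∀
    ring₃ : ∀ a → a + -[1+ 0 ] * a ≡ 0ℤ
    ring₃ = solve-∀
    ψ-span : YoungSpan n ψ
    ψ-span = span-∑ (All.map (λ {c} p → span-* (proj₁ c) (span-irrChar (proj₂ c) (Part-sum p))) ps)
    δ-class : IsClassFunction δ
    δ-class = record
      { ext = λ g h e → cong₂ (λ a b → a + -[1+ 0 ] * b) (IsClassFunction.ext φ-class g h e) (IsClassFunction.ext (span-class ψ-span) g h e)
      ; conj-inv = λ h g → cong₂ (λ a b → a + -[1+ 0 ] * b) (IsClassFunction.conj-inv φ-class h g) (IsClassFunction.conj-inv (span-class ψ-span) h g) }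
    ψ-inner : ∀ γ → Part n n γ → ∑ᴳ (λ g → ψ g * young n γ g) ≡ ord n * proj₁ (int γ)
    ψ-inner γ p = begin
      ∑ᴳ (λ g → ψ g * young n γ g)
        ≡⟨ ∑ᴳ-cong (λ g → trans (sym (∑-*ʳ cs (young n γ g) _)) (∑-cong cs (λ c → ℤₚ.*-assoc (proj₁ c) (irrChar n (proj₂ c) g) (young n γ g)))) ⟩
      ∑ᴳ (λ g → ∑ cs (λ c → proj₁ c * (irrChar n (proj₂ c) g * young n γ g)))
        ≡⟨ ∑ᴳ-∑ cs _ ⟩
      ∑ cs (λ c → ∑ᴳ (λ g → proj₁ c * (irrChar n (proj₂ c) g * young n γ g)))
        ≡⟨ ∑-congᴬ (All.map (λ {c} q → trans (∑ᴳ-*ˡ (proj₁ c) _) (trans (cong (proj₁ c *_) (irrChar-inner n (proj₂ c) γ (Part-sum q) (Part-small p)))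
             (*-swap (proj₁ c) (ord n) (K (proj₂ c) γ)))) ps) ⟩
      ∑ cs (λ c → ord n * (proj₁ c * K (proj₂ c) γ))
        ≡⟨ ∑-*ˡ cs (ord n) _ ⟩
      ord n * ∑ cs (λ c → proj₁ c * K (proj₂ c) γ)
        ≡⟨ cong (ord n *_) (sym (solved γ p)) ⟩
      ord n * proj₁ (int γ) ∎
    δ-inner : ∀ γ → Part n n γ → ∑ᴳ (λ g → δ g * young n γ g) ≡ 0ℤ
    δ-inner γ p = begin
      ∑ᴳ (λ g → δ g * young n γ g)
        ≡⟨ ∑ᴳ-cong (λ g → ring₂ (φ g) (ψ g) (young n γ g)) ⟩
      ∑ᴳ (λ g → φ g * young n γ g + -[1+ 0 ] * (ψ g * young n γ g))
        ≡⟨ trans (∑ᴳ-+ _ _) (cong (_+_ (∑ᴳ (λ g → φ g * young n γ g))) (∑ᴳ-*ˡ -[1+ 0 ] _)) ⟩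
      ∑ᴳ (λ g → φ g * young n γ g) + -[1+ 0 ] * ∑ᴳ (λ g → ψ g * young n γ g)
        ≡⟨ cong₂ (λ a b → a + -[1+ 0 ] * b) (proj₂ (int γ)) (ψ-inner γ p) ⟩
      ord n * proj₁ (int γ) + -[1+ 0 ] * (ord n * proj₁ (int γ))
        ≡⟨ ring₃ (ord n * proj₁ (int γ)) ⟩
      0ℤ ∎
    δ-zero : ∀ w → ∑ᴳ (λ g → δ g * GSet.perm-char (Coloured.words n n) (Coloured.has n (Coloured.cnt n (lookup w))) g) ≡ 0ℤ
    δ-zero w with normal (γ-of w)
    ... | k , l , part , p = trans (∑ᴳ-cong (λ g → cong (δ g *_) (trans (γ-young w g) (young-normal n k l p g))))
      (δ-inner l (IsPartition⇒Part′ (subst (λ m → IsPartition m l) (γ-sum w) part)))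

  perm-char-span : (X : GSet n) → ∀ p → GSet.Invariant X p → YoungSpan n (GSet.perm-char X p)
  perm-char-span X p inv = integral⇒span
    (record { ext = GSet.perm-char-ext X p ; conj-inv = GSet.perm-char-conj X p inv })
    (λ γ → let W = Coloured.words (length γ) n
               h = Coloured.has (length γ) (colours γ)
               N , e = GSet.burnside (×-GSet X W) (λ (x , w) → p x ∧ h w)
                         (λ g (x , w) → cong₂ _∧_ (inv g x) (Coloured.has-invariant (length γ) n (colours γ) g w))
           in N , trans (∑ᴳ-cong (λ g → sym (perm-char-× X W p h g))) e)

-- Set partitions

⇒ᵇ-intro : ∀ {a b} → (a ≡ true → b ≡ true) → (a ⇒ᵇ b) ≡ true
⇒ᵇ-intro {false} h = refl
⇒ᵇ-intro {true} h = h refl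

⇒ᵇ-elim : ∀ {a b} → (a ⇒ᵇ b) ≡ true → a ≡ true → b ≡ true
⇒ᵇ-elim {true} e _ = e

≡Bᵇ-intro : ∀ {a b} → a ≡ b → (a ≡Bᵇ b) ≡ true
≡Bᵇ-intro {true} refl = refl
≡Bᵇ-intro {false} refl = refl

≡Bᵇ-elim : ∀ {a b} → (a ≡Bᵇ b) ≡ true → a ≡ b
≡Bᵇ-elim {true} e = sym e
≡Bᵇ-elim {false} {false} e = refl

allB² : ∀ {n} (p : Fin n → Fin n → Bool) → (∀ x y → p x y ≡ true) → allB (λ x → allB (λ y → p x y)) ≡ true
allB² p h = allB-complete _ (λ x → allB-complete _ (h x))

allB²⁻¹ : ∀ {n} (p : Fin n → Fin n → Bool) → allB (λ x → allB (λ y → p x y)) ≡ true → ∀ x y → p x y ≡ true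
allB²⁻¹ p e x y = allB-sound (p x) (allB-sound (λ x → allB (p x)) e x) y

rel-ext : ∀ {n} {π σ : Rel n} → (∀ x y → rel π x y ≡ rel σ x y) → π ≡ σ
rel-ext {π = π} {σ} h = trans (sym (Vₚ.tabulate∘lookup π)) (trans (Vₚ.tabulate-cong (λ x →
  trans (sym (Vₚ.tabulate∘lookup (lookup π x))) (trans (Vₚ.tabulate-cong (h x)) (Vₚ.tabulate∘lookup (lookup σ x))))) (Vₚ.tabulate∘lookup σ))

mkRel : ∀ {n} → (Fin n → Fin n → Bool) → Rel n
mkRel f = tabulate (λ x → tabulate (f x))

rel-mkRel : ∀ {n} (f : Fin n → Fin n → Bool) x y → rel (mkRel f) x y ≡ f x y
rel-mkRel f x y = trans (cong (λ v → lookup v y) (Vₚ.lookup∘tabulate (λ x → tabulate (f x)) x)) (Vₚ.lookup∘tabulate (f x) y)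

record Equiv {n} (π : Rel n) : Set where
  field
    reflx : ∀ x → rel π x x ≡ true
    symm  : ∀ {x y} → rel π x y ≡ true → rel π y x ≡ true
    trns  : ∀ {x y z} → rel π x y ≡ true → rel π y z ≡ true → rel π x z ≡ true

isEquiv-sound : ∀ {n} (π : Rel n) → isEquivᵇ π ≡ true → Equiv π
isEquiv-sound π e = record
  { reflx = allB-sound _ (proj₁ (∧-true e))
  ; symm = λ {x} {y} r → ⇒ᵇ-elim (allB²⁻¹ (λ x y → rel π x y ⇒ᵇ rel π y x) (proj₁ (∧-true e′)) x y) r
  ; trns = λ {x} {y} {z} r s → ⇒ᵇ-elim (allB-sound (λ z → (rel π x y ∧ rel π y z) ⇒ᵇ rel π x z)
      (allB²⁻¹ (λ x y → allB (λ z → (rel π x y ∧ rel π y z) ⇒ᵇ rel π x z)) (proj₂ (∧-true {allB (λ x → allB (λ y → rel π x y ⇒ᵇ rel π y x))} e′)) x y) z) (true-∧ r s) }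
  where e′ = proj₂ (∧-true {allB (λ x → rel π x x)} e)

isEquiv-complete : ∀ {n} {π : Rel n} → Equiv π → isEquivᵇ π ≡ true
isEquiv-complete {π = π} E = true-∧ (allB-complete (λ x → rel π x x) reflx)
    (true-∧ (allB² (λ x y → rel π x y ⇒ᵇ rel π y x) (λ x y → ⇒ᵇ-intro {rel π x y} {rel π y x} symm))
      (allB² (λ x y → allB (λ z → (rel π x y ∧ rel π y z) ⇒ᵇ rel π x z))
        (λ x y → allB-complete (λ z → (rel π x y ∧ rel π y z) ⇒ᵇ rel π x z)
          (λ z → ⇒ᵇ-intro {rel π x y ∧ rel π y z} {rel π x z} (λ e → trns (proj₁ (∧-true e)) (proj₂ (∧-true {rel π x y} e)))))))
  where open Equiv E

≤Π-sound : ∀ {n} {π σ : Rel n} → (π ≤Πᵇ σ) ≡ true → ∀ {x y} → rel π x y ≡ true → rel σ x y ≡ true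
≤Π-sound {π = π} {σ} e {x} {y} = ⇒ᵇ-elim (allB²⁻¹ (λ x y → rel π x y ⇒ᵇ rel σ x y) e x y)

≤Π-complete : ∀ {n} {π σ : Rel n} → (∀ {x y} → rel π x y ≡ true → rel σ x y ≡ true) → (π ≤Πᵇ σ) ≡ true
≤Π-complete {π = π} {σ} h = allB² (λ x y → rel π x y ⇒ᵇ rel σ x y) (λ x y → ⇒ᵇ-intro {rel π x y} {rel σ x y} h)

Rel-finite : ∀ n → Finite (Rel n)
Rel-finite n = Vec-finite (Vec-finite Bool-finite n) n

relations : ∀ n → GSet n
relations n = record
  { X = Rel n
  ; finite = Rel-finite n
  ; act = act
  ; act-≈ = λ {g} {h} e π → rel-ext (λ x y → trans (rel-act g π x y) (trans (cong₂ (rel π) (e x) (e y)) (sym (rel-act h π x y))))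
  ; act-id = λ π → rel-ext (rel-act P.id π)
  ; act-∘ = λ g h π → rel-ext (λ x y → trans (rel-act g (act h π) x y) (trans (rel-act h π (g ⟨$⟩ʳ x) (g ⟨$⟩ʳ y)) (sym (rel-act (g ∘ₚ h) π x y))))
  }
  where
  act : Permutation′ n → Rel n → Rel n
  act g π = mkRel (λ x y → rel π (g ⟨$⟩ʳ x) (g ⟨$⟩ʳ y))
  rel-act : ∀ g π x y → rel (act g π) x y ≡ rel π (g ⟨$⟩ʳ x) (g ⟨$⟩ʳ y)
  rel-act g π = rel-mkRel _

actΠ : ∀ {n} → Permutation′ n → Rel n → Rel n
actΠ {n} = GSet.act (relations n)

rel-actΠ : ∀ {n} (g : Permutation′ n) π x y → rel (actΠ g π) x y ≡ rel π (g ⟨$⟩ʳ x) (g ⟨$⟩ʳ y)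
rel-actΠ g π = rel-mkRel _

rel-bottom : ∀ {n} (x y : Fin n) → rel (bottom n) x y ≡ ⌊ x Fₚ.≟ y ⌋
rel-bottom = rel-mkRel (λ x y → ⌊ x Fₚ.≟ y ⌋)

bottom-Equiv : ∀ n → Equiv (bottom n)
bottom-Equiv n = record
  { reflx = λ x → trans (rel-bottom x x) (⌊⌋-true (x Fₚ.≟ x) refl)
  ; symm = λ {x} {y} e → trans (rel-bottom y x) (⌊⌋-true (y Fₚ.≟ x) (sym (bottom-≡ e)))
  ; trns = λ {x} {y} {z} e e′ → trans (rel-bottom x z) (⌊⌋-true (x Fₚ.≟ z) (trans (bottom-≡ e) (bottom-≡ e′))) }
  where
  bottom-≡ : ∀ {x y : Fin n} → rel (bottom n) x y ≡ true → x ≡ y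
  bottom-≡ {x} {y} e = true-⌊⌋ (x Fₚ.≟ y) (trans (sym (rel-bottom x y)) e)

fixedᵇ≡fix : ∀ {n} g (π : Rel n) → fixedᵇ g π ≡ GSet.fix (relations n) g π
fixedᵇ≡fix {n} g π = bool-ext
  (λ e → ⌊⌋-true (GSet._≟ˣ_ (relations n) (actΠ g π) π) (rel-ext (λ x y → trans (rel-actΠ g π x y) (sym (≡Bᵇ-elim (allB²⁻¹ (λ x y → rel π x y ≡Bᵇ rel π (g ⟨$⟩ʳ x) (g ⟨$⟩ʳ y)) e x y))))))
  (λ e → allB² _ (λ x y → ≡Bᵇ-intro (trans (cong (λ σ → rel σ x y) (sym (GSet.==-sound (relations n) {actΠ g π} {π} e))) (rel-actΠ g π x y))))

-- Block representatives

-- The test counted by `numBlocks`: x is the least point of its block.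
isRep : ∀ {n} → Rel n → Fin n → Bool
isRep π x = allB (λ y → (toℕ y <ᵇ toℕ x) ⇒ᵇ not (rel π x y))

find-minimal : ∀ {n} (p : Fin n → Bool) {y} → find p ≡ just y → ∀ z → toℕ z < toℕ y → p z ≡ false
find-minimal {suc n} p e z lt with p zero in p0
find-minimal {suc n} p refl z () | true
find-minimal {suc n} p e zero lt | false = p0
find-minimal {suc n} p e (suc z) lt | false with find (p ∘ suc) in eq
find-minimal {suc n} p refl (suc z) (s≤s lt) | false | just y = find-minimal (p ∘ suc) eq z lt

module _ {n} {π : Rel n} (E : Equiv π) where

  open Equiv E

  isRep-minimal : ∀ {x y} → isRep π x ≡ true → rel π x y ≡ true → toℕ x ≤ toℕ y
  isRep-minimal {x} {y} e r with toℕ y ℕ.<? toℕ x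
  ... | no ¬lt = ℕₚ.≮⇒≥ ¬lt
  ... | yes lt = contradiction (trans (sym (cong not r)) (⇒ᵇ-elim (allB-sound (λ y → (toℕ y <ᵇ toℕ x) ⇒ᵇ not (rel π x y)) e y) (<ᵇ-true lt))) λ ()

  isRep-unique : ∀ {x y} → isRep π x ≡ true → isRep π y ≡ true → rel π x y ≡ true → x ≡ y
  isRep-unique p q r = Fₚ.toℕ-injective (ℕₚ.≤-antisym (isRep-minimal p r) (isRep-minimal q (symm r)))

  rep : ∀ x → ∃[ y ] isRep π y ≡ true × rel π x y ≡ true
  rep x with find-spec (rel π x) x (reflx x)
  ... | y , f , r = y , allB-complete _ (λ z → ⇒ᵇ-intro (λ lt → cong not (least z (ℕₚ.<ᵇ⇒< (toℕ z) (toℕ y) (subst T (sym lt) tt))))) , r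
    where
    least : ∀ z → toℕ z < toℕ y → rel π y z ≡ false
    least z lt with rel π y z in e
    ... | false = refl
    ... | true = trans (sym (trns r e)) (find-minimal (rel π x) f z lt)

  one-rep : ∀ x → ∑ (allFin n) (λ y → ⟦ isRep π y ⟧ * ⟦ rel π x y ⟧) ≡ 1ℤ
  one-rep x with rep x
  ... | y₀ , p₀ , r₀ = trans (∑-cong (allFin n) (λ y → trans (sym (⟦∧⟧ (isRep π y) (rel π x y))) (cong ⟦_⟧ (bool-ext
      (λ e → ⌊⌋-true (y Fₚ.≟ y₀) (isRep-unique (proj₁ (∧-true e)) p₀ (trns (symm (proj₂ (∧-true {isRep π y} e))) r₀)))
      (λ e → subst (λ z → (isRep π z ∧ rel π x z) ≡ true) (sym (true-⌊⌋ (y Fₚ.≟ y₀) e)) (true-∧ p₀ r₀))))))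
    (Finite.once (Fin-finite n) y₀)

  one-rep′ : ∀ x → ∑ (allFin n) (λ y → ⟦ isRep π y ⟧ * ⟦ rel π y x ⟧) ≡ 1ℤ
  one-rep′ x = trans (∑-cong (allFin n) (λ y → cong (λ b → ⟦ isRep π y ⟧ * ⟦ b ⟧) (bool-ext symm symm))) (one-rep x)

numBlocks-∑ : ∀ {n} (π : Rel n) → + numBlocks π ≡ ∑ (allFin n) (λ x → ⟦ isRep π x ⟧)
numBlocks-∑ {n} π = ∑-count (isRep π) (allFin n)

act-Equiv : ∀ {n} g {π : Rel n} → Equiv π → Equiv (actΠ g π)
act-Equiv g {π} E = record
  { reflx = λ x → trans (rel-actΠ g π x x) (reflx _)
  ; symm = λ {x} {y} e → trans (rel-actΠ g π y x) (symm (trans (sym (rel-actΠ g π x y)) e))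
  ; trns = λ {x} {y} {z} e e′ → trans (rel-actΠ g π x z) (trns (trans (sym (rel-actΠ g π x y)) e) (trans (sym (rel-actΠ g π y z)) e′)) }
  where open Equiv E

-- A permutation need not carry least points to least points, so representatives are matched through
-- the blocks that contain them: each one on either side is related to exactly one on the other.
numBlocks-act : ∀ {n} g {π : Rel n} → Equiv π → numBlocks (actΠ g π) ≡ numBlocks π
numBlocks-act {n} g {π} E = ℤₚ.+-injective (trans (numBlocks-∑ (actΠ g π)) (trans
  (∑-double (allFin n) (allFin n) (isRep (actΠ g π)) (isRep π) (λ x y → rel π (g ⟨$⟩ʳ x) y)
    (λ x _ → one-rep E (g ⟨$⟩ʳ x))
    (λ y _ → trans (∑-cong (allFin n) (λ x → cong (λ b → ⟦ isRep (actΠ g π) x ⟧ * ⟦ b ⟧)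
        (trans (cong (rel π (g ⟨$⟩ʳ x)) (sym (P.inverseʳ g))) (sym (rel-actΠ g π x (g ⟨$⟩ˡ y))))))
      (one-rep′ (act-Equiv g E) (g ⟨$⟩ˡ y))))
  (sym (numBlocks-∑ π))))

-- Points in non-singleton blocks

touches : ∀ {n} → Rel n → Fin n → Bool
touches π x = not (allB (λ y → rel π x y ⇒ᵇ ⌊ x Fₚ.≟ y ⌋))

touches-intro : ∀ {n} (π : Rel n) {x y} → rel π x y ≡ true → x ≢ y → touches π x ≡ true
touches-intro π {x} {y} r ne with allB (λ y → rel π x y ⇒ᵇ ⌊ x Fₚ.≟ y ⌋) in e
... | false = refl
... | true = contradiction (true-⌊⌋ (x Fₚ.≟ y) (⇒ᵇ-elim (allB-sound (λ y → rel π x y ⇒ᵇ ⌊ x Fₚ.≟ y ⌋) e y) r)) ne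

touches-elim : ∀ {n} (π : Rel n) {x} → touches π x ≡ true → ∃[ y ] rel π x y ≡ true × x ≢ y
touches-elim {n} π {x} t with Finite.any? (Fin-finite n) (λ y → rel π x y ∧ not ⌊ x Fₚ.≟ y ⌋)
... | yes (y , e) = y , proj₁ (∧-true e) , (λ eq → contradiction (trans (sym (proj₂ (∧-true {rel π x y} e))) (cong not (⌊⌋-true (x Fₚ.≟ y) eq))) λ ())
... | no ¬y = contradiction (trans (sym t) (cong not (allB-complete (λ y → rel π x y ⇒ᵇ ⌊ x Fₚ.≟ y ⌋) (λ y → ⇒ᵇ-intro (same y))))) λ ()
  where
  same : ∀ y → rel π x y ≡ true → ⌊ x Fₚ.≟ y ⌋ ≡ true
  same y r with ⌊ x Fₚ.≟ y ⌋ in e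
  ... | true = refl
  ... | false = contradiction (y , true-∧ r (cong not e)) ¬y

⟦not⟧ : ∀ b → ⟦ b ⟧ + ⟦ not b ⟧ ≡ 1ℤ
⟦not⟧ true = refl
⟦not⟧ false = refl

numBlocks≤n : ∀ {n} (π : Rel n) → numBlocks π ≤ n
numBlocks≤n {n} π = ℤₚ.drop‿+≤+ (subst₂ ℤ._≤_ (sym (numBlocks-∑ π)) (∑-one n) (∑-mono (allFin n) (λ x → le (isRep π x))))
  where le : ∀ b → ⟦ b ⟧ ℤ.≤ 1ℤ
        le true = ℤₚ.≤-refl
        le false = ℤ.+≤+ z≤n

nonreps : ∀ {n} (π : Rel n) → ∑ (allFin n) (λ x → ⟦ not (isRep π x) ⟧) ≡ + rank π
nonreps {n} π = +-cancelˡ (+ numBlocks π) (begin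
  + numBlocks π + ∑ (allFin n) (λ x → ⟦ not (isRep π x) ⟧)
    ≡⟨ cong (_+ ∑ (allFin n) (λ x → ⟦ not (isRep π x) ⟧)) (numBlocks-∑ π) ⟩
  ∑ (allFin n) (λ x → ⟦ isRep π x ⟧) + ∑ (allFin n) (λ x → ⟦ not (isRep π x) ⟧)
    ≡⟨ sym (∑-+ (allFin n) _ _) ⟩
  ∑ (allFin n) (λ x → ⟦ isRep π x ⟧ + ⟦ not (isRep π x) ⟧)
    ≡⟨ trans (∑-cong (allFin n) (λ x → ⟦not⟧ (isRep π x))) (∑-one n) ⟩
  + n
    ≡⟨ cong +_ (sym (ℕₚ.m+[n∸m]≡n (numBlocks≤n π))) ⟩
  + (numBlocks π ℕ.+ rank π)
    ≡⟨ ℤₚ.pos-+ (numBlocks π) (rank π) ⟩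
  + numBlocks π + + rank π ∎)

-- Every non-singleton block contains a non-representative, so at most 2·rank points lie in such blocks.
touches-bound : ∀ {n} {π : Rel n} → Equiv π → ∑ (allFin n) (λ x → ⟦ touches π x ⟧) ℤ.≤ + (2 ℕ.* rank π)
touches-bound {n} {π} E = subst (∑ (allFin n) (λ x → ⟦ touches π x ⟧) ℤ.≤_) total
  (ℤₚ.≤-trans (∑-mono (allFin n) {g = λ x → ⟦ not (isRep π x) ⟧ + ⟦ isRep π x ⟧ * mates x} bound) (ℤₚ.≤-reflexive (trans (∑-+ (allFin n) _ _) (cong (_+_ (∑ (allFin n) (λ x → ⟦ not (isRep π x) ⟧))) swapped))))
  where
  open Equiv E
  -- The non-representatives in the block of x. A representative of a non-singleton block has at
  -- least one, and over all representatives each is counted once.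
  mates : Fin n → ℤ
  mates x = ∑ (allFin n) (λ y → ⟦ not (isRep π y) ⟧ * ⟦ rel π y x ⟧)
  product-nonneg : ∀ a b → 0ℤ ℤ.≤ ⟦ a ⟧ * ⟦ b ⟧
  product-nonneg a b = subst (0ℤ ℤ.≤_) (⟦∧⟧ a b) (⟦⟧-nonneg (a ∧ b))
  mates-pos : ∀ x → touches π x ≡ true → isRep π x ≡ true → 1ℤ ℤ.≤ mates x
  mates-pos x t p with touches-elim π t
  ... | y , r , ne = subst (ℤ._≤ mates x) (trans (∑-cong (allFin n) (λ z → cong (⟦ z FF.== y ⟧ *_) refl)) (FF.∑-pick y (λ _ → 1ℤ)))
      (∑-mono (allFin n) {λ z → ⟦ z FF.== y ⟧ * 1ℤ} le)
    where
    module FF = Finite (Fin-finite n)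
    y-nonrep : isRep π y ≡ false
    y-nonrep with isRep π y in q
    ... | false = refl
    ... | true = contradiction (isRep-unique E p q r) ne
    le : ∀ z → ⟦ z FF.== y ⟧ * 1ℤ ℤ.≤ ⟦ not (isRep π z) ⟧ * ⟦ rel π z x ⟧
    le z with z Fₚ.≟ y
    ... | no _ = product-nonneg (not (isRep π z)) (rel π z x)
    ... | yes refl = ℤₚ.≤-reflexive (sym (cong₂ (λ a b → ⟦ not a ⟧ * ⟦ b ⟧) y-nonrep (symm r)))
  bound : ∀ x → ⟦ touches π x ⟧ ℤ.≤ ⟦ not (isRep π x) ⟧ + ⟦ isRep π x ⟧ * mates x
  bound x with touches π x in t | isRep π x in p
  ... | true | true = subst (1ℤ ℤ.≤_) (sym (trans (ℤₚ.+-identityˡ _) (ℤₚ.*-identityˡ (mates x)))) (mates-pos x t p)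
  ... | true | false = ℤₚ.≤-refl
  ... | false | true = subst (0ℤ ℤ.≤_) (sym (trans (ℤₚ.+-identityˡ _) (ℤₚ.*-identityˡ (mates x)))) (∑-nonneg (allFin n) (λ y → product-nonneg (not (isRep π y)) (rel π y x)))
  ... | false | false = ℤ.+≤+ z≤n
  swapped : ∑ (allFin n) (λ x → ⟦ isRep π x ⟧ * mates x) ≡ ∑ (allFin n) (λ y → ⟦ not (isRep π y) ⟧)
  swapped = begin
    ∑ (allFin n) (λ x → ⟦ isRep π x ⟧ * mates x)
      ≡⟨ ∑-cong (allFin n) (λ x → sym (∑-*ˡ (allFin n) ⟦ isRep π x ⟧ _)) ⟩
    ∑ (allFin n) (λ x → ∑ (allFin n) (λ y → ⟦ isRep π x ⟧ * (⟦ not (isRep π y) ⟧ * ⟦ rel π y x ⟧)))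
      ≡⟨ ∑-swap (allFin n) (allFin n) _ ⟩
    ∑ (allFin n) (λ y → ∑ (allFin n) (λ x → ⟦ isRep π x ⟧ * (⟦ not (isRep π y) ⟧ * ⟦ rel π y x ⟧)))
      ≡⟨ ∑-cong (allFin n) (λ y → trans (∑-cong (allFin n) (λ x → *-swap ⟦ isRep π x ⟧ ⟦ not (isRep π y) ⟧ ⟦ rel π y x ⟧)) (trans (∑-*ˡ (allFin n) ⟦ not (isRep π y) ⟧ _)
           (trans (cong (⟦ not (isRep π y) ⟧ *_) (one-rep E y)) (ℤₚ.*-identityʳ ⟦ not (isRep π y) ⟧)))) ⟩
    ∑ (allFin n) (λ y → ⟦ not (isRep π y) ⟧) ∎
  total : ∑ (allFin n) (λ x → ⟦ not (isRep π x) ⟧) + ∑ (allFin n) (λ x → ⟦ not (isRep π x) ⟧) ≡ + (2 ℕ.* rank π)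
  total = trans (cong₂ _+_ (nonreps π) (nonreps π)) (trans (sym (ℤₚ.pos-+ (rank π) (rank π))) (cong +_ (cong (rank π ℕ.+_) (sym (ℕₚ.+-identityʳ (rank π))))))

rank-bottom : ∀ n → rank (bottom n) ≡ 0
rank-bottom n = ℤₚ.+-injective (trans (sym (nonreps (bottom n))) (∑-zero (allFin n) (λ x → cong (λ b → ⟦ not b ⟧)
  (allB-complete (λ y → (toℕ y <ᵇ toℕ x) ⇒ᵇ not (rel (bottom n) x y)) (λ y → ⇒ᵇ-intro (λ lt → cong not (trans (rel-bottom x y) (apart x y lt))))))))
  where
  apart : ∀ (x y : Fin n) → (toℕ y <ᵇ toℕ x) ≡ true → ⌊ x Fₚ.≟ y ⌋ ≡ false
  apart x y lt with x Fₚ.≟ y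
  ... | no _ = refl
  ... | yes refl = contradiction (ℕₚ.<ᵇ⇒< (toℕ x) (toℕ x) (subst T (sym lt) tt)) (ℕₚ.<-irrefl refl)

-- Subsets and their order embeddings

size : ∀ {n} → Vec Bool n → ℕ
size [] = 0
size (true ∷ A) = suc (size A)
size (false ∷ A) = size A

emb : ∀ {n} (A : Vec Bool n) → Fin (size A) → Fin n
emb (true ∷ A) zero = zero
emb (true ∷ A) (suc a) = suc (emb A a)
emb (false ∷ A) a = suc (emb A a)

pos : ∀ {n} (A : Vec Bool n) → Fin n → Maybe (Fin (size A))
pos (true ∷ A) zero = just zero
pos (true ∷ A) (suc x) = Maybe.map suc (pos A x)
pos (false ∷ A) zero = nothing
pos (false ∷ A) (suc x) = pos A x

pos-emb : ∀ {n} (A : Vec Bool n) a → pos A (emb A a) ≡ just a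
pos-emb (true ∷ A) zero = refl
pos-emb (true ∷ A) (suc a) rewrite pos-emb A a = refl
pos-emb (false ∷ A) a = pos-emb A a

emb-pos : ∀ {n} (A : Vec Bool n) x {a} → pos A x ≡ just a → emb A a ≡ x
emb-pos (true ∷ A) zero refl = refl
emb-pos (true ∷ A) (suc x) e with pos A x in eq
emb-pos (true ∷ A) (suc x) refl | just a = cong suc (emb-pos A x eq)
emb-pos (false ∷ A) (suc x) e = cong suc (emb-pos A x e)

pos-∈ : ∀ {n} (A : Vec Bool n) x → lookup A x ≡ true → ∃[ a ] pos A x ≡ just a
pos-∈ (true ∷ A) zero e = zero , refl
pos-∈ (true ∷ A) (suc x) e with pos-∈ A x e
... | a , eq rewrite eq = suc a , refl
pos-∈ (false ∷ A) (suc x) e = pos-∈ A x e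

pos-∉ : ∀ {n} (A : Vec Bool n) x → lookup A x ≡ false → pos A x ≡ nothing
pos-∉ (true ∷ A) (suc x) e rewrite pos-∉ A x e = refl
pos-∉ (false ∷ A) zero e = refl
pos-∉ (false ∷ A) (suc x) e = pos-∉ A x e

emb-surjective : ∀ {n} (A : Vec Bool n) x → lookup A x ≡ true → ∃[ a ] emb A a ≡ x
emb-surjective A x e with pos-∈ A x e
... | a , eq = a , emb-pos A x eq

emb-injective : ∀ {n} (A : Vec Bool n) {a b} → emb A a ≡ emb A b → a ≡ b
emb-injective A {a} {b} e with trans (sym (pos-emb A a)) (trans (cong (pos A) e) (pos-emb A b))
... | refl = refl

lookup-emb : ∀ {n} (A : Vec Bool n) a → lookup A (emb A a) ≡ true
lookup-emb (true ∷ A) zero = refl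
lookup-emb (true ∷ A) (suc a) = lookup-emb A a
lookup-emb (false ∷ A) a = lookup-emb A a

∑-emb : ∀ {n} (A : Vec Bool n) (f : Fin n → ℤ) → ∑ (allFin n) (λ x → ⟦ lookup A x ⟧ * f x) ≡ ∑ (allFin (size A)) (λ a → f (emb A a))
∑-emb [] f = refl
∑-emb {suc n} (true ∷ A) f = trans (∑-allFin n (λ x → ⟦ lookup (true ∷ A) x ⟧ * f x)) (trans (cong₂ _+_ (ℤₚ.*-identityˡ (f zero)) (∑-emb A (f ∘ suc))) (sym (∑-allFin (size A) (f ∘ emb (true ∷ A)))))
∑-emb {suc n} (false ∷ A) f = trans (∑-allFin n (λ x → ⟦ lookup (false ∷ A) x ⟧ * f x)) (trans (ℤₚ.+-identityˡ _) (∑-emb A (f ∘ suc)))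

-- Chains of set partitions

Vec-GSet : ∀ {k} → GSet k → ℕ → GSet k
Vec-GSet G t = record
  { X = Vec X t
  ; finite = Vec-finite finite t
  ; act = λ g → V.map (act g)
  ; act-≈ = λ e c → Vₚ.map-cong (act-≈ e) c
  ; act-id = λ c → trans (Vₚ.map-cong act-id c) (Vₚ.map-id c)
  ; act-∘ = λ g h c → trans (sym (Vₚ.map-∘ (act g) (act h) c)) (Vₚ.map-cong (act-∘ g h) c)
  }
  where open GSet G

chains : ℕ → ∀ n → GSet n
chains t n = Vec-GSet (relations n) t

Valid : ∀ {n} → Rel n → (T : List ℕ) → Vec (Rel n) (length T) → Set
Valid prev [] [] = ⊤
Valid prev (t ∷ T) (π ∷ c) = Equiv π × rank π ≡ t × (∀ x y → rel prev x y ≡ true → rel π x y ≡ true) × Valid π T c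

valid : ∀ {n} → Rel n → (T : List ℕ) → Vec (Rel n) (length T) → Bool
valid prev [] [] = true
valid prev (t ∷ T) (π ∷ c) = isEquivᵇ π ∧ ((rank π ≡ᵇ t) ∧ (prev ≤Πᵇ π)) ∧ valid π T c

valid-sound : ∀ {n} (prev : Rel n) T c → valid prev T c ≡ true → Valid prev T c
valid-sound prev [] [] e = tt
valid-sound prev (t ∷ T) (π ∷ c) e = isEquiv-sound π (proj₁ (∧-true e)) ,
  ≡ᵇ-sound (proj₁ (∧-true (proj₁ (∧-true e₂)))) ,
  (λ x y → ≤Π-sound {π = prev} {π} (proj₂ (∧-true {rank π ≡ᵇ t} (proj₁ (∧-true e₂))))) ,
  valid-sound π T c (proj₂ (∧-true {(rank π ≡ᵇ t) ∧ (prev ≤Πᵇ π)} e₂))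
  where
  e₂ = proj₂ (∧-true {isEquivᵇ π} e)

valid-complete : ∀ {n} (prev : Rel n) T c → Valid prev T c → valid prev T c ≡ true
valid-complete prev [] [] _ = refl
valid-complete prev (t ∷ T) (π ∷ c) (E , r , le , v) =
  true-∧ (isEquiv-complete E) (true-∧ (true-∧ (≡ᵇ-true r) (≤Π-complete {π = prev} {π} (λ {x} {y} → le x y))) (valid-complete π T c v))

fix-∷ : ∀ {k} (G : GSet k) {t} g x (c : Vec (GSet.X G) t) → GSet.fix (Vec-GSet G (suc t)) g (x ∷ c) ≡ GSet.fix G g x ∧ GSet.fix (Vec-GSet G t) g c
fix-∷ G {t} g x c = bool-ext
  (λ e → let e′ = Vₚ.∷-injective (GSet.==-sound (Vec-GSet G (suc t)) {GSet.act (Vec-GSet G (suc t)) g (x ∷ c)} {x ∷ c} e) in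
         true-∧ (⌊⌋-true (GSet._≟ˣ_ G _ x) (proj₁ e′)) (⌊⌋-true (GSet._≟ˣ_ (Vec-GSet G t) _ c) (proj₂ e′)))
  (λ e → ⌊⌋-true (GSet._≟ˣ_ (Vec-GSet G (suc t)) _ (x ∷ c)) (cong₂ _∷_ (GSet.==-sound G (proj₁ (∧-true e)))
           (GSet.==-sound (Vec-GSet G t) {_} {c} (proj₂ (∧-true {GSet.fix G g x} e)))))

fixedChains-∑ : ∀ {n} (g : Permutation′ n) prev T →
  + fixedChains g prev T ≡ ∑ (elems (GSet.finite (chains (length T) n))) (λ c → ⟦ valid prev T c ⟧ * ⟦ GSet.fix (chains (length T) n) g c ⟧)
fixedChains-∑ g prev [] = refl
fixedChains-∑ {n} g prev (t ∷ T) = begin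
  + fixedChains g prev (t ∷ T)
    ≡⟨ ∑-sumℕ _ (SetPartitions n) ⟩
  ∑ (SetPartitions n) (λ π → + (if step π then fixedChains g π T else 0))
    ≡⟨ ∑-filter isEquivᵇ Π _ ⟩
  ∑ Π (λ π → ⟦ isEquivᵇ π ⟧ * + (if step π then fixedChains g π T else 0))
    ≡⟨ ∑-cong Π (λ π → trans (cong (⟦ isEquivᵇ π ⟧ *_) (expand π)) (trans (sym (∑-*ˡ C ⟦ isEquivᵇ π ⟧ _)) (∑-cong C (λ c → regroup π c)))) ⟩
  ∑ Π (λ π → ∑ C (λ c → ⟦ valid prev (t ∷ T) (π ∷ c) ⟧ * ⟦ GSet.fix (chains (suc (length T)) n) g (π ∷ c) ⟧))
    ≡⟨ sym (∑-allVec Π (length T) _) ⟩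
  ∑ (elems (GSet.finite (chains (suc (length T)) n))) (λ c → ⟦ valid prev (t ∷ T) c ⟧ * ⟦ GSet.fix (chains (suc (length T)) n) g c ⟧) ∎
  where
  Π = elems (Rel-finite n)
  C = elems (GSet.finite (chains (length T) n))
  step : Rel n → Bool
  step π = (rank π ≡ᵇ t) ∧ (prev ≤Πᵇ π) ∧ fixedᵇ g π
  if-⟦⟧ : ∀ b m → + (if b then m else 0) ≡ ⟦ b ⟧ * + m
  if-⟦⟧ true m = sym (ℤₚ.*-identityˡ (+ m))
  if-⟦⟧ false m = refl
  expand : ∀ π → + (if step π then fixedChains g π T else 0) ≡ ∑ C (λ c → ⟦ step π ⟧ * (⟦ valid π T c ⟧ * ⟦ GSet.fix (chains (length T) n) g c ⟧))
  expand π = trans (if-⟦⟧ (step π) (fixedChains g π T)) (trans (cong (⟦ step π ⟧ *_) (fixedChains-∑ g π T)) (sym (∑-*ˡ C ⟦ step π ⟧ _)))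
  ring : ∀ e r l f v w → e * ((r * (l * f)) * (v * w)) ≡ (e * ((r * l) * v)) * (f * w)
  ring = solve-∀
  regroup : ∀ π c → ⟦ isEquivᵇ π ⟧ * (⟦ step π ⟧ * (⟦ valid π T c ⟧ * ⟦ GSet.fix (chains (length T) n) g c ⟧)) ≡
    ⟦ valid prev (t ∷ T) (π ∷ c) ⟧ * ⟦ GSet.fix (chains (suc (length T)) n) g (π ∷ c) ⟧
  regroup π c = begin
    ⟦ isEquivᵇ π ⟧ * (⟦ step π ⟧ * (v * w))
      ≡⟨ cong (λ z → ⟦ isEquivᵇ π ⟧ * (z * (v * w))) (trans (⟦∧⟧ (rank π ≡ᵇ t) ((prev ≤Πᵇ π) ∧ fixedᵇ g π)) (cong (⟦ rank π ≡ᵇ t ⟧ *_) (⟦∧⟧ (prev ≤Πᵇ π) (fixedᵇ g π)))) ⟩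
    ⟦ isEquivᵇ π ⟧ * ((⟦ rank π ≡ᵇ t ⟧ * (⟦ prev ≤Πᵇ π ⟧ * ⟦ fixedᵇ g π ⟧)) * (v * w))
      ≡⟨ ring ⟦ isEquivᵇ π ⟧ ⟦ rank π ≡ᵇ t ⟧ ⟦ prev ≤Πᵇ π ⟧ ⟦ fixedᵇ g π ⟧ v w ⟩
    (⟦ isEquivᵇ π ⟧ * ((⟦ rank π ≡ᵇ t ⟧ * ⟦ prev ≤Πᵇ π ⟧) * v)) * (⟦ fixedᵇ g π ⟧ * w)
      ≡⟨ cong₂ _*_ (sym (trans (⟦∧⟧ (isEquivᵇ π) _) (cong (⟦ isEquivᵇ π ⟧ *_) (trans (⟦∧⟧ ((rank π ≡ᵇ t) ∧ (prev ≤Πᵇ π)) (valid π T c)) (cong (_* v) (⟦∧⟧ (rank π ≡ᵇ t) (prev ≤Πᵇ π)))))))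
           (trans (cong (λ b → ⟦ b ⟧ * w) (fixedᵇ≡fix g π)) (trans (sym (⟦∧⟧ (GSet.fix (relations n) g π) (GSet.fix (chains (length T) n) g c))) (cong ⟦_⟧ (sym (fix-∷ (relations n) g π c))))) ⟩
    ⟦ valid prev (t ∷ T) (π ∷ c) ⟧ * ⟦ GSet.fix (chains (suc (length T)) n) g (π ∷ c) ⟧ ∎
    where
    v = ⟦ valid π T c ⟧
    w = ⟦ GSet.fix (chains (length T) n) g c ⟧

supp : ∀ {n t} → Vec (Rel n) t → Fin n → Bool
supp [] x = false
supp (π ∷ c) x = touches π x ∨ supp c x

∨-true : ∀ {a b} → a ∨ b ≡ true → a ≡ true ⊎ b ≡ true
∨-true {true} _ = inj₁ refl
∨-true {false} e = inj₂ e

true-∨ˡ : ∀ {a b} → a ≡ true → a ∨ b ≡ true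
true-∨ˡ refl = refl

true-∨ʳ : ∀ {a b} → b ≡ true → a ∨ b ≡ true
true-∨ʳ {true} _ = refl
true-∨ʳ {false} e = e

touches-act : ∀ {n} g (π : Rel n) x → touches (actΠ g π) x ≡ touches π (g ⟨$⟩ʳ x)
touches-act g π x = bool-ext
  (λ e → let y , r , ne = touches-elim (actΠ g π) e in
         touches-intro π (trans (sym (rel-actΠ g π x y)) r) (λ eq → ne (trans (sym (P.inverseˡ g)) (trans (cong (g ⟨$⟩ˡ_) eq) (P.inverseˡ g)))))
  (λ e → let y , r , ne = touches-elim π e in
         touches-intro (actΠ g π) {x} {g ⟨$⟩ˡ y} (trans (rel-actΠ g π x (g ⟨$⟩ˡ y)) (trans (cong (rel π (g ⟨$⟩ʳ x)) (P.inverseʳ g)) r))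
           (λ eq → ne (trans (cong (g ⟨$⟩ʳ_) eq) (P.inverseʳ g))))

supp-act : ∀ {n t} g (c : Vec (Rel n) t) x → supp (V.map (actΠ g) c) x ≡ supp c (g ⟨$⟩ʳ x)
supp-act g [] x = refl
supp-act g (π ∷ c) x = cong₂ _∨_ (touches-act g π x) (supp-act g c x)

Valid-act : ∀ {n} g {prev : Rel n} T c → Valid prev T c → Valid (actΠ g prev) T (V.map (actΠ g) c)
Valid-act g [] [] _ = tt
Valid-act {n} g {prev} (t ∷ T) (π ∷ c) (E , r , le , v) = act-Equiv g E , trans (cong (n ∸_) (numBlocks-act g E)) r ,
  (λ x y e → trans (rel-actΠ g π x y) (le _ _ (trans (sym (rel-actΠ g prev x y)) e))) , Valid-act g T c v

act-bottom : ∀ {n} (g : Permutation′ n) → actΠ g (bottom n) ≡ bottom n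
act-bottom g = rel-ext (λ x y → trans (rel-actΠ g (bottom _) x y) (trans (rel-bottom (g ⟨$⟩ʳ x) (g ⟨$⟩ʳ y)) (trans
  (⌊⌋-cong (g ⟨$⟩ʳ x Fₚ.≟ g ⟨$⟩ʳ y) (x Fₚ.≟ y) (λ e → trans (sym (P.inverseˡ g)) (trans (cong (g ⟨$⟩ˡ_) e) (P.inverseˡ g))) (cong (g ⟨$⟩ʳ_)))
  (sym (rel-bottom x y)))))

valid-act : ∀ {n} g T (c : Vec (Rel n) (length T)) → valid (bottom n) T (V.map (actΠ g) c) ≡ valid (bottom n) T c
valid-act {n} g T c = bool-ext
  (λ e → valid-complete (bottom n) T c (subst₂ (λ p c → Valid p T c) (act-bottom (P.flip g)) (GSet.act-flip (chains (length T) n) g refl)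
           (Valid-act (P.flip g) T _ (valid-sound (bottom n) T _ e))))
  (λ e → valid-complete (bottom n) T _ (subst (λ p → Valid p T (V.map (actΠ g) c)) (act-bottom g) (Valid-act g T c (valid-sound (bottom n) T c e))))

full : ∀ {n t} → Vec (Rel n) t → Bool
full c = allB (supp c)

full-act : ∀ {n t} g (c : Vec (Rel n) t) → full (V.map (actΠ g) c) ≡ full c
full-act g c = bool-ext
  (λ e → allB-complete (supp c) (λ x → trans (cong (supp c) (sym (P.inverseʳ g))) (trans (sym (supp-act g c (g ⟨$⟩ˡ x))) (allB-sound _ e (g ⟨$⟩ˡ x)))))
  (λ e → allB-complete _ (λ x → trans (supp-act g c x) (allB-sound (supp c) e (g ⟨$⟩ʳ x))))

-- The character of V_k: chains on k points in which no point is a singleton in all members.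
fullChar : List ℕ → ∀ k → ClassFn k
fullChar T k = GSet.perm-char (chains (length T) k) (λ c → valid (bottom k) T c ∧ full c)

opaque
  fullChar-span : ∀ T k → YoungSpan k (fullChar T k)
  fullChar-span T k = perm-char-span (chains (length T) k) (λ c → valid (bottom k) T c ∧ full c) (λ g c → cong₂ _∧_ (valid-act g T c) (full-act g c))

-- Restriction of permutations and chains to a subset

module _ {n : ℕ} (g : Permutation′ n) (A : Vec Bool n) where

  Inv : Set
  Inv = ∀ x → lookup A (g ⟨$⟩ʳ x) ≡ lookup A x

  module _ (inv : Inv) where

    private
      inv⁻¹ : ∀ x → lookup A (g ⟨$⟩ˡ x) ≡ lookup A x
      inv⁻¹ x = trans (sym (inv (g ⟨$⟩ˡ x))) (cong (lookup A) (P.inverseʳ g))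
      forth : ∀ a → ∃[ b ] emb A b ≡ g ⟨$⟩ʳ emb A a
      forth a = emb-surjective A _ (trans (inv (emb A a)) (lookup-emb A a))
      back : ∀ a → ∃[ b ] emb A b ≡ g ⟨$⟩ˡ emb A a
      back a = emb-surjective A _ (trans (inv⁻¹ (emb A a)) (lookup-emb A a))

    restrictPerm : Permutation′ (size A)
    restrictPerm = P.permutation (λ a → proj₁ (forth a)) (λ a → proj₁ (back a))
      (λ a → emb-injective A (trans (proj₂ (forth (proj₁ (back a)))) (trans (cong (g ⟨$⟩ʳ_) (proj₂ (back a))) (P.inverseʳ g))))
      (λ a → emb-injective A (trans (proj₂ (back (proj₁ (forth a)))) (trans (cong (g ⟨$⟩ˡ_) (proj₂ (forth a))) (P.inverseˡ g))))

    emb-restrictPerm : ∀ a → emb A (restrictPerm ⟨$⟩ʳ a) ≡ g ⟨$⟩ʳ emb A a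
    emb-restrictPerm a = proj₂ (forth a)

  inv? : Dec Inv
  inv? = Fₚ.all? (λ x → lookup A (g ⟨$⟩ʳ x) Boolₚ.≟ lookup A x)

  restrictDec : Dec Inv → Permutation′ (size A)
  restrictDec (yes inv) = restrictPerm inv
  -- An arbitrary value, always multiplied by the indicator of invariance, which is 0 here.
  restrictDec (no _) = P.id

module Restriction {n : ℕ} (A : Vec Bool n) where

  k = size A
  ι = emb A

  -- All non-singleton blocks lie within A. Such partitions correspond to partitions of A, by
  -- deleting or adding singletons outside A.
  Inside : Rel n → Set
  Inside π = ∀ x y → rel π x y ≡ true → x ≡ y ⊎ (lookup A x ≡ true × lookup A y ≡ true)

  Insides : ∀ {t} → Vec (Rel n) t → Set
  Insides [] = ⊤
  Insides (π ∷ c) = Inside π × Insides c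

  restrict : Rel n → Rel k
  restrict π = mkRel (λ a b → rel π (ι a) (ι b))

  rel-restrict : ∀ π a b → rel (restrict π) a b ≡ rel π (ι a) (ι b)
  rel-restrict π = rel-mkRel _

  private
    ext : Rel k → Maybe (Fin k) → Maybe (Fin k) → Bool → Bool
    ext π (just a) (just b) d = rel π a b
    ext π _ _ d = d

  extend : Rel k → Rel n
  extend π = mkRel (λ x y → ext π (pos A x) (pos A y) ⌊ x Fₚ.≟ y ⌋)

  rel-extend : ∀ π a b → rel (extend π) (ι a) (ι b) ≡ rel π a b
  rel-extend π a b = trans (rel-mkRel _ (ι a) (ι b)) (cong₂ (λ p q → ext π p q ⌊ ι a Fₚ.≟ ι b ⌋) (pos-emb A a) (pos-emb A b))

  rel-extend-out : ∀ π x y → lookup A x ≡ false ⊎ lookup A y ≡ false → rel (extend π) x y ≡ ⌊ x Fₚ.≟ y ⌋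
  rel-extend-out π x y (inj₁ e) = trans (rel-mkRel _ x y) (cong (λ p → ext π p (pos A y) ⌊ x Fₚ.≟ y ⌋) (pos-∉ A x e))
  rel-extend-out π x y (inj₂ e) = trans (rel-mkRel _ x y) (trans (cong (λ p → ext π (pos A x) p ⌊ x Fₚ.≟ y ⌋) (pos-∉ A y e)) (lem (pos A x)))
    where lem : ∀ p → ext π p nothing ⌊ x Fₚ.≟ y ⌋ ≡ ⌊ x Fₚ.≟ y ⌋
          lem (just _) = refl
          lem nothing = refl

  data Position (x : Fin n) : Set where
    inside  : ∀ a → x ≡ ι a → Position x
    outside : lookup A x ≡ false → Position x

  position : ∀ x → Position x
  position x with lookup A x in e
  ... | true = inside (proj₁ (emb-surjective A x e)) (sym (proj₂ (emb-surjective A x e)))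
  ... | false = outside e

  restrict-extend : ∀ π → restrict (extend π) ≡ π
  restrict-extend π = rel-ext (λ a b → trans (rel-restrict (extend π) a b) (rel-extend π a b))

  extend-inside : ∀ π → Inside (extend π)
  extend-inside π x y r with position x | position y
  ... | inside a refl | inside b refl = inj₂ (lookup-emb A a , lookup-emb A b)
  ... | outside e | _ = inj₁ (true-⌊⌋ (x Fₚ.≟ y) (trans (sym (rel-extend-out π x y (inj₁ e))) r))
  ... | inside _ _ | outside e = inj₁ (true-⌊⌋ (x Fₚ.≟ y) (trans (sym (rel-extend-out π x y (inj₂ e))) r))

  extend-restrict : ∀ {π} → Equiv π → Inside π → extend (restrict π) ≡ π
  extend-restrict {π} E ins = rel-ext same
    where
    same-out : ∀ x y → lookup A x ≡ false ⊎ lookup A y ≡ false → ⌊ x Fₚ.≟ y ⌋ ≡ rel π x y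
    same-out x y out = bool-ext (λ e → subst (λ z → rel π x z ≡ true) (true-⌊⌋ (x Fₚ.≟ y) e) (Equiv.reflx E x)) (λ r → ⌊⌋-true (x Fₚ.≟ y) (eq r (ins x y r) out))
      where
      eq : rel π x y ≡ true → x ≡ y ⊎ (lookup A x ≡ true × lookup A y ≡ true) → lookup A x ≡ false ⊎ lookup A y ≡ false → x ≡ y
      eq r (inj₁ e) _ = e
      eq r (inj₂ (p , _)) (inj₁ q) = contradiction (trans (sym p) q) λ ()
      eq r (inj₂ (_ , p)) (inj₂ q) = contradiction (trans (sym p) q) λ ()
    same : ∀ x y → rel (extend (restrict π)) x y ≡ rel π x y
    same x y with position x | position y
    ... | inside a refl | inside b refl = trans (rel-extend (restrict π) a b) (rel-restrict π a b)
    ... | outside e | _ = trans (rel-extend-out (restrict π) x y (inj₁ e)) (same-out x y (inj₁ e))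
    ... | inside _ _ | outside e = trans (rel-extend-out (restrict π) x y (inj₂ e)) (same-out x y (inj₂ e))

  restrict-Equiv : ∀ {π} → Equiv π → Equiv (restrict π)
  restrict-Equiv {π} E = record
    { reflx = λ a → trans (rel-restrict π a a) (reflx (ι a))
    ; symm = λ {a} {b} e → trans (rel-restrict π b a) (symm (trans (sym (rel-restrict π a b)) e))
    ; trns = λ {a} {b} {c} e e′ → trans (rel-restrict π a c) (trns (trans (sym (rel-restrict π a b)) e) (trans (sym (rel-restrict π b c)) e′)) }
    where open Equiv E

  extend-sound : ∀ π x y → rel (extend π) x y ≡ true → x ≡ y ⊎ ∃[ a ] ∃[ b ] x ≡ ι a × y ≡ ι b × rel π a b ≡ true
  extend-sound π x y r with position x | position y
  ... | inside a refl | inside b refl = inj₂ (a , b , refl , refl , trans (sym (rel-extend π a b)) r)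
  ... | outside e | _ = inj₁ (true-⌊⌋ (x Fₚ.≟ y) (trans (sym (rel-extend-out π x y (inj₁ e))) r))
  ... | inside _ _ | outside e = inj₁ (true-⌊⌋ (x Fₚ.≟ y) (trans (sym (rel-extend-out π x y (inj₂ e))) r))

  extend-refl : ∀ {π} → Equiv π → ∀ x → rel (extend π) x x ≡ true
  extend-refl {π} E x with position x
  ... | inside a refl = trans (rel-extend π a a) (Equiv.reflx E a)
  ... | outside e = trans (rel-extend-out π x x (inj₁ e)) (⌊⌋-true (x Fₚ.≟ x) refl)

  extend-mono : ∀ {π σ} → Equiv σ → (∀ a b → rel π a b ≡ true → rel σ a b ≡ true) → ∀ x y → rel (extend π) x y ≡ true → rel (extend σ) x y ≡ true
  extend-mono {π} {σ} E le x y r with extend-sound π x y r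
  ... | inj₁ refl = extend-refl E x
  ... | inj₂ (a , b , refl , refl , s) = trans (rel-extend σ a b) (le a b s)

  extend-Equiv : ∀ {π} → Equiv π → Equiv (extend π)
  extend-Equiv {π} E = record { reflx = extend-refl E ; symm = λ {x} {y} → sm x y ; trns = λ {x} {y} {z} → tr x y z }
    where
    open Equiv E
    sm : ∀ x y → rel (extend π) x y ≡ true → rel (extend π) y x ≡ true
    sm x y r with extend-sound π x y r
    ... | inj₁ refl = r
    ... | inj₂ (a , b , refl , refl , s) = trans (rel-extend π b a) (symm s)
    tr : ∀ x y z → rel (extend π) x y ≡ true → rel (extend π) y z ≡ true → rel (extend π) x z ≡ true
    tr x y z r r′ with extend-sound π x y r
    ... | inj₁ refl = r′
    ... | inj₂ (a , b , refl , refl , s) with extend-sound π (ι b) z r′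
    ...   | inj₁ refl = r
    ...   | inj₂ (b′ , c , e , refl , s′) with emb-injective A e
    ...     | refl = trans (rel-extend π a c) (trns s s′)

  private
    outs : ℤ
    outs = ∑ (allFin n) (λ x → ⟦ not (lookup A x) ⟧)

    ⟦⟧-split : ∀ b z → z ≡ ⟦ b ⟧ * z + ⟦ not b ⟧ * z
    ⟦⟧-split true z = sym (trans (ℤₚ.+-identityʳ (1ℤ * z)) (ℤₚ.*-identityˡ z))
    ⟦⟧-split false z = sym (trans (ℤₚ.+-identityˡ (1ℤ * z)) (ℤₚ.*-identityˡ z))

    ∑-split : ∀ (f : Fin n → ℤ) → ∑ (allFin n) f ≡ ∑ (allFin k) (λ a → f (ι a)) + ∑ (allFin n) (λ x → ⟦ not (lookup A x) ⟧ * f x)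
    ∑-split f = trans (∑-cong (allFin n) (λ x → ⟦⟧-split (lookup A x) (f x))) (trans (∑-+ (allFin n) _ _)
      (cong (_+ ∑ (allFin n) (λ x → ⟦ not (lookup A x) ⟧ * f x)) (∑-emb A f)))

  module _ {π : Rel n} (E : Equiv π) (ins : Inside π) where

    open Equiv E

    private
      inside-A : ∀ b x → rel π x (ι b) ≡ true → lookup A x ≡ true
      inside-A b x r with ins x (ι b) r
      ... | inj₁ refl = lookup-emb A b
      ... | inj₂ (p , _) = p

      outside-rep : ∀ x → lookup A x ≡ false → isRep π x ≡ true
      outside-rep x e = allB-complete (λ y → (toℕ y <ᵇ toℕ x) ⇒ᵇ not (rel π x y)) (λ y → ⇒ᵇ-intro (λ lt → alone y (ℕₚ.<ᵇ⇒< (toℕ y) (toℕ x) (subst T (sym lt) tt))))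
        where
        alone : ∀ y → toℕ y < toℕ x → not (rel π x y) ≡ true
        alone y lt with rel π x y in r
        ... | false = refl
        ... | true with ins x y r
        ...   | inj₁ refl = contradiction lt (ℕₚ.<-irrefl refl)
        ...   | inj₂ (p , _) = contradiction (trans (sym p) e) λ ()

      inner : ∑ (allFin k) (λ a → ⟦ isRep π (ι a) ⟧) ≡ ∑ (allFin k) (λ a → ⟦ isRep (restrict π) a ⟧)
      inner = ∑-double (allFin k) (allFin k) (λ a → isRep π (ι a)) (isRep (restrict π)) (λ a b → rel π (ι a) (ι b))
        (λ a _ → trans (∑-cong (allFin k) (λ b → cong (λ r → ⟦ isRep (restrict π) b ⟧ * ⟦ r ⟧) (sym (rel-restrict π a b)))) (one-rep (restrict-Equiv E) a))
        (λ b _ → trans (sym (∑-emb A (λ x → ⟦ isRep π x ⟧ * ⟦ rel π x (ι b) ⟧))) (trans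
          (∑-cong (allFin n) (λ x → drop (lookup A x) (isRep π x) (rel π x (ι b)) (inside-A b x)))
          (one-rep′ E (ι b))))
        where
        drop : ∀ a p r → (r ≡ true → a ≡ true) → ⟦ a ⟧ * (⟦ p ⟧ * ⟦ r ⟧) ≡ ⟦ p ⟧ * ⟦ r ⟧
        drop a p true h rewrite h refl = ℤₚ.*-identityˡ (⟦ p ⟧ * 1ℤ)
        drop a p false h = trans (cong (⟦ a ⟧ *_) (ℤₚ.*-zeroʳ ⟦ p ⟧)) (trans (ℤₚ.*-zeroʳ ⟦ a ⟧) (sym (ℤₚ.*-zeroʳ ⟦ p ⟧)))

    -- Every point outside A is a block by itself, so the restriction loses equally many points and
    -- blocks. The count is made additively in ℤ because `rank` is a truncated difference.
    rank-restrict : rank (restrict π) ≡ rank π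
    rank-restrict = ℤₚ.+-injective (+-cancelˡ (+ numBlocks π) (begin
      + numBlocks π + + rank (restrict π)
        ≡⟨ cong (_+ + rank (restrict π)) blocks ⟩
      (+ numBlocks (restrict π) + outs) + + rank (restrict π)
        ≡⟨ shuffle (+ numBlocks (restrict π)) outs (+ rank (restrict π)) ⟩
      (+ numBlocks (restrict π) + + rank (restrict π)) + outs
        ≡⟨ cong (_+ outs) (total (restrict π)) ⟩
      + k + outs
        ≡⟨ cong₂ _+_ (sym (∑-one k)) (∑-cong (allFin n) (λ x → sym (ℤₚ.*-identityʳ ⟦ not (lookup A x) ⟧))) ⟩
      ∑ (allFin k) (λ _ → 1ℤ) + ∑ (allFin n) (λ x → ⟦ not (lookup A x) ⟧ * 1ℤ)
        ≡⟨ sym (∑-split (λ _ → 1ℤ)) ⟩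
      ∑ (allFin n) (λ _ → 1ℤ)
        ≡⟨ trans (∑-one n) (sym (total π)) ⟩
      + numBlocks π + + rank π ∎))
      where
      total : ∀ {m} (σ : Rel m) → + numBlocks σ + + rank σ ≡ + m
      total σ = trans (sym (ℤₚ.pos-+ (numBlocks σ) (rank σ))) (cong +_ (ℕₚ.m+[n∸m]≡n (numBlocks≤n σ)))
      shuffle : ∀ a b c → (a + b) + c ≡ (a + c) + b
      shuffle = solve-∀
      outer : ∀ x → ⟦ not (lookup A x) ⟧ * ⟦ isRep π x ⟧ ≡ ⟦ not (lookup A x) ⟧
      outer x with lookup A x in e
      ... | true = refl
      ... | false = cong (λ b → 1ℤ * ⟦ b ⟧) (outside-rep x e)
      blocks : + numBlocks π ≡ + numBlocks (restrict π) + outs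
      blocks = trans (numBlocks-∑ π) (trans (∑-split (λ x → ⟦ isRep π x ⟧)) (cong₂ _+_ (trans inner (sym (numBlocks-∑ (restrict π)))) (∑-cong (allFin n) outer)))

  rank-extend : ∀ {π} → Equiv π → rank (extend π) ≡ rank π
  rank-extend {π} E = trans (sym (rank-restrict (extend-Equiv E) (extend-inside π))) (cong rank (restrict-extend π))

  restrict-Valid : ∀ {prev} T c → Valid prev T c → Insides c → Valid (restrict prev) T (V.map restrict c)
  restrict-Valid [] [] _ _ = tt
  restrict-Valid {prev} (t ∷ T) (π ∷ c) (E , r , le , v) (ins , inss) = restrict-Equiv E , trans (rank-restrict E ins) r ,
    (λ a b e → trans (rel-restrict π a b) (le _ _ (trans (sym (rel-restrict prev a b)) e))) , restrict-Valid T c v inss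

  extend-Valid : ∀ {prev} T c → Valid prev T c → Valid (extend prev) T (V.map extend c)
  extend-Valid [] [] _ = tt
  extend-Valid (t ∷ T) (π ∷ c) (E , r , le , v) = extend-Equiv E , trans (rank-extend E) r , extend-mono E le , extend-Valid T c v

  restrict-bottom : restrict (bottom n) ≡ bottom k
  restrict-bottom = rel-ext (λ a b → trans (rel-restrict (bottom n) a b) (trans (rel-bottom (ι a) (ι b)) (trans (⌊⌋-cong (ι a Fₚ.≟ ι b) (a Fₚ.≟ b) (emb-injective A) (cong ι)) (sym (rel-bottom a b)))))

  extend-bottom : extend (bottom k) ≡ bottom n
  extend-bottom = trans (cong extend (sym restrict-bottom)) (extend-restrict (bottom-Equiv n) (λ x y r → inj₁ (true-⌊⌋ (x Fₚ.≟ y) (trans (sym (rel-bottom x y)) r))))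

  supp⇒Insides : ∀ {prev} T c → Valid prev T c → (∀ x → supp c x ≡ true → lookup A x ≡ true) → Insides c
  supp⇒Insides [] [] _ _ = tt
  supp⇒Insides (t ∷ T) (π ∷ c) (E , _ , _ , v) h = ins , supp⇒Insides T c v (λ x e → h x (true-∨ʳ {touches π x} e))
    where
    ins : Inside π
    ins x y r with x Fₚ.≟ y
    ... | yes e = inj₁ e
    ... | no ne = inj₂ (h x (true-∨ˡ (touches-intro π r ne)) , h y (true-∨ˡ (touches-intro π (Equiv.symm E r) (λ e → ne (sym e)))))

  supp-restrict : ∀ {t} (c : Vec (Rel n) t) → Insides c → ∀ a → supp c (ι a) ≡ true → supp (V.map restrict c) a ≡ true
  supp-restrict (π ∷ c) (ins , inss) a e with ∨-true e
  ... | inj₂ e′ = true-∨ʳ {touches (restrict π) a} (supp-restrict c inss a e′)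
  ... | inj₁ e′ with touches-elim π e′
  ...   | y , r , ne with ins (ι a) y r
  ...     | inj₁ eq = contradiction eq ne
  ...     | inj₂ (_ , y∈) with emb-surjective A y y∈
  ...       | b , refl = true-∨ˡ (touches-intro (restrict π) (trans (rel-restrict π a b) r) (λ eq → ne (cong ι eq)))

  supp-extend : ∀ {t} (c : Vec (Rel k) t) → (∀ a → supp c a ≡ true) → ∀ x → supp (V.map extend c) x ≡ lookup A x
  supp-extend c h x with position x
  ... | inside a refl = trans (ins c (h a)) (sym (lookup-emb A a))
    where
    ins : ∀ {t} (c : Vec (Rel k) t) → supp c a ≡ true → supp (V.map extend c) (ι a) ≡ true
    ins (π ∷ c) e with ∨-true e
    ... | inj₂ e′ = true-∨ʳ {touches (extend π) (ι a)} (ins c e′)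
    ... | inj₁ e′ with touches-elim π e′
    ...   | b , r , ne = true-∨ˡ (touches-intro (extend π) (trans (rel-extend π a b) r) (λ eq → ne (emb-injective A eq)))
  ... | outside o = trans (out c) (sym o)
    where
    out : ∀ {t} (c : Vec (Rel k) t) → supp (V.map extend c) x ≡ false
    out [] = refl
    out (π ∷ c) with touches (extend π) x in e
    ... | false = out c
    ... | true with touches-elim (extend π) e
    ...   | y , r , ne with extend-inside π x y r
    ...     | inj₁ eq = contradiction eq ne
    ...     | inj₂ (p , _) = contradiction (trans (sym p) o) λ ()

  module _ (g : Permutation′ n) (inv : Inv g A) where

    private
      h = restrictPerm g A inv

    act-restrict : ∀ π → actΠ h (restrict π) ≡ restrict (actΠ g π)
    act-restrict π = rel-ext (λ a b → trans (rel-actΠ h (restrict π) a b) (trans (rel-restrict π _ _) (trans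
      (cong₂ (rel π) (emb-restrictPerm g A inv a) (emb-restrictPerm g A inv b))
      (trans (sym (rel-actΠ g π (ι a) (ι b))) (sym (rel-restrict (actΠ g π) a b))))))

    act-Inside : ∀ {π} → Inside π → Inside (actΠ g π)
    act-Inside {π} ins x y r with ins _ _ (trans (sym (rel-actΠ g π x y)) r)
    ... | inj₁ e = inj₁ (trans (sym (P.inverseˡ g)) (trans (cong (g ⟨$⟩ˡ_) e) (P.inverseˡ g)))
    ... | inj₂ (p , q) = inj₂ (trans (sym (inv x)) p , trans (sym (inv y)) q)

    fix-restrict : ∀ {prev} T c → Valid prev T c → Insides c → V.map (actΠ h) (V.map restrict c) ≡ V.map restrict c → V.map (actΠ g) c ≡ c
    fix-restrict [] [] _ _ _ = refl
    fix-restrict (t ∷ T) (π ∷ c) (E , _ , _ , v) (ins , inss) e = cong₂ _∷_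
      (begin
        actΠ g π                       ≡⟨ sym (extend-restrict (act-Equiv g E) (act-Inside {π} ins)) ⟩
        extend (restrict (actΠ g π))   ≡⟨ cong extend (sym (act-restrict π)) ⟩
        extend (actΠ h (restrict π))   ≡⟨ cong extend (proj₁ (Vₚ.∷-injective e)) ⟩
        extend (restrict π)            ≡⟨ extend-restrict E ins ⟩
        π ∎)
      (fix-restrict T c v inss (proj₂ (Vₚ.∷-injective e)))

    fix-restrict⁻¹ : ∀ {t} (c : Vec (Rel n) t) → V.map (actΠ g) c ≡ c → V.map (actΠ h) (V.map restrict c) ≡ V.map restrict c
    fix-restrict⁻¹ c e = trans (sym (Vₚ.map-∘ (actΠ h) restrict c)) (trans (Vₚ.map-cong act-restrict c) (trans (Vₚ.map-∘ restrict (actΠ g) c) (cong (V.map restrict) e)))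

  map-extend-restrict : ∀ {prev} T c → Valid prev T c → Insides c → V.map extend (V.map restrict c) ≡ c
  map-extend-restrict [] [] _ _ = refl
  map-extend-restrict (t ∷ T) (π ∷ c) (E , _ , _ , v) (ins , inss) = cong₂ _∷_ (extend-restrict E ins) (map-extend-restrict T c v inss)

-- Chains sorted by their supports

Subset-finite : ∀ n → Finite (Vec Bool n)
Subset-finite = Vec-finite Bool-finite

module _ {n : ℕ} (T : List ℕ) (g : Permutation′ n) where

  private
    t = length T
    C = elems (GSet.finite (chains t n))
    suppV : Vec (Rel n) t → Vec Bool n
    suppV c = tabulate (supp c)
    good : Vec Bool n → Vec (Rel n) t → Bool
    good A c = valid (bottom n) T c ∧ Finite._==_ (Subset-finite n) A (suppV c)

    part : ∀ A (d : Dec (Inv g A)) → ∑ C (λ c → ⟦ good A c ⟧ * ⟦ GSet.fix (chains t n) g c ⟧) ≡ ⟦ ⌊ d ⌋ ⟧ * fullChar T (size A) (restrictDec g A d)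
    part A (no ¬inv) = ∑-zero C (λ c → zero-term c)
      where
      not-fixed : ∀ c → good A c ≡ true → GSet.fix (chains t n) g c ≡ true → ⊥
      not-fixed c e f = ¬inv (λ x → trans (A≡ (g ⟨$⟩ʳ x)) (trans (sym (supp-act g c x)) (trans (cong (λ c → supp c x) (GSet.==-sound (chains t n) {_} {c} f)) (sym (A≡ x)))))
        where
        A≡ : ∀ x → lookup A x ≡ supp c x
        A≡ x = trans (cong (λ v → lookup v x) (Finite.==-sound (Subset-finite n) {A} {suppV c} (proj₂ (∧-true {valid (bottom n) T c} e)))) (Vₚ.lookup∘tabulate (supp c) x)
      zero-term : ∀ c → ⟦ good A c ⟧ * ⟦ GSet.fix (chains t n) g c ⟧ ≡ 0ℤ
      zero-term c = trans (sym (⟦∧⟧ (good A c) (GSet.fix (chains t n) g c))) (cong ⟦_⟧ (bool-ext {b = false}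
        (λ e → ⊥-elim (not-fixed c (proj₁ (∧-true e)) (proj₂ (∧-true {good A c} e)))) (λ ())))
    part A (yes inv) = trans (∑-bij (GSet.finite (chains t n)) (GSet.finite (chains t R.k)) (good A) (λ c → valid (bottom R.k) T c ∧ full c)
        (λ c → ⟦ GSet.fix (chains t n) g c ⟧) (λ c → ⟦ GSet.fix (chains t R.k) (restrictPerm g A inv) c ⟧) (V.map R.restrict) (V.map R.extend) down up)
        (sym (ℤₚ.*-identityˡ _))
      where
      module R = Restriction A
      down : ∀ c → good A c ≡ true → (valid (bottom R.k) T (V.map R.restrict c) ∧ full (V.map R.restrict c)) ≡ true
        × V.map R.extend (V.map R.restrict c) ≡ c
        × ⟦ GSet.fix (chains t n) g c ⟧ ≡ ⟦ GSet.fix (chains t R.k) (restrictPerm g A inv) (V.map R.restrict c) ⟧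
      down c e = true-∧ (valid-complete (bottom R.k) T _ (subst (λ p → Valid p T (V.map R.restrict c)) R.restrict-bottom (R.restrict-Valid T c v ins)))
                   (allB-complete (supp (V.map R.restrict c)) (λ a → R.supp-restrict c ins a (trans (sym (A≡ (R.ι a))) (lookup-emb A a)))) ,
                 R.map-extend-restrict T c v ins ,
                 cong ⟦_⟧ (⌊⌋-cong (GSet._≟ˣ_ (chains t n) _ c) (GSet._≟ˣ_ (chains t R.k) _ (V.map R.restrict c))
                   (R.fix-restrict⁻¹ g inv c) (R.fix-restrict g inv T c v ins))
        where
        v = valid-sound (bottom n) T c (proj₁ (∧-true e))
        A≡ : ∀ x → lookup A x ≡ supp c x
        A≡ x = trans (cong (λ v → lookup v x) (Finite.==-sound (Subset-finite n) {A} {suppV c} (proj₂ (∧-true {valid (bottom n) T c} e)))) (Vₚ.lookup∘tabulate (supp c) x)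
        ins = R.supp⇒Insides T c v (λ x s → trans (A≡ x) s)
      up : ∀ c → (valid (bottom R.k) T c ∧ full c) ≡ true → good A (V.map R.extend c) ≡ true × V.map R.restrict (V.map R.extend c) ≡ c
      up c e = true-∧ (valid-complete (bottom n) T _ (subst (λ p → Valid p T (V.map R.extend c)) R.extend-bottom (R.extend-Valid T c (valid-sound (bottom R.k) T c (proj₁ (∧-true e))))))
                 (⌊⌋-true (Finite._≟_ (Subset-finite n) A (suppV (V.map R.extend c))) (trans (sym (Vₚ.tabulate∘lookup A)) (Vₚ.tabulate-cong (λ x →
                   sym (R.supp-extend c (allB-sound (supp c) (proj₂ (∧-true {valid (bottom R.k) T c} e))) x))))) ,
               trans (sym (Vₚ.map-∘ R.restrict R.extend c)) (trans (Vₚ.map-cong R.restrict-extend c) (Vₚ.map-id c))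

  -- The value at g of the sum over k of Ind (V_k ⊗ 1). The support of a fixed chain is invariant
  -- under g, and the fixed chains with a given invariant support A are the chains on A without
  -- common singletons that are fixed by the restriction of g.
  alpha-by-support : alphaΠ n T g ≡ ∑ (elems (Subset-finite n)) (λ A → ⟦ ⌊ inv? g A ⌋ ⟧ * fullChar T (size A) (restrictDec g A (inv? g A)))
  alpha-by-support = begin
    alphaΠ n T g
      ≡⟨ fixedChains-∑ g (bottom n) T ⟩
    ∑ C (λ c → ⟦ valid (bottom n) T c ⟧ * ⟦ GSet.fix (chains t n) g c ⟧)
      ≡⟨ ∑-cong C (λ c → sym (Finite.∑-pick (Subset-finite n) (suppV c) (λ _ → ⟦ valid (bottom n) T c ⟧ * ⟦ GSet.fix (chains t n) g c ⟧))) ⟩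
    ∑ C (λ c → ∑ (elems (Subset-finite n)) (λ A → ⟦ Finite._==_ (Subset-finite n) A (suppV c) ⟧ * (⟦ valid (bottom n) T c ⟧ * ⟦ GSet.fix (chains t n) g c ⟧)))
      ≡⟨ ∑-swap C (elems (Subset-finite n)) _ ⟩
    ∑ (elems (Subset-finite n)) (λ A → ∑ C (λ c → ⟦ Finite._==_ (Subset-finite n) A (suppV c) ⟧ * (⟦ valid (bottom n) T c ⟧ * ⟦ GSet.fix (chains t n) g c ⟧)))
      ≡⟨ ∑-cong (elems (Subset-finite n)) (λ A → trans (∑-cong C (λ c → trans
           (shuffle ⟦ Finite._==_ (Subset-finite n) A (suppV c) ⟧ ⟦ valid (bottom n) T c ⟧ ⟦ GSet.fix (chains t n) g c ⟧)
           (cong (_* ⟦ GSet.fix (chains t n) g c ⟧) (sym (⟦∧⟧ (valid (bottom n) T c) (Finite._==_ (Subset-finite n) A (suppV c)))))))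
           (part A (inv? g A))) ⟩
    ∑ (elems (Subset-finite n)) (λ A → ⟦ ⌊ inv? g A ⌋ ⟧ * fullChar T (size A) (restrictDec g A (inv? g A))) ∎
    where
    shuffle : ∀ a b c → a * (b * c) ≡ (b * a) * c
    shuffle = solve-∀

-- Separating the singletons: chains and coloured words

letters-total : ∀ {q n} (w : Vec (Fin q) n) → ∑ (allFin q) (λ j → Coloured.cnt q (lookup w) j) ≡ + n
letters-total {q} {n} w = trans (∑-swap (allFin q) (allFin n) _) (trans (∑-cong (allFin n) (λ x →
  trans (∑-cong (allFin q) (λ j → cong ⟦_⟧ (⌊⌋-cong (lookup w x Fₚ.≟ j) (j Fₚ.≟ lookup w x) sym sym))) (Finite.once (Fin-finite q) (lookup w x)))) (∑-one n))

has-sum : ∀ {m} β (w : Vec (Fin (length β)) m) → Coloured.has (length β) (colours β) w ≡ true → sumℕ β ≡ m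
has-sum β w e = ℤₚ.+-injective (trans (sym (∑-colours β)) (trans (∑-cong (allFin (length β)) (λ j → sym (true-⌊⌋ (Coloured.content? (length β) (colours β) w) e j))) (letters-total w)))

young-wrong-size : ∀ m β g → sumℕ β ≢ m → young m β g ≡ 0ℤ
young-wrong-size m β g ne = ∑-zero (elems (Vec-finite (Fin-finite (length β)) m)) (λ w → cong (λ b → ⟦ b ⟧ * ⟦ GSet.fix (Coloured.words (length β) m) g w ⟧) (bool-ext {b = false} (λ e → contradiction (has-sum β w e) ne) λ ()))

isSuc : ∀ {q} → Fin (suc q) → Bool
isSuc zero = false
isSuc (suc _) = true

module _ {n : ℕ} (a : ℕ) (β : List ℕ) (a+β : a ℕ.+ sumℕ β ≡ n) (g : Permutation′ n) where

  private
    p = length β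
    module W = Coloured (suc p)
    words = elems (Vec-finite (Fin-finite (suc p)) n)

    nonzero : Vec (Fin (suc p)) n → Vec Bool n
    nonzero = V.map isSuc

    good : Vec Bool n → Vec (Fin (suc p)) n → Bool
    good A w = W.has (colours (a ∷ β)) w ∧ Finite._==_ (Subset-finite n) A (nonzero w)

    good-A : ∀ A w → good A w ≡ true → ∀ x → lookup A x ≡ isSuc (lookup w x)
    good-A A w e x = trans (cong (λ v → lookup v x) (Finite.==-sound (Subset-finite n) {A} {nonzero w} (proj₂ (∧-true {W.has (colours (a ∷ β)) w} e)))) (Vₚ.lookup-map x isSuc w)

    module Inside (A : Vec Bool n) (inv : Inv g A) where

      k = size A
      h = restrictPerm g A inv
      module U = Coloured p

      raise : Vec (Fin p) k → Maybe (Fin k) → Fin (suc p)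
      raise v (just b) = suc (lookup v b)
      raise v nothing = zero

      up : Vec (Fin p) k → Vec (Fin (suc p)) n
      up v = tabulate (λ x → raise v (pos A x))

      up-in : ∀ v b → lookup (up v) (emb A b) ≡ suc (lookup v b)
      up-in v b = trans (Vₚ.lookup∘tabulate (λ x → raise v (pos A x)) (emb A b)) (cong (raise v) (pos-emb A b))

      up-out : ∀ v x → lookup A x ≡ false → lookup (up v) x ≡ zero
      up-out v x e = trans (Vₚ.lookup∘tabulate (λ x → raise v (pos A x)) x) (cong (raise v) (pos-∉ A x e))

      up-injective : ∀ u v → up u ≡ up v → u ≡ v
      up-injective u v e = trans (sym (Vₚ.tabulate∘lookup u)) (trans (Vₚ.tabulate-cong (λ b → Fₚ.suc-injective (trans (sym (up-in u b)) (trans (cong (λ w → lookup w (emb A b)) e) (up-in v b))))) (Vₚ.tabulate∘lookup v))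

      nonzero-up : ∀ v → nonzero (up v) ≡ A
      nonzero-up v = trans (sym (Vₚ.tabulate∘lookup (nonzero (up v)))) (trans (Vₚ.tabulate-cong same) (Vₚ.tabulate∘lookup A))
        where
        same : ∀ x → lookup (nonzero (up v)) x ≡ lookup A x
        same x with Restriction.position A x
        ... | Restriction.inside b refl = trans (Vₚ.lookup-map (emb A b) isSuc (up v)) (trans (cong isSuc (up-in v b)) (sym (lookup-emb A b)))
        ... | Restriction.outside e = trans (Vₚ.lookup-map x isSuc (up v)) (trans (cong isSuc (up-out v x e)) (sym e))

      up-surjective : ∀ w → nonzero w ≡ A → ∃[ v ] up v ≡ w
      up-surjective w e = tabulate (λ b → proj₁ (letter b)) , (begin
          tabulate (λ x → raise v (pos A x))  ≡⟨ Vₚ.tabulate-cong same ⟩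
          tabulate (lookup w)                 ≡⟨ Vₚ.tabulate∘lookup w ⟩
          w ∎)
        where
        w∈ : ∀ x → isSuc (lookup w x) ≡ lookup A x
        w∈ x = trans (sym (Vₚ.lookup-map x isSuc w)) (cong (λ B → lookup B x) e)
        isSuc-true : ∀ {q} (j : Fin (suc q)) → isSuc j ≡ true → ∃[ i ] j ≡ suc i
        isSuc-true (suc i) _ = i , refl
        isSuc-false : ∀ {q} (j : Fin (suc q)) → isSuc j ≡ false → j ≡ zero
        isSuc-false zero _ = refl
        letter : ∀ b → ∃[ i ] lookup w (emb A b) ≡ suc i
        letter b = isSuc-true _ (trans (w∈ (emb A b)) (lookup-emb A b))
        v = tabulate (λ b → proj₁ (letter b))
        same : ∀ x → raise v (pos A x) ≡ lookup w x
        same x with Restriction.position A x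
        ... | Restriction.inside b refl = trans (cong (raise v) (pos-emb A b)) (trans (cong suc (Vₚ.lookup∘tabulate (λ b → proj₁ (letter b)) b)) (sym (proj₂ (letter b))))
        ... | Restriction.outside o = trans (cong (raise v) (pos-∉ A x o)) (sym (isSuc-false _ (trans (w∈ x) o)))

      cnt-up : ∀ v j → W.cnt (lookup (up v)) (suc j) ≡ U.cnt (lookup v) j
      cnt-up v j = begin
        ∑ (allFin n) (λ x → ⟦ ⌊ lookup (up v) x Fₚ.≟ suc j ⌋ ⟧)
          ≡⟨ ∑-cong (allFin n) summand ⟩
        ∑ (allFin n) (λ x → ⟦ lookup A x ⟧ * ⟦ ⌊ lookup (up v) x Fₚ.≟ suc j ⌋ ⟧)
          ≡⟨ ∑-emb A _ ⟩
        ∑ (allFin k) (λ b → ⟦ ⌊ lookup (up v) (emb A b) Fₚ.≟ suc j ⌋ ⟧)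
          ≡⟨ ∑-cong (allFin k) (λ b → cong ⟦_⟧ (trans (cong (λ i → ⌊ i Fₚ.≟ suc j ⌋) (up-in v b)) (⌊⌋-cong (suc (lookup v b) Fₚ.≟ suc j) (lookup v b Fₚ.≟ j) Fₚ.suc-injective (cong suc)))) ⟩
        U.cnt (lookup v) j ∎
        where
        summand : ∀ x → ⟦ ⌊ lookup (up v) x Fₚ.≟ suc j ⌋ ⟧ ≡ ⟦ lookup A x ⟧ * ⟦ ⌊ lookup (up v) x Fₚ.≟ suc j ⌋ ⟧
        summand x with lookup A x in e
        ... | true = sym (ℤₚ.*-identityˡ _)
        ... | false = cong (λ i → ⟦ ⌊ i Fₚ.≟ suc j ⌋ ⟧) (up-out v x e)

      -- The first colour takes the positions that the other colours leave, n - |β| = a of them.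
      cnt-zero : ∀ w → (∀ j → W.cnt (lookup w) (suc j) ≡ colours β j) → W.cnt (lookup w) zero ≡ + a
      cnt-zero w h = trans (cancel (W.cnt (lookup w) zero) (∑ (allFin p) (λ j → W.cnt (lookup w) (suc j)))) (trans
        (cong₂ _-_ (trans (sym (∑-allFin p (λ j → W.cnt (lookup w) j))) (letters-total w)) (trans (∑-cong (allFin p) h) (∑-colours β)))
        (trans (cong (λ m → + m - + sumℕ β) (sym a+β)) (trans (cong (_- + sumℕ β) (ℤₚ.pos-+ a (sumℕ β))) (sym (cancel (+ a) (+ sumℕ β))))))
        where
        cancel : ∀ x y → x ≡ x + y - y
        cancel = solve-∀

      act-up : ∀ v → GSet.act (W.words n) g (up v) ≡ up (GSet.act (U.words k) h v)
      act-up v = Vₚ.tabulate-cong same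
        where
        same : ∀ x → lookup (up v) (g ⟨$⟩ʳ x) ≡ raise (GSet.act (U.words k) h v) (pos A x)
        same x with Restriction.position A x
        ... | Restriction.inside b refl = trans (cong (lookup (up v)) (sym (emb-restrictPerm g A inv b))) (trans (up-in v (h ⟨$⟩ʳ b))
              (sym (trans (cong (raise _) (pos-emb A b)) (cong suc (Vₚ.lookup∘tabulate (λ y → lookup v (h ⟨$⟩ʳ y)) b)))))
        ... | Restriction.outside e = trans (up-out v (g ⟨$⟩ʳ x) (trans (inv x) e)) (sym (cong (raise _) (pos-∉ A x e)))

      has-up : ∀ v → W.has (colours (a ∷ β)) (up v) ≡ U.has (colours β) v
      has-up v = ⌊⌋-cong (W.content? (colours (a ∷ β)) (up v)) (U.content? (colours β) v)
        (λ h j → trans (sym (cnt-up v j)) (h (suc j)))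
        (λ h → λ { zero → cnt-zero (up v) (λ j → trans (cnt-up v j) (h j)) ; (suc j) → trans (cnt-up v j) (h j) })

      sum-inside : ∑ words (λ w → ⟦ good A w ⟧ * ⟦ GSet.fix (W.words n) g w ⟧) ≡ young k β h
      sum-inside = sym (∑-bij-surjective (Vec-finite (Fin-finite p) k) (Vec-finite (Fin-finite (suc p)) n) (U.has (colours β)) (good A)
        (λ v → ⟦ GSet.fix (U.words k) h v ⟧) (λ w → ⟦ GSet.fix (W.words n) g w ⟧) up
        (λ v e → true-∧ (trans (has-up v) e) (⌊⌋-true (Finite._≟_ (Subset-finite n) A (nonzero (up v))) (sym (nonzero-up v))) ,
                 cong ⟦_⟧ (⌊⌋-cong (GSet._≟ˣ_ (U.words k) _ v) (GSet._≟ˣ_ (W.words n) _ (up v))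
                   (λ e → trans (act-up v) (cong up e)) (λ e → up-injective _ v (trans (sym (act-up v)) e))))
        (λ u v _ _ → up-injective u v)
        (λ w e → let v , eq = up-surjective w (sym (Finite.==-sound (Subset-finite n) {A} {nonzero w} (proj₂ (∧-true {W.has (colours (a ∷ β)) w} e)))) in
                 v , trans (sym (has-up v)) (trans (cong (W.has (colours (a ∷ β))) eq) (proj₁ (∧-true e))) , eq))

    part : ∀ A (d : Dec (Inv g A)) → ∑ words (λ w → ⟦ good A w ⟧ * ⟦ GSet.fix (W.words n) g w ⟧) ≡ ⟦ ⌊ d ⌋ ⟧ * young (size A) β (restrictDec g A d)
    part A (yes inv) = trans (Inside.sum-inside A inv) (sym (ℤₚ.*-identityˡ _))
    part A (no ¬inv) = ∑-zero words (λ w → trans (sym (⟦∧⟧ (good A w) (GSet.fix (W.words n) g w))) (cong ⟦_⟧ (bool-ext {b = false}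
        (λ e → ⊥-elim (not-fixed w (proj₁ (∧-true e)) (proj₂ (∧-true {good A w} e)))) (λ ()))))
      where
      not-fixed : ∀ w → good A w ≡ true → GSet.fix (W.words n) g w ≡ true → ⊥
      not-fixed w e f = ¬inv (λ x → trans (good-A A w e (g ⟨$⟩ʳ x)) (trans (cong isSuc (trans (sym (Vₚ.lookup∘tabulate (λ y → lookup w (g ⟨$⟩ʳ y)) x))
        (cong (λ v → lookup v x) (GSet.==-sound (W.words n) {_} {w} f)))) (sym (good-A A w e x))))

  -- Sorting words by the set A of positions that do not carry the first colour exhibits η_(a, β) as
  -- Ind (η_β ⊗ 1). The outer sum is that of `alpha-by-support`, so expansions on A lift term by
  -- term to n points.
  young-by-support : young n (a ∷ β) g ≡ ∑ (elems (Subset-finite n)) (λ A → ⟦ ⌊ inv? g A ⌋ ⟧ * young (size A) β (restrictDec g A (inv? g A)))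
  young-by-support = begin
    ∑ words (λ w → ⟦ W.has (colours (a ∷ β)) w ⟧ * ⟦ GSet.fix (W.words n) g w ⟧)
      ≡⟨ ∑-cong words (λ w → sym (Finite.∑-pick (Subset-finite n) (nonzero w) (λ _ → ⟦ W.has (colours (a ∷ β)) w ⟧ * ⟦ GSet.fix (W.words n) g w ⟧))) ⟩
    ∑ words (λ w → ∑ (elems (Subset-finite n)) (λ A → ⟦ Finite._==_ (Subset-finite n) A (nonzero w) ⟧ * (⟦ W.has (colours (a ∷ β)) w ⟧ * ⟦ GSet.fix (W.words n) g w ⟧)))
      ≡⟨ ∑-swap words (elems (Subset-finite n)) _ ⟩
    ∑ (elems (Subset-finite n)) (λ A → ∑ words (λ w → ⟦ Finite._==_ (Subset-finite n) A (nonzero w) ⟧ * (⟦ W.has (colours (a ∷ β)) w ⟧ * ⟦ GSet.fix (W.words n) g w ⟧)))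
      ≡⟨ ∑-cong (elems (Subset-finite n)) (λ A → trans (∑-cong words (λ w → trans
           (shuffle ⟦ Finite._==_ (Subset-finite n) A (nonzero w) ⟧ ⟦ W.has (colours (a ∷ β)) w ⟧ ⟦ GSet.fix (W.words n) g w ⟧)
           (cong (_* ⟦ GSet.fix (W.words n) g w ⟧) (sym (⟦∧⟧ (W.has (colours (a ∷ β)) w) (Finite._==_ (Subset-finite n) A (nonzero w)))))))
           (part A (inv? g A))) ⟩
    ∑ (elems (Subset-finite n)) (λ A → ⟦ ⌊ inv? g A ⌋ ⟧ * young (size A) β (restrictDec g A (inv? g A))) ∎
    where
    shuffle : ∀ a b c → a * (b * c) ≡ (b * a) * c
    shuffle = solve-∀

-- Expansion of α into Young characters with a free first part

top-exists : ∀ {n i} (prev : Rel n) T c → Equiv prev → rank prev ≤ i → All (_≤ i) T → Valid prev T c →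
  ∃[ top ] Equiv top × rank top ≤ i × (∀ x y → rel prev x y ≡ true → rel top x y ≡ true) × (∀ x → supp c x ≡ true → touches top x ≡ true)
top-exists prev [] [] E le _ _ = prev , E , le , (λ _ _ r → r) , λ _ ()
top-exists prev (t ∷ T) (π ∷ c) E le (le′ ∷ les) (E′ , refl , mono , v) with top-exists π T c E′ le′ les v
... | top , E″ , le″ , mono′ , s = top , E″ , le″ , (λ x y r → mono′ x y (mono x y r)) , λ x e → on x (∨-true e)
  where
  on : ∀ x → touches π x ≡ true ⊎ supp c x ≡ true → touches top x ≡ true
  on x (inj₁ e) = let y , r , ne = touches-elim π e in touches-intro top (mono′ x y r) ne
  on x (inj₂ e) = s x e

-- Supports grow along a chain, so the last member has no singletons at all; its rank is at most i,
-- and `touches-bound` applies.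
full-bound : ∀ {k i} T c → All (_≤ i) T → (valid (bottom k) T c ∧ full c) ≡ true → k ≤ 2 ℕ.* i
full-bound {k} {i} T c les e with top-exists (bottom k) T c (bottom-Equiv k) (subst (_≤ i) (sym (rank-bottom k)) z≤n) les (valid-sound (bottom k) T c (proj₁ (∧-true e)))
... | top , E , le , _ , s = ℤₚ.drop‿+≤+ (ℤₚ.≤-trans (ℤₚ.≤-reflexive (trans (sym (∑-one k)) (∑-cong (allFin k) (λ x → cong ⟦_⟧ (sym (s x (allB-sound (supp c) (proj₂ (∧-true {valid (bottom k) T c} e)) x)))))))
  (ℤₚ.≤-trans (touches-bound E) (ℤ.+≤+ (ℕₚ.*-monoʳ-≤ 2 le))))

fullChar-large : ∀ {i} T k g → All (_≤ i) T → 2 ℕ.* i < k → fullChar T k g ≡ 0ℤ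
fullChar-large T k g les lt = ∑-zero (elems (GSet.finite (chains (length T) k))) (λ c →
  cong (λ b → ⟦ b ⟧ * ⟦ GSet.fix (chains (length T) k) g c ⟧) (bool-ext {b = false} (λ e → contradiction (full-bound T c les e) (ℕₚ.<⇒≱ lt)) λ ()))

∑-upTo-single : ∀ N m (f : ℕ → ℤ) → m < N → (∀ k → k ≢ m → f k ≡ 0ℤ) → ∑ (upTo N) f ≡ f m
∑-upTo-single (suc N) zero f lt z = trans (∑-upTo N f) (trans (cong (_+_ (f 0)) (∑-zero (upTo N) (λ k → z (suc k) λ ()))) (ℤₚ.+-identityʳ (f 0)))
∑-upTo-single (suc N) (suc m) f (s≤s lt) z = trans (∑-upTo N f) (trans (cong₂ _+_ (z 0 λ ()) (∑-upTo-single N m (f ∘ suc) lt (λ k ne → z (suc k) (λ e → ne (ℕₚ.suc-injective e))))) (ℤₚ.+-identityˡ (f (suc m))))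

opaque
  -- One list serves all m: it joins the expansions of V_k for k ≤ 2i, and on m points the terms
  -- with k ≠ m vanish because no word has their content. For m > 2i both sides are 0.
  fullChar-expansion : ∀ T i → All (_≤ i) T → Σ[ bs ∈ List (ℤ × List ℕ) ] All (λ b → sumℕ (proj₂ b) ≤ 2 ℕ.* i) bs ×
    (∀ m h → fullChar T m h ≡ ∑ bs (λ b → proj₁ b * young m (proj₂ b) h))
  fullChar-expansion T i les = concatMap bs ks , bounded , λ m h → trans (expand m h (m ℕ.<? suc (2 ℕ.* i))) (sym (∑-concatMap bs ks _))
    where
    ks : List ℕ
    ks = upTo (suc (2 ℕ.* i))
    bs : ℕ → List (ℤ × List ℕ)
    bs k = proj₁ (fullChar-span T k)
    bs-sum : ∀ k → All (λ b → sumℕ (proj₂ b) ≡ k) (bs k)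
    bs-sum k = proj₁ (proj₂ (fullChar-span T k))
    bounded : All (λ b → sumℕ (proj₂ b) ≤ 2 ℕ.* i) (concatMap bs ks)
    bounded = Allₚ.concat⁺ (Allₚ.map⁺ (Allₚ.applyUpTo⁺₁ id (suc (2 ℕ.* i)) (λ {k} lt → All.map (λ e → subst (_≤ 2 ℕ.* i) (sym e) (ℕₚ.≤-pred lt)) (bs-sum k))))
    other : ∀ k m h → k ≢ m → ∑ (bs k) (λ b → proj₁ b * young m (proj₂ b) h) ≡ 0ℤ
    other k m h ne = go (bs-sum k)
      where
      go : ∀ {cs} → All (λ b → sumℕ (proj₂ b) ≡ k) cs → ∑ cs (λ b → proj₁ b * young m (proj₂ b) h) ≡ 0ℤ
      go [] = refl
      go {(c , β) ∷ cs} (e ∷ es) = cong₂ _+_ (trans (cong (c *_) (young-wrong-size m β h (λ e′ → ne (trans (sym e) e′)))) (ℤₚ.*-zeroʳ c)) (go es)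
    expand : ∀ m h → Dec (m < suc (2 ℕ.* i)) → fullChar T m h ≡ ∑ ks (λ k → ∑ (bs k) (λ b → proj₁ b * young m (proj₂ b) h))
    expand m h (yes lt) = trans (proj₂ (proj₂ (fullChar-span T m)) h) (sym (∑-upTo-single (suc (2 ℕ.* i)) m (λ k → ∑ (bs k) (λ b → proj₁ b * young m (proj₂ b) h)) lt (λ k ne → other k m h ne)))
    expand m h (no ¬lt) = trans (fullChar-large T m h les (ℕₚ.≮⇒≥ ¬lt)) (sym (trans (∑-upTo-cong (suc (2 ℕ.* i)) {g = λ _ → 0ℤ} (λ k lt → other k m h (λ e → ¬lt (subst (_< suc (2 ℕ.* i)) e lt)))) (∑-zero ks (λ _ → refl))))

-- `alpha-by-support` and `young-by-support` are compared subset by subset. Since |β| ≤ 2i ≤ n, the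
-- difference n - |β| is not truncated and the sizes add up to n.
alpha-expansion : ∀ {i} T bs → All (λ b → sumℕ (proj₂ b) ≤ 2 ℕ.* i) bs → (∀ m h → fullChar T m h ≡ ∑ bs (λ b → proj₁ b * young m (proj₂ b) h)) →
  ∀ n → 2 ℕ.* i ≤ n → ∀ g → alphaΠ n T g ≡ ∑ bs (λ b → proj₁ b * young n ((n ∸ sumℕ (proj₂ b)) ∷ proj₂ b) g)
alpha-expansion {i} T bs small exp n le g = begin
  alphaΠ n T g
    ≡⟨ alpha-by-support T g ⟩
  ∑ S (λ A → ⟦ ⌊ inv? g A ⌋ ⟧ * fullChar T (size A) (h A))
    ≡⟨ ∑-cong S (λ A → trans (cong (⟦ ⌊ inv? g A ⌋ ⟧ *_) (exp (size A) (h A))) (trans (sym (∑-*ˡ bs ⟦ ⌊ inv? g A ⌋ ⟧ _)) (∑-cong bs (λ b → *-swap ⟦ ⌊ inv? g A ⌋ ⟧ (proj₁ b) (young (size A) (proj₂ b) (h A)))))) ⟩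
  ∑ S (λ A → ∑ bs (λ b → proj₁ b * (⟦ ⌊ inv? g A ⌋ ⟧ * young (size A) (proj₂ b) (h A))))
    ≡⟨ ∑-swap S bs _ ⟩
  ∑ bs (λ b → ∑ S (λ A → proj₁ b * (⟦ ⌊ inv? g A ⌋ ⟧ * young (size A) (proj₂ b) (h A))))
    ≡⟨ ∑-congᴬ (All.map (λ {b} s → trans (∑-*ˡ S (proj₁ b) _) (cong (proj₁ b *_) (sym (young-by-support (n ∸ sumℕ (proj₂ b)) (proj₂ b) (ℕₚ.m∸n+n≡m (ℕₚ.≤-trans s le)) g)))) small) ⟩
  ∑ bs (λ b → proj₁ b * young n ((n ∸ sumℕ (proj₂ b)) ∷ proj₂ b) g) ∎
  where
  S = elems (Subset-finite n)
  h : ∀ A → Permutation′ (size A)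
  h A = restrictDec g A (inv? g A)

-- Inverting the Jacobi-Trudi formula uniformly in the first part

-- `IsShiftOf` for a pair of class functions instead of a sequence. As a single list expands both,
-- the relation passes to linear combinations of pairs.
Good : (n m : ℕ) → ClassFn n → ClassFn (n ℕ.+ m) → Set
Good n m φ ψ = Σ[ cs ∈ List (Term n) ]
  (∀ g → φ g ≡ ∑ cs (λ c → coeff c * irrChar n (addFirst 0 (shape c)) g)) ×
  (∀ g → ψ g ≡ ∑ cs (λ c → coeff c * irrChar (n ℕ.+ m) (addFirst m (shape c)) g))

module _ {n m : ℕ} where

  good-≐ : ∀ {φ φ′ : ClassFn n} {ψ ψ′ : ClassFn (n ℕ.+ m)} → φ′ ≐ φ → ψ′ ≐ ψ → Good n m φ ψ → Good n m φ′ ψ′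
  good-≐ e f (cs , p , q) = cs , (λ g → trans (e g) (p g)) , (λ g → trans (f g) (q g))

  good-zero : Good n m (λ _ → 0ℤ) (λ _ → 0ℤ)
  good-zero = [] , (λ _ → refl) , (λ _ → refl)

  good-+ : ∀ {φ φ′ ψ ψ′} → Good n m φ ψ → Good n m φ′ ψ′ → Good n m (λ g → φ g + φ′ g) (λ g → ψ g + ψ′ g)
  good-+ (cs , p , q) (cs′ , p′ , q′) = cs ++ cs′ ,
    (λ g → trans (cong₂ _+_ (p g) (p′ g)) (sym (∑-++ cs cs′ _))) , (λ g → trans (cong₂ _+_ (q g) (q′ g)) (sym (∑-++ cs cs′ _)))

  good-* : ∀ a {φ ψ} → Good n m φ ψ → Good n m (λ g → a * φ g) (λ g → a * ψ g)
  good-* a (cs , p , q) = map (λ c → record { shape = shape c ; isPart = isPart c ; coeff = a * coeff c }) cs ,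
    (λ g → trans (cong (a *_) (p g)) (scale (λ l → irrChar n (addFirst 0 l) g))) ,
    (λ g → trans (cong (a *_) (q g)) (scale (λ l → irrChar (n ℕ.+ m) (addFirst m l) g)))
    where
    scale : ∀ (f : List ℕ → ℤ) → a * ∑ cs (λ c → coeff c * f (shape c)) ≡ ∑ (map (λ c → record { shape = shape c ; isPart = isPart c ; coeff = a * coeff c }) cs) (λ c → coeff c * f (shape c))
    scale f = trans (sym (∑-*ˡ cs a _)) (trans (∑-cong cs (λ c → sym (ℤₚ.*-assoc a (coeff c) (f (shape c))))) (sym (∑-map _ cs _)))

  good-∑ : ∀ {A : Set} {xs : List A} {φ : A → ClassFn n} {ψ : A → ClassFn (n ℕ.+ m)} → All (λ x → Good n m (φ x) (ψ x)) xs →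
    Good n m (λ g → ∑ xs (λ x → φ x g)) (λ g → ∑ xs (λ x → ψ x g))
  good-∑ [] = good-zero
  good-∑ (s ∷ ss) = good-+ s (good-∑ ss)

-- Rearrangement and growth of the sum of squares

dot : List ℤ → List ℕ → ℤ
dot (κ ∷ κs) (s ∷ ss) = κ * + s + dot κs ss
dot _ _ = 0ℤ

-- With decreasing κs, each step of the least letter x to the right, past a letter y, raises the
-- pairing by (κ₀ - κ₁)(y - x) > 0.
insertions-dot : ∀ x σ κs → All (x <_) σ → AllPairs ℤ._>_ κs → length κs ≡ suc (length σ) →
  ∃[ others ] insertions x σ ≡ (x ∷ σ) ∷ others × All (λ τ → dot κs (x ∷ σ) ℤ.< dot κs τ) others
insertions-dot x [] κs _ _ _ = [] , refl , []
insertions-dot x (y ∷ ys) (κ₀ ∷ κ₁ ∷ κs) (x<y ∷ x<ys) ((κ₀>κ₁ ∷ _) ∷ dec) len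
  with insertions-dot x ys (κ₁ ∷ κs) x<ys dec (ℕₚ.suc-injective len)
... | others , eq , gt = map (y ∷_) (insertions x ys) , refl ,
      subst (λ l → All (λ τ → dot (κ₀ ∷ κ₁ ∷ κs) (x ∷ y ∷ ys) ℤ.< dot (κ₀ ∷ κ₁ ∷ κs) τ) (map (y ∷_) l)) (sym eq)
        (swapped ∷ Allₚ.map⁺ (All.map (λ lt → ℤₚ.<-trans swapped (ℤₚ.+-monoʳ-< (κ₀ * + y) lt)) gt))
  where
  d e : ℤ
  d = κ₀ - κ₁
  e = + y - + x
  d>0 : 0ℤ ℤ.< d
  d>0 = subst (ℤ._< d) (ℤₚ.+-inverseʳ κ₁) (ℤₚ.+-monoˡ-< (- κ₁) κ₀>κ₁)
  e>0 : 0ℤ ℤ.< e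
  e>0 = subst (ℤ._< e) (ℤₚ.+-inverseʳ (+ x)) (ℤₚ.+-monoˡ-< (- + x) (ℤ.+<+ x<y))
  ring : ∀ a b x y r → a * y + (b * x + r) ≡ (a - b) * (y - x) + (a * x + (b * y + r))
  ring = solve-∀
  positive : ∀ {a b} → 0ℤ ℤ.< a → 0ℤ ℤ.< b → 0ℤ ℤ.< a * b
  positive {+ suc a} {+ suc b} _ _ = ℤ.+<+ (s≤s z≤n)
  positive {+ zero} (ℤ.+<+ ()) _
  positive {+ suc a} {+ zero} _ (ℤ.+<+ ())
  swapped : dot (κ₀ ∷ κ₁ ∷ κs) (x ∷ y ∷ ys) ℤ.< dot (κ₀ ∷ κ₁ ∷ κs) (y ∷ x ∷ ys)
  swapped = subst₂ ℤ._<_ (ℤₚ.+-identityˡ _) (sym (ring κ₀ κ₁ (+ x) (+ y) (dot κs ys)))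
    (ℤₚ.+-monoˡ-< (κ₀ * + x + (κ₁ * + y + dot κs ys)) (positive d>0 e>0))

-- Rearrangement inequality, with the identity as unique minimiser.
perms-dot : ∀ xs κs → AllPairs _<_ xs → AllPairs ℤ._>_ κs → length κs ≡ length xs →
  ∃[ others ] perms xs ≡ xs ∷ others × All (λ τ → dot κs xs ℤ.< dot κs τ) others
perms-dot [] κs _ _ _ = [] , refl , []
perms-dot (x ∷ xs) (κ ∷ κs) (x< ∷ inc) (κ> ∷ dec) len with perms-dot xs κs inc dec (ℕₚ.suc-injective len)
... | others , eq , gt with insertions-dot x xs (κ ∷ κs) x< (κ> ∷ dec) len
...   | others′ , eq′ , gt′ = others′ ++ concatMap (insertions x) others ,
        trans (cong (concatMap (insertions x)) eq) (cong (_++ concatMap (insertions x) others) eq′) ,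
        Allₚ.++⁺ gt′ (Allₚ.concat⁺ (Allₚ.map⁺ (All.zipWith (λ {σ} (p , lt) → rest σ p lt) (tail-↭ , gt))))
  where
  tail-↭ : All (_↭ xs) others
  tail-↭ = All.tail (subst (All (_↭ xs)) eq (perms-↭ xs))
  rest : ∀ σ → σ ↭ xs → dot κs xs ℤ.< dot κs σ → All (λ τ → dot (κ ∷ κs) (x ∷ xs) ℤ.< dot (κ ∷ κs) τ) (insertions x σ)
  rest σ p lt with insertions-dot x σ (κ ∷ κs) (Permₚ.All-resp-↭ (Perm.↭-sym p) x<) (κ> ∷ dec) (trans len (cong suc (sym (Permₚ.↭-length p))))
  ... | others″ , eq″ , gt″ = subst (All _) (sym eq″) (first ∷ All.map (ℤₚ.<-trans first) gt″)
    where
    first : dot (κ ∷ κs) (x ∷ xs) ℤ.< dot (κ ∷ κs) (x ∷ σ)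
    first = ℤₚ.+-monoʳ-< (κ * + x) lt

-- The progress measure of the Jacobi-Trudi recursion: it ignores order and zero parts, is at most
-- the square of the total, and grows in every term other than the identity.
squares : List ℕ → ℕ
squares [] = 0
squares (a ∷ l) = a ℕ.* a ℕ.+ squares l

squares-↭ : ∀ {l l′} → l ↭ l′ → squares l ≡ squares l′
squares-↭ Perm.refl = refl
squares-↭ (Perm.prep a p) = cong (a ℕ.* a ℕ.+_) (squares-↭ p)
squares-↭ (Perm.swap a b p) = trans (cong (λ s → a ℕ.* a ℕ.+ (b ℕ.* b ℕ.+ s)) (squares-↭ p)) (shuffle (a ℕ.* a) (b ℕ.* b) _)
  where shuffle : ∀ a b c → a ℕ.+ (b ℕ.+ c) ≡ b ℕ.+ (a ℕ.+ c)
        shuffle = ℕ-Solver.solve-∀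
squares-↭ (Perm.trans p q) = trans (squares-↭ p) (squares-↭ q)

squares-zeros : ∀ k l → squares (L.replicate k 0 ++ l) ≡ squares l
squares-zeros zero l = refl
squares-zeros (suc k) l = squares-zeros k l

squares≤ : ∀ l → squares l ≤ sumℕ l ℕ.* sumℕ l
squares≤ [] = z≤n
squares≤ (a ∷ l) = ℕₚ.≤-trans (ℕₚ.+-monoʳ-≤ (a ℕ.* a) (squares≤ l))
  (ℕₚ.≤-trans (ℕₚ.m≤m+n _ (2 ℕ.* (a ℕ.* sumℕ l))) (ℕₚ.≤-reflexive (ring a (sumℕ l))))
  where ring : ∀ a s → a ℕ.* a ℕ.+ s ℕ.* s ℕ.+ 2 ℕ.* (a ℕ.* s) ≡ (a ℕ.+ s) ℕ.* (a ℕ.+ s)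
        ring = ℕ-Solver.solve-∀

squaresℤ : List ℤ → ℤ
squaresℤ [] = 0ℤ
squaresℤ (a ∷ l) = a * a + squaresℤ l

+squares : ∀ l → + squares l ≡ squaresℤ (map +_ l)
+squares [] = refl
+squares (a ∷ l) = trans (ℤₚ.pos-+ (a ℕ.* a) (squares l)) (cong₂ _+_ (ℤₚ.pos-* a a) (+squares l))

-- Among rearrangements σ of the columns only the cross term varies, so the rearrangement inequality
-- for `dot` becomes a comparison of sums of squares.
squares-zipAdd : ∀ κs σ → length κs ≡ length σ → squaresℤ (zipAdd κs σ) ≡ squaresℤ κs + (dot κs σ + dot κs σ) + + squares σ
squares-zipAdd [] [] _ = refl
squares-zipAdd (κ ∷ κs) (s ∷ σ) e = trans (cong (_+_ ((κ + + s) * (κ + + s))) (squares-zipAdd κs σ (ℕₚ.suc-injective e)))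
  (trans (ring κ (+ s) (squaresℤ κs) (dot κs σ) (+ squares σ))
    (cong (_+_ (κ * κ + squaresℤ κs + (κ * + s + dot κs σ + (κ * + s + dot κs σ)))) (sym (trans (ℤₚ.pos-+ (s ℕ.* s) (squares σ)) (cong (_+ + squares σ) (ℤₚ.pos-* s s))))))
  where ring : ∀ k s q d r → (k + s) * (k + s) + (q + (d + d) + r) ≡ (k * k + q) + ((k * s + d) + (k * s + d)) + (s * s + r)
        ring = solve-∀

zipAdd-cols : ∀ i λ′ → zipAdd (rows i λ′) (cols i (length λ′)) ≡ map +_ λ′
zipAdd-cols i [] = refl
zipAdd-cols i (a ∷ l) = cong₂ _∷_ (ring (+ a) (+ i)) (zipAdd-cols (suc i) l)
  where ring : ∀ a i → a - i + i ≡ a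
        ring = solve-∀

rows-decreasing : ∀ i {n m λ′} → Part n m λ′ → AllPairs ℤ._>_ (rows i λ′)
rows-decreasing i nil = []
rows-decreasing i (cons {a = a} _ _ p) = All.map (λ {x} le → ℤₚ.≤-<-trans le (ℤₚ.+-monoʳ-< (+ a) (ℤₚ.neg-mono-< (ℤ.+<+ (ℕₚ.n<1+n i))))) (rows-bounded (suc i) p) ∷ rows-decreasing (suc i) p

inversions-cols : ∀ c p → inversions (cols c p) ≡ 0
inversions-cols c zero = refl
inversions-cols c (suc p) = cong₂ ℕ._+_ (none (cols-increasing c (suc p))) (inversions-cols (suc c) p)
  where
  none : ∀ {x xs} → AllPairs _<_ (x ∷ xs) → count (_<ᵇ x) xs ≡ 0
  none (lt ∷ _) = go lt
    where
    go : ∀ {x xs} → All (x <_) xs → count (_<ᵇ x) xs ≡ 0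
    go [] = refl
    go (lt ∷ lts) = cong₂ ℕ._+_ (cong (λ b → if b then 1 else 0) (<ᵇ-false lt)) (go lts)

jt-cols : ∀ i λ′ → jtComp i λ′ (cols i (length λ′)) ≡ just λ′
jt-cols i [] = refl
jt-cols i (a ∷ l) with i ℕ.≤ᵇ (a ℕ.+ i) in le | jtComp (suc i) l (cols (suc i) (length l)) | jt-cols (suc i) l
... | true | .(just l) | refl = cong (λ x → just (x ∷ l)) (ℕₚ.m+n∸n≡m a i)
... | false | .(just l) | refl = contradiction (trans (sym le) (≤ᵇ-refl i a)) λ ()
  where
  ≤ᵇ-refl : ∀ i a → (i ℕ.≤ᵇ (a ℕ.+ i)) ≡ true
  ≤ᵇ-refl i a with i ℕ.≤ᵇ (a ℕ.+ i) | ℕₚ.≤⇒≤ᵇ (ℕₚ.m≤n+m i a)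
  ... | true | _ = refl

-- Row 0 subtracts nothing, so its index a + s is never negative and the rest of the composition
-- does not depend on a. Adding m to the first part thus commutes with each term of the Jacobi-Trudi
-- sum.
jt-head : ∀ a l s ss → jtComp 0 (a ∷ l) (s ∷ ss) ≡ Maybe.map ((a ℕ.+ s) ∷_) (jtComp 1 l ss)
jt-head a l s ss with jtComp 1 l ss
... | just _ = refl
... | nothing = refl

addFirst-∷ : ∀ m a as → addFirst m (a ∷ as) ≡ (m ℕ.+ a) ∷ as
addFirst-∷ zero a as = refl
addFirst-∷ (suc m) a as = refl

module _ (n m : ℕ) (0<n : 0 < n) where

  private
    N = n ℕ.+ m

  good-irrChar : ∀ a l → IsPartition n (a ∷ l) → Good n m (irrChar n (a ∷ l)) (irrChar N ((m ℕ.+ a) ∷ l))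
  good-irrChar a l part = term (a ∷ l) part 1ℤ ∷ [] ,
    (λ g → sym (trans (ℤₚ.+-identityʳ _) (ℤₚ.*-identityˡ (irrChar n (a ∷ l) g)))) ,
    (λ g → sym (trans (ℤₚ.+-identityʳ _) (trans (ℤₚ.*-identityˡ (irrChar N (addFirst m (a ∷ l)) g)) (cong (λ λ′ → irrChar N λ′ g) (addFirst-∷ m a l)))))

  -- young (a ∷ l) = irrChar (a ∷ l) minus the terms of the Jacobi-Trudi sum other than the identity; in those
  -- the first part has not decreased and the sum of squares of the parts has increased.
  good-young-fuel : ∀ fuel a β → a ℕ.+ sumℕ β ≡ n → sumℕ β ≤ a → n ℕ.* n < squares (a ∷ β) ℕ.+ fuel →
    Good n m (young n (a ∷ β)) (young N ((m ℕ.+ a) ∷ β))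
  good-young-fuel zero a β sum le lt = contradiction (subst (λ s → squares (a ∷ β) ≤ s ℕ.* s) sum (squares≤ (a ∷ β)))
    (ℕₚ.<⇒≱ (subst (n ℕ.* n <_) (ℕₚ.+-identityʳ _) lt))
  good-young-fuel (suc fuel) a β sum le lt with normal β
  -- Only β is sorted: a is at least the sum of β, hence at least each of its parts, and the same
  -- holds for m + a. So a stays in front on n and on n + m points alike.
  ... | k , l , part@(_ , _ , sum-l) , β↭ = good-≐ (reorder n a) (reorder N (m ℕ.+ a)) main
    where
    reorder : ∀ n′ a′ g → young n′ (a′ ∷ β) g ≡ young n′ (a′ ∷ l) g
    reorder n′ a′ = young-normal n′ k (a′ ∷ l) (Perm.trans (Perm.prep a′ β↭) (Perm.↭-sym (Permₚ.shift a′ (L.replicate k 0) l)))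
    p = length (a ∷ l)
    0<a : 0 < a
    0<a = ℕₚ.n≢0⇒n>0 (λ a≡0 → ℕₚ.<⇒≱ 0<n (subst (_≤ 0) (trans (cong (ℕ._+ sumℕ β) (sym a≡0)) sum) (subst (sumℕ β ≤_) a≡0 le)))
    isPart-n : Part n a (a ∷ l)
    isPart-n = subst (λ n′ → Part n′ a (a ∷ l)) sum (cons 0<a ℕₚ.≤-refl
      (IsPartition⇒Part part a (All.map (λ x≤ → ℕₚ.≤-trans (subst (_ ≤_) sum-l x≤) le) (parts≤sum l))))
    squares-eq : squares (a ∷ β) ≡ squares (a ∷ l)
    squares-eq = cong (a ℕ.* a ℕ.+_) (trans (squares-↭ β↭) (squares-zeros k l))
    κs = rows 0 (a ∷ l)
    len-κs : length κs ≡ length (cols 0 p)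
    len-κs = trans (length-rows 0 (a ∷ l)) (sym (length-cols 0 p))
    split = perms-dot (cols 0 p) κs (cols-increasing 0 p) (rows-decreasing 0 isPart-n) len-κs
    others = proj₁ split
    perms-eq : perms (cols 0 p) ≡ cols 0 p ∷ others
    perms-eq = proj₁ (proj₂ split)
    others-↭ : All (_↭ cols 0 p) others
    others-↭ = All.tail (subst (All (_↭ cols 0 p)) perms-eq (perms-↭ (cols 0 p)))

    good-term : ∀ σ → σ ↭ cols 0 p → dot κs (cols 0 p) ℤ.< dot κs σ →
      Good n m (λ g → irrTerm n (a ∷ l) g σ) (λ g → irrTerm N ((m ℕ.+ a) ∷ l) g σ)
    good-term [] σ↭ _ = contradiction (Permₚ.↭-length σ↭) λ ()
    good-term σ@(s ∷ ss) σ↭ gt = by-cases (jtComp 1 l ss) refl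
      where
      by-cases : ∀ r → jtComp 1 l ss ≡ r → Good n m (λ g → irrTerm n (a ∷ l) g σ) (λ g → irrTerm N ((m ℕ.+ a) ∷ l) g σ)
      by-cases nothing e = good-≐
        (λ g → irrTerm-nothing n (a ∷ l) g σ (trans (jt-head a l s ss) (cong (Maybe.map _) e)))
        (λ g → irrTerm-nothing N ((m ℕ.+ a) ∷ l) g σ (trans (jt-head (m ℕ.+ a) l s ss) (cong (Maybe.map _) e))) good-zero
      by-cases (just α) e = good-≐
        (λ g → trans (irrTerm-just n (a ∷ l) g σ jt) (cong (signℤ (inversions σ) *_) (youngChar≡young n ((a ℕ.+ s) ∷ α) g)))
        (λ g → trans (irrTerm-just N ((m ℕ.+ a) ∷ l) g σ (trans (jt-head (m ℕ.+ a) l s ss) (cong (Maybe.map _) e)))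
          (cong (signℤ (inversions σ) *_) (trans (youngChar≡young N ((m ℕ.+ a ℕ.+ s) ∷ α) g) (cong (λ x → young N (x ∷ α) g) (ℕₚ.+-assoc m a s)))))
        (good-* (signℤ (inversions σ)) (good-young-fuel fuel (a ℕ.+ s) α sum-α α≤ fuel-ok))
        where
        jt : jtComp 0 (a ∷ l) σ ≡ just ((a ℕ.+ s) ∷ α)
        jt = trans (jt-head a l s ss) (cong (Maybe.map _) e)
        len-σ : length (a ∷ l) ≡ length σ
        len-σ = trans (sym (length-cols 0 p)) (sym (Permₚ.↭-length σ↭))
        sum-α : a ℕ.+ s ℕ.+ sumℕ α ≡ n
        sum-α = ℕₚ.+-cancelʳ-≡ (sumℕ (cols 0 p)) _ n (trans (jt-sum 0 (a ∷ l) σ len-σ jt) (cong₂ ℕ._+_ (Part-sum isPart-n) (sum-↭ σ↭)))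
        -- The total is fixed and the first part has not decreased, so the remaining parts have not
        -- grown in sum.
        α≤ : sumℕ α ≤ a ℕ.+ s
        α≤ = ℕₚ.≤-trans (ℕₚ.+-cancelˡ-≤ (a ℕ.+ s) (sumℕ α) (sumℕ β) (ℕₚ.≤-trans (ℕₚ.≤-reflexive (trans sum-α (sym sum))) (ℕₚ.+-monoˡ-≤ (sumℕ β) (ℕₚ.m≤m+n a s))))
          (ℕₚ.≤-trans le (ℕₚ.m≤m+n a s))
        squares< : squares (a ∷ l) < squares ((a ℕ.+ s) ∷ α)
        squares< = ℤₚ.drop‿+<+ (subst₂ ℤ._<_
          (sym (trans (+squares (a ∷ l)) (trans (cong squaresℤ (sym (zipAdd-cols 0 (a ∷ l)))) (trans (squares-zipAdd κs (cols 0 p) len-κs) (cong (λ q → squaresℤ κs + (dot κs (cols 0 p) + dot κs (cols 0 p)) + + q) (sym (squares-↭ σ↭)))))))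
          (sym (trans (+squares ((a ℕ.+ s) ∷ α)) (trans (cong squaresℤ (jt-just 0 (a ∷ l) σ len-σ jt)) (squares-zipAdd κs σ (trans (length-rows 0 (a ∷ l)) len-σ)))))
          (ℤₚ.+-monoˡ-< (+ squares σ) (ℤₚ.+-monoʳ-< (squaresℤ κs) (ℤₚ.+-mono-< gt gt))))
        fuel-ok : n ℕ.* n < squares ((a ℕ.+ s) ∷ α) ℕ.+ fuel
        fuel-ok = ℕₚ.<-≤-trans (subst (n ℕ.* n <_) (trans (ℕₚ.+-suc (squares (a ∷ β)) fuel) (cong (λ q → suc (q ℕ.+ fuel)) squares-eq)) lt) (ℕₚ.+-monoˡ-≤ fuel squares<)

    identity-term : ∀ n′ a′ g → irrTerm n′ (a′ ∷ l) g (cols 0 p) ≡ young n′ (a′ ∷ l) g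
    identity-term n′ a′ g = trans (irrTerm-just n′ (a′ ∷ l) g (cols 0 p) (jt-cols 0 (a′ ∷ l)))
      (trans (cong (λ i → signℤ i * youngChar n′ (a′ ∷ l) g) (inversions-cols 0 p)) (trans (ℤₚ.*-identityˡ _) (youngChar≡young n′ (a′ ∷ l) g)))

    solve-for-young : ∀ n′ a′ g → young n′ (a′ ∷ l) g ≡ irrChar n′ (a′ ∷ l) g + -[1+ 0 ] * ∑ others (irrTerm n′ (a′ ∷ l) g)
    solve-for-young n′ a′ g = trans (ring (young n′ (a′ ∷ l) g) (∑ others (irrTerm n′ (a′ ∷ l) g))) (cong (_+ -[1+ 0 ] * ∑ others (irrTerm n′ (a′ ∷ l) g)) (sym (begin
      irrChar n′ (a′ ∷ l) g
        ≡⟨ irrChar-∑ n′ (a′ ∷ l) g ⟩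
      ∑ (perms (upTo p)) (irrTerm n′ (a′ ∷ l) g)
        ≡⟨ cong (λ xs → ∑ xs (irrTerm n′ (a′ ∷ l) g)) (trans (cong perms (upTo≡cols p)) perms-eq) ⟩
      irrTerm n′ (a′ ∷ l) g (cols 0 p) + ∑ others (irrTerm n′ (a′ ∷ l) g)
        ≡⟨ cong (_+ ∑ others (irrTerm n′ (a′ ∷ l) g)) (identity-term n′ a′ g) ⟩
      young n′ (a′ ∷ l) g + ∑ others (irrTerm n′ (a′ ∷ l) g) ∎)))
      where
      ring : ∀ y o → y ≡ y + o + -[1+ 0 ] * o
      ring = solve-∀

    main : Good n m (young n (a ∷ l)) (young N ((m ℕ.+ a) ∷ l))
    main = good-≐ (solve-for-young n a) (solve-for-young N (m ℕ.+ a))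
      (good-+ (good-irrChar a l (Part⇒IsPartition isPart-n)) (good-* -[1+ 0 ]
        (good-∑ {φ = λ σ g → irrTerm n (a ∷ l) g σ} {ψ = λ σ g → irrTerm N ((m ℕ.+ a) ∷ l) g σ}
          (All.zipWith (λ {σ} (q , gt) → good-term σ q gt) (others-↭ , proj₂ (proj₂ split))))))

  good-young : ∀ a β → a ℕ.+ sumℕ β ≡ n → sumℕ β ≤ a → Good n m (young n (a ∷ β)) (young N ((m ℕ.+ a) ∷ β))
  -- Sums of squares never exceed n², so n² + 1 rounds suffice.
  good-young a β sum le = good-young-fuel (suc (n ℕ.* n)) a β sum le (ℕₚ.≤-trans (ℕₚ.n<1+n (n ℕ.* n)) (ℕₚ.m≤n+m (suc (n ℕ.* n)) (squares (a ∷ β))))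

-- Stability of the rank-selected characters

sublists-All : ∀ {P : ℕ → Set} {S} → All P S → All (All P) (sublists S)
sublists-All [] = [] ∷ []
sublists-All (p ∷ ps) = Allₚ.++⁺ (Allₚ.map⁺ (All.map (p ∷_) (sublists-All ps))) (sublists-All ps)

4*-split : ∀ i → 4 ℕ.* i ≡ 2 ℕ.* i ℕ.+ 2 ℕ.* i
4*-split = ℕ-Solver.solve-∀

module _ (i m : ℕ) (0<i : 0 < i) where

  private
    n = 4 ℕ.* i

    2i≤n : 2 ℕ.* i ≤ n
    2i≤n = ℕₚ.*-monoˡ-≤ i {2} {4} (s≤s (s≤s z≤n))

    0<n : 0 < n
    0<n = ℕₚ.<-≤-trans 0<i (ℕₚ.m≤m+n i _)

  -- The place where 4i enters: |β| ≤ 2i ≤ 4i - |β|, so the first part dominates the rest.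
  good-summand : ∀ β → sumℕ β ≤ 2 ℕ.* i → Good n m (young n ((n ∸ sumℕ β) ∷ β)) (young (n ℕ.+ m) ((n ℕ.+ m ∸ sumℕ β) ∷ β))
  good-summand β le = subst (λ a → Good n m (young n ((n ∸ sumℕ β) ∷ β)) (young (n ℕ.+ m) (a ∷ β))) (sym first)
      (good-young n m 0<n (n ∸ sumℕ β) β (ℕₚ.m∸n+n≡m (ℕₚ.≤-trans le 2i≤n)) (ℕₚ.≤-trans le (ℕₚ.m+n≤o⇒m≤o∸n (2 ℕ.* i)
        (ℕₚ.≤-trans (ℕₚ.+-monoʳ-≤ (2 ℕ.* i) le) (ℕₚ.≤-reflexive (sym (4*-split i)))))))
    where
    first : n ℕ.+ m ∸ sumℕ β ≡ m ℕ.+ (n ∸ sumℕ β)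
    first = trans (cong (_∸ sumℕ β) (ℕₚ.+-comm n m)) (ℕₚ.+-∸-assoc m (ℕₚ.≤-trans le 2i≤n))

  good-alpha : ∀ T → All (_≤ i) T → Good n m (alphaΠ n T) (alphaΠ (n ℕ.+ m) T)
  good-alpha T les = good-≐ (alpha-expansion {i} T bs small exp n 2i≤n) (alpha-expansion {i} T bs small exp (n ℕ.+ m) (ℕₚ.≤-trans 2i≤n (ℕₚ.m≤m+n n m)))
    (good-∑ {φ = λ b g → proj₁ b * young n ((n ∸ sumℕ (proj₂ b)) ∷ proj₂ b) g} {ψ = λ b g → proj₁ b * young (n ℕ.+ m) ((n ℕ.+ m ∸ sumℕ (proj₂ b)) ∷ proj₂ b) g}
      (All.map (λ {b} le → good-* (proj₁ b) (good-summand (proj₂ b) le)) small))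
    where
    expansion = fullChar-expansion T i les
    bs = proj₁ expansion
    small = proj₁ (proj₂ expansion)
    exp = proj₂ (proj₂ expansion)

beta-∑ : ∀ n S g → betaΠ n S g ≡ ∑ (sublists S) (λ T → signℤ (length S ∸ length T) * alphaΠ n T g)
beta-∑ n S g = ∑-sumℤ _ (sublists S)

beta-stabilizes : ∀ S i → 0 < i → All (_≤ i) S → StabilizesBeyond (λ n → betaΠ n S) (4 ℕ.* i)
beta-stabilizes S i 0<i les m = proj₁ good ,
  (λ g → trans (beta-∑ (4 ℕ.* i) S g) (trans (proj₁ (proj₂ good) g) (sym (∑-sumℤ _ (proj₁ good))))) ,
  (λ g → trans (beta-∑ (4 ℕ.* i ℕ.+ m) S g) (trans (proj₂ (proj₂ good) g) (sym (∑-sumℤ _ (proj₁ good)))))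
  where
  φ : ∀ n → List ℕ → ClassFn n
  φ n T g = signℤ (length S ∸ length T) * alphaΠ n T g
  good = good-∑ {xs = sublists S} {φ = φ (4 ℕ.* i)} {ψ = φ (4 ℕ.* i ℕ.+ m)}
    (All.map (λ {T} q → good-* (signℤ (length S ∸ length T)) {alphaΠ (4 ℕ.* i) T} {alphaΠ (4 ℕ.* i ℕ.+ m) T} (good-alpha i m 0<i T q)) (sublists-All les))

-- A functional vanishing on the irreducible characters χ^λ with λ₁ > λ₂

-- In a one-column matrix each entry equals its row sum, so lowering the first row sum by 1 lowers
-- the column sum by 1.
M-shift : ∀ v l j → M (+ suc v ∷ l) (suc j ∷ []) ≡ M (+ v ∷ l) (j ∷ [])
M-shift v l j = trans (∑-upTo (suc j) (λ s → T⁻ (suc j ∸ s) (λ l′ → M ((+ suc v - + s) ∷ l′) []) l)) (trans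
  (cong₂ _+_ (T⁻-zero (suc j) l (λ l′ → refl)) (∑-cong (upTo (suc j)) (λ s → T⁻-cong (j ∸ s) l (λ l′ _ → cong (λ x → M (x ∷ l′) []) (suc-cancel v s)))))
  (ℤₚ.+-identityˡ _))
  where
  ring : ∀ v s → 1ℤ + v - (1ℤ + s) ≡ v - s
  ring = solve-∀
  suc-cancel : ∀ v s → + suc v - + suc s ≡ + v - + s
  suc-cancel v s = trans (cong₂ _-_ (ℤₚ.pos-+ 1 v) (ℤₚ.pos-+ 1 s)) (ring (+ v) (+ s))

rows-suc-bounded : ∀ {n b′ λ′ h} → Part n b′ λ′ → b′ < h → All (ℤ._< + h) (rows 1 λ′)
rows-suc-bounded {b′ = b′} {h = h} p lt = All.map (λ {x} le → ℤₚ.≤-<-trans le (ℤₚ.≤-<-trans (ℤₚ.i≤j⇒i-k≤j {+ b′} {+ b′} (+ 1) ℤₚ.≤-refl) (ℤ.+<+ lt))) (rows-bounded 1 p)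

K-row : ∀ {n b′} b λ′ h γ → Part n b′ λ′ → b′ < h → K (b ∷ λ′) (h ∷ γ) ≡
  Alt (cols 1 (length λ′)) (rows 1 λ′) (λ l → M ((+ b + 0ℤ + 0ℤ - + h) ∷ l) γ)
K-row b λ′ h γ p lt = trans (K-expand b λ′ h γ) (trans (cong (_-_ (Alt (cols 1 (length λ′)) (rows 1 λ′) (λ l → M ((+ b + 0ℤ + 0ℤ - + h) ∷ l) γ)))
    (Pick-All (rows-suc-bounded p lt) (λ κ r κ<h → K-column-neg (cols 1 (length λ′)) ((+ b + 0ℤ) ∷ r) h γ κ<h)))
  (ℤₚ.+-identityʳ _))

-- Put h = j + 1. As η_(h, h) - η_(h+1, h-1) is χ^(h, h), this is orthogonality to χ^(h, h). The
-- parts after b are below h, so only the first row can be picked in the first column; it is left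
-- with b - h against the column h, or with b - h - 1 against h - 1, and `M-shift` identifies the
-- two when b > h.
K-two-rows : ∀ {n b′} b λ′ j → Part n b′ λ′ → b′ < suc j →
  K (b ∷ λ′) (suc j ∷ suc j ∷ []) ≡ K (b ∷ λ′) (suc (suc j) ∷ j ∷ [])
K-two-rows {b′ = b′} b λ′ j p lt = trans (K-row b λ′ (suc j) (suc j ∷ []) p lt) (trans (compare (ℕₚ.<-cmp b (suc j))) (sym (K-row b λ′ (suc (suc j)) (j ∷ []) p (ℕₚ.m<n⇒m<1+n lt))))
  where
  cs = cols 1 (length λ′)
  ks = rows 1 λ′
  u : ℕ → ℤ
  u h = + b + 0ℤ + 0ℤ - + h
  ring : ∀ b h → b + 0ℤ + 0ℤ - h ≡ b - h
  ring = solve-∀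
  u-neg : ∀ h → b < h → u h ℤ.< 0ℤ
  u-neg h b<h = subst (ℤ._< 0ℤ) (sym (ring (+ b) (+ h))) (i<j⇒i-j<0 (+ h) (ℤ.+<+ b<h))
  compare : Tri (b < suc j) (b ≡ suc j) (suc j < b) →
    Alt cs ks (λ l → M (u (suc j) ∷ l) (suc j ∷ [])) ≡ Alt cs ks (λ l → M (u (suc (suc j)) ∷ l) (j ∷ []))
  compare (tri< b<h _ _) = trans (Alt-zero cs ks (λ l _ → M-neg l (suc j ∷ []) (u-neg (suc j) b<h))) (sym (Alt-zero cs ks (λ l _ → M-neg l (j ∷ []) (u-neg (suc (suc j)) (ℕₚ.m<n⇒m<1+n b<h)))))
  -- For b = h the first row is used up on the left, and λ′, with parts below h, is paired with the
  -- single column h; on the right the first row has become negative.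
  compare (tri≈ _ refl _) = trans (Alt-cong cs ks (λ l _ → trans (cong (λ x → M (x ∷ l) (suc j ∷ [])) (trans (ring (+ b) (+ b)) (ℤₚ.+-inverseʳ (+ b)))) (M-zero l (suc j ∷ []))))
    (trans (Alt-rows-suc λ′ (λ l → M l (suc j ∷ []))) (trans (K-large [] lt p)
      (sym (Alt-zero cs ks (λ l _ → M-neg l (j ∷ []) (u-neg (suc (suc j)) (ℕₚ.n<1+n (suc j))))))))
  compare (tri> _ _ h<b) with ℕₚ.m≤n⇒∃[o]m+o≡n h<b
  ... | v , refl = Alt-cong cs ks (λ l _ → trans (cong (λ x → M (x ∷ l) (suc j ∷ [])) (diff (suc j) (suc v) (ℕₚ.+-suc (suc j) v)))
      (trans (M-shift v l j) (cong (λ x → M (x ∷ l) (j ∷ [])) (sym (diff (suc (suc j)) v refl)))))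
    where
    diff : ∀ h w → h ℕ.+ w ≡ suc (suc j) ℕ.+ v → u h ≡ + w
    diff h w e = trans (ring (+ b) (+ h)) (trans (cong (λ x → + x - + h) (sym e)) (trans (cong (_- + h) (ℤₚ.pos-+ h w)) (cancel (+ h) (+ w))))
      where cancel : ∀ h w → h + w - h ≡ w
            cancel = solve-∀

young-total : ∀ n γ → sumℕ γ ≡ n → ∑ᴳ (young n γ) ≡ ord n
young-total n γ e with Coloured.word-exists (length γ) n (λ j → lookup (V.fromList γ) j) (trans (∑-colours γ) (cong +_ e))
... | f , h = GSet.transitive-sum (W.words n) (W.has (colours γ)) (tabulate f) (⌊⌋-true (W.content? (colours γ) (tabulate f)) y-cnt)
    (W.has-invariant n (colours γ)) (λ x x∈ → W.same-content-act (tabulate f) x (λ a → trans (y-cnt a) (sym (true-⌊⌋ (W.content? (colours γ) x) x∈ a))))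
  where
  module W = Coloured (length γ)
  y-cnt : ∀ a → W.cnt (lookup (tabulate f)) a ≡ colours γ a
  y-cnt a = trans (W.cnt-cong (Vₚ.lookup∘tabulate f) a) (h a)

-- Subtracting more than the total of β makes some entry negative, and F vanishes there.
T⁻-overflow : ∀ c F β → sumℕ β < c → (∀ {l} → Any (ℤ._< 0ℤ) l → F l ≡ 0ℤ) → T⁻ c F (map +_ β) ≡ 0ℤ
T⁻-overflow (suc c) F [] lt h = refl
T⁻-overflow c F (b ∷ β) lt h = trans (∑-upTo-cong (suc c) {g = λ _ → 0ℤ} (λ s s≤ → summand s (ℕₚ.≤-<-connex s b))) (∑-zero (upTo (suc c)) (λ _ → refl))
  where
  summand : ∀ s → s ≤ b ⊎ b < s → T⁻ (c ∸ s) (λ l → F ((+ b - + s) ∷ l)) (map +_ β) ≡ 0ℤ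
  summand s (inj₁ le) = T⁻-overflow (c ∸ s) _ β (ℕₚ.m+n≤o⇒m≤o∸n (suc (sumℕ β)) (ℕₚ.≤-trans (s≤s (ℕₚ.≤-trans (ℕₚ.+-monoʳ-≤ (sumℕ β) le) (ℕₚ.≤-reflexive (ℕₚ.+-comm (sumℕ β) b)))) lt)) (λ p → h (there p))
  summand s (inj₂ b<s) = T⁻-zero (c ∸ s) (map +_ β) (λ l → h (here (i<j⇒i-j<0 (+ s) (ℤ.+<+ b<s))))

M-one-column : ∀ β → M (map +_ β) (sumℕ β ∷ []) ≡ 1ℤ
M-one-column [] = refl
M-one-column (b ∷ β) = trans (∑-upTo-single (suc (b ℕ.+ sumℕ β)) b _ (s≤s (ℕₚ.m≤m+n b (sumℕ β))) (λ s ne → T⁻-zero (b ℕ.+ sumℕ β ∸ s) (map +_ β) (λ l → head-nonzero s l ne)))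
  (trans (cong (λ c → T⁻ c (λ l → M ((+ b - + b) ∷ l) []) (map +_ β)) (ℕₚ.m+n∸m≡n b (sumℕ β)))
    (trans (T⁻-cong (sumℕ β) (map +_ β) (λ l _ → cong (λ x → M (x ∷ l) []) (ℤₚ.+-inverseʳ (+ b)))) (M-one-column β)))
  where
  head-nonzero : ∀ s l → s ≢ b → M ((+ b - + s) ∷ l) [] ≡ 0ℤ
  head-nonzero s l ne with (+ b - + s) ℤ.≟ 0ℤ
  ... | yes e = contradiction (sym (ℤₚ.+-injective (ℤₚ.i-j≡0⇒i≡j (+ b) (+ s) e))) ne
  ... | no _ = refl

T⁻-0 : ∀ F l → T⁻ 0 F l ≡ F l
T⁻-0 F [] = ℤₚ.*-identityˡ (F [])
T⁻-0 F (u ∷ l) = trans (ℤₚ.+-identityʳ _) (trans (T⁻-0 _ l) (cong (λ x → F (x ∷ l)) (ℤₚ.+-identityʳ u)))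

-- Put h = j + 1 and a = 2h - |β|. Moving one unit of the first row from the second column to the
-- first is a bijection away from two boundary cases. A matrix on the left whose first row has
-- nothing in the second column forces a = h = |β| and is then unique. One on the right whose first
-- row has nothing in the first column would need |β| > h.
M-two-rows : ∀ j β → sumℕ β ≤ suc j → M (map +_ ((suc j ℕ.+ suc j ∸ sumℕ β) ∷ β)) (suc j ∷ suc j ∷ []) ≡
  M (map +_ ((suc j ℕ.+ suc j ∸ sumℕ β) ∷ β)) (suc (suc j) ∷ j ∷ []) + ⟦ sumℕ β ≡ᵇ suc j ⟧
M-two-rows j β le = begin
  ∑ (upTo (suc h)) (λ s → T⁻ (h ∸ s) (λ l → M ((+ a - + s) ∷ l) (h ∷ [])) (map +_ β))
    ≡⟨ ∑-upTo-last h (λ s → T⁻ (h ∸ s) (λ l → M ((+ a - + s) ∷ l) (h ∷ [])) (map +_ β)) ⟩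
  ∑ (upTo h) (λ s → T⁻ (h ∸ s) (λ l → M ((+ a - + s) ∷ l) (h ∷ [])) (map +_ β)) + T⁻ (h ∸ h) (λ l → M ((+ a - + h) ∷ l) (h ∷ [])) (map +_ β)
    ≡⟨ cong₂ _+_ (∑-upTo-cong h (λ s lt → T⁻-cong (h ∸ s) (map +_ β) (λ l _ → step s (ℕₚ.<-≤-trans lt h≤a) l))) (last-term (ℕₚ.m≤n⇒m<n∨m≡n le)) ⟩
  ∑ (upTo h) R + (R h + e)
    ≡⟨ sym (ℤₚ.+-assoc (∑ (upTo h) R) (R h) e) ⟩
  (∑ (upTo h) R + R h) + e
    ≡⟨ cong (_+ e) (sym (∑-upTo-last h R)) ⟩
  ∑ (upTo (suc h)) R + e
    ≡⟨ cong (_+ e) (sym (trans (∑-upTo (suc h) (λ s → T⁻ (suc h ∸ s) (λ l → M ((+ a - + s) ∷ l) (j ∷ [])) (map +_ β)))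
         (trans (cong (_+ ∑ (upTo (suc h)) R) (T⁻-overflow (suc h) (λ l → M ((+ a - + 0) ∷ l) (j ∷ [])) β (s≤s le) (λ p → M-any-neg (j ∷ []) (there {x = + a - + 0} p)))) (ℤₚ.+-identityˡ (∑ (upTo (suc h)) R))))) ⟩
  M (map +_ (a ∷ β)) (suc h ∷ j ∷ []) + e ∎
  where
  h = suc j
  a = h ℕ.+ h ∸ sumℕ β
  e = ⟦ sumℕ β ≡ᵇ h ⟧
  R : ℕ → ℤ
  R s = T⁻ (h ∸ s) (λ l → M ((+ a - + suc s) ∷ l) (j ∷ [])) (map +_ β)
  h≤a : h ≤ a
  h≤a = ℕₚ.m+n≤o⇒m≤o∸n h (ℕₚ.+-monoʳ-≤ h le)
  step : ∀ s → s < a → ∀ l → M ((+ a - + s) ∷ l) (h ∷ []) ≡ M ((+ a - + suc s) ∷ l) (j ∷ [])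
  step s lt l with ℕₚ.m≤n⇒∃[o]m+o≡n lt
  ... | v , eq = trans (cong (λ x → M (x ∷ l) (h ∷ [])) (diff s (suc v) (trans (ℕₚ.+-suc s v) eq))) (trans (M-shift v l j) (cong (λ x → M (x ∷ l) (j ∷ [])) (sym (diff (suc s) v eq))))
    where
    diff : ∀ s w → s ℕ.+ w ≡ a → + a - + s ≡ + w
    diff s w e = trans (cong (λ x → + x - + s) (sym e)) (trans (cong (_- + s) (ℤₚ.pos-+ s w)) (cancel (+ s) (+ w)))
      where cancel : ∀ h w → h + w - h ≡ w
            cancel = solve-∀
  ≡ᵇ-false : ∀ x y → x < y → (x ≡ᵇ y) ≡ false
  ≡ᵇ-false x y lt with x ≡ᵇ y in eq
  ... | false = refl
  ... | true = contradiction (≡ᵇ-sound {x} eq) (ℕₚ.<⇒≢ lt)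
  last-term : sumℕ β < h ⊎ sumℕ β ≡ h → T⁻ (h ∸ h) (λ l → M ((+ a - + h) ∷ l) (h ∷ [])) (map +_ β) ≡ R h + e
  last-term (inj₁ lt) = trans (T⁻-cong (h ∸ h) (map +_ β) (λ l _ → step h h<a l)) (sym (trans (cong (λ b → R h + ⟦ b ⟧) (≡ᵇ-false (sumℕ β) h lt)) (ℤₚ.+-identityʳ (R h))))
    where
    h<a : h < a
    h<a = ℕₚ.m+n≤o⇒m≤o∸n (suc h) (subst (_≤ h ℕ.+ h) (ℕₚ.+-suc h (sumℕ β)) (ℕₚ.+-monoʳ-≤ h lt))
  last-term (inj₂ eq) = begin
    T⁻ (h ∸ h) (λ l → M ((+ a - + h) ∷ l) (h ∷ [])) (map +_ β)
      ≡⟨ cong (λ c → T⁻ c (λ l → M ((+ a - + h) ∷ l) (h ∷ [])) (map +_ β)) (ℕₚ.n∸n≡0 h) ⟩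
    T⁻ 0 (λ l → M ((+ a - + h) ∷ l) (h ∷ [])) (map +_ β)
      ≡⟨ T⁻-0 _ (map +_ β) ⟩
    M ((+ a - + h) ∷ map +_ β) (h ∷ [])
      ≡⟨ trans (cong (λ x → M (x ∷ map +_ β) (h ∷ [])) (trans (cong (λ x → + x - + h) a≡h) (ℤₚ.+-inverseʳ (+ h)))) (M-zero (map +_ β) (h ∷ [])) ⟩
    M (map +_ β) (h ∷ [])
      ≡⟨ trans (cong (λ c → M (map +_ β) (c ∷ [])) (sym eq)) (M-one-column β) ⟩
    1ℤ
      ≡⟨ sym (cong₂ (λ x b → x + ⟦ b ⟧) (T⁻-zero (h ∸ h) (map +_ β) (λ l → M-neg l (j ∷ []) negative)) (≡ᵇ-true eq)) ⟩
    R h + e ∎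
    where
    a≡h : a ≡ h
    a≡h = trans (cong (h ℕ.+ h ∸_) eq) (ℕₚ.m+n∸n≡m h h)
    negative : + a - + suc h ℤ.< 0ℤ
    negative = subst (λ x → + x - + suc h ℤ.< 0ℤ) (sym a≡h) (i<j⇒i-j<0 (+ suc h) (ℤ.+<+ (ℕₚ.n<1+n h)))

-- The perfect matching {j, i + j} of 2i points

module Matching (i : ℕ) where

  fold : Fin (i ℕ.+ i) → Fin i
  fold x = Sum.[ id , id ] (F.splitAt i x)

  matching : Rel (i ℕ.+ i)
  matching = mkRel (λ x y → ⌊ fold x Fₚ.≟ fold y ⌋)

  rel-matching : ∀ x y → rel matching x y ≡ ⌊ fold x Fₚ.≟ fold y ⌋
  rel-matching = rel-mkRel _

  matching-Equiv : Equiv matching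
  matching-Equiv = record
    { reflx = λ x → trans (rel-matching x x) (⌊⌋-true (fold x Fₚ.≟ fold x) refl)
    ; symm = λ {x} {y} e → trans (rel-matching y x) (⌊⌋-true (fold y Fₚ.≟ fold x) (sym (same e)))
    ; trns = λ {x} {y} {z} e e′ → trans (rel-matching x z) (⌊⌋-true (fold x Fₚ.≟ fold z) (trans (same e) (same e′))) }
    where
    same : ∀ {x y} → rel matching x y ≡ true → fold x ≡ fold y
    same {x} {y} e = true-⌊⌋ (fold x Fₚ.≟ fold y) (trans (sym (rel-matching x y)) e)

  fold-ˡ : ∀ j → fold (j F.↑ˡ i) ≡ j
  fold-ˡ j = cong Sum.[ id , id ] (Fₚ.splitAt-↑ˡ i j i)

  fold-ʳ : ∀ j → fold (i F.↑ʳ j) ≡ j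
  fold-ʳ j = cong Sum.[ id , id ] (Fₚ.splitAt-↑ʳ i i j)

  matching-rank : rank matching ≡ i
  matching-rank = trans (cong (i ℕ.+ i ∸_) blocks) (ℕₚ.m+n∸n≡m i i)
    where
    blocks : numBlocks matching ≡ i
    blocks = ℤₚ.+-injective (trans (numBlocks-∑ matching) (trans
      (∑-double (allFin (i ℕ.+ i)) (allFin i) (isRep matching) (λ _ → true) (λ x j → ⌊ fold x Fₚ.≟ j ⌋)
        (λ x _ → trans (∑-cong (allFin i) (λ j → trans (ℤₚ.*-identityˡ ⟦ ⌊ fold x Fₚ.≟ j ⌋ ⟧) (cong ⟦_⟧ (⌊⌋-cong (fold x Fₚ.≟ j) (j Fₚ.≟ fold x) sym sym)))) (Finite.once (Fin-finite i) (fold x)))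
        (λ j _ → trans (∑-cong (allFin (i ℕ.+ i)) (λ x → cong (λ b → ⟦ isRep matching x ⟧ * ⟦ b ⟧) (trans (cong (λ z → ⌊ fold x Fₚ.≟ z ⌋) (sym (fold-ˡ j))) (sym (rel-matching x (j F.↑ˡ i))))))
                       (one-rep′ matching-Equiv (j F.↑ˡ i))))
      (∑-one i)))

  matching-touches : ∀ x → touches matching x ≡ true
  matching-touches x with F.splitAt i x in e
  ... | inj₁ j = touches-intro matching {x} {i F.↑ʳ j} (trans (rel-matching x (i F.↑ʳ j)) (⌊⌋-true (fold x Fₚ.≟ fold (i F.↑ʳ j)) (trans (cong Sum.[ id , id ] e) (sym (fold-ʳ j)))))
        (λ eq → contradiction (trans (sym e) (trans (cong (F.splitAt i) eq) (Fₚ.splitAt-↑ʳ i i j))) λ ())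
  ... | inj₂ j = touches-intro matching {x} {j F.↑ˡ i} (trans (rel-matching x (j F.↑ˡ i)) (⌊⌋-true (fold x Fₚ.≟ fold (j F.↑ˡ i)) (trans (cong Sum.[ id , id ] e) (sym (fold-ˡ j)))))
        (λ eq → contradiction (trans (sym e) (trans (cong (F.splitAt i) eq) (Fₚ.splitAt-↑ˡ i j i))) λ ())

  -- At the identity the character counts chains, and the matching is one of them.
  fullChar-matching : fullChar (i ∷ []) (i ℕ.+ i) P.id ≢ 0ℤ
  fullChar-matching z = contradiction (trans (sym (cong₂ (λ a b → ⟦ a ⟧ * ⟦ b ⟧) good fixed)) (Finite.∑-zero⇒ (GSet.finite G)
      {λ c → ⟦ valid (bottom (i ℕ.+ i)) (i ∷ []) c ∧ full c ⟧ * ⟦ GSet.fix G P.id c ⟧}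
      (λ c → subst (0ℤ ℤ.≤_) (⟦∧⟧ (valid (bottom (i ℕ.+ i)) (i ∷ []) c ∧ full c) (GSet.fix G P.id c)) (⟦⟧-nonneg ((valid (bottom (i ℕ.+ i)) (i ∷ []) c ∧ full c) ∧ GSet.fix G P.id c))) z (matching ∷ []))) λ ()
    where
    G = chains 1 (i ℕ.+ i)
    good : (valid (bottom (i ℕ.+ i)) (i ∷ []) (matching ∷ []) ∧ full (matching ∷ [])) ≡ true
    good = true-∧ (valid-complete (bottom (i ℕ.+ i)) (i ∷ []) (matching ∷ [])
        (matching-Equiv , matching-rank , (λ x y r → subst (λ z → rel matching x z ≡ true) (true-⌊⌋ (x Fₚ.≟ y) (trans (sym (rel-bottom x y)) r)) (Equiv.reflx matching-Equiv x)) , tt))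
      (allB-complete (supp (matching ∷ [])) (λ x → true-∨ˡ (matching-touches x)))
    fixed : GSet.fix G P.id (matching ∷ []) ≡ true
    fixed = ⌊⌋-true (GSet._≟ˣ_ G _ (matching ∷ [])) (GSet.act-id G (matching ∷ []))

-- The sum is the group order times the multiplicity of the trivial character in V_2i. Its terms are
-- nonnegative, and the one at the identity is not 0.
fullChar-sum≢0 : ∀ i → ∑ᴳ (fullChar (i ∷ []) (2 ℕ.* i)) ≢ 0ℤ
fullChar-sum≢0 i = subst (λ h → ∑ᴳ (fullChar (i ∷ []) h) ≢ 0ℤ) (cong (i ℕ.+_) (sym (ℕₚ.+-identityʳ i)))
  (λ z → Matching.fullChar-matching i (∑ᴳ-zero⇒ (GSet.perm-char-ext G p) nonneg z P.id))
  where
  G = chains 1 (i ℕ.+ i)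
  p : GSet.X G → Bool
  p c = valid (bottom (i ℕ.+ i)) (i ∷ []) c ∧ full c
  nonneg : ∀ g → 0ℤ ℤ.≤ fullChar (i ∷ []) (i ℕ.+ i) g
  nonneg g = ∑-nonneg (elems (GSet.finite G)) (λ c → subst (0ℤ ℤ.≤_) (⟦∧⟧ (p c) (GSet.fix G g c)) (⟦⟧-nonneg (p c ∧ GSet.fix G g c)))

-- Sharpness

-- With h = j + 1, a partition of k = 2h - m has its parts after the first below h, as two parts of
-- at least h would exceed its total. The shift enlarges only the first part, so `K-two-rows`
-- applies.
shifted-two-rows : ∀ {k} m j → 0 < m → k ℕ.+ m ≡ suc j ℕ.+ suc j → ∀ λ′ → IsPartition k λ′ →
  K (addFirst m λ′) (suc j ∷ suc j ∷ []) ≡ K (addFirst m λ′) (suc (suc j) ∷ j ∷ [])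
shifted-two-rows (suc m) j _ _ [] _ = K-two-rows (suc m) [] j (nil {0}) (s≤s z≤n)
shifted-two-rows {k} m j 0<m e (a ∷ l) part = trans (cong (λ λ′ → K λ′ (suc j ∷ suc j ∷ [])) (addFirst-∷ m a l))
    (trans (K-two-rows (m ℕ.+ a) l j (small (IsPartition⇒Part′ part)) (ℕₚ.n<1+n j)) (sym (cong (λ λ′ → K λ′ (suc (suc j) ∷ j ∷ [])) (addFirst-∷ m a l))))
  where
  below : ∀ {n′ b x γ} → Part n′ b γ → x ∈ γ → x ≤ b × x ≤ n′
  below (cons {n} {a = a} p q r) (here refl) = q , ℕₚ.m≤m+n a n
  below (cons {n} {a = a} p q r) (there x∈) = let u , v = below r x∈ in ℕₚ.≤-trans u q , ℕₚ.≤-trans v (ℕₚ.m≤n+m n a)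
  -- 2x + m ≤ a + x + m ≤ 2(j + 1) with m > 0.
  bound : ∀ {x} → x ≤ a → a ℕ.+ x ≤ k → x ≤ j
  bound {x} x≤a le with ℕₚ.≤-<-connex x j
  ... | inj₁ x≤j = x≤j
  ... | inj₂ j<x = contradiction (ℕₚ.<-≤-trans (ℕₚ.m<m+n k 0<m) (ℕₚ.≤-reflexive e))
                     (ℕₚ.≤⇒≯ (ℕₚ.≤-trans (ℕₚ.+-mono-≤ (ℕₚ.≤-trans j<x x≤a) j<x) le))
  small : Part k k (a ∷ l) → Part (sumℕ l) j l
  small p = restrict (tail p)
    where
    tail : ∀ {n′ m′} → Part n′ m′ (a ∷ l) → n′ ≡ a ℕ.+ sumℕ l × Part (sumℕ l) a l
    tail (cons _ _ r) = cong (a ℕ.+_) (sym (Part-sum r)) , subst (λ s → Part s a l) (sym (Part-sum r)) r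
    restrict : k ≡ a ℕ.+ sumℕ l × Part (sumℕ l) a l → Part (sumℕ l) j l
    restrict (k≡ , r) = IsPartition⇒Part (Part⇒IsPartition r) j (All.tabulate (λ x∈ → let x≤a , x≤s = below r x∈ in
      bound x≤a (ℕₚ.≤-trans (ℕₚ.+-monoʳ-≤ a x≤s) (ℕₚ.≤-reflexive (sym k≡)))))

sumℕ-addFirst : ∀ m λ′ → sumℕ (addFirst m λ′) ≡ sumℕ λ′ ℕ.+ m
sumℕ-addFirst zero [] = refl
sumℕ-addFirst (suc m) [] = ℕₚ.+-identityʳ (suc m)
sumℕ-addFirst m (a ∷ l) = trans (cong sumℕ (addFirst-∷ m a l)) (trans (ℕₚ.+-assoc m a (sumℕ l)) (ℕₚ.+-comm m (a ℕ.+ sumℕ l)))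


beta-singleton : ∀ n i g → betaΠ n (i ∷ []) g ≡ alphaΠ n (i ∷ []) g + -[1+ 0 ]
beta-singleton n i g = trans (beta-∑ n (i ∷ []) g) (cong (_+ -[1+ 0 ]) (ℤₚ.*-identityˡ (alphaΠ n (i ∷ []) g)))

solve-for-top : ∀ o x₁ x₂ t {p₁ p₂ : ℤ} → o ≢ 0ℤ → x₁ ≡ x₂ + t →
  p₁ ≡ o * x₁ + -[1+ 0 ] * o → p₂ ≡ o * x₂ + -[1+ 0 ] * o → p₁ ≡ p₂ → t ≡ 0ℤ
solve-for-top o x₁ x₂ t o≢0 refl refl refl eq = Sum.[ (λ o≡0 → contradiction o≡0 o≢0) , id ] (ℤₚ.i*j≡0⇒i≡0∨j≡0 o
    (trans (ring o x₂ t) (trans (cong (_+ -[1+ 0 ] * (o * x₂ + -[1+ 0 ] * o)) eq) (cancel (o * x₂ + -[1+ 0 ] * o)))))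
  where
  ring : ∀ o x t → o * t ≡ (o * (x + t) + -[1+ 0 ] * o) + -[1+ 0 ] * (o * x + -[1+ 0 ] * o)
  ring = solve-∀
  cancel : ∀ a → a + -[1+ 0 ] * a ≡ 0ℤ
  cancel = solve-∀

-- Here h = 2i = j + 1, and `pair γ₁` - `pair γ₂` is `ord n` times the multiplicity of χ^(h, h) in
-- β. The shifted expansion makes it 0. The expansion into Young characters makes it `ord n` times
-- `top`, since the trivial character subtracted in β pairs equally with η_(h, h) and η_(h+1, h-1).
module _ (i j k m : ℕ) (2i≡h : 2 ℕ.* i ≡ suc j) (n≡ : k ℕ.+ m ≡ suc j ℕ.+ suc j) (0<m : 0 < m) (cs : List (Term k))
         (shift : betaΠ (k ℕ.+ m) (i ∷ []) ≐ combo (k ℕ.+ m) m cs) where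

  private
    n h : ℕ
    n = k ℕ.+ m
    h = suc j

    γ₁ γ₂ : List ℕ
    γ₁ = h ∷ h ∷ []
    γ₂ = suc h ∷ j ∷ []

    pair : List ℕ → ℤ
    pair γ = ∑ᴳ (λ g → betaΠ n (i ∷ []) g * young n γ g)

    h≤n : h ≤ n
    h≤n = subst (h ≤_) (sym n≡) (ℕₚ.m≤m+n h h)

    sum₁ : sumℕ γ₁ ≡ n
    sum₁ = trans (cong (h ℕ.+_) (ℕₚ.+-identityʳ h)) (sym n≡)

    sum₂ : sumℕ γ₂ ≡ n
    sum₂ = trans (cong (suc h ℕ.+_) (ℕₚ.+-identityʳ j)) (trans (sym (ℕₚ.+-suc h j)) (sym n≡))

    all-small : ∀ γ → sumℕ γ ≡ n → All (_≤ n) γ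
    all-small γ s = subst (λ x → All (_≤ x) γ) s (parts≤sum γ)

    pair-combo : ∀ γ → sumℕ γ ≡ n → pair γ ≡ ord n * ∑ cs (λ c → coeff c * K (addFirst m (shape c)) γ)
    pair-combo γ s = begin
      ∑ᴳ (λ g → betaΠ n (i ∷ []) g * young n γ g)
        ≡⟨ ∑ᴳ-cong (λ g → trans (cong (_* young n γ g) (trans (shift g) (∑-sumℤ _ cs))) (trans (sym (∑-*ʳ cs (young n γ g) _)) (∑-cong cs (λ c → ℤₚ.*-assoc (coeff c) (irrChar n (addFirst m (shape c)) g) (young n γ g))))) ⟩
      ∑ᴳ (λ g → ∑ cs (λ c → coeff c * (irrChar n (addFirst m (shape c)) g * young n γ g)))
        ≡⟨ ∑ᴳ-∑ cs _ ⟩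
      ∑ cs (λ c → ∑ᴳ (λ g → coeff c * (irrChar n (addFirst m (shape c)) g * young n γ g)))
        ≡⟨ ∑-cong cs (λ c → trans (∑ᴳ-*ˡ (coeff c) _) (trans (cong (coeff c *_) (irrChar-inner n (addFirst m (shape c)) γ
             (trans (sumℕ-addFirst m (shape c)) (cong (ℕ._+ m) (proj₂ (proj₂ (isPart c))))) (all-small γ s))) (*-swap (coeff c) (ord n) (K (addFirst m (shape c)) γ)))) ⟩
      ∑ cs (λ c → ord n * (coeff c * K (addFirst m (shape c)) γ))
        ≡⟨ ∑-*ˡ cs (ord n) _ ⟩
      ord n * ∑ cs (λ c → coeff c * K (addFirst m (shape c)) γ) ∎

    pair-equal : pair γ₁ ≡ pair γ₂
    pair-equal = trans (pair-combo γ₁ sum₁) (trans (cong (ord n *_) (∑-cong cs (λ c → cong (coeff c *_) (shifted-two-rows m j 0<m n≡ (shape c) (isPart c))))) (sym (pair-combo γ₂ sum₂)))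

    expansion = fullChar-expansion (i ∷ []) i (ℕₚ.≤-refl ∷ [])
    bs = proj₁ expansion
    small : All (λ b → sumℕ (proj₂ b) ≤ h) bs
    small = subst (λ h → All (λ b → sumℕ (proj₂ b) ≤ h) bs) 2i≡h (proj₁ (proj₂ expansion))
    exp = proj₂ (proj₂ expansion)

    matrices : List ℕ → ℤ
    matrices γ = ∑ bs (λ b → proj₁ b * M (map +_ ((n ∸ sumℕ (proj₂ b)) ∷ proj₂ b)) γ)

    alpha-inner : ∀ γ → sumℕ γ ≡ n → ∑ᴳ (λ g → alphaΠ n (i ∷ []) g * young n γ g) ≡ ord n * matrices γ
    alpha-inner γ s = begin
      ∑ᴳ (λ g → alphaΠ n (i ∷ []) g * young n γ g)
        ≡⟨ ∑ᴳ-cong (λ g → trans (cong (_* young n γ g) (alpha-expansion {i} (i ∷ []) bs (proj₁ (proj₂ expansion)) exp n (subst (_≤ n) (sym 2i≡h) h≤n) g)) (trans (sym (∑-*ʳ bs (young n γ g) _)) (∑-cong bs (λ b → ℤₚ.*-assoc (proj₁ b) (young n ((n ∸ sumℕ (proj₂ b)) ∷ proj₂ b) g) (young n γ g))))) ⟩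
      ∑ᴳ (λ g → ∑ bs (λ b → proj₁ b * (young n ((n ∸ sumℕ (proj₂ b)) ∷ proj₂ b) g * young n γ g)))
        ≡⟨ ∑ᴳ-∑ bs _ ⟩
      ∑ bs (λ b → ∑ᴳ (λ g → proj₁ b * (young n ((n ∸ sumℕ (proj₂ b)) ∷ proj₂ b) g * young n γ g)))
        ≡⟨ ∑-congᴬ (All.map (λ {b} le → trans (∑ᴳ-*ˡ (proj₁ b) _) (trans (cong (proj₁ b *_) (young-inner n ((n ∸ sumℕ (proj₂ b)) ∷ proj₂ b) γ
             (ℕₚ.m∸n+n≡m (ℕₚ.≤-trans le h≤n)) (all-small γ s))) (*-swap (proj₁ b) (ord n) (M (map +_ ((n ∸ sumℕ (proj₂ b)) ∷ proj₂ b)) γ)))) small) ⟩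
      ∑ bs (λ b → ord n * (proj₁ b * M (map +_ ((n ∸ sumℕ (proj₂ b)) ∷ proj₂ b)) γ))
        ≡⟨ ∑-*ˡ bs (ord n) _ ⟩
      ord n * matrices γ ∎

    pair-beta : ∀ γ → sumℕ γ ≡ n → pair γ ≡ ord n * matrices γ + -[1+ 0 ] * ord n
    pair-beta γ s = begin
      ∑ᴳ (λ g → betaΠ n (i ∷ []) g * young n γ g)
        ≡⟨ ∑ᴳ-cong (λ g → trans (cong (_* young n γ g) (beta-singleton n i g)) (ring (alphaΠ n (i ∷ []) g) (young n γ g))) ⟩
      ∑ᴳ (λ g → alphaΠ n (i ∷ []) g * young n γ g + -[1+ 0 ] * young n γ g)
        ≡⟨ trans (∑ᴳ-+ _ _) (cong₂ _+_ (alpha-inner γ s) (trans (∑ᴳ-*ˡ -[1+ 0 ] (young n γ)) (cong (-[1+ 0 ] *_) (young-total n γ s)))) ⟩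
      ord n * matrices γ + -[1+ 0 ] * ord n ∎
      where
      ring : ∀ a y → (a + -[1+ 0 ]) * y ≡ a * y + -[1+ 0 ] * y
      ring = solve-∀

    -- The multiplicity of the trivial character in V_h: each η_β with |β| = h contains it once.
    top : ℤ
    top = ∑ bs (λ b → proj₁ b * ⟦ sumℕ (proj₂ b) ≡ᵇ h ⟧)

    matrices-split : matrices γ₁ ≡ matrices γ₂ + top
    matrices-split = trans (∑-congᴬ (All.map (λ {b} le → trans (cong (proj₁ b *_) (split (proj₂ b) le)) (ℤₚ.*-distribˡ-+ (proj₁ b) (M (map +_ ((n ∸ sumℕ (proj₂ b)) ∷ proj₂ b)) γ₂) ⟦ sumℕ (proj₂ b) ≡ᵇ h ⟧)) small)) (∑-+ bs _ _)
      where
      split : ∀ β → sumℕ β ≤ h → M (map +_ ((n ∸ sumℕ β) ∷ β)) γ₁ ≡ M (map +_ ((n ∸ sumℕ β) ∷ β)) γ₂ + ⟦ sumℕ β ≡ᵇ h ⟧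
      split β le = subst (λ n → M (map +_ ((n ∸ sumℕ β) ∷ β)) γ₁ ≡ M (map +_ ((n ∸ sumℕ β) ∷ β)) γ₂ + ⟦ sumℕ β ≡ᵇ h ⟧) (sym n≡) (M-two-rows j β le)

    top≡0 : top ≡ 0ℤ
    top≡0 = solve-for-top (ord n) (matrices γ₁) (matrices γ₂) top (ord≢0 n) matrices-split (pair-beta γ₁ sum₁) (pair-beta γ₂ sum₂) pair-equal

    fullChar-sum : ∑ᴳ (fullChar (i ∷ []) h) ≡ top * ord h
    fullChar-sum = begin
      ∑ᴳ (fullChar (i ∷ []) h)
        ≡⟨ ∑ᴳ-cong (exp h) ⟩
      ∑ᴳ (λ g → ∑ bs (λ b → proj₁ b * young h (proj₂ b) g))
        ≡⟨ ∑ᴳ-∑ bs _ ⟩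
      ∑ bs (λ b → ∑ᴳ (λ g → proj₁ b * young h (proj₂ b) g))
        ≡⟨ ∑-cong bs (λ b → trans (∑ᴳ-*ˡ (proj₁ b) (young h (proj₂ b))) (trans (cong (proj₁ b *_) (young-sum (proj₂ b) (sumℕ (proj₂ b) ℕ.≟ h))) (sym (ℤₚ.*-assoc (proj₁ b) ⟦ sumℕ (proj₂ b) ≡ᵇ h ⟧ (ord h))))) ⟩
      ∑ bs (λ b → proj₁ b * ⟦ sumℕ (proj₂ b) ≡ᵇ h ⟧ * ord h)
        ≡⟨ ∑-*ʳ bs (ord h) _ ⟩
      top * ord h ∎
      where
      young-sum : ∀ β → Dec (sumℕ β ≡ h) → ∑ᴳ (young h β) ≡ ⟦ sumℕ β ≡ᵇ h ⟧ * ord h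
      young-sum β (yes eq) = trans (young-total h β eq) (sym (trans (cong (λ b → ⟦ b ⟧ * ord h) (≡ᵇ-true eq)) (ℤₚ.*-identityˡ (ord h))))
      young-sum β (no ne) = trans (trans (∑ᴳ-cong (λ g → young-wrong-size h β g ne)) (∑ᴳ-*ˡ 0ℤ (λ _ → 0ℤ))) (cong (λ b → ⟦ b ⟧ * ord h) (sym (≢⇒≡ᵇ-false (sumℕ β) ne)))
        where
        ≢⇒≡ᵇ-false : ∀ x → x ≢ h → (x ≡ᵇ h) ≡ false
        ≢⇒≡ᵇ-false x ne with x ≡ᵇ h in eq
        ... | false = refl
        ... | true = contradiction (ℕₚ.≡ᵇ⇒≡ x h (subst T (sym eq) tt)) ne

  no-early-shift : ⊥
  no-early-shift = fullChar-sum≢0 i (subst (λ h → ∑ᴳ (fullChar (i ∷ []) h) ≡ 0ℤ) (sym 2i≡h) (trans fullChar-sum (cong (_* ord h) top≡0)))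

theorem1p7 : (S : List ℕ) (i : ℕ) → Linked _<_ S → All (λ s → 0 < s) S →
    i ∈ S → All (λ s → s ≤ i) S →
    StabilizesBeyond (λ n → betaΠ n S) (4 ℕ.* i)
    × (S ≡ i ∷ [] → StabilizesSharplyAt (λ n → betaΠ n S) (4 ℕ.* i))
theorem1p7 S zero _ positive i∈S _ = contradiction (All.lookup positive i∈S) λ ()
theorem1p7 S i@(suc i′) _ positive i∈S bounded = stable , λ S≡ → stable , λ k k< st →
    sharp k k< (subst (λ S → StabilizesBeyond (λ n → betaΠ n S) k) S≡ st)
  where
  stable : StabilizesBeyond (λ n → betaΠ n S) (4 ℕ.* i)
  stable = beta-stabilizes S i (s≤s z≤n) bounded
  sharp : ∀ k → k < 4 ℕ.* i → ¬ StabilizesBeyond (λ n → betaΠ n (i ∷ [])) k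
  -- The shift by 4i - k lands on 4i points, where (2i, 2i) is a partition.
  sharp k k< st with st (4 ℕ.* i ∸ k)
  -- The omitted j is 2i - 1, which `refl` determines because i is a successor.
  ... | cs , _ , shift = no-early-shift i _ k (4 ℕ.* i ∸ k) refl (trans (ℕₚ.m+[n∸m]≡n (ℕₚ.<⇒≤ k<)) (4*-split i)) (ℕₚ.m<n⇒0<n∸m k<) cs shift
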